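{- For every $\epsilon>0$ there are constants $Q=Q(\epsilon)$ and $P=P(\epsilon)$ such that the following holds. Let $q=p^n$ be a prime power with $q>Q$ and $p>P$, let $\delta>0$, and let $d$ be a divisor of $q-1$ with $2\le d\le q^{1/4-\epsilon}\delta^{3/2}$ such that the pair $(d,q)$ is $\delta$-good. Then there are no sets $A,B,C\subset\mathbb{F}_q$ with $|A|,|B|,|C|\ge2$ and $S_d=A+B+C$, where $S_d=\{x^d:x\in\mathbb{F}_q^*\}$.
   Context: $\mathbb{F}_q$ is the finite field with $q$ elements, $q=p^n$, $p$ prime. $A+B+C=\{a+b+c:a\in A,b\in B,c\in C\}$. For $d\mid(q-1)$ with $2\le d<q-1$, write the base-$p$ expansion $\frac{q-1}{d}=\sum_{j=0}^n e_jp^j$ with $0\le e_j\le p-1$. For a positive real $\delta$, the pair $(d,q)$ is called $\delta$-good if $e_j\le\lfloor(1-\delta)(p-1)\rfloor$ for every integer $j$ with $0\le j<(n+1)/2$.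
   Formalization: The quantities ε and δ range over positive rationals rather than positive reals; the real case follows by shrinking ε to a rational and replacing δ by the rational 1 − max e_j/(p−1), which is at least δ. -}

module Defs where

open import Level using (Level; suc; _⊔_)
open import Data.Nat as ℕ using (ℕ; zero; _∸_; _^_)
open import Data.Nat.DivMod using (_/_; _%_)
open import Data.Nat.Properties using (m^n≢0)
open import Data.Fin using (Fin)
open import Data.Integer as ℤ using (ℤ; +_)
open import Data.Rational as ℚ using (ℚ; floor; 1ℚ; _-_)
open import Data.Product using (Σ; ∃; _×_)
open import Relation.Binary.PropositionalEquality using (_≡_)
open import Relation.Nullary using (¬_)
open import Algebra.Bundles using (CommutativeRing)

_^ℚ_ : ℚ → ℕ → ℚ
x ^ℚ zero      = 1ℚ
x ^ℚ ℕ.suc k   = x ℚ.* (x ^ℚ k)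

record FiniteField (c ℓ : Level) (q : ℕ) : Set (suc (c ⊔ ℓ)) where
  field
    cring       : CommutativeRing c ℓ
  open CommutativeRing cring public
  field
    1≉0         : ¬ (1# ≈ 0#)
    inverse     : ∀ x → ¬ (x ≈ 0#) → ∃ λ y → x * y ≈ 1#
    enum        : Fin q → Carrier
    enum-inj    : ∀ i j → enum i ≈ enum j → i ≡ j
    enum-surj   : ∀ x → ∃ λ i → enum i ≈ x

  pow : Carrier → ℕ → Carrier
  pow x zero      = 1#
  pow x (ℕ.suc k) = x * pow x k

  InS : ℕ → Carrier → Set (c ⊔ ℓ)
  InS d x = ∃ λ y → ¬ (y ≈ 0#) × (x ≈ pow y d)

  InSum : (Carrier → Set c) → (Carrier → Set c) → (Carrier → Set c) → Carrier → Set (c ⊔ ℓ)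
  InSum A B C x = ∃ λ a → ∃ λ b → ∃ λ c → A a × B b × C c × (x ≈ a + b + c)

  AtLeastTwo : (Carrier → Set c) → Set (c ⊔ ℓ)
  AtLeastTwo A = ∃ λ a → ∃ λ a' → A a × A a' × ¬ (a ≈ a')

digit : (p : ℕ) → .{{_ : ℕ.NonZero p}} → ℕ → ℕ → ℕ
digit p m j = (_/_ m (p ^ j) {{m^n≢0 p j}}) % p

-- (d,q) is δ-good, q = p^n:  2 ≤ d < q-1, d ∣ q-1 (assumed separately), and for every
-- integer j with 0 ≤ j < (n+1)/2 (i.e. 2j < n+1) the j-th base-p digit e_j of (q-1)/d
-- satisfies e_j ≤ ⌊(1-δ)(p-1)⌋.
DeltaGood : (δ : ℚ) (d p n : ℕ) → .{{_ : ℕ.NonZero p}} → .{{_ : ℕ.NonZero d}} → Set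
DeltaGood δ d p n =
  (2 ℕ.≤ d) × (d ℕ.< p ^ n ∸ 1) ×
  (∀ j → 2 ℕ.* j ℕ.< n ℕ.+ 1 →
     (+ digit p ((p ^ n ∸ 1) / d) j) ℤ.≤ floor ((1ℚ - δ) ℚ.* ((+ (p ∸ 1)) ℚ./ 1)))

{-# OPTIONS --safe #-}

-- Let N = (q − 1)/d = |S|, S = A + B + C.  The polynomial Σ_a c_a (x + a)^(N+m−1) − λ of Hanson and Petridis,
-- with a running through m elements of A, vanishes to order m on B + C; if the binomial coefficient
-- (N+m−1 over N) is nonzero modulo p, it has degree N and so m |B + C| ≤ N.  For a δ-good pair m may be
-- taken ≥ δ |A|, whence δ |A| |B + C| ≤ N, and likewise for B and C.  Together with Ruzsa's inequality
-- |A + B + C|² ≤ |A + B| |B + C| |C + A| this gives |A| |B| |C| ≤ N/δ³.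
--
-- On the other hand B + C lies in the intersection of the S − a for a ∈ A.  Stepanov's method, applied to
-- k ≈ log |A| of these shifts, bounds the intersection by about q/dᵏ + O(k² √q); since |A| |B + C| ≥ N, this
-- forces |A| ≥ √q/(d (log q)²) up to a constant.  The same holds for B and C, which contradicts
-- |A| |B| |C| ≤ N/δ³ when d ≤ q^(1/4−ε) δ^(3/2) and q is large.
--
-- Stepanov's auxiliary polynomial does not vanish identically because the monomials in the Kummer series
-- (1 + eᵢ x)^(−1/d) are linearly independent over 𝔽(x): a relation can be compared with its q-th power.
module Submission where

open import Defs
open import Level using (0ℓ)
open import Algebra.Bundles using (CommutativeRing)
open import Algebra.Structures using (IsCommutativeRing)
open import Data.Bool using (Bool; true; false; _∨_; if_then_else_)
open import Data.Empty using (⊥; ⊥-elim)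
open import Data.Fin as Fin using (Fin; zero; suc; toℕ; fromℕ; fromℕ<; inject₁; inject≤; finToFun; funToFin; combine; remQuot; _↑ˡ_; _↑ʳ_; splitAt; join)
open import Data.Fin.Permutation using (Permutation′; permutation)
open import Data.Fin.Properties as Finₚ using (_≟_; any?; toℕ<n; toℕ-fromℕ; toℕ-inject₁; pigeonhole; funToFin-finToFin)
open import Data.Integer as ℤ using (ℤ; -[1+_])
open import Data.List using (List; []; _∷_; length; map; tabulate)
open import Data.List.Properties using (length-tabulate; length-map)
open import Data.Nat as ℕ using (ℕ; zero; suc; z≤n; s≤s; NonZero; _∸_)
open import Data.Nat.Base using (_!)
open import Data.Nat.Combinatorics using (nCk≡n!/k![n-k]!; k![n∸k]!∣n!; nCn≡1; k>n⇒nCk≡0; nCk+nC[k+1]≡[n+1]C[k+1]) renaming (_C_ to infixl 6.5 _choose_)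
open import Data.Nat.Coprimality using (Coprime; coprime-Bézout)
open import Data.Nat.Divisibility using (_∣_; divides; ∣⇒≤; ∣1⇒≡1; m∣m*n; ∣m⇒∣m*n; ∣m+n∣m⇒∣n)
open import Data.Nat.DivMod using (_/_; _%_; m/n*n≡m; m≡m%n+[m/n]*n; m%n<n; m<n⇒m%n≡m; [m+kn]%n≡m%n; m/n/o≡m/[n*o]; m/n*n≤m; /-mono-≤; m*n/n≡m; m<n*o⇒m/o<n; n/1≡n)
open import Data.Nat.GCD using (module Bézout)
open import Data.Nat.Primality using (Prime; euclidsLemma; prime⇒nonZero; prime⇒irreducible; ¬prime[0]; ¬prime[1])
open import Data.Nat.Properties using (_!*_!≢0)
open import Data.Nat.Tactic.RingSolver using (solve-∀)
open import Data.Product using (_,_; Σ; ∃; ∃₂; _×_; proj₁; proj₂)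
open import Data.Rational as ℚ using (ℚ; mkℚ; 0ℚ; 1ℚ; floor; toℚᵘ; ↥_; ↧_)
open import Data.Rational.Unnormalised as ℚᵘ using (ℚᵘ; mkℚᵘ; *≡*; *≤*)
open import Data.Sum using (_⊎_; inj₁; inj₂; map₂)
open import Function using (_∘_)
open import Relation.Binary using (tri<; tri≈; tri>)
open import Relation.Binary.PropositionalEquality as ≡ using (_≡_; _≢_)
open import Relation.Nullary using (¬_; Dec; yes; no)
open import Relation.Nullary.Decidable using (isYes; _×-dec_; ¬?; True; toWitness)
import Algebra.Properties.CommutativeMonoid.Sum as CMSum
import Algebra.Properties.CommutativeSemiring.Binomial as Binomial
import Algebra.Properties.CommutativeSemiring.Exp as CExp
import Algebra.Properties.Group as GroupProps
import Algebra.Properties.Ring as RingProps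
import Algebra.Properties.Semiring.Exp as Exp
import Algebra.Properties.Semiring.Mult as Mult
import Algebra.Properties.Semiring.Sum as Sum
import Algebra.Solver.Ring.NaturalCoefficients.Default as SemiringSolver
import Data.Bool.Properties as Boolₚ
import Data.Integer.DivMod as ℤ-DivMod
import Data.Integer.Properties as ℤₚ
import Data.Integer.Tactic.RingSolver as ℤ-Solver
import Data.Nat.Properties as ℕₚ
import Data.Rational.Properties as ℚₚ
import Data.Rational.Unnormalised.Properties as ℚᵘₚ
import Relation.Binary.Reasoning.Setoid as SetoidReasoning

-- Power series

-- Since |B + C| is at most about q/d^k and at least N/|A|, shifts help as soon as d^(k-1) exceeds
-- |A| by a fixed factor. With k ≤ |A| shifts this can be arranged unless |A| = d = 2, where both
-- sides balance and a third shift has to be brought in. Only the error term then keeps A alive,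
-- which is how √q enters. Orders of vanishing are read off from the expansion in b + θX, since
-- iterated derivatives lose information in characteristic p. The Kummer series is the X-adic limit
-- of f^((q^t - 1)/d), and modulo X^q it equals the polynomial f^N; this congruence is what links
-- Stepanov's polynomials to algebraic functions that are independent over 𝔽(x). The digit condition
-- reaches only the lower half of the digits. It is applied to at most p^K elements of A, where p^K
-- ≥ √q, so a larger set is cut down to a size that still meets the lower bound. With ε = a/b and δ
-- = u/v all estimates are inequalities between natural numbers, raised to powers that remove the
-- roots.

module RingLemmas (R : CommutativeRing 0ℓ 0ℓ) where
  open CommutativeRing R hiding (zero)
  open SemiringSolver commutativeSemiring

  distrib-interchange : ∀ a b c x y → (a + b) * c + (x + y) ≈ (a * c + x) + (b * c + y)
  distrib-interchange = solve 5 (λ a b c x y → (a :+ b) :* c :+ (x :+ y) := (a :* c :+ x) :+ (b :* c :+ y)) refl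

  assoc-distrib : ∀ a b c x y → a * b * c + (a * x + y) ≈ a * (b * c + x) + y
  assoc-distrib = solve 5 (λ a b c x y → a :* b :* c :+ (a :* x :+ y) := a :* (b :* c :+ x) :+ y) refl

module PowerSeries (R : CommutativeRing 0ℓ 0ℓ) where
  open CommutativeRing R hiding (zero)
  open SetoidReasoning setoid

  open RingLemmas R
  Series : Set
  Series = ℕ → Carrier

  infix 4 _≋_
  infixl 7 _⊛_
  infixl 6 _⊕_

  _≋_ : Series → Series → Set
  f ≋ g = ∀ n → f n ≈ g n

  shift : Series → Series
  shift f n = f (suc n)

  _⊕_ : Series → Series → Series
  (f ⊕ g) n = f n + g n

  _⊛_ : Series → Series → Series
  (f ⊛ g) zero    = f 0 * g 0
  (f ⊛ g) (suc n) = f 0 * g (suc n) + (shift f ⊛ g) n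

  ⊖_ : Series → Series
  (⊖ f) n = - f n

  0ₛ : Series
  0ₛ _ = 0#

  const : Carrier → Series
  const c zero    = c
  const c (suc _) = 0#

  1ₛ : Series
  1ₛ = const 1#

  ⊛-cong : ∀ {f f′ g g′} → f ≋ f′ → g ≋ g′ → (f ⊛ g) ≋ (f′ ⊛ g′)
  ⊛-cong p r zero    = *-cong (p 0) (r 0)
  ⊛-cong p r (suc n) = +-cong (*-cong (p 0) (r (suc n))) (⊛-cong (λ i → p (suc i)) r n)

  ⊛-distribʳ : ∀ h f g → ((f ⊕ g) ⊛ h) ≋ ((f ⊛ h) ⊕ (g ⊛ h))
  ⊛-distribʳ h f g zero    = distribʳ _ _ _
  ⊛-distribʳ h f g (suc n) = begin
    (f 0 + g 0) * h (suc n) + ((shift f ⊕ shift g) ⊛ h) n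
      ≈⟨ +-congˡ (⊛-distribʳ h (shift f) (shift g) n) ⟩
    (f 0 + g 0) * h (suc n) + ((shift f ⊛ h) n + (shift g ⊛ h) n)
      ≈⟨ distrib-interchange (f 0) (g 0) (h (suc n)) _ _ ⟩
    (f 0 * h (suc n) + (shift f ⊛ h) n) + (g 0 * h (suc n) + (shift g ⊛ h) n) ∎

  scale-⊛ : ∀ c f g → ((λ i → c * f i) ⊛ g) ≋ (λ i → c * (f ⊛ g) i)
  scale-⊛ c f g zero    = *-assoc _ _ _
  scale-⊛ c f g (suc n) = begin
    c * f 0 * g (suc n) + ((λ i → c * f (suc i)) ⊛ g) n ≈⟨ +-cong (*-assoc _ _ _) (scale-⊛ c (shift f) g n) ⟩
    c * (f 0 * g (suc n)) + c * (shift f ⊛ g) n         ≈⟨ distribˡ _ _ _ ⟨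
    c * (f 0 * g (suc n) + (shift f ⊛ g) n)             ∎

  -- The product is defined by peeling off the first factor; peeling off the second one as well is
  -- what turns commutativity into an induction.
  ⊛-sucʳ : ∀ f g n → (f ⊛ g) (suc n) ≈ (f ⊛ shift g) n + f (suc n) * g 0
  ⊛-sucʳ f g zero    = refl
  ⊛-sucʳ f g (suc n) = begin
    f 0 * g (2 ℕ.+ n) + (shift f ⊛ g) (suc n)                          ≈⟨ +-congˡ (⊛-sucʳ (shift f) g n) ⟩
    f 0 * g (2 ℕ.+ n) + ((shift f ⊛ shift g) n + f (2 ℕ.+ n) * g 0)    ≈⟨ +-assoc _ _ _ ⟨
    (f ⊛ shift g) (suc n) + f (2 ℕ.+ n) * g 0                          ∎

  ⊛-comm : ∀ f g → (f ⊛ g) ≋ (g ⊛ f)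
  ⊛-comm f g zero    = *-comm _ _
  ⊛-comm f g (suc n) = begin
    f 0 * g (suc n) + (shift f ⊛ g) n   ≈⟨ +-cong (*-comm _ _) (⊛-comm (shift f) g n) ⟩
    g (suc n) * f 0 + (g ⊛ shift f) n   ≈⟨ +-comm _ _ ⟩
    (g ⊛ shift f) n + g (suc n) * f 0   ≈⟨ ⊛-sucʳ g f n ⟨
    (g ⊛ f) (suc n)                     ∎

  ⊛-assoc : ∀ f g h → ((f ⊛ g) ⊛ h) ≋ (f ⊛ (g ⊛ h))
  ⊛-assoc f g h zero    = *-assoc _ _ _
  ⊛-assoc f g h (suc n) = begin
    f 0 * g 0 * h (suc n) + (shift (f ⊛ g) ⊛ h) n
      ≈⟨ +-congˡ (⊛-distribʳ h (λ i → f 0 * g (suc i)) (shift f ⊛ g) n) ⟩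
    f 0 * g 0 * h (suc n) + (((λ i → f 0 * g (suc i)) ⊛ h) n + ((shift f ⊛ g) ⊛ h) n)
      ≈⟨ +-congˡ (+-cong (scale-⊛ (f 0) (shift g) h n) (⊛-assoc (shift f) g h n)) ⟩
    f 0 * g 0 * h (suc n) + (f 0 * (shift g ⊛ h) n + (shift f ⊛ (g ⊛ h)) n)
      ≈⟨ assoc-distrib (f 0) (g 0) (h (suc n)) _ _ ⟩
    f 0 * (g 0 * h (suc n) + (shift g ⊛ h) n) + (shift f ⊛ (g ⊛ h)) n ∎

  0-⊛ : ∀ g → (0ₛ ⊛ g) ≋ 0ₛ
  0-⊛ g zero    = zeroˡ _
  0-⊛ g (suc n) = trans (+-cong (zeroˡ _) (0-⊛ g n)) (+-identityˡ _)

  const-⊛ : ∀ c g → (const c ⊛ g) ≋ (λ i → c * g i)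
  const-⊛ c g zero    = refl
  const-⊛ c g (suc n) = trans (+-congˡ (0-⊛ g n)) (+-identityʳ _)

  ⊛-identityˡ : ∀ g → (1ₛ ⊛ g) ≋ g
  ⊛-identityˡ g n = trans (const-⊛ 1# g n) (*-identityˡ _)

  ps : CommutativeRing 0ℓ 0ℓ
  ps = record
    { Carrier = Series ; _≈_ = _≋_ ; _+_ = _⊕_ ; _*_ = _⊛_ ; -_ = ⊖_ ; 0# = 0ₛ ; 1# = 1ₛ
    ; isCommutativeRing = record
      { isRing = record
        { +-isAbelianGroup = record
          { isGroup = record
            { isMonoid = record
              { isSemigroup = record
                { isMagma = record
                  { isEquivalence = record
                    { refl = λ _ → refl ; sym = λ p n → sym (p n) ; trans = λ p r n → trans (p n) (r n) }
                  ; ∙-cong = λ p r n → +-cong (p n) (r n) }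
                ; assoc = λ f g h n → +-assoc _ _ _ }
              ; identity = (λ f n → +-identityˡ _) , (λ f n → +-identityʳ _) }
            ; inverse = (λ f n → -‿inverseˡ _) , (λ f n → -‿inverseʳ _)
            ; ⁻¹-cong = λ p n → -‿cong (p n) }
          ; comm = λ f g n → +-comm _ _ }
        ; *-cong = ⊛-cong
        ; *-assoc = ⊛-assoc
        ; *-identity = ⊛-identityˡ , (λ f n → trans (⊛-comm f 1ₛ n) (⊛-identityˡ f n))
        ; distrib = (λ f g h n → trans (⊛-comm f (g ⊕ h) n) (trans (⊛-distribʳ f g h n)
                       (+-cong (⊛-comm g f n) (⊛-comm h f n))))
                  , ⊛-distribʳ }
      ; *-comm = ⊛-comm } }

  X : Series
  X zero          = 0#
  X (suc zero)    = 1#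
  X (suc (suc _)) = 0#

  X-⊛-zero : ∀ g → (X ⊛ g) 0 ≈ 0#
  X-⊛-zero g = zeroˡ _

  X-⊛-suc : ∀ g n → (X ⊛ g) (suc n) ≈ g n
  X-⊛-suc g n = trans (+-cong (zeroˡ _) (trans (⊛-cong {f = shift X} {f′ = 1ₛ} eq (λ _ → refl) n) (⊛-identityˡ g n))) (+-identityˡ _)
    where
    eq : ∀ i → shift X i ≈ 1ₛ i
    eq zero    = refl
    eq (suc i) = refl

  -- The basis of all later congruences modulo a power of X.
  ⊛-local : ∀ m {f f′ g g′} → (∀ i → i ℕ.≤ m → f i ≈ f′ i) → (∀ i → i ℕ.≤ m → g i ≈ g′ i) →
            (f ⊛ g) m ≈ (f′ ⊛ g′) m
  ⊛-local zero p r = *-cong (p 0 z≤n) (r 0 z≤n)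
  ⊛-local (suc m) p r = +-cong (*-cong (p 0 z≤n) (r (suc m) ℕₚ.≤-refl))
    (⊛-local m (λ i i≤m → p (suc i) (s≤s i≤m)) (λ i i≤m → r i (ℕₚ.m≤n⇒m≤1+n i≤m)))

-- Binomial coefficients and the Frobenius map in characteristic p

p>1 : ∀ {p} → Prime p → 1 ℕ.< p
p>1 {zero}        pr = ⊥-elim (¬prime[0] pr)
p>1 {suc zero}    pr = ⊥-elim (¬prime[1] pr)
p>1 {suc (suc p)} pr = s≤s (s≤s z≤n)

prime∤1 : ∀ {p} → Prime p → ¬ (p ∣ 1)
prime∤1 pr p∣1 = ℕₚ.<⇒≢ (p>1 pr) (≡.sym (∣1⇒≡1 p∣1))

prime∤n! : ∀ {p} → Prime p → ∀ n → n ℕ.< p → ¬ (p ∣ n !)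
prime∤n! pr zero    n<p p∣ = prime∤1 pr p∣
prime∤n! pr (suc n) n<p p∣ with euclidsLemma (suc n) (n !) pr p∣
... | inj₁ p∣sn = ℕₚ.<⇒≱ n<p (∣⇒≤ p∣sn)
... | inj₂ p∣n! = prime∤n! pr n (ℕₚ.<-trans (ℕₚ.n<1+n n) n<p) p∣n!

nCk*k![n∸k]!≡n! : ∀ {n k} → k ℕ.≤ n → (n choose k) ℕ.* (k ! ℕ.* (n ℕ.∸ k) !) ≡ n !
nCk*k![n∸k]!≡n! {n} {k} k≤n = ≡.trans (≡.cong (ℕ._* (k ! ℕ.* (n ℕ.∸ k) !)) (nCk≡n!/k![n-k]! k≤n))
  (m/n*n≡m {{_!*_!≢0 k (n ℕ.∸ k)}} (k![n∸k]!∣n! k≤n))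

-- The factor p of p! cannot come from k! (p - k)!, a product of integers below p.
prime∣pCk : ∀ {p} → Prime p → ∀ k → 0 ℕ.< k → k ℕ.< p → p ∣ (p choose k)
prime∣pCk {p@(suc p-1)} pr k 0<k k<p
  with euclidsLemma (p choose k) (k ! ℕ.* (p ℕ.∸ k) !) pr
         (≡.subst (p ∣_) (≡.sym (nCk*k![n∸k]!≡n! (ℕₚ.<⇒≤ k<p))) (m∣m*n (p-1 !)))
... | inj₁ h = h
... | inj₂ h with euclidsLemma (k !) ((p ℕ.∸ k) !) pr h
... | inj₁ h′ = ⊥-elim (prime∤n! pr k k<p h′)
... | inj₂ h′ = ⊥-elim (prime∤n! pr (p ℕ.∸ k) (ℕₚ.∸-monoʳ-< 0<k (ℕₚ.<⇒≤ k<p)) h′)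

HasChar : CommutativeRing 0ℓ 0ℓ → ℕ → Set
HasChar R p = p · 1# ≈ 0#
  where
  open CommutativeRing R hiding (zero)
  open Mult semiring using () renaming (_×_ to _·_)

module Frobenius (R : CommutativeRing 0ℓ 0ℓ) {p : ℕ} (prime : Prime p) (p×1≈0 : HasChar R p) where
  open CommutativeRing R hiding (zero)
  open Mult semiring using (×-homo-1; ×-assocˡ; ×-congʳ; ×-assoc-*; ×-congˡ) renaming (_×_ to _·_)
  open Exp semiring
  open Sum semiring using (sum; sum-cong-≋; sum-init-last; sum-replicate-zero)
  open Binomial commutativeSemiring using (theorem; binomialTerm)
  open SetoidReasoning setoid

  ×-cong-∣ : ∀ {m} x → p ∣ m → m · x ≈ 0#
  ×-cong-∣ {m} x (divides k m≡kp) = begin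
    m · x            ≈⟨ ×-congˡ (≡.trans m≡kp (ℕₚ.*-comm k p)) ⟩
    (p ℕ.* k) · x    ≈⟨ ×-assocˡ x p k ⟨
    p · (k · x)      ≈⟨ ×-congʳ p (*-identityˡ _) ⟨
    p · (1# * (k · x)) ≈⟨ ×-assoc-* p 1# _ ⟨
    (p · 1#) * (k · x) ≈⟨ *-congʳ p×1≈0 ⟩
    0# * (k · x)     ≈⟨ zeroˡ _ ⟩
    0#               ∎

  sum-ends : ∀ m (t : Fin (suc (suc m)) → Carrier) → (∀ i → t (suc (inject₁ i)) ≈ 0#) →
             sum t ≈ t zero + t (fromℕ (suc m))
  sum-ends m t mid = +-congˡ (begin
    sum (λ i → t (suc i))                                             ≈⟨ sum-init-last (λ i → t (suc i)) ⟩
    sum (λ i → t (suc (inject₁ i))) + t (fromℕ (suc m))               ≈⟨ +-congʳ (sum-cong-≋ mid) ⟩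
    sum {m} (λ _ → 0#) + t (fromℕ (suc m))                            ≈⟨ +-congʳ (sum-replicate-zero m) ⟩
    0# + t (fromℕ (suc m))                                            ≈⟨ +-identityˡ _ ⟩
    t (fromℕ (suc m))                                                 ∎)

  private
    freshman : ∀ p → Prime p → (∀ {m} x → p ∣ m → m · x ≈ 0#) → ∀ x y → (x + y) ^ p ≈ x ^ p + y ^ p
    freshman zero          pr _  x y = ⊥-elim (¬prime[0] pr)
    freshman (suc zero)    pr _  x y = ⊥-elim (¬prime[1] pr)
    -- Two successors are exposed so that the terms 0 and p of the binomial sum are distinct; all
    -- terms between them are multiples of p.
    freshman p@(suc (suc m)) pr ×0 x y = begin
      (x + y) ^ p                                                ≈⟨ theorem p x y ⟩
      sum (binomialTerm x y p)                                   ≈⟨ sum-ends (suc m) (binomialTerm x y p) mid ⟩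
      binomialTerm x y p zero + binomialTerm x y p (fromℕ p)     ≈⟨ +-cong first last ⟩
      y ^ p + x ^ p                                              ≈⟨ +-comm _ _ ⟩
      x ^ p + y ^ p                                              ∎
      where
      mid : ∀ i → binomialTerm x y p (suc (inject₁ i)) ≈ 0#
      mid i = ×0 _ (prime∣pCk pr _ (s≤s z≤n)
        (s≤s (≡.subst (ℕ._< suc m) (≡.sym (toℕ-inject₁ i)) (toℕ<n i))))
      first : binomialTerm x y p zero ≈ y ^ p
      first = trans (×-homo-1 _) (*-identityˡ _)
      last : binomialTerm x y p (fromℕ p) ≈ x ^ p
      last = begin
        binomialTerm x y p (fromℕ p)                    ≡⟨ ≡.cong (λ k → (p choose k) · (x ^ k * y ^ (p ℕ.∸ k))) (toℕ-fromℕ p) ⟩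
        (p choose p) · (x ^ p * y ^ (p ℕ.∸ p))               ≡⟨ ≡.cong₂ (λ c e → c · (x ^ p * y ^ e)) (nCn≡1 p) (ℕₚ.n∸n≡0 p) ⟩
        1 · (x ^ p * 1#)                                ≈⟨ ×-homo-1 _ ⟩
        x ^ p * 1#                                      ≈⟨ *-identityʳ _ ⟩
        x ^ p                                           ∎

  ^p-distrib-+ : ∀ x y → (x + y) ^ p ≈ x ^ p + y ^ p
  ^p-distrib-+ = freshman p prime ×-cong-∣

  ^p^-distrib-+ : ∀ s x y → (x + y) ^ (p ℕ.^ s) ≈ x ^ (p ℕ.^ s) + y ^ (p ℕ.^ s)
  ^p^-distrib-+ zero    x y = trans (*-identityʳ _) (sym (+-cong (*-identityʳ _) (*-identityʳ _)))
  ^p^-distrib-+ (suc s) x y = begin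
    (x + y) ^ (p ℕ.* p ℕ.^ s)                    ≈⟨ ^-assocʳ (x + y) p (p ℕ.^ s) ⟨
    ((x + y) ^ p) ^ (p ℕ.^ s)                    ≈⟨ ^-congˡ (p ℕ.^ s) (^p-distrib-+ x y) ⟩
    (x ^ p + y ^ p) ^ (p ℕ.^ s)                  ≈⟨ ^p^-distrib-+ s _ _ ⟩
    (x ^ p) ^ (p ℕ.^ s) + (y ^ p) ^ (p ℕ.^ s)    ≈⟨ +-cong (^-assocʳ x p (p ℕ.^ s)) (^-assocʳ y p (p ℕ.^ s)) ⟩
    x ^ (p ℕ.* p ℕ.^ s) + y ^ (p ℕ.* p ℕ.^ s)    ∎

  0^p^≈0 : ∀ s → 0# ^ (p ℕ.^ s) ≈ 0#
  0^p^≈0 s with p ℕ.^ s | ℕₚ.m^n≢0 p s {{prime⇒nonZero prime}}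
  ... | suc e | _ = zeroˡ _

  ^p^-distrib-sum : ∀ s {m} (t : Fin m → Carrier) → (sum t) ^ (p ℕ.^ s) ≈ sum (λ i → t i ^ (p ℕ.^ s))
  ^p^-distrib-sum s {zero}  t = 0^p^≈0 s
  ^p^-distrib-sum s {suc m} t = trans (^p^-distrib-+ s _ _) (+-congˡ (^p^-distrib-sum s (λ i → t (suc i))))

-- Finite fields

-- With `Fin q` itself as carrier, equality is decidable and sums, products and searches over the
-- whole field are indexed by its elements.
record FinField (q : ℕ) : Set where
  field
    _+′_ _*′_ : Fin q → Fin q → Fin q
    -′_       : Fin q → Fin q
    0′ 1′     : Fin q
    isCommutativeRing : IsCommutativeRing _≡_ _+′_ _*′_ -′_ 0′ 1′
    1≢0       : 1′ ≢ 0′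
    inverse   : ∀ x → x ≢ 0′ → ∃ λ y → x *′ y ≡ 1′

  ring : CommutativeRing 0ℓ 0ℓ
  ring = record { isCommutativeRing = isCommutativeRing }

funToFin-cong : ∀ {m n} {f g : Fin m → Fin n} → (∀ i → f i ≡ g i) → funToFin f ≡ funToFin g
funToFin-cong {zero}  eq = ≡.refl
funToFin-cong {suc m} eq = ≡.cong₂ combine (eq zero) (funToFin-cong (λ i → eq (suc i)))

-- With a finite scalar field, a map into a space of smaller dimension is not injective simply by counting.
vector-pigeonhole : ∀ {q} → 1 ℕ.< q → ∀ {u v} → v ℕ.< u → (φ : (Fin u → Fin q) → (Fin v → Fin q)) →
  ∃₂ λ x y → ¬ (∀ i → x i ≡ y i) × (∀ j → φ x j ≡ φ y j)
vector-pigeonhole {q} 1<q {u} {v} v<u φ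
  with pigeonhole (ℕₚ.^-monoʳ-< q 1<q v<u) (λ i → funToFin (φ (finToFun i)))
... | i , j , i<j , eq = finToFun i , finToFun j , differ , agree
  where
  differ : ¬ (∀ k → finToFun i k ≡ finToFun j k)
  differ same = Finₚ.<⇒≢ i<j (≡.trans (≡.sym (funToFin-finToFin {u} {q} i))
    (≡.trans (funToFin-cong same) (funToFin-finToFin {u} {q} j)))
  agree : ∀ k → φ (finToFun i) k ≡ φ (finToFun j) k
  agree k = ≡.trans (≡.sym (Finₚ.finToFun-funToFin (φ (finToFun i)) k))
    (≡.trans (≡.cong (λ z → finToFun z k) eq) (Finₚ.finToFun-funToFin (φ (finToFun j)) k))

module FieldTheory {q : ℕ} (F : FinField q) where
  open FinField F public using (ring; 1≢0; inverse)
  open CommutativeRing ring public using (_+_; _*_; -_; _-_; 0#; 1#; semiring; commutativeSemiring;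
    +-cong; +-congˡ; +-congʳ; *-cong; *-congˡ; *-congʳ; +-assoc; +-comm; *-assoc; *-comm; +-identityˡ; +-identityʳ;
    *-identityˡ; *-identityʳ; zeroˡ; zeroʳ; distribˡ; distribʳ; -‿inverseˡ; -‿inverseʳ;
    *-commutativeMonoid; +-group)
  open Exp semiring public using (_^_; ^-homo-*; ^-assocʳ)
  open CExp commutativeSemiring public using (^-distrib-*)
  open Mult semiring using (×1-homo-*; ×-congˡ; ×-homo-+) renaming (_×_ to _·_) public
  open Sum semiring public using (sum; sum-cong-≗; sum-replicate; ∑-distrib-+; ∑-permute; *-distribˡ-sum; *-distribʳ-sum)
  open ≡.≡-Reasoning

  𝔽 : Set
  𝔽 = Fin q

  *-cancelˡ : ∀ x {y z} → x ≢ 0# → x * y ≡ x * z → y ≡ z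
  *-cancelˡ x {y} {z} x≢0 eq with inverse x x≢0
  ... | x⁻¹ , inv = begin
    y               ≡⟨ cancels y ⟨
    x⁻¹ * (x * y)   ≡⟨ ≡.cong (x⁻¹ *_) eq ⟩
    x⁻¹ * (x * z)   ≡⟨ cancels z ⟩
    z               ∎
    where
    cancels : ∀ t → x⁻¹ * (x * t) ≡ t
    cancels t = begin
      x⁻¹ * (x * t)   ≡⟨ *-assoc _ _ _ ⟨
      x⁻¹ * x * t     ≡⟨ ≡.cong (_* t) (≡.trans (*-comm _ _) inv) ⟩
      1# * t          ≡⟨ *-identityˡ t ⟩
      t               ∎

  no-zero-divisors : ∀ {x y} → x * y ≡ 0# → x ≢ 0# → y ≡ 0#
  no-zero-divisors {x} {y} xy≡0 x≢0 = *-cancelˡ x x≢0 (≡.trans xy≡0 (≡.sym (zeroʳ x)))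

  *-nonzero : ∀ {x y} → x ≢ 0# → y ≢ 0# → x * y ≢ 0#
  *-nonzero x≢0 y≢0 xy≡0 = y≢0 (no-zero-divisors xy≡0 x≢0)

  ^-nonzero : ∀ {x} → x ≢ 0# → ∀ n → x ^ n ≢ 0#
  ^-nonzero x≢0 zero    = 1≢0
  ^-nonzero x≢0 (suc n) = *-nonzero x≢0 (^-nonzero x≢0 n)

  1^n≡1 : ∀ n → 1# ^ n ≡ 1#
  1^n≡1 zero    = ≡.refl
  1^n≡1 (suc n) = ≡.trans (*-identityˡ _) (1^n≡1 n)

  x-y≡0⇒x≡y : ∀ {x y} → x - y ≡ 0# → x ≡ y
  x-y≡0⇒x≡y {x} {y} = GroupProps.x∙y⁻¹≈ε⇒x≈y +-group x y

  +-cancelˡ : ∀ x {y z} → x + y ≡ x + z → y ≡ z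
  +-cancelˡ x = GroupProps.∙-cancelˡ +-group x _ _

  1<q : 1 ℕ.< q
  1<q = go 0# 1# 1≢0
    where
    go : ∀ {n} (a b : Fin n) → b ≢ a → 1 ℕ.< n
    go {suc zero}    zero zero b≢a = ⊥-elim (b≢a ≡.refl)
    go {suc (suc n)} _ _ _ = s≤s (s≤s z≤n)

  -- Translation by x permutes the field, so the sum of all y equals the sum of all y + x.
  q·x≡0 : ∀ x → q · x ≡ 0#
  q·x≡0 x = +-cancelˡ (sum (λ y → y)) (begin
    sum (λ y → y) + q · x               ≡⟨ ≡.cong (sum (λ y → y) +_) (sum-replicate q) ⟨
    sum (λ y → y) + sum {q} (λ _ → x)   ≡⟨ ∑-distrib-+ {q} (λ y → y) (λ _ → x) ⟨
    sum (λ y → y + x)                   ≡⟨ ∑-permute (λ y → y) translate ⟨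
    sum (λ y → y)                       ≡⟨ +-identityʳ _ ⟨
    sum (λ y → y) + 0#                  ∎)
    where
    translate : Permutation′ q
    translate = permutation (_+ x) (_- x)
      (λ y → ≡.trans (+-assoc _ _ _) (≡.trans (≡.cong (y +_) (-‿inverseˡ x)) (+-identityʳ y)))
      (λ y → ≡.trans (+-assoc _ _ _) (≡.trans (≡.cong (y +_) (-‿inverseʳ x)) (+-identityʳ y)))

  module _ where
    open CMSum *-commutativeMonoid using () renaming (sum to ∏; sum-cong-≗ to ∏-cong; sum-replicate to ∏-replicate;
      ∑-distrib-+ to ∏-distrib; ∑-permute to ∏-permute)

    private
      -- The proof of x^q = x takes products over all of 𝔽. The two functions place a neutral 1 at
      -- zero, respectively away from zero, and so split x^q into a single x and a product over the
      -- units.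
      unless0 : 𝔽 → 𝔽 → 𝔽
      unless0 x y with y ≟ 0#
      ... | yes _ = 1#
      ... | no  _ = x

      if0 : 𝔽 → 𝔽 → 𝔽
      if0 x y with y ≟ 0#
      ... | yes _ = x
      ... | no  _ = 1#

    ∏-nonzero : ∀ {n} (f : Fin n → 𝔽) → (∀ i → f i ≢ 0#) → ∏ f ≢ 0#
    ∏-nonzero {zero}  f h = 1≢0
    ∏-nonzero {suc n} f h = *-nonzero (h zero) (∏-nonzero (f ∘ suc) (h ∘ suc))

    ∏-delta : ∀ {n} (f : Fin n → 𝔽) i → (∀ j → j ≢ i → f j ≡ 1#) → ∏ f ≡ f i
    ∏-delta {suc n} f zero h = ≡.trans (≡.cong (f zero *_) (ones n (f ∘ suc) (λ j → h (suc j) λ ()))) (*-identityʳ _)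
      where
      ones : ∀ n (g : Fin n → 𝔽) → (∀ j → g j ≡ 1#) → ∏ g ≡ 1#
      ones zero    g e = ≡.refl
      ones (suc n) g e = ≡.trans (≡.cong₂ _*_ (e zero) (ones n (g ∘ suc) (e ∘ suc))) (*-identityˡ _)
    ∏-delta {suc n} f (suc i) h = ≡.trans (≡.cong₂ _*_ (h zero λ ()) (∏-delta (f ∘ suc) i (λ j j≢i → h (suc j) (j≢i ∘ Finₚ.suc-injective)))) (*-identityˡ _)

    x^q≡x : ∀ x → x ^ q ≡ x
    x^q≡x x with x ≟ 0#
    ... | yes ≡.refl = lem q (ℕₚ.<-trans (s≤s z≤n) 1<q)
      where
      lem : ∀ m → 0 ℕ.< m → 0# ^ m ≡ 0#
      lem (suc m) _ = zeroˡ _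
    ... | no x≢0 = begin
      x ^ q                              ≡⟨ ∏-replicate q ⟨
      ∏ {q} (λ _ → x)                    ≡⟨ ∏-cong {q} split ⟩
      ∏ (λ y → if0 x y * unless0 x y)    ≡⟨ ∏-distrib (if0 x) (unless0 x) ⟩
      ∏ (if0 x) * ∏ (unless0 x)          ≡⟨ ≡.cong₂ _*_ (≡.trans (∏-delta (if0 x) 0# offzero) atzero) ∏unless≡1 ⟩
      x * 1#                             ≡⟨ *-identityʳ x ⟩
      x                                  ∎
      where
      split : ∀ y → x ≡ if0 x y * unless0 x y
      split y with y ≟ 0#
      ... | yes _ = ≡.sym (*-identityʳ x)
      ... | no  _ = ≡.sym (*-identityˡ x)
      offzero : ∀ y → y ≢ 0# → if0 x y ≡ 1#
      offzero y y≢0 with y ≟ 0#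
      ... | yes y≡0 = ⊥-elim (y≢0 y≡0)
      ... | no  _   = ≡.refl
      atzero : if0 x 0# ≡ x
      atzero with 0# ≟ 0#
      ... | yes _   = ≡.refl
      ... | no  0≢0 = ⊥-elim (0≢0 ≡.refl)
      self : 𝔽 → 𝔽
      self y = unless0 y y
      self-nonzero : ∀ y → self y ≢ 0#
      self-nonzero y with y ≟ 0#
      ... | yes _   = 1≢0
      ... | no  y≢0 = y≢0
      self-* : ∀ y → self (x * y) ≡ unless0 x y * self y
      self-* y with y ≟ 0# | (x * y) ≟ 0#
      ... | yes _ | yes _ = ≡.sym (*-identityˡ 1#)
      ... | yes ≡.refl | no h = ⊥-elim (h (zeroʳ x))
      ... | no y≢0 | yes h = ⊥-elim (*-nonzero x≢0 y≢0 h)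
      ... | no _ | no _ = ≡.refl
      x⁻¹ : 𝔽
      x⁻¹ = proj₁ (inverse x x≢0)
      xx⁻¹ : x * x⁻¹ ≡ 1#
      xx⁻¹ = proj₂ (inverse x x≢0)
      dilate : Permutation′ q
      dilate = permutation (x *_) (x⁻¹ *_)
        (λ y → ≡.trans (≡.sym (*-assoc _ _ _)) (≡.trans (≡.cong (_* y) xx⁻¹) (*-identityˡ y)))
        (λ y → ≡.trans (≡.sym (*-assoc _ _ _)) (≡.trans (≡.cong (_* y) (≡.trans (*-comm _ _) xx⁻¹)) (*-identityˡ y)))
      ∏unless≡1 : ∏ (unless0 x) ≡ 1#
      -- Multiplication by x permutes the units, so the product of all y equals the product of all x
      -- y, and the former can be cancelled.
      ∏unless≡1 = *-cancelˡ (∏ self) (∏-nonzero self self-nonzero) (begin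
        ∏ self * ∏ (unless0 x)             ≡⟨ *-comm _ _ ⟩
        ∏ (unless0 x) * ∏ self             ≡⟨ ∏-distrib (unless0 x) self ⟨
        ∏ (λ y → unless0 x y * self y)     ≡⟨ ∏-cong self-* ⟨
        ∏ (λ y → self (x * y))             ≡⟨ ∏-permute self dilate ⟨
        ∏ self                             ≡⟨ *-identityʳ _ ⟨
        ∏ self * 1#                        ∎)

  x^[q-1]≡1 : ∀ {m} → suc m ≡ q → ∀ {x} → x ≢ 0# → x ^ m ≡ 1#
  x^[q-1]≡1 {m} m+1≡q {x} x≢0 = *-cancelˡ x x≢0
    (≡.trans (≡.trans (≡.cong (x ^_) m+1≡q) (x^q≡x x)) (≡.sym (*-identityʳ x)))

  module Characteristic {p n : ℕ} (prime : Prime p) (q≡p^n : q ≡ p ℕ.^ n) where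

    hasChar : HasChar ring p
    hasChar with (p · 1#) ≟ 0#
    ... | yes h = h
    -- From 0 = q · 1 = (p · 1)^n and the absence of nilpotents.
    ... | no  h = ⊥-elim (^-nonzero h n (≡.trans (≡.sym (lem n)) (≡.trans (≡.cong (_· 1#) (≡.sym q≡p^n)) (q·x≡0 1#))))
      where
      lem : ∀ k → (p ℕ.^ k) · 1# ≡ (p · 1#) ^ k
      lem zero    = +-identityʳ 1#
      lem (suc k) = ≡.trans (×1-homo-* p (p ℕ.^ k)) (≡.cong ((p · 1#) *_) (lem k))

    private
      multiple : ∀ k → (k ℕ.* p) · 1# ≡ 0#
      multiple k = ≡.trans (×1-homo-* k p) (≡.trans (≡.cong ((k · 1#) *_) hasChar) (zeroʳ _))

    ∤⇒·1≢0 : ∀ m → ¬ (p ∣ m) → m · 1# ≢ 0#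
    ∤⇒·1≢0 m p∤m m·1≡0 = 1≢0 (case-identity (coprime-Bézout coprime))
      where
      coprime : Coprime p m
      coprime (d∣p , d∣m) with prime⇒irreducible prime d∣p
      ... | inj₁ d≡1    = d≡1
      ... | inj₂ ≡.refl = ⊥-elim (p∤m d∣m)
      multiple-m : ∀ k → (k ℕ.* m) · 1# ≡ 0#
      multiple-m k = ≡.trans (×1-homo-* k m) (≡.trans (≡.cong ((k · 1#) *_) m·1≡0) (zeroʳ _))
      one : ∀ a b → 1 ℕ.+ a ≡ b → a · 1# ≡ 0# → b · 1# ≡ 0# → 1# ≡ 0#
      one a b ≡.refl a≡0 b≡0 = ≡.trans (≡.sym (+-identityʳ 1#)) (≡.trans (≡.cong (1# +_) (≡.sym a≡0)) b≡0)
      case-identity : Bézout.Identity 1 p m → 1# ≡ 0#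
      case-identity (Bézout.+- x y eq) = one (y ℕ.* m) (x ℕ.* p) eq (multiple-m y) (multiple x)
      case-identity (Bézout.-+ x y eq) = one (x ℕ.* p) (y ℕ.* m) eq (multiple x) (multiple-m y)

-- Polynomials

module Polynomials {q : ℕ} (F : FinField q) where
  open FieldTheory F

  -- Coefficient lists, lowest degree first and not normalised: `length f ≤ suc D` stands for deg f
  -- ≤ D, and trailing zeros are allowed, so that being zero is the separate predicate `IsZero`.
  Poly : Set
  Poly = List 𝔽

  infixl 6 _+ₚ_
  infixl 7 _*ₚ_
  infixr 8 _^ₚ_

  _+ₚ_ : Poly → Poly → Poly
  []      +ₚ g       = g
  f       +ₚ []      = f
  (a ∷ f) +ₚ (b ∷ g) = (a + b) ∷ (f +ₚ g)

  _*ₚ_ : Poly → Poly → Poly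
  []      *ₚ g = []
  (a ∷ f) *ₚ g = map (a *_) g +ₚ (0# ∷ (f *ₚ g))

  constₚ : 𝔽 → Poly
  constₚ c = c ∷ []

  _^ₚ_ : Poly → ℕ → Poly
  f ^ₚ zero  = constₚ 1#
  f ^ₚ suc n = f *ₚ f ^ₚ n

  ∑ₚ : ∀ {n} → (Fin n → Poly) → Poly
  ∑ₚ {zero}  t = []
  ∑ₚ {suc n} t = t zero +ₚ ∑ₚ (t ∘ suc)

  ∏ₚ : ∀ {n} → (Fin n → Poly) → Poly
  ∏ₚ {zero}  t = constₚ 1#
  ∏ₚ {suc n} t = t zero *ₚ ∏ₚ (t ∘ suc)

  Xₚ : Poly
  Xₚ = 0# ∷ 1# ∷ []

  coef : Poly → ℕ → 𝔽
  coef []      n       = 0#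
  coef (a ∷ f) zero    = a
  coef (a ∷ f) (suc n) = coef f n

  IsZero : Poly → Set
  IsZero f = ∀ n → coef f n ≡ 0#

  -- Synthetic division by X - b: the result (h , r) satisfies a + X f = (X - b) h + r.
  divide : 𝔽 → 𝔽 → Poly → Poly × 𝔽
  divide b a []       = [] , a
  divide b a (a′ ∷ f) = let (h , r) = divide b a′ f in (r ∷ h) , (a + b * r)

  coef-beyond : ∀ f {D} → length f ℕ.≤ D → ∀ n → D ℕ.≤ n → coef f n ≡ 0#
  coef-beyond []      len n       D≤n       = ≡.refl
  coef-beyond (a ∷ f) (s≤s len) (suc n) (s≤s D≤n) = coef-beyond f len n D≤n

  coef-tabulate : ∀ {L} (t : Fin L → 𝔽) l → coef (tabulate t) (toℕ l) ≡ t l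
  coef-tabulate t zero    = ≡.refl
  coef-tabulate t (suc l) = coef-tabulate (t ∘ suc) l

  isZero? : ∀ f → Dec (IsZero f)
  isZero? []      = yes λ _ → ≡.refl
  isZero? (a ∷ f) with a ≟ 0# | isZero? f
  ... | yes a≡0 | yes f≡0 = yes λ { zero → a≡0 ; (suc n) → f≡0 n }
  ... | no  a≢0 | _       = no λ z → a≢0 (z 0)
  ... | _       | no  f≢0 = no λ z → f≢0 (z ∘ suc)

  length-+ : ∀ f g {D} → length f ℕ.≤ D → length g ℕ.≤ D → length (f +ₚ g) ℕ.≤ D
  length-+ []      g       lf lg = lg
  length-+ (a ∷ f) []      lf lg = lf
  length-+ (a ∷ f) (b ∷ g) (s≤s lf) (s≤s lg) = s≤s (length-+ f g lf lg)

  length-* : ∀ f g {D E} → length f ℕ.≤ suc D → length g ℕ.≤ suc E → length (f *ₚ g) ℕ.≤ suc (D ℕ.+ E)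
  length-* []      g lf lg = z≤n
  length-* (a ∷ f) g {D} {E} lf lg = length-+ (map (a *_) g) (0# ∷ f *ₚ g)
    (ℕₚ.≤-trans (ℕₚ.≤-reflexive (length-map (a *_) g)) (ℕₚ.≤-trans lg (s≤s (ℕₚ.m≤n+m E D))))
    (s≤s (tail f D (ℕₚ.≤-pred lf)))
    where
    tail : ∀ f D → length f ℕ.≤ D → length (f *ₚ g) ℕ.≤ D ℕ.+ E
    tail []      D       l = z≤n
    tail (b ∷ f) (suc D) l = length-* (b ∷ f) g l lg

  length-^ : ∀ f {D} → length f ℕ.≤ suc D → ∀ n → length (f ^ₚ n) ℕ.≤ suc (n ℕ.* D)
  length-^ f l zero    = s≤s z≤n
  length-^ f l (suc n) = length-* f (f ^ₚ n) l (length-^ f l n)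

  length-∏ : ∀ {n} (t : Fin n → Poly) {D} → (∀ i → length (t i) ℕ.≤ suc D) → length (∏ₚ t) ℕ.≤ suc (n ℕ.* D)
  length-∏ {zero}  t l = s≤s z≤n
  length-∏ {suc n} t l = length-* (t zero) (∏ₚ (t ∘ suc)) (l zero) (length-∏ (t ∘ suc) (l ∘ suc))

  length-∑ : ∀ {n} (t : Fin n → Poly) {D} → (∀ i → length (t i) ℕ.≤ D) → length (∑ₚ t) ℕ.≤ D
  length-∑ {zero}  t l = z≤n
  length-∑ {suc n} t l = length-+ (t zero) (∑ₚ (t ∘ suc)) (l zero) (length-∑ (t ∘ suc) (l ∘ suc))

  -- Polynomials are evaluated both at field elements and at power series, the latter giving local
  -- expansions; the record serves both targets.
  record Algebra : Set₁ where
    field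
      target : CommutativeRing 0ℓ 0ℓ
    open CommutativeRing target renaming (_≈_ to _≈ₐ_; _+_ to _+ₐ_; _*_ to _*ₐ_; 0# to 0ₐ; 1# to 1ₐ)
    field
      ι   : 𝔽 → Carrier
      ι-+ : ∀ a b → ι (a + b) ≈ₐ ι a +ₐ ι b
      ι-* : ∀ a b → ι (a * b) ≈ₐ ι a *ₐ ι b
      ι-0 : ι 0# ≈ₐ 0ₐ
      ι-1 : ι 1# ≈ₐ 1ₐ

  module Eval (A : Algebra) where
    open Algebra A using (target; ι; ι-+; ι-*; ι-0; ι-1)
    open CommutativeRing target hiding (zero) renaming
      ( Carrier to 𝔸; _≈_ to _≈ₐ_; _+_ to _+ₐ_; _*_ to _*ₐ_; 0# to 0ₐ; 1# to 1ₐ; setoid to setoidₐ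
      ; refl to reflₐ; sym to symₐ; trans to transₐ; reflexive to reflexiveₐ
      ; +-cong to +ₐ-cong; +-congˡ to +ₐ-congˡ; *-congˡ to *ₐ-congˡ
      ; +-identityˡ to +ₐ-identityˡ; +-identityʳ to +ₐ-identityʳ; *-identityʳ to *ₐ-identityʳ
      ; zeroˡ to zeroₐˡ; zeroʳ to zeroₐʳ
      ; commutativeSemiring to csₐ; semiring to semiringₐ; *-commutativeMonoid to *-cmₐ)
    open Exp semiringₐ using () renaming (_^_ to _^ₐ_)
    open Sum semiringₐ using () renaming (sum to sumₐ)
    open CMSum *-cmₐ using () renaming (sum to prodₐ)
    open SetoidReasoning setoidₐ
    open SemiringSolver csₐ

    eval : Poly → 𝔸 → 𝔸
    eval []      s = 0ₐ
    eval (a ∷ f) s = ι a +ₐ s *ₐ eval f s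

    eval-const : ∀ c s → eval (constₚ c) s ≈ₐ ι c
    eval-const c s = transₐ (+ₐ-congˡ (zeroₐʳ s)) (+ₐ-identityʳ _)

    eval-X : ∀ s → eval Xₚ s ≈ₐ s
    eval-X s = begin
      ι 0# +ₐ s *ₐ (ι 1# +ₐ s *ₐ 0ₐ)   ≈⟨ +ₐ-cong ι-0 (*ₐ-congˡ (transₐ (eval-const 1# s) ι-1)) ⟩
      0ₐ +ₐ s *ₐ 1ₐ                    ≈⟨ transₐ (+ₐ-identityˡ _) (*ₐ-identityʳ s) ⟩
      s                                ∎

    eval-+ : ∀ f g s → eval (f +ₚ g) s ≈ₐ eval f s +ₐ eval g s
    eval-+ []      g       s = symₐ (+ₐ-identityˡ _)
    eval-+ (a ∷ f) []      s = symₐ (+ₐ-identityʳ _)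
    eval-+ (a ∷ f) (b ∷ g) s = begin
      ι (a + b) +ₐ s *ₐ eval (f +ₚ g) s                     ≈⟨ +ₐ-cong (ι-+ a b) (*ₐ-congˡ (eval-+ f g s)) ⟩
      (ι a +ₐ ι b) +ₐ s *ₐ (eval f s +ₐ eval g s)
        ≈⟨ solve 5 (λ a b s x y → (a :+ b) :+ s :* (x :+ y) := (a :+ s :* x) :+ (b :+ s :* y)) reflₐ (ι a) (ι b) s (eval f s) (eval g s) ⟩
      (ι a +ₐ s *ₐ eval f s) +ₐ (ι b +ₐ s *ₐ eval g s)      ∎

    eval-scale : ∀ a f s → eval (map (a *_) f) s ≈ₐ ι a *ₐ eval f s
    eval-scale a []      s = symₐ (zeroₐʳ _)
    eval-scale a (b ∷ f) s = begin
      ι (a * b) +ₐ s *ₐ eval (map (a *_) f) s     ≈⟨ +ₐ-cong (ι-* a b) (*ₐ-congˡ (eval-scale a f s)) ⟩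
      ι a *ₐ ι b +ₐ s *ₐ (ι a *ₐ eval f s)
        ≈⟨ solve 4 (λ a b s x → a :* b :+ s :* (a :* x) := a :* (b :+ s :* x)) reflₐ (ι a) (ι b) s (eval f s) ⟩
      ι a *ₐ (ι b +ₐ s *ₐ eval f s)               ∎

    eval-* : ∀ f g s → eval (f *ₚ g) s ≈ₐ eval f s *ₐ eval g s
    eval-* []      g s = symₐ (zeroₐˡ _)
    eval-* (a ∷ f) g s = begin
      eval (map (a *_) g +ₚ (0# ∷ f *ₚ g)) s                    ≈⟨ eval-+ (map (a *_) g) (0# ∷ f *ₚ g) s ⟩
      eval (map (a *_) g) s +ₐ (ι 0# +ₐ s *ₐ eval (f *ₚ g) s)   ≈⟨ +ₐ-cong (eval-scale a g s) (+ₐ-cong ι-0 (*ₐ-congˡ (eval-* f g s))) ⟩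
      ι a *ₐ eval g s +ₐ (0ₐ +ₐ s *ₐ (eval f s *ₐ eval g s))
        ≈⟨ solve 4 (λ a s x y → a :* y :+ (con 0 :+ s :* (x :* y)) := (a :+ s :* x) :* y) reflₐ (ι a) s (eval f s) (eval g s) ⟩
      (ι a +ₐ s *ₐ eval f s) *ₐ eval g s                        ∎

    eval-^ : ∀ f n s → eval (f ^ₚ n) s ≈ₐ eval f s ^ₐ n
    eval-^ f zero    s = transₐ (eval-const 1# s) ι-1
    eval-^ f (suc n) s = transₐ (eval-* f (f ^ₚ n) s) (*ₐ-congˡ (eval-^ f n s))

    eval-∑ : ∀ {n} (t : Fin n → Poly) s → eval (∑ₚ t) s ≈ₐ sumₐ (λ i → eval (t i) s)
    eval-∑ {zero}  t s = reflₐ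
    eval-∑ {suc n} t s = transₐ (eval-+ (t zero) (∑ₚ (t ∘ suc)) s) (+ₐ-congˡ (eval-∑ (t ∘ suc) s))

    eval-∏ : ∀ {n} (t : Fin n → Poly) s → eval (∏ₚ t) s ≈ₐ prodₐ (λ i → eval (t i) s)
    eval-∏ {zero}  t s = transₐ (eval-const 1# s) ι-1
    eval-∏ {suc n} t s = transₐ (eval-* (t zero) (∏ₚ (t ∘ suc)) s) (*ₐ-congˡ (eval-∏ (t ∘ suc) s))

    eval-zero : ∀ f → IsZero f → ∀ s → eval f s ≈ₐ 0ₐ
    eval-zero []      z s = reflₐ
    eval-zero (a ∷ f) z s = begin
      ι a +ₐ s *ₐ eval f s   ≈⟨ +ₐ-cong (transₐ (reflexiveₐ (≡.cong ι (z 0))) ι-0) (*ₐ-congˡ (eval-zero f (z ∘ suc) s)) ⟩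
      0ₐ +ₐ s *ₐ 0ₐ          ≈⟨ transₐ (+ₐ-identityˡ _) (zeroₐʳ s) ⟩
      0ₐ                     ∎

    eval-cong : ∀ f g → (∀ n → coef f n ≡ coef g n) → ∀ s → eval f s ≈ₐ eval g s
    eval-cong []      g       e s = symₐ (eval-zero g (≡.sym ∘ e) s)
    eval-cong (a ∷ f) []      e s = eval-zero (a ∷ f) e s
    eval-cong (a ∷ f) (b ∷ g) e s =
      +ₐ-cong (reflexiveₐ (≡.cong ι (e 0))) (*ₐ-congˡ (eval-cong f g (e ∘ suc) s))

    -- Both sides are moved so that no subtraction occurs.
    eval-divide : ∀ b a f s → let (h , r) = divide b a f in
      eval (a ∷ f) s +ₐ ι b *ₐ eval h s ≈ₐ s *ₐ eval h s +ₐ ι r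
    eval-divide b a [] s = solve 3 (λ a s b → (a :+ s :* con 0) :+ b :* con 0 := s :* con 0 :+ a) reflₐ (ι a) s (ι b)
    eval-divide b a (a′ ∷ f) s with divide b a′ f | eval-divide b a′ f s
    ... | h , r | ih = begin
      (ι a +ₐ s *ₐ eval (a′ ∷ f) s) +ₐ ι b *ₐ (ι r +ₐ s *ₐ eval h s)
        ≈⟨ solve 6 (λ a s x b r h → (a :+ s :* x) :+ b :* (r :+ s :* h) := (a :+ b :* r) :+ s :* (x :+ b :* h)) reflₐ (ι a) s _ (ι b) (ι r) (eval h s) ⟩
      (ι a +ₐ ι b *ₐ ι r) +ₐ s *ₐ (eval (a′ ∷ f) s +ₐ ι b *ₐ eval h s)
        ≈⟨ +ₐ-cong (transₐ (+ₐ-congˡ (symₐ (ι-* b r))) (symₐ (ι-+ a (b * r)))) (*ₐ-congˡ ih) ⟩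
      ι (a + b * r) +ₐ s *ₐ (s *ₐ eval h s +ₐ ι r)
        ≈⟨ solve 4 (λ c s h r → c :+ s :* (s :* h :+ r) := s :* (r :+ s :* h) :+ c) reflₐ _ s (eval h s) (ι r) ⟩
      s *ₐ (ι r +ₐ s *ₐ eval h s) +ₐ ι (a + b * r) ∎

-- Orders of vanishing and the count of zeros

module Multiplicity {q : ℕ} (F : FinField q) where
  open FieldTheory F
  open Polynomials F
  open PowerSeries ring
  open ≡.≡-Reasoning

  𝕊 : CommutativeRing 0ℓ 0ℓ
  𝕊 = ps

  open Exp (CommutativeRing.semiring 𝕊) using () renaming (_^_ to _^ₛ_; ^-congˡ to ^ₛ-congˡ)

  fieldAlgebra : Algebra
  fieldAlgebra = record { target = ring ; ι = λ c → c ; ι-+ = λ _ _ → ≡.refl ; ι-* = λ _ _ → ≡.refl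
                        ; ι-0 = ≡.refl ; ι-1 = ≡.refl }

  seriesAlgebra : Algebra
  seriesAlgebra = record
    { target = 𝕊 ; ι = const ; ι-+ = const-+ ; ι-* = const-*
    ; ι-0 = const-0 ; ι-1 = λ _ → ≡.refl }
    where
    const-+ : ∀ a b → const (a + b) ≋ (const a ⊕ const b)
    const-+ a b zero    = ≡.refl
    const-+ a b (suc n) = ≡.sym (+-identityˡ 0#)
    const-* : ∀ a b → const (a * b) ≋ (const a ⊛ const b)
    const-* a b zero    = ≡.refl
    const-* a b (suc n) = ≡.sym (≡.trans (const-⊛ a (const b) (suc n)) (zeroʳ a))
    const-0 : const 0# ≋ 0ₛ
    const-0 zero    = ≡.refl
    const-0 (suc n) = ≡.refl

  module 𝔼 = Eval fieldAlgebra
  module 𝕊𝔼 = Eval seriesAlgebra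
  open 𝕊𝔼 using () renaming (eval to evalₛ)

  evalₛ-X : ∀ f → evalₛ f X ≋ coef f
  evalₛ-X []      n       = ≡.refl
  evalₛ-X (a ∷ f) zero    = ≡.trans (≡.cong (a +_) (X-⊛-zero (evalₛ f X))) (+-identityʳ a)
  evalₛ-X (a ∷ f) (suc n) = ≡.trans (+-identityˡ _) (≡.trans (X-⊛-suc (evalₛ f X) n) (evalₛ-X f n))

  -- The series b + θX. Substituted into f it yields the Taylor expansion of f at b in the variable
  -- θX; for θ ≠ 0, `Vanish m` of the result therefore says that (X - b)^m divides f, in every
  -- characteristic.
  lin : 𝔽 → 𝔽 → Series
  lin b θ zero          = b
  lin b θ (suc zero)    = θ
  lin b θ (suc (suc _)) = 0#

  lin-⊛-suc : ∀ b θ g n → (lin b θ ⊛ g) (suc n) ≡ b * g (suc n) + θ * g n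
  lin-⊛-suc b θ g n = ≡.cong (b * g (suc n) +_)
    (≡.trans (⊛-cong {f = shift (lin b θ)} {f′ = const θ} eq (λ _ → ≡.refl) n) (const-⊛ θ g n))
    where
    eq : ∀ i → shift (lin b θ) i ≡ const θ i
    eq zero    = ≡.refl
    eq (suc i) = ≡.refl

  Vanish : ℕ → Series → Set
  Vanish m g = ∀ i → i ℕ.< m → g i ≡ 0#

  vanish-cong : ∀ {m f g} → f ≋ g → Vanish m f → Vanish m g
  vanish-cong e v i i<m = ≡.trans (≡.sym (e i)) (v i i<m)

  b*x≡b′*x⇒x≡0 : ∀ {b b′ x} → b ≢ b′ → b * x ≡ b′ * x → x ≡ 0#
  b*x≡b′*x⇒x≡0 {b} {b′} {x} b≢b′ eq with x ≟ 0#
  ... | yes x≡0 = x≡0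
  ... | no  x≢0 = ⊥-elim (b≢b′ (*-cancelˡ x x≢0 (≡.trans (*-comm x b) (≡.trans eq (*-comm b′ x)))))

  module _ (b a : 𝔽) (f : Poly) where
    private
      h = proj₁ (divide b a f)
      r = proj₂ (divide b a f)

    divide-zero : ∀ b′ θ → evalₛ (a ∷ f) (lin b′ θ) 0 + b * evalₛ h (lin b′ θ) 0 ≡ b′ * evalₛ h (lin b′ θ) 0 + r
    divide-zero b′ θ = 𝕊𝔼.eval-divide b a f (lin b′ θ) 0

    divide-suc : ∀ b′ θ n → evalₛ (a ∷ f) (lin b′ θ) (suc n) + b * evalₛ h (lin b′ θ) (suc n)
                 ≡ b′ * evalₛ h (lin b′ θ) (suc n) + θ * evalₛ h (lin b′ θ) n
    divide-suc b′ θ n = begin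
      evalₛ (a ∷ f) (lin b′ θ) (suc n) + b * evalₛ h (lin b′ θ) (suc n)
        ≡⟨ ≡.cong (evalₛ (a ∷ f) (lin b′ θ) (suc n) +_) (const-⊛ b (evalₛ h (lin b′ θ)) (suc n)) ⟨
      evalₛ (a ∷ f) (lin b′ θ) (suc n) + (const b ⊛ evalₛ h (lin b′ θ)) (suc n)
        ≡⟨ 𝕊𝔼.eval-divide b a f (lin b′ θ) (suc n) ⟩
      (lin b′ θ ⊛ evalₛ h (lin b′ θ)) (suc n) + 0#
        ≡⟨ +-identityʳ _ ⟩
      (lin b′ θ ⊛ evalₛ h (lin b′ θ)) (suc n)
        ≡⟨ lin-⊛-suc b′ θ (evalₛ h (lin b′ θ)) n ⟩
      b′ * evalₛ h (lin b′ θ) (suc n) + θ * evalₛ h (lin b′ θ) n ∎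

    remainder-zero : ∀ θ {m} → Vanish (suc m) (evalₛ (a ∷ f) (lin b θ)) → r ≡ 0#
    remainder-zero θ v = ≡.trans (≡.sym (+-cancelˡ (b * evalₛ h (lin b θ) 0)
      (≡.trans (+-comm _ _) (divide-zero b θ)))) (v 0 (s≤s z≤n))

    -- For b′ = b the terms with b cancel in `divide-suc`, leaving coefficient i + 1 of the dividend
    -- equal to θ times coefficient i of the quotient.
    quotient-vanish : ∀ θ {m} → θ ≢ 0# → Vanish (suc m) (evalₛ (a ∷ f) (lin b θ)) → Vanish m (evalₛ h (lin b θ))
    quotient-vanish θ θ≢0 v i i<m = no-zero-divisors
      (≡.trans (≡.sym (+-cancelˡ (b * evalₛ h (lin b θ) (suc i)) (≡.trans (+-comm _ _) (divide-suc b θ i)))) (v (suc i) (s≤s i<m)))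
      θ≢0

    -- Away from b the factor X - b is a unit. Instead of inverting it, the coefficients of the
    -- quotient H are found in turn: once H i = 0, the next one satisfies b H = b′ H.
    quotient-vanish-elsewhere : r ≡ 0# → ∀ b′ θ → b′ ≢ b → ∀ m → Vanish m (evalₛ (a ∷ f) (lin b′ θ)) → Vanish m (evalₛ h (lin b′ θ))
    quotient-vanish-elsewhere r≡0 b′ θ b′≢b m v zero 0<m = b*x≡b′*x⇒x≡0 (b′≢b ∘ ≡.sym) (begin
      b * H 0                                      ≡⟨ +-identityˡ _ ⟨
      0# + b * H 0                                 ≡⟨ ≡.cong (_+ b * H 0) (v 0 0<m) ⟨
      evalₛ (a ∷ f) (lin b′ θ) 0 + b * H 0         ≡⟨ divide-zero b′ θ ⟩
      b′ * H 0 + r                                 ≡⟨ ≡.cong (b′ * H 0 +_) r≡0 ⟩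
      b′ * H 0 + 0#                                ≡⟨ +-identityʳ _ ⟩
      b′ * H 0                                     ∎)
      where H = evalₛ h (lin b′ θ)
    quotient-vanish-elsewhere r≡0 b′ θ b′≢b m v (suc i) i<m = b*x≡b′*x⇒x≡0 (b′≢b ∘ ≡.sym) (begin
      b * H (suc i)                                      ≡⟨ +-identityˡ _ ⟨
      0# + b * H (suc i)                                 ≡⟨ ≡.cong (_+ b * H (suc i)) (v (suc i) i<m) ⟨
      evalₛ (a ∷ f) (lin b′ θ) (suc i) + b * H (suc i)   ≡⟨ divide-suc b′ θ i ⟩
      b′ * H (suc i) + θ * H i
        ≡⟨ ≡.cong (λ z → b′ * H (suc i) + θ * z) (quotient-vanish-elsewhere r≡0 b′ θ b′≢b m v i (ℕₚ.<⇒≤ i<m)) ⟩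
      b′ * H (suc i) + θ * 0#                            ≡⟨ ≡.trans (≡.cong (b′ * H (suc i) +_) (zeroʳ θ)) (+-identityʳ _) ⟩
      b′ * H (suc i)                                     ∎)
      where H = evalₛ h (lin b′ θ)

    quotient-IsZero : r ≡ 0# → IsZero h → IsZero (a ∷ f)
    quotient-IsZero r≡0 z n = begin
      coef (a ∷ f) n                                        ≡⟨ evalₛ-X (a ∷ f) n ⟨
      evalₛ (a ∷ f) X n                                     ≡⟨ +-identityʳ _ ⟨
      evalₛ (a ∷ f) X n + 0#
        ≡⟨ ≡.cong (evalₛ (a ∷ f) X n +_) (≡.trans (⊛-cong {f = const b} (λ _ → ≡.refl) (𝕊𝔼.eval-zero h z X) n) (⊛0 (const b) n)) ⟨
      evalₛ (a ∷ f) X n + (const b ⊛ evalₛ h X) n           ≡⟨ 𝕊𝔼.eval-divide b a f X n ⟩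
      (X ⊛ evalₛ h X) n + const r n
        ≡⟨ ≡.cong₂ _+_ (≡.trans (⊛-cong {f = X} (λ _ → ≡.refl) (𝕊𝔼.eval-zero h z X) n) (⊛0 X n)) (constr n) ⟩
      0# + 0#                                               ≡⟨ +-identityˡ 0# ⟩
      0#                                                    ∎
      where
      ⊛0 : ∀ g n → (g ⊛ 0ₛ) n ≡ 0#
      ⊛0 = CommutativeRing.zeroʳ 𝕊
      constr : ∀ n → const r n ≡ 0#
      constr zero    = r≡0
      constr (suc n) = ≡.refl

  length-divide : ∀ b a f → length (proj₁ (divide b a f)) ≡ length f
  length-divide b a []       = ≡.refl
  length-divide b a (a′ ∷ f) = ≡.cong suc (length-divide b a′ f)

  -- Divides by (X - b)^m. The last two components are what the induction over the remaining points
  -- needs: a zero quotient comes only from zero, and orders at other points survive.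
  strip : ∀ m b θ → θ ≢ 0# → ∀ f n → length f ℕ.≤ m ℕ.+ n → Vanish m (evalₛ f (lin b θ)) →
    ∃ λ h → length h ℕ.≤ n × (IsZero h → IsZero f) ×
      (∀ b′ θ′ k → b′ ≢ b → Vanish k (evalₛ f (lin b′ θ′)) → Vanish k (evalₛ h (lin b′ θ′)))
  strip zero    b θ θ≢0 f n len v = f , len , (λ z → z) , (λ _ _ _ _ w → w)
  strip (suc m) b θ θ≢0 [] n len v = [] , z≤n , (λ z → z) , (λ _ _ _ _ w → w)
  strip (suc m) b θ θ≢0 (a ∷ f) n (s≤s len) v
    with strip m b θ θ≢0 (proj₁ (divide b a f)) n (≡.subst (ℕ._≤ m ℕ.+ n) (≡.sym (length-divide b a f)) len) (quotient-vanish b a f θ θ≢0 v)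
  ... | h , len-h , zero-h , rest = h , len-h , (λ z → quotient-IsZero b a f r≡0 (zero-h z)) ,
        (λ b′ θ′ k b′≢b w → rest b′ θ′ k b′≢b (quotient-vanish-elsewhere b a f r≡0 b′ θ′ b′≢b k w))
    where r≡0 = remainder-zero b a f θ v

  -- Every point splits off m linear factors, until no coefficient is left.
  multiplicity : ∀ s m f (b θ : Fin s → 𝔽) → (∀ i j → b i ≡ b j → i ≡ j) → (∀ i → θ i ≢ 0#) →
    length f ℕ.≤ s ℕ.* m → (∀ i → Vanish m (evalₛ f (lin (b i) (θ i)))) → IsZero f
  multiplicity zero    m []      b θ inj θ≢0 len v n = ≡.refl
  multiplicity (suc s) m f       b θ inj θ≢0 len v
    with strip m (b zero) (θ zero) (θ≢0 zero) f (s ℕ.* m) len (v zero)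
  ... | h , len-h , zero-h , rest = zero-h (multiplicity s m h (b ∘ suc) (θ ∘ suc)
        (λ i j e → Finₚ.suc-injective (inj _ _ e)) (θ≢0 ∘ suc) len-h
        (λ i → rest _ _ m (λ e → Finₚ.0≢1+n (≡.sym (inj _ _ e))) (v (suc i))))

  DegBelow : ℕ → Series → Set
  DegBelow D f = ∀ n → D ℕ.≤ n → f n ≡ 0#

  truncate : ∀ D f → DegBelow D (coef f) → ∃ λ g → length g ℕ.≤ D × (∀ n → coef g n ≡ coef f n)
  truncate zero    f       z = [] , z≤n , λ n → ≡.sym (z n z≤n)
  truncate (suc D) []      z = [] , z≤n , λ n → ≡.refl
  truncate (suc D) (a ∷ f) z with truncate D f (λ n D≤n → z (suc n) (s≤s D≤n))
  ... | g , len , eq = a ∷ g , s≤s len , λ { zero → ≡.refl ; (suc n) → eq n }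

  -- When leading coefficients cancel, the list is longer than the degree warrants. Cutting it is
  -- harmless; the Hanson-Petridis polynomial needs this form.
  multiplicity-deg : ∀ s m D f (b θ : Fin s → 𝔽) → (∀ i j → b i ≡ b j → i ≡ j) → (∀ i → θ i ≢ 0#) →
    DegBelow D (coef f) → D ℕ.≤ s ℕ.* m → (∀ i → Vanish m (evalₛ f (lin (b i) (θ i)))) → IsZero f
  multiplicity-deg s m D f b θ inj θ≢0 deg D≤sm v with truncate D f deg
  ... | g , len , eq = λ n → ≡.trans (≡.sym (eq n)) (multiplicity s m g b θ inj θ≢0 (ℕₚ.≤-trans len D≤sm)
        (λ i → vanish-cong (𝕊𝔼.eval-cong f g (≡.sym ∘ eq) (lin (b i) (θ i))) (v i)) n)

  HasOrder : Series → ℕ → Set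
  HasOrder g s = Vanish s g × g s ≢ 0#

  order-exists : ∀ g n → g n ≢ 0# → ∃ (HasOrder g)
  order-exists g zero    gn≢0 = 0 , (λ _ ()) , gn≢0
  order-exists g (suc n) gn≢0 with g 0 ≟ 0#
  ... | no  g0≢0 = 0 , (λ _ ()) , g0≢0
  ... | yes g0≡0 with order-exists (shift g) n gn≢0
  ... | s , v , h = suc s , (λ { zero _ → g0≡0 ; (suc i) (s≤s i<s) → v i i<s }) , h

  order-unique : ∀ {f g s t} → f ≋ g → HasOrder f s → HasOrder g t → s ≡ t
  order-unique {f} {g} {s} {t} e (vf , f≢0) (vg , g≢0) with ℕₚ.<-cmp s t
  ... | tri< s<t _ _ = ⊥-elim (f≢0 (≡.trans (e s) (vg s s<t)))
  ... | tri≈ _ s≡t _ = s≡t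
  ... | tri> _ _ t<s = ⊥-elim (g≢0 (≡.trans (≡.sym (e t)) (vf t t<s)))

  order-cong : ∀ {f g s} → f ≋ g → HasOrder f s → HasOrder g s
  order-cong e (v , h) = vanish-cong e v , λ z → h (≡.trans (e _) z)

  order-⊛ : ∀ s t f g → HasOrder f s → HasOrder g t → HasOrder (f ⊛ g) (s ℕ.+ t)
  order-⊛ zero zero f g (_ , f≢0) (_ , g≢0) = (λ _ ()) , *-nonzero f≢0 g≢0
  order-⊛ zero (suc t) f g hf (vg , g≢0) with order-⊛ zero t f (shift g) hf ((λ i i<t → vg (suc i) (s≤s i<t)) , g≢0)
  ... | v , h = (λ { zero _ → ≡.trans (≡.cong (f 0 *_) (vg 0 (s≤s z≤n))) (zeroʳ _) ; (suc i) (s≤s i<t) → ≡.trans (step i) (v i i<t) })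
              , (λ z → h (≡.trans (≡.sym (step t)) z))
    where
    step : ∀ n → (f ⊛ g) (suc n) ≡ (f ⊛ shift g) n
    step n = ≡.trans (⊛-sucʳ f g n) (≡.trans (≡.cong ((f ⊛ shift g) n +_) (≡.trans (≡.cong (f (suc n) *_) (vg 0 (s≤s z≤n))) (zeroʳ _))) (+-identityʳ _))
  order-⊛ (suc s) t f g (vf , f≢0) hg with order-⊛ s t (shift f) g ((λ i i<s → vf (suc i) (s≤s i<s)) , f≢0) hg
  ... | v , h = (λ { zero _ → ≡.trans (≡.cong (_* g 0) (vf 0 (s≤s z≤n))) (zeroˡ _) ; (suc i) (s≤s i<) → ≡.trans (step i) (v i i<) })
              , (λ z → h (≡.trans (≡.sym (step (s ℕ.+ t))) z))
    where
    step : ∀ n → (f ⊛ g) (suc n) ≡ (shift f ⊛ g) n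
    step n = ≡.trans (≡.cong (_+ (shift f ⊛ g) n) (≡.trans (≡.cong (_* g (suc n)) (vf 0 (s≤s z≤n))) (zeroˡ _))) (+-identityˡ _)

  order-1 : HasOrder 1ₛ 0
  order-1 = (λ _ ()) , 1≢0

  order-^ : ∀ {f s} → HasOrder f s → ∀ n → HasOrder (f ^ₛ n) (n ℕ.* s)
  order-^ h zero    = order-1
  order-^ h (suc n) = order-⊛ _ _ _ _ h (order-^ h n)

  series-no-zero-divisors : ∀ f g n → (f ⊛ g) ≋ 0ₛ → f n ≢ 0# → g ≋ 0ₛ
  series-no-zero-divisors f g n fg≋0 fn≢0 m with g m ≟ 0#
  ... | yes gm≡0 = gm≡0
  ... | no  gm≢0 with order-exists f n fn≢0 | order-exists g m gm≢0
  ... | s , hs | t , ht = ⊥-elim (proj₂ (order-⊛ s t f g hs ht) (fg≋0 (s ℕ.+ t)))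

  -- The order is found by a finite search: by `multiplicity` at a single point, the expansion of a
  -- nonzero polynomial has a nonzero coefficient below `length f`.
  order-poly : ∀ f → ¬ IsZero f → ∀ b θ → θ ≢ 0# → ∃ (HasOrder (evalₛ f (lin b θ)))
  order-poly f f≢0 b θ θ≢0 with Finₚ.any? {n = length f} (λ i → ¬? (evalₛ f (lin b θ) (toℕ i) ≟ 0#))

  ... | yes (i , h) = order-exists _ (toℕ i) h
  ... | no  none = ⊥-elim (f≢0 (multiplicity 1 (length f) f (λ _ → b) (λ _ → θ) (λ { zero zero _ → ≡.refl }) (λ _ → θ≢0)
        (ℕₚ.≤-reflexive (≡.sym (ℕₚ.+-identityʳ _))) (λ _ → vanish)))
    where
    vanish : Vanish (length f) (evalₛ f (lin b θ))
    vanish i i<len with evalₛ f (lin b θ) i ≟ 0#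
    ... | yes z  = z
    ... | no  nz = ⊥-elim (none (fromℕ< i<len , λ z → nz (≡.trans (≡.cong (evalₛ f (lin b θ)) (≡.sym (Finₚ.toℕ-fromℕ< i<len))) z)))

-- The Kummer tower

module KummerSeries {q : ℕ} (F : FinField q) {p n : ℕ} (prime : Prime p) (q≡p^n : q ≡ p ℕ.^ n)
                    (d N : ℕ) (1+dN≡q : suc (d ℕ.* N) ≡ q) where
  open FieldTheory F
  open Characteristic {p} {n} prime q≡p^n
  open Polynomials F
  open PowerSeries ring
  open Multiplicity F

  module 𝕊R = CommutativeRing 𝕊
  open Exp 𝕊R.semiring using () renaming
    (_^_ to _^ₛ_; ^-congˡ to ^ₛ-congˡ; ^-congʳ to ^ₛ-congʳ; ^-homo-* to ^ₛ-homo-*; ^-assocʳ to ^ₛ-assocʳ) public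
  open CExp 𝕊R.commutativeSemiring using () renaming (^-distrib-* to ^ₛ-distrib-⊛) public
  open Mult 𝕊R.semiring using () renaming (_×_ to _·ₛ_)
  open Sum 𝕊R.semiring using () renaming (sum to ∑; sum-cong-≋ to ∑-cong; *-distribˡ-sum to ⊛-distribˡ-∑; *-distribʳ-sum to ⊛-distribʳ-∑;
    ∑-distrib-+ to ∑-distrib-⊕; sum-replicate-zero to ∑-zero) public
  open CMSum 𝕊R.*-commutativeMonoid using () renaming (sum to ∏; sum-cong-≋ to ∏-cong; ∑-distrib-+ to ∏-distrib) public
  module ≋-Reasoning = SetoidReasoning 𝕊R.setoid

  seriesHasChar : HasChar 𝕊 p
  seriesHasChar zero    = ≡.trans (coordinate p 1ₛ 0) hasChar
    where
    coordinate : ∀ m f i → (m ·ₛ f) i ≡ m · f i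
    coordinate zero    f i = ≡.refl
    coordinate (suc m) f i = ≡.cong (f i +_) (coordinate m f i)
  seriesHasChar (suc i) = zeros p
    where
    zeros : ∀ m → (m ·ₛ 1ₛ) (suc i) ≡ 0#
    zeros zero    = ≡.refl
    zeros (suc m) = ≡.trans (+-identityˡ _) (zeros m)

  module 𝔽rob = Frobenius 𝕊 prime seriesHasChar

  ^qᵗ-distrib-⊕ : ∀ t f g → (f ⊕ g) ^ₛ (q ℕ.^ t) ≋ ((f ^ₛ (q ℕ.^ t)) ⊕ (g ^ₛ (q ℕ.^ t)))
  ^qᵗ-distrib-⊕ t f g = ≡.subst (λ m → (f ⊕ g) ^ₛ m ≋ ((f ^ₛ m) ⊕ (g ^ₛ m)))
    (≡.sym (≡.trans (≡.cong (ℕ._^ t) q≡p^n) (ℕₚ.^-*-assoc p n t))) (𝔽rob.^p^-distrib-+ (n ℕ.* t) f g)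

  ^q-distrib-∑ : ∀ {m} (t : Fin m → Series) → (∑ t) ^ₛ q ≋ ∑ (λ i → t i ^ₛ q)
  ^q-distrib-∑ t = ≡.subst (λ m → (∑ t) ^ₛ m ≋ ∑ (λ i → t i ^ₛ m)) (≡.sym q≡p^n) (𝔽rob.^p^-distrib-sum n t)

  infix 4 _≋[_]_
  _≋[_]_ : Series → ℕ → Series → Set
  f ≋[ m ] g = ∀ i → i ℕ.< m → f i ≡ g i

  ⊛-cong-mod : ∀ {m f f′ g g′} → f ≋[ m ] f′ → g ≋[ m ] g′ → (f ⊛ g) ≋[ m ] (f′ ⊛ g′)
  ⊛-cong-mod a b i i<m = ⊛-local i (λ j j≤i → a j (ℕₚ.≤-<-trans j≤i i<m)) (λ j j≤i → b j (ℕₚ.≤-<-trans j≤i i<m))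

  ^-cong-mod : ∀ {m f g} → f ≋[ m ] g → ∀ r → (f ^ₛ r) ≋[ m ] (g ^ₛ r)
  ^-cong-mod a zero    i i<m = ≡.refl
  ^-cong-mod {f = f} {g} a (suc r) = ⊛-cong-mod {f = f} {f′ = g} a (^-cong-mod a r)

  ∏-cong-mod : ∀ {m r} {s t : Fin r → Series} → (∀ i → s i ≋[ m ] t i) → ∏ s ≋[ m ] ∏ t
  ∏-cong-mod {r = zero}  a i i<m = ≡.refl
  ∏-cong-mod {r = suc r} {s} {t} a = ⊛-cong-mod {f = s zero} {f′ = t zero} (a zero) (∏-cong-mod (a ∘ suc))

  ∑-cong-mod : ∀ {m r} {s t : Fin r → Series} → (∀ i → s i ≋[ m ] t i) → ∑ s ≋[ m ] ∑ t
  ∑-cong-mod {r = zero}  a i i<m = ≡.refl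
  ∑-cong-mod {r = suc r} a i i<m = ≡.cong₂ _+_ (a zero i i<m) (∑-cong-mod (a ∘ suc) i i<m)

  1ₛ^ : ∀ r → 1ₛ ^ₛ r ≋ 1ₛ
  1ₛ^ zero    i = ≡.refl
  1ₛ^ (suc r) i = ≡.trans (⊛-identityˡ _ i) (1ₛ^ r i)

  vanish-⊛ˡ : ∀ s f g → Vanish s f → Vanish s (f ⊛ g)
  vanish-⊛ˡ s f g v i i<s = ≡.trans (⊛-cong-mod {f = f} {f′ = 0ₛ} {g} v (λ _ _ → ≡.refl) i i<s) (0-⊛ g i)

  vanish-⊛ : ∀ f g t → Vanish 1 f → Vanish t g → Vanish (suc t) (f ⊛ g)
  vanish-⊛ f g t vf vg zero    _         = ≡.trans (≡.cong (_* g 0) (vf 0 (s≤s z≤n))) (zeroˡ _)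
  vanish-⊛ f g t vf vg (suc i) (s≤s i<t) = ≡.trans
    (≡.cong₂ _+_ (≡.trans (≡.cong (_* g (suc i)) (vf 0 (s≤s z≤n))) (zeroˡ _))
      (≡.trans (⊛-comm (shift f) g i) (vanish-⊛ˡ t g (shift f) vg i i<t)))
    (+-identityˡ 0#)

  vanish-^ : ∀ f → Vanish 1 f → ∀ t → Vanish t (f ^ₛ t)
  vanish-^ f v zero    = λ _ ()
  vanish-^ f v (suc t) = vanish-⊛ f (f ^ₛ t) t v (vanish-^ f v t)

  tail-of : Series → Series
  tail-of f zero    = 0#
  tail-of f (suc i) = f (suc i)

  head+tail : ∀ f → f ≋ (const (f 0) ⊕ tail-of f)
  head+tail f zero    = ≡.sym (+-identityʳ _)
  head+tail f (suc i) = ≡.sym (+-identityˡ _)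

  -- Raising to the power q^t is additive, and it takes a series without constant term to a multiple
  -- of X^(q^t).
  ^qᵗ≋head : ∀ t f → (f ^ₛ (q ℕ.^ t)) ≋[ q ℕ.^ t ] (const (f 0) ^ₛ (q ℕ.^ t))
  ^qᵗ≋head t f i i< = ≡.trans (^ₛ-congˡ (q ℕ.^ t) (head+tail f) i)
    (≡.trans (^qᵗ-distrib-⊕ t (const (f 0)) (tail-of f) i)
    (≡.trans (≡.cong ((const (f 0) ^ₛ (q ℕ.^ t)) i +_) (vanish-^ (tail-of f) (λ { zero _ → ≡.refl ; (suc _) (s≤s ()) }) (q ℕ.^ t) i i<)) (+-identityʳ _)))

  ^qᵗ≋1 : ∀ t f → f 0 ≡ 1# → (f ^ₛ (q ℕ.^ t)) ≋[ q ℕ.^ t ] 1ₛ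
  ^qᵗ≋1 t f f0≡1 i i< = ≡.trans (^qᵗ≋head t f i i<)
    (≡.trans (^ₛ-congˡ (q ℕ.^ t) {y = 1ₛ} (λ { zero → f0≡1 ; (suc _) → ≡.refl }) i) (1ₛ^ (q ℕ.^ t) i))

  -- (q^t − 1)/d
  exponent : ℕ → ℕ
  exponent zero    = 0
  exponent (suc t) = exponent t ℕ.+ q ℕ.^ t ℕ.* N

  1+d*exponent≡q^t : ∀ t → suc (d ℕ.* exponent t) ≡ q ℕ.^ t
  1+d*exponent≡q^t zero    = ≡.cong suc (ℕₚ.*-zeroʳ d)
  1+d*exponent≡q^t (suc t) = begin
    suc (d ℕ.* (exponent t ℕ.+ q ℕ.^ t ℕ.* N))          ≡⟨ ≡.cong suc (ℕₚ.*-distribˡ-+ d (exponent t) _) ⟩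
    suc (d ℕ.* exponent t) ℕ.+ d ℕ.* (q ℕ.^ t ℕ.* N)    ≡⟨ ≡.cong₂ ℕ._+_ (1+d*exponent≡q^t t) (rearrange d (q ℕ.^ t) N) ⟩
    q ℕ.^ t ℕ.+ (d ℕ.* N) ℕ.* q ℕ.^ t                   ≡⟨ ≡.cong (ℕ._* q ℕ.^ t) 1+dN≡q ⟩
    q ℕ.* q ℕ.^ t                                       ∎
    where
    open ≡.≡-Reasoning
    rearrange : ∀ (a b c : ℕ) → a ℕ.* (b ℕ.* c) ≡ (a ℕ.* c) ℕ.* b
    rearrange a b c = ≡.trans (≡.cong (a ℕ.*_) (ℕₚ.*-comm b c)) (≡.sym (ℕₚ.*-assoc a c b))

  n<q^n : ∀ (i : ℕ) → i ℕ.< q ℕ.^ i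
  n<q^n i = ℕₚ.≤-<-trans ℕₚ.≤-refl (lem i)
    where
    lem : ∀ (i : ℕ) → i ℕ.< q ℕ.^ i
    lem zero    = s≤s z≤n
    lem (suc i) = ℕₚ.≤-trans (s≤s (lem i)) (ℕₚ.≤-trans
      (ℕₚ.+-monoˡ-≤ (q ℕ.^ i) (ℕₚ.≤-trans (s≤s z≤n) (lem i)))
      (ℕₚ.≤-trans (ℕₚ.≤-reflexive (≡.cong (q ℕ.^ i ℕ.+_) (≡.sym (ℕₚ.+-identityʳ _)))) (ℕₚ.*-monoˡ-≤ (q ℕ.^ i) 1<q)))

  module Root (f : Series) (f0≡1 : f 0 ≡ 1#) where

    -- Consecutive exponents differ by q^t N, and f^(q^t N) is 1 modulo X^(q^t). Hence the powers
    -- f^((q^t - 1)/d) converge X-adically, to f^(-1/d) because f^(q^t) tends to 1.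
    ^exponent-step : ∀ t r → (f ^ₛ exponent (r ℕ.+ t)) ≋[ q ℕ.^ t ] (f ^ₛ exponent t)
    ^exponent-step t zero    i i< = ≡.refl
    ^exponent-step t (suc r) i i< = begin
      (f ^ₛ (exponent (r ℕ.+ t) ℕ.+ q ℕ.^ (r ℕ.+ t) ℕ.* N)) i
        ≡⟨ ^ₛ-homo-* f (exponent (r ℕ.+ t)) (q ℕ.^ (r ℕ.+ t) ℕ.* N) i ⟩
      ((f ^ₛ exponent (r ℕ.+ t)) ⊛ (f ^ₛ (q ℕ.^ (r ℕ.+ t) ℕ.* N))) i
        ≡⟨ ⊛-cong-mod {f = f ^ₛ exponent (r ℕ.+ t)} {f′ = f ^ₛ exponent t} (^exponent-step t r) one i i< ⟩
      ((f ^ₛ exponent t) ⊛ 1ₛ) i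
        ≡⟨ 𝕊R.*-identityʳ (f ^ₛ exponent t) i ⟩
      (f ^ₛ exponent t) i ∎
      where
      open ≡.≡-Reasoning
      one : (f ^ₛ (q ℕ.^ (r ℕ.+ t) ℕ.* N)) ≋[ q ℕ.^ t ] 1ₛ
      one i i< = ≡.trans (≡.sym (^ₛ-assocʳ f (q ℕ.^ (r ℕ.+ t)) N i))
        (≡.trans (^-cong-mod (^qᵗ≋1 (r ℕ.+ t) f f0≡1) N i
          (ℕₚ.<-≤-trans i< (ℕₚ.^-monoʳ-≤ q {{ℕ.>-nonZero (ℕₚ.<⇒≤ 1<q)}} (ℕₚ.m≤n+m t r)))) (1ₛ^ N i))

    -- the power series (1/f)^{1/d}
    root : Series
    root i = (f ^ₛ exponent (suc i)) i

    -- Coefficient i no longer changes from the exponent of index i + 1 on, as i < q^(i+1).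
    root≋^exponent : ∀ r → root ≋[ suc r ] (f ^ₛ exponent (suc r))
    root≋^exponent r i (s≤s i≤r) = ≡.sym (≡.subst (λ m → (f ^ₛ exponent m) i ≡ root i)
      (≡.trans (ℕₚ.+-suc (r ∸ i) i) (≡.cong suc (ℕₚ.m∸n+n≡m i≤r)))
      (^exponent-step (suc i) (r ∸ i) i (ℕₚ.<-trans (ℕₚ.n<1+n i) (n<q^n (suc i)))))

    root^d⊛f≋1 : ((root ^ₛ d) ⊛ f) ≋ 1ₛ
    root^d⊛f≋1 i = begin
      ((root ^ₛ d) ⊛ f) i                    ≡⟨ ⊛-cong-mod {g = f} (^-cong-mod {suc i} {root} (root≋^exponent i) d) (λ _ _ → ≡.refl) i (ℕₚ.n<1+n i) ⟩
      (((f ^ₛ exponent (suc i)) ^ₛ d) ⊛ f) i ≡⟨ ⊛-comm _ f i ⟩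
      (f ⊛ ((f ^ₛ exponent (suc i)) ^ₛ d)) i ≡⟨ ⊛-cong {f = f} (λ _ → ≡.refl) (^ₛ-assocʳ f (exponent (suc i)) d) i ⟩
      (f ^ₛ suc (exponent (suc i) ℕ.* d)) i  ≡⟨ ≡.cong (λ m → (f ^ₛ suc m) i) (ℕₚ.*-comm (exponent (suc i)) d) ⟩
      (f ^ₛ suc (d ℕ.* exponent (suc i))) i  ≡⟨ ≡.cong (λ m → (f ^ₛ m) i) (1+d*exponent≡q^t (suc i)) ⟩
      (f ^ₛ (q ℕ.^ suc i)) i                 ≡⟨ ^qᵗ≋1 (suc i) f f0≡1 i (ℕₚ.<-trans (ℕₚ.n<1+n i) (n<q^n (suc i))) ⟩
      1ₛ i                                   ∎
      where open ≡.≡-Reasoning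

    -- Convergence from t = 1 on, where the exponent is N. Through this congruence the polynomials
    -- f^N are exchanged for Kummer series.
    root≋f^N : root ≋[ q ] (f ^ₛ N)
    root≋f^N i i<q = ≡.trans (≡.subst (λ m → (f ^ₛ exponent m) i ≡ (f ^ₛ exponent 1) i) (ℕₚ.+-comm i 1)
        (^exponent-step 1 i i (ℕₚ.<-≤-trans i<q (ℕₚ.≤-reflexive (≡.sym (ℕₚ.*-identityʳ q))))))
      (≡.cong (λ m → (f ^ₛ m) i) (ℕₚ.+-identityʳ N))

    root0≡1 : root 0 ≡ 1#
    root0≡1 = head^ (exponent 1)
      where
      head^ : ∀ m → (f ^ₛ m) 0 ≡ 1#
      head^ zero    = ≡.refl
      head^ (suc m) = ≡.trans (≡.cong₂ _*_ f0≡1 (head^ m)) (*-identityˡ 1#)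

    -- Write q = 1 + d N and use root^d f = 1. Thus the q-th power of the root is the root times a
    -- rational function, and taking q-th powers of a linear relation introduces no new monomials.
    root^q : ((root ^ₛ q) ⊛ (f ^ₛ N)) ≋ root
    root^q = begin
      (root ^ₛ q) ⊛ (f ^ₛ N)                         ≈⟨ 𝕊R.*-congʳ (^ₛ-congʳ root (≡.sym 1+dN≡q)) ⟩
      (root ⊛ (root ^ₛ (d ℕ.* N))) ⊛ (f ^ₛ N)        ≈⟨ ⊛-assoc root _ _ ⟩
      root ⊛ ((root ^ₛ (d ℕ.* N)) ⊛ (f ^ₛ N))        ≈⟨ 𝕊R.*-congˡ {root} (𝕊R.*-congʳ (^ₛ-assocʳ root d N)) ⟨
      root ⊛ (((root ^ₛ d) ^ₛ N) ⊛ (f ^ₛ N))         ≈⟨ 𝕊R.*-congˡ {root} (^ₛ-distrib-⊛ (root ^ₛ d) f N) ⟨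
      root ⊛ (((root ^ₛ d) ⊛ f) ^ₛ N)                ≈⟨ 𝕊R.*-congˡ {root} (^ₛ-congˡ N root^d⊛f≋1) ⟩
      root ⊛ (1ₛ ^ₛ N)                               ≈⟨ 𝕊R.*-congˡ {root} (1ₛ^ N) ⟩
      root ⊛ 1ₛ                                      ≈⟨ 𝕊R.*-identityʳ root ⟩
      root                                           ∎
      where open ≋-Reasoning

  order-∏ : ∀ {r} (t : Fin r → Series) (o : ℕ) l → HasOrder (t l) o → (∀ i → i ≢ l → HasOrder (t i) 0) → HasOrder (∏ t) o
  order-∏ {suc r} t o zero hl h = ≡.subst (HasOrder (∏ t)) (ℕₚ.+-identityʳ o)
    (order-⊛ o 0 (t zero) (∏ (t ∘ suc)) hl (zeros (t ∘ suc) (λ i → h (suc i) λ ())))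
    where
    zeros : ∀ {r} (t : Fin r → Series) → (∀ i → HasOrder (t i) 0) → HasOrder (∏ t) 0
    zeros {zero}  t h = order-1
    zeros {suc r} t h = order-⊛ 0 0 (t zero) (∏ (t ∘ suc)) (h zero) (zeros (t ∘ suc) (h ∘ suc))
  order-∏ {suc r} t o (suc l) hl h = order-⊛ 0 o (t zero) (∏ (t ∘ suc)) (h zero λ ())
    (order-∏ (t ∘ suc) o l hl (λ i i≢l → h (suc i) (i≢l ∘ Finₚ.suc-injective)))

  infixl 6 _⊝_
  _⊝_ : Series → Series → Series
  f ⊝ g = f ⊕ (⊖ g)

  ⊝-self : ∀ {f g} → f ≋ g → (f ⊝ g) ≋ 0ₛ
  ⊝-self {f} {g} e i = ≡.trans (≡.cong (_+ - g i) (e i)) (-‿inverseʳ (g i))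

  ⊝-zero : ∀ {f g} → (f ⊝ g) ≋ 0ₛ → f ≋ g
  ⊝-zero e i = x-y≡0⇒x≡y (e i)

  ⊝-distribʳ-⊛ : ∀ f g h → ((f ⊝ g) ⊛ h) ≋ ((f ⊛ h) ⊝ (g ⊛ h))
  ⊝-distribʳ-⊛ f g h = begin
    (f ⊝ g) ⊛ h              ≈⟨ ⊛-distribʳ h f (⊖ g) ⟩
    (f ⊛ h) ⊕ ((⊖ g) ⊛ h)    ≈⟨ 𝕊R.+-congˡ {f ⊛ h} (RingProps.-‿distribˡ-* 𝕊R.ring g h) ⟨
    (f ⊛ h) ⊝ (g ⊛ h)        ∎
    where open ≋-Reasoning

  drop-zeroˡ : ∀ f g → f ≋ 0ₛ → (f ⊕ g) ≋ 0ₛ → g ≋ 0ₛ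
  drop-zeroˡ f g f≋0 f+g≋0 i = ≡.trans (≡.sym (≡.trans (≡.cong (_+ g i) (f≋0 i)) (+-identityˡ _))) (f+g≋0 i)

  ∑-⊝ : ∀ {r} (s t : Fin r → Series) → ∑ (λ i → s i ⊝ t i) ≋ (∑ s ⊝ ∑ t)
  ∑-⊝ s t = begin
    ∑ (λ i → s i ⊝ t i)           ≈⟨ ∑-distrib-⊕ s (λ i → ⊖ t i) ⟩
    ∑ s ⊕ ∑ (λ i → ⊖ t i)         ≈⟨ 𝕊R.+-congˡ {∑ s} (neg t) ⟩
    ∑ s ⊝ ∑ t                     ∎
    where
    open ≋-Reasoning
    neg : ∀ {r} (t : Fin r → Series) → ∑ (λ i → ⊖ t i) ≋ ⊖ ∑ t
    neg {zero}  t i = ≡.sym (RingProps.-0#≈0# (CommutativeRing.ring ring))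
    neg {suc r} t i = ≡.trans (≡.cong (- t zero i +_) (neg (t ∘ suc) i)) (RingProps.-‿+-comm (CommutativeRing.ring ring) (t zero i) (∑ (t ∘ suc) i))

  negₚ : Poly → Poly
  negₚ f = constₚ (- 1#) *ₚ f

  _-ₚ_ : Poly → Poly → Poly
  f -ₚ g = f +ₚ negₚ g

  evalₛ-neg : ∀ f s → 𝕊𝔼.eval (negₚ f) s ≋ ⊖ 𝕊𝔼.eval f s
  evalₛ-neg f s i = begin
    𝕊𝔼.eval (negₚ f) s i                           ≡⟨ 𝕊𝔼.eval-* (constₚ (- 1#)) f s i ⟩
    (𝕊𝔼.eval (constₚ (- 1#)) s ⊛ 𝕊𝔼.eval f s) i         ≡⟨ 𝕊R.*-congʳ {𝕊𝔼.eval f s} (𝕊𝔼.eval-const (- 1#) s) i ⟩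
    (const (- 1#) ⊛ 𝕊𝔼.eval f s) i                 ≡⟨ const-⊛ (- 1#) (𝕊𝔼.eval f s) i ⟩
    - 1# * 𝕊𝔼.eval f s i                           ≡⟨ RingProps.-1*x≈-x (CommutativeRing.ring ring) _ ⟩
    - 𝕊𝔼.eval f s i                                ∎
    where open ≡.≡-Reasoning

  evalₛ-- : ∀ f g s → 𝕊𝔼.eval (f -ₚ g) s ≋ (𝕊𝔼.eval f s ⊝ 𝕊𝔼.eval g s)
  evalₛ-- f g s i = ≡.trans (𝕊𝔼.eval-+ f (negₚ g) s i) (≡.cong (𝕊𝔼.eval f s i +_) (evalₛ-neg g s i))

  module Tower (k : ℕ) (e : Fin k → 𝔽) (e-injective : ∀ i j → e i ≡ e j → i ≡ j) (e≢0 : ∀ i → e i ≢ 0#) where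
    open 𝕊𝔼 using () renaming (eval to evalₛ)

    fₚ : Fin k → Poly
    fₚ i = 1# ∷ e i ∷ []

    f : Fin k → Series
    f i = evalₛ (fₚ i) X

    f0≡1 : ∀ i → f i 0 ≡ 1#
    f0≡1 i = evalₛ-X (fₚ i) 0

    private module R i = Root (f i) (f0≡1 i)

    -- The Kummer series (1 + eᵢ X)^(-1/d); `y i` below is the polynomial (1 + eᵢ X)^N that agrees
    -- with it modulo X^q.
    w : Fin k → Series
    w i = R.root i

    y : Fin k → Series
    y i = f i ^ₛ N

    -- Multi-indices with k entries below d, coded as numbers so that they can index finite sums.
    J : Set
    J = Fin (d ℕ.^ k)

    expo : J → Fin k → ℕ
    expo j i = toℕ (finToFun {d} {k} j i)

    expo<d : ∀ j i → expo j i ℕ.< d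
    expo<d j i = Finₚ.toℕ<n (finToFun {d} {k} j i)

    expo-injective : ∀ {j j′} → (∀ i → expo j i ≡ expo j′ i) → j ≡ j′
    expo-injective {j} {j′} same = ≡.trans (≡.sym (Finₚ.funToFin-finToFin {k} {d} j))
      (≡.trans (funToFin-cong (λ i → Finₚ.toℕ-injective (same i))) (Finₚ.funToFin-finToFin {k} {d} j′))

    W : (Fin k → ℕ) → Series
    W m = ∏ (λ i → w i ^ₛ m i)

    Y : (Fin k → ℕ) → Series
    Y m = ∏ (λ i → y i ^ₛ m i)

    Yₚ : (Fin k → ℕ) → Poly
    Yₚ m = ∏ₚ (λ i → (fₚ i ^ₚ N) ^ₚ m i)

    evalₛ-Yₚ : ∀ m s → evalₛ (Yₚ m) s ≋ ∏ (λ i → (evalₛ (fₚ i) s ^ₛ N) ^ₛ m i)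
    evalₛ-Yₚ m s = 𝕊R.trans (𝕊𝔼.eval-∏ (λ i → (fₚ i ^ₚ N) ^ₚ m i) s)
      (∏-cong (λ i → 𝕊R.trans (𝕊𝔼.eval-^ (fₚ i ^ₚ N) (m i) s) (^ₛ-congˡ (m i) (𝕊𝔼.eval-^ (fₚ i) N s))))

    head-W : ∀ m → W m 0 ≡ 1#
    head-W m = head-∏ (λ i → w i ^ₛ m i) (λ i → head-^ (w i) (R.root0≡1 i) (m i))
      where
      head-^ : ∀ g → g 0 ≡ 1# → ∀ r → (g ^ₛ r) 0 ≡ 1#
      head-^ g h zero    = ≡.refl
      head-^ g h (suc r) = ≡.trans (≡.cong₂ _*_ h (head-^ g h r)) (*-identityˡ 1#)
      head-∏ : ∀ {r} (t : Fin r → Series) → (∀ i → t i 0 ≡ 1#) → ∏ t 0 ≡ 1#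
      head-∏ {zero}  t h = ≡.refl
      head-∏ {suc r} t h = ≡.trans (≡.cong₂ _*_ (h zero) (head-∏ (t ∘ suc) (h ∘ suc))) (*-identityˡ 1#)

    ∏-^ : ∀ {r} (t : Fin r → Series) m → (∏ t) ^ₛ m ≋ ∏ (λ i → t i ^ₛ m)
    ∏-^ {zero}  t m = 1ₛ^ m
    ∏-^ {suc r} t m = 𝕊R.trans (^ₛ-distrib-⊛ (t zero) (∏ (t ∘ suc)) m) (𝕊R.*-congˡ {t zero ^ₛ m} (∏-^ (t ∘ suc) m))

    -- The q-th power of a monomial produces negative powers of the `y i`. Multiplying by all `y i`
    -- to the power d - 1 clears them, and these exponents remain.
    complement : J → Fin k → ℕ
    complement j i = (d ∸ 1) ∸ expo j i

    expo+complement : ∀ j i → expo j i ℕ.+ complement j i ≡ d ∸ 1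
    expo+complement j i = ℕₚ.m+[n∸m]≡n (ℕₚ.<⇒≤pred (expo<d j i))

    W^q : ∀ j → ((W (expo j) ^ₛ q) ⊛ Y (λ _ → d ∸ 1)) ≋ (W (expo j) ⊛ Y (complement j))
    W^q j = begin
      (W (expo j) ^ₛ q) ⊛ Y (λ _ → d ∸ 1)
        ≈⟨ 𝕊R.*-congʳ {Y (λ _ → d ∸ 1)} (∏-^ (λ i → w i ^ₛ expo j i) q) ⟩
      ∏ (λ i → (w i ^ₛ expo j i) ^ₛ q) ⊛ Y (λ _ → d ∸ 1)
        ≈⟨ ∏-distrib (λ i → (w i ^ₛ expo j i) ^ₛ q) (λ i → y i ^ₛ (d ∸ 1)) ⟨
      ∏ (λ i → ((w i ^ₛ expo j i) ^ₛ q) ⊛ (y i ^ₛ (d ∸ 1)))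
        ≈⟨ ∏-cong factor ⟩
      ∏ (λ i → (w i ^ₛ expo j i) ⊛ (y i ^ₛ complement j i))
        ≈⟨ ∏-distrib (λ i → w i ^ₛ expo j i) (λ i → y i ^ₛ complement j i) ⟩
      W (expo j) ⊛ Y (complement j) ∎
      where
      open ≋-Reasoning
      swap-^ : ∀ g a b → (g ^ₛ a) ^ₛ b ≋ (g ^ₛ b) ^ₛ a
      swap-^ g a b = 𝕊R.trans (^ₛ-assocʳ g a b) (𝕊R.trans (^ₛ-congʳ g (ℕₚ.*-comm a b)) (𝕊R.sym (^ₛ-assocʳ g b a)))
      factor : ∀ i → (((w i ^ₛ expo j i) ^ₛ q) ⊛ (y i ^ₛ (d ∸ 1))) ≋ ((w i ^ₛ expo j i) ⊛ (y i ^ₛ complement j i))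
      factor i = begin
        ((w i ^ₛ a) ^ₛ q) ⊛ (y i ^ₛ (d ∸ 1))                 ≈⟨ 𝕊R.*-cong (swap-^ (w i) a q) (^ₛ-congʳ (y i) (≡.sym (expo+complement j i))) ⟩
        ((w i ^ₛ q) ^ₛ a) ⊛ (y i ^ₛ (a ℕ.+ b))               ≈⟨ 𝕊R.*-congˡ {(w i ^ₛ q) ^ₛ a} (^ₛ-homo-* (y i) a b) ⟩
        ((w i ^ₛ q) ^ₛ a) ⊛ ((y i ^ₛ a) ⊛ (y i ^ₛ b))        ≈⟨ ⊛-assoc ((w i ^ₛ q) ^ₛ a) _ _ ⟨
        (((w i ^ₛ q) ^ₛ a) ⊛ (y i ^ₛ a)) ⊛ (y i ^ₛ b)        ≈⟨ 𝕊R.*-congʳ {y i ^ₛ b} (^ₛ-distrib-⊛ (w i ^ₛ q) (y i) a) ⟨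
        (((w i ^ₛ q) ⊛ y i) ^ₛ a) ⊛ (y i ^ₛ b)               ≈⟨ 𝕊R.*-congʳ {y i ^ₛ b} (^ₛ-congˡ a (R.root^q i)) ⟩
        (w i ^ₛ a) ⊛ (y i ^ₛ b)                              ∎
        where
        a = expo j i
        b = complement j i

    -- At the zero -1/e_l of f_l all other factors are units, so the order reveals the exponent
    -- `m l` alone.
    order-Y : ∀ l m → HasOrder (evalₛ (Yₚ m) (lin (- proj₁ (inverse (e l) (e≢0 l))) 1#)) (m l ℕ.* (N ℕ.* 1))
    order-Y l m = order-cong (𝕊R.sym (evalₛ-Yₚ m s)) (order-∏ (λ i → (evalₛ (fₚ i) s ^ₛ N) ^ₛ m i) _ l
        (order-^ (order-^ (vanishes , λ z → e≢0 l (≡.trans (≡.sym at1) z)) N) (m l))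
        (λ i i≢l → ≡.subst (HasOrder _) (ℕₚ.*-zeroʳ (m i)) (order-^ (≡.subst (HasOrder _) (ℕₚ.*-zeroʳ N) (order-^ ((λ _ ()) , λ z → i≢l (nonroot i z)) N)) (m i))))
      where
      open ≡.≡-Reasoning
      e⁻¹ = proj₁ (inverse (e l) (e≢0 l))
      s = lin (- e⁻¹) 1#
      at0 : ∀ i → evalₛ (fₚ i) s 0 ≡ 1# + - e⁻¹ * e i
      at0 i = ≡.cong (1# +_) (≡.cong (- e⁻¹ *_) (𝕊𝔼.eval-const (e i) s 0))
      -e⁻¹*e : - e⁻¹ * e l ≡ - 1#
      -e⁻¹*e = ≡.trans (≡.sym (RingProps.-‿distribˡ-* (CommutativeRing.ring ring) e⁻¹ (e l)))
        (≡.cong -_ (≡.trans (*-comm _ _) (proj₂ (inverse (e l) (e≢0 l)))))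
      vanishes : Vanish 1 (evalₛ (fₚ l) s)
      vanishes zero    _ = ≡.trans (at0 l) (≡.trans (≡.cong (1# +_) -e⁻¹*e) (-‿inverseʳ 1#))
      vanishes (suc _) (s≤s ())
      at1 : evalₛ (fₚ l) s 1 ≡ e l
      at1 = begin
        0# + (s ⊛ evalₛ (constₚ (e l)) s) 1             ≡⟨ +-identityˡ _ ⟩
        (s ⊛ evalₛ (constₚ (e l)) s) 1                  ≡⟨ 𝕊R.*-congˡ {s} (𝕊𝔼.eval-const (e l) s) 1 ⟩
        (s ⊛ const (e l)) 1                        ≡⟨ lin-⊛-suc (- e⁻¹) 1# (const (e l)) 0 ⟩
        - e⁻¹ * 0# + 1# * e l                      ≡⟨ ≡.cong₂ _+_ (zeroʳ _) (*-identityˡ _) ⟩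
        0# + e l                                   ≡⟨ +-identityˡ _ ⟩
        e l                                        ∎
      nonroot : ∀ i → evalₛ (fₚ i) s 0 ≡ 0# → i ≡ l
      nonroot i z = e-injective i l (*-cancelˡ (- e⁻¹) -e⁻¹≢0 (+-cancelˡ 1#
          (≡.trans (≡.sym (at0 i)) (≡.trans z (≡.sym (≡.trans (≡.sym (at0 l)) (vanishes 0 (s≤s z≤n))))))))
        where
        -e⁻¹≢0 : - e⁻¹ ≢ 0#
        -e⁻¹≢0 h = 1≢0 (+-cancelˡ (- 1#) (≡.trans (-‿inverseˡ 1#) (≡.trans (≡.sym (≡.trans (≡.cong (_* e l) h) (zeroˡ _)))
          (≡.trans -e⁻¹*e (≡.sym (+-identityʳ _))))))

    N≢0 : N ≢ 0
    N≢0 N≡0 = ℕₚ.<⇒≢ 1<q (≡.trans (≡.sym (≡.cong suc (≡.trans (≡.cong (d ℕ.*_) N≡0) (ℕₚ.*-zeroʳ d)))) 1+dN≡q)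

    -- With q = 1 + d N the equation becomes N (a + s d) = N (b + t d), so a and b agree modulo d.
    complement-equation : ∀ s t a b → a ℕ.< d → b ℕ.< d →
      (q ℕ.* s ℕ.+ a ℕ.* (N ℕ.* 1)) ℕ.+ t ≡ s ℕ.+ (q ℕ.* t ℕ.+ b ℕ.* (N ℕ.* 1)) → a ≡ b
    complement-equation s t a b a<d b<d eq = begin
      a                        ≡⟨ m<n⇒m%n≡m a<d ⟨
      a % d                    ≡⟨ [m+kn]%n≡m%n a s d ⟨
      (a ℕ.+ s ℕ.* d) % d      ≡⟨ ≡.cong (_% d) (ℕₚ.*-cancelˡ-≡ _ _ N {{ℕ.≢-nonZero N≢0}} (ℕₚ.+-cancelˡ-≡ (s ℕ.+ t) _ _ scaled)) ⟩
      (b ℕ.+ t ℕ.* d) % d      ≡⟨ [m+kn]%n≡m%n b t d ⟩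
      b % d                    ≡⟨ m<n⇒m%n≡m b<d ⟩
      b                        ∎
      where
      open ≡.≡-Reasoning
      instance d≢0 = ℕ.>-nonZero (ℕₚ.≤-<-trans z≤n a<d)
      expandˡ : ∀ s t a d N → s ℕ.+ t ℕ.+ N ℕ.* (a ℕ.+ s ℕ.* d) ≡ (suc (d ℕ.* N) ℕ.* s ℕ.+ a ℕ.* (N ℕ.* 1)) ℕ.+ t
      expandˡ = solve-∀
      expandʳ : ∀ s t b d N → s ℕ.+ (suc (d ℕ.* N) ℕ.* t ℕ.+ b ℕ.* (N ℕ.* 1)) ≡ s ℕ.+ t ℕ.+ N ℕ.* (b ℕ.+ t ℕ.* d)
      expandʳ = solve-∀
      scaled : s ℕ.+ t ℕ.+ N ℕ.* (a ℕ.+ s ℕ.* d) ≡ s ℕ.+ t ℕ.+ N ℕ.* (b ℕ.+ t ℕ.* d)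
      scaled = begin
        s ℕ.+ t ℕ.+ N ℕ.* (a ℕ.+ s ℕ.* d)                              ≡⟨ expandˡ s t a d N ⟩
        (suc (d ℕ.* N) ℕ.* s ℕ.+ a ℕ.* (N ℕ.* 1)) ℕ.+ t                ≡⟨ ≡.cong (λ z → (z ℕ.* s ℕ.+ a ℕ.* (N ℕ.* 1)) ℕ.+ t) 1+dN≡q ⟩
        (q ℕ.* s ℕ.+ a ℕ.* (N ℕ.* 1)) ℕ.+ t                            ≡⟨ eq ⟩
        s ℕ.+ (q ℕ.* t ℕ.+ b ℕ.* (N ℕ.* 1))                            ≡⟨ ≡.cong (λ z → s ℕ.+ (z ℕ.* t ℕ.+ b ℕ.* (N ℕ.* 1))) 1+dN≡q ⟨
        s ℕ.+ (suc (d ℕ.* N) ℕ.* t ℕ.+ b ℕ.* (N ℕ.* 1))                ≡⟨ expandʳ s t b d N ⟩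
        s ℕ.+ t ℕ.+ N ℕ.* (b ℕ.+ t ℕ.* d)                              ∎

    -- Subtracting suitable multiples of a relation and of its q-th power eliminates the term of index j₀.
    eliminant : Poly → J → Poly → J → Poly
    eliminant P₀ j₀ P j = ((P₀ ^ₚ q *ₚ Yₚ (complement j₀)) *ₚ P) -ₚ (P₀ *ₚ (P ^ₚ q *ₚ Yₚ (complement j)))

    evalₛ-eliminant : ∀ P₀ j₀ P j s → evalₛ (eliminant P₀ j₀ P j) s ≋
      ((((evalₛ P₀ s ^ₛ q) ⊛ evalₛ (Yₚ (complement j₀)) s) ⊛ evalₛ P s) ⊝
       (evalₛ P₀ s ⊛ ((evalₛ P s ^ₛ q) ⊛ evalₛ (Yₚ (complement j)) s)))
    evalₛ-eliminant P₀ j₀ P j s i = ≡.trans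
      (evalₛ-- ((P₀ ^ₚ q *ₚ Yₚ (complement j₀)) *ₚ P) (P₀ *ₚ (P ^ₚ q *ₚ Yₚ (complement j))) s i)
      (≡.cong₂ (λ u v → u + - v)
        (𝕊R.trans (𝕊𝔼.eval-* (P₀ ^ₚ q *ₚ Yₚ (complement j₀)) P s) (𝕊R.*-congʳ {evalₛ P s} (part P₀ j₀)) i)
        (𝕊R.trans (𝕊𝔼.eval-* P₀ (P ^ₚ q *ₚ Yₚ (complement j)) s) (𝕊R.*-congˡ {evalₛ P₀ s} (part P j)) i))
      where
      part : ∀ P j → evalₛ (P ^ₚ q *ₚ Yₚ (complement j)) s ≋ ((evalₛ P s ^ₛ q) ⊛ evalₛ (Yₚ (complement j)) s)
      part P j = 𝕊R.trans (𝕊𝔼.eval-* (P ^ₚ q) (Yₚ (complement j)) s) (𝕊R.*-congʳ {evalₛ (Yₚ (complement j)) s} (𝕊𝔼.eval-^ P q s))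

    -- A vanishing eliminant equates the orders of two products at each point -1/e_l. The unknown
    -- orders of P₀ and P enter only with the factor q - 1 = d N, while the exponents enter with the
    -- factor N, and these can therefore be compared modulo d.
    eliminant-zero⇒same-index : ∀ P₀ j₀ P j → ¬ IsZero P₀ → ¬ IsZero P → IsZero (eliminant P₀ j₀ P j) → j₀ ≡ j
    eliminant-zero⇒same-index P₀ j₀ P j P₀≢0 P≢0 z = expo-injective λ l → same l
      where
      same : ∀ l → expo j₀ l ≡ expo j l
      same l = ℕₚ.+-cancelʳ-≡ (complement j l) _ _ (begin
        expo j₀ l ℕ.+ complement j l     ≡⟨ ≡.cong (expo j₀ l ℕ.+_) complements ⟨
        expo j₀ l ℕ.+ complement j₀ l    ≡⟨ expo+complement j₀ l ⟩
        d ∸ 1                             ≡⟨ expo+complement j l ⟨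
        expo j l ℕ.+ complement j l      ∎)
        where
        open ≡.≡-Reasoning
        s = lin (- proj₁ (inverse (e l) (e≢0 l))) 1#
        order₀ = order-poly P₀ P₀≢0 (- proj₁ (inverse (e l) (e≢0 l))) 1# 1≢0
        order₁ = order-poly P P≢0 (- proj₁ (inverse (e l) (e≢0 l))) 1# 1≢0
        complement<d : ∀ j → complement j l ℕ.< d
        complement<d j = ℕₚ.≤-<-trans (ℕₚ.m∸n≤m (d ∸ 1) (expo j l))
          (ℕₚ.≤-reflexive (ℕₚ.suc-pred d {{ℕ.>-nonZero (ℕₚ.≤-<-trans z≤n (expo<d j l))}}))
        complements : complement j₀ l ≡ complement j l
        complements = complement-equation (proj₁ order₀) (proj₁ order₁) _ _ (complement<d j₀) (complement<d j)
          (order-unique (⊝-zero (𝕊R.trans (𝕊R.sym (evalₛ-eliminant P₀ j₀ P j s)) (𝕊𝔼.eval-zero (eliminant P₀ j₀ P j) z s)))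
            (order-⊛ _ _ _ _ (order-⊛ _ _ _ _ (order-^ (proj₂ order₀) q) (order-Y l (complement j₀))) (proj₂ order₁))
            (order-⊛ _ _ _ _ (proj₂ order₀) (order-⊛ _ _ _ _ (order-^ (proj₂ order₁) q) (order-Y l (complement j)))))

    0^q : 0ₛ ^ₛ q ≋ 0ₛ
    0^q = 𝕊R.trans (^ₛ-congʳ 0ₛ (≡.sym 1+dN≡q)) (0-⊛ (0ₛ ^ₛ (d ℕ.* N)))

    -- Induction on the number of terms, for all coefficient polynomials at once because elimination
    -- raises their degrees. The eliminants form a shorter relation and so vanish; if P₀ ≠ 0, any
    -- other nonzero coefficient would then belong to the same index as P₀.
    independent : ∀ r (ι : Fin r → J) → (∀ i i′ → ι i ≡ ι i′ → i ≡ i′) → (P : Fin r → Poly) →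
      ∑ (λ i → evalₛ (P i) X ⊛ W (expo (ι i))) ≋ 0ₛ → ∀ i → IsZero (P i)
    independent (suc r) ι inj P relation = zeros
      where
      open ≋-Reasoning
      open SemiringSolver 𝕊R.commutativeSemiring
      a : Fin (suc r) → Series
      a i = evalₛ (P i) X
      V : Fin (suc r) → Series
      V i = W (expo (ι i))
      c : Fin (suc r) → Series
      c i = Y (complement (ι i))
      Yd : Series
      Yd = Y (λ _ → d ∸ 1)
      P₀ = P zero

      relation^q : ∑ (λ i → ((a i ^ₛ q) ⊛ c i) ⊛ V i) ≋ 0ₛ
      relation^q = begin
        ∑ (λ i → ((a i ^ₛ q) ⊛ c i) ⊛ V i)      ≈⟨ ∑-cong term ⟨
        ∑ (λ i → ((a i ⊛ V i) ^ₛ q) ⊛ Yd)       ≈⟨ ⊛-distribʳ-∑ Yd (λ i → (a i ⊛ V i) ^ₛ q) ⟨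
        ∑ (λ i → (a i ⊛ V i) ^ₛ q) ⊛ Yd         ≈⟨ 𝕊R.*-congʳ {Yd} (^q-distrib-∑ (λ i → a i ⊛ V i)) ⟨
        (∑ (λ i → a i ⊛ V i) ^ₛ q) ⊛ Yd         ≈⟨ 𝕊R.*-congʳ {Yd} (^ₛ-congˡ q relation) ⟩
        (0ₛ ^ₛ q) ⊛ Yd                          ≈⟨ 𝕊R.*-congʳ {Yd} 0^q ⟩
        0ₛ ⊛ Yd                                 ≈⟨ 0-⊛ Yd ⟩
        0ₛ                                      ∎
        where
        term : ∀ i → (((a i ⊛ V i) ^ₛ q) ⊛ Yd) ≋ (((a i ^ₛ q) ⊛ c i) ⊛ V i)
        term i = begin
          ((a i ⊛ V i) ^ₛ q) ⊛ Yd               ≈⟨ 𝕊R.*-congʳ {Yd} (^ₛ-distrib-⊛ (a i) (V i) q) ⟩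
          ((a i ^ₛ q) ⊛ (V i ^ₛ q)) ⊛ Yd        ≈⟨ ⊛-assoc (a i ^ₛ q) (V i ^ₛ q) Yd ⟩
          (a i ^ₛ q) ⊛ ((V i ^ₛ q) ⊛ Yd)        ≈⟨ 𝕊R.*-congˡ {a i ^ₛ q} (W^q (ι i)) ⟩
          (a i ^ₛ q) ⊛ (V i ⊛ c i)              ≈⟨ solve 3 (λ x v c → x :* (v :* c) := (x :* c) :* v) 𝕊R.refl (a i ^ₛ q) (V i) (c i) ⟩
          ((a i ^ₛ q) ⊛ c i) ⊛ V i              ∎

      Q : Fin (suc r) → Poly
      Q i = eliminant P₀ (ι zero) (P i) (ι i)

      evalQ : ∀ i → evalₛ (Q i) X ≋ ((((a zero ^ₛ q) ⊛ c zero) ⊛ a i) ⊝ (a zero ⊛ ((a i ^ₛ q) ⊛ c i)))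
      evalQ i n = ≡.trans (evalₛ-eliminant P₀ (ι zero) (P i) (ι i) X n)
        (≡.cong₂ (λ u v → u + - v)
          (𝕊R.*-congʳ {a i} (𝕊R.*-congˡ {a zero ^ₛ q} (evalₛ-Yₚ (complement (ι zero)) X)) n)
          (𝕊R.*-congˡ {a zero} (𝕊R.*-congˡ {a i ^ₛ q} (evalₛ-Yₚ (complement (ι i)) X)) n))

      eliminated : ∑ (λ i → evalₛ (Q i) X ⊛ V i) ≋ 0ₛ
      eliminated = begin
        ∑ (λ i → evalₛ (Q i) X ⊛ V i)
          ≈⟨ ∑-cong term ⟩
        ∑ (λ i → (((a zero ^ₛ q) ⊛ c zero) ⊛ (a i ⊛ V i)) ⊝ (a zero ⊛ (((a i ^ₛ q) ⊛ c i) ⊛ V i)))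
          ≈⟨ ∑-⊝ (λ i → ((a zero ^ₛ q) ⊛ c zero) ⊛ (a i ⊛ V i)) (λ i → a zero ⊛ (((a i ^ₛ q) ⊛ c i) ⊛ V i)) ⟩
        ∑ (λ i → ((a zero ^ₛ q) ⊛ c zero) ⊛ (a i ⊛ V i)) ⊝ ∑ (λ i → a zero ⊛ (((a i ^ₛ q) ⊛ c i) ⊛ V i))
          ≈⟨ ⊝-self (𝕊R.trans (multiple ((a zero ^ₛ q) ⊛ c zero) (λ i → a i ⊛ V i) relation)
                    (𝕊R.sym (multiple (a zero) (λ i → ((a i ^ₛ q) ⊛ c i) ⊛ V i) relation^q))) ⟩
        0ₛ ∎
        where
        multiple : ∀ g (t : Fin (suc r) → Series) → ∑ t ≋ 0ₛ → ∑ (λ i → g ⊛ t i) ≋ 0ₛ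
        multiple g t z = 𝕊R.trans (𝕊R.sym (⊛-distribˡ-∑ g t)) (𝕊R.trans (𝕊R.*-congˡ {g} z) (𝕊R.zeroʳ g))
        term : ∀ i → (evalₛ (Q i) X ⊛ V i) ≋ ((((a zero ^ₛ q) ⊛ c zero) ⊛ (a i ⊛ V i)) ⊝ (a zero ⊛ (((a i ^ₛ q) ⊛ c i) ⊛ V i)))
        term i = begin
          evalₛ (Q i) X ⊛ V i
            ≈⟨ 𝕊R.*-congʳ {V i} (evalQ i) ⟩
          ((((a zero ^ₛ q) ⊛ c zero) ⊛ a i) ⊝ (a zero ⊛ ((a i ^ₛ q) ⊛ c i))) ⊛ V i
            ≈⟨ ⊝-distribʳ-⊛ (((a zero ^ₛ q) ⊛ c zero) ⊛ a i) (a zero ⊛ ((a i ^ₛ q) ⊛ c i)) (V i) ⟩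
          ((((a zero ^ₛ q) ⊛ c zero) ⊛ a i) ⊛ V i) ⊝ ((a zero ⊛ ((a i ^ₛ q) ⊛ c i)) ⊛ V i)
            ≈⟨ (λ n → ≡.cong₂ (λ u v → u + - v) (⊛-assoc ((a zero ^ₛ q) ⊛ c zero) (a i) (V i) n) (⊛-assoc (a zero) ((a i ^ₛ q) ⊛ c i) (V i) n)) ⟩
          (((a zero ^ₛ q) ⊛ c zero) ⊛ (a i ⊛ V i)) ⊝ (a zero ⊛ (((a i ^ₛ q) ⊛ c i) ⊛ V i)) ∎

      Q₀≋0 : evalₛ (Q zero) X ≋ 0ₛ
      Q₀≋0 = 𝕊R.trans (evalQ zero) (⊝-self (⊛-comm ((a zero ^ₛ q) ⊛ c zero) (a zero)))

      Q-zeros : ∀ i → IsZero (Q (suc i))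
      Q-zeros = independent r (ι ∘ suc) (λ i i′ eq → Finₚ.suc-injective (inj _ _ eq)) (Q ∘ suc)
        (drop-zeroˡ (evalₛ (Q zero) X ⊛ V zero) (∑ (λ i → evalₛ (Q (suc i)) X ⊛ V (suc i)))
          (𝕊R.trans (𝕊R.*-congʳ {V zero} Q₀≋0) (0-⊛ (V zero))) eliminated)

      split : ¬ IsZero P₀ → ∀ i → IsZero (P (suc i))
      split P₀≢0 i with isZero? (P (suc i))
      ... | yes z = z
      ... | no nz = ⊥-elim (Finₚ.0≢1+n (inj _ _ (eliminant-zero⇒same-index P₀ (ι zero) (P (suc i)) (ι (suc i)) P₀≢0 nz (Q-zeros i))))

      zeros : ∀ i → IsZero (P i)
      zeros with isZero? P₀
      ... | yes P₀≡0 = λ { zero → P₀≡0 ; (suc i) →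
        independent r (ι ∘ suc) (λ i i′ eq → Finₚ.suc-injective (inj _ _ eq)) (P ∘ suc)
          (drop-zeroˡ (a zero ⊛ V zero) (∑ (λ i → a (suc i) ⊛ V (suc i)))
            (𝕊R.trans (𝕊R.*-congʳ {V zero} (𝕊𝔼.eval-zero P₀ P₀≡0 X)) (0-⊛ (V zero))) relation) i }
      -- Only the first term of the relation survives, and its monomial has constant term 1.
      ... | no P₀≢0 = ⊥-elim (P₀≢0 (λ n → ≡.trans (≡.sym (evalₛ-X P₀ n))
          (series-no-zero-divisors (V zero) (a zero) 0 (𝕊R.trans (⊛-comm (V zero) (a zero)) only) (λ z → 1≢0 (≡.trans (≡.sym (head-W (expo (ι zero)))) z)) n)))
        where
        tail≋0 : ∀ {r} (P : Fin r → Poly) (V : Fin r → Series) → (∀ i → IsZero (P i)) → ∑ (λ i → evalₛ (P i) X ⊛ V i) ≋ 0ₛ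
        tail≋0 {r} P V z = 𝕊R.trans (∑-cong (λ i → 𝕊R.trans (𝕊R.*-congʳ {V i} (𝕊𝔼.eval-zero (P i) (z i) X)) (0-⊛ (V i)))) (∑-zero r)
        only : (a zero ⊛ V zero) ≋ 0ₛ
        only n = ≡.trans (≡.sym (≡.trans (≡.cong ((a zero ⊛ V zero) n +_) (tail≋0 (P ∘ suc) (V ∘ suc) (split P₀≢0) n)) (+-identityʳ _))) (relation n)

-- A zero estimate for combinations of the Kummer monomials

module ZeroEstimate {q : ℕ} (F : FinField q) {p n : ℕ} (prime : Prime p) (q≡p^n : q ≡ p ℕ.^ n)
                    (d N : ℕ) (1+dN≡q : suc (d ℕ.* N) ≡ q)
                    (k : ℕ) (e : Fin k → Fin q) (e-injective : ∀ i j → e i ≡ e j → i ≡ j)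
                    (e≢0 : ∀ i → e i ≢ FieldTheory.0# F) where
  open FieldTheory F
  open Polynomials F
  open PowerSeries ring
  open Multiplicity F
  open KummerSeries F {p} {n} prime q≡p^n d N 1+dN≡q
  open Tower k e e-injective e≢0
  open 𝕊𝔼 using () renaming (eval to evalₛ)

  private module R i = Root (f i) (f0≡1 i)

  Ev : (J → Poly) → Series
  Ev P = ∑ (λ j → evalₛ (P j) X ⊛ W (expo j))

  -- Membership in the span of the series X^t W_j with t < E, a space described by d^k E
  -- coefficients.
  IsForm : ℕ → Series → Set
  IsForm E s = Σ (J → Poly) λ c → (∀ j → length (c j) ℕ.≤ E) × s ≋ Ev c

  form-cong : ∀ {E} s t → s ≋ t → IsForm E s → IsForm E t
  form-cong s t s≋t (c , len , eq) = c , len , 𝕊R.trans (𝕊R.sym s≋t) eq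

  Ev-+ : ∀ P Q → Ev (λ j → P j +ₚ Q j) ≋ (Ev P ⊕ Ev Q)
  Ev-+ P Q = 𝕊R.trans (∑-cong (λ j → 𝕊R.trans (𝕊R.*-congʳ {W (expo j)} (𝕊𝔼.eval-+ (P j) (Q j) X)) (⊛-distribʳ (W (expo j)) _ _)))
    (∑-distrib-⊕ (λ j → evalₛ (P j) X ⊛ W (expo j)) (λ j → evalₛ (Q j) X ⊛ W (expo j)))

  Ev-- : ∀ P Q → Ev (λ j → P j -ₚ Q j) ≋ (Ev P ⊝ Ev Q)
  Ev-- P Q = 𝕊R.trans (∑-cong (λ j → 𝕊R.trans (𝕊R.*-congʳ {W (expo j)} (evalₛ-- (P j) (Q j) X)) (⊝-distribʳ-⊛ _ _ (W (expo j)))))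
    (∑-⊝ (λ j → evalₛ (P j) X ⊛ W (expo j)) (λ j → evalₛ (Q j) X ⊛ W (expo j)))

  form-⊕ : ∀ {E} s t → IsForm E s → IsForm E t → IsForm E (s ⊕ t)
  form-⊕ s t (c , len , eq) (c′ , len′ , eq′) = (λ j → c j +ₚ c′ j) , (λ j → length-+ (c j) (c′ j) (len j) (len′ j)) ,
    𝕊R.trans (𝕊R.+-cong eq eq′) (𝕊R.sym (Ev-+ c c′))

  form-∑ : ∀ {E r} (t : Fin r → Series) → (∀ i → IsForm E (t i)) → IsForm E (∑ t)
  form-∑ {r = zero}  t h = (λ _ → []) , (λ _ → z≤n) , 𝕊R.sym (𝕊R.trans (∑-cong (λ j → 0-⊛ (W (expo j)))) (∑-zero (d ℕ.^ k)))
  form-∑ {r = suc r} t h = form-⊕ (t zero) (∑ (t ∘ suc)) (h zero) (form-∑ (t ∘ suc) (h ∘ suc))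

  ∑-delta : ∀ {r} (t : Fin r → Series) i → (∀ j → j ≢ i → t j ≋ 0ₛ) → ∑ t ≋ t i
  ∑-delta {suc r} t zero    h = 𝕊R.trans (𝕊R.+-congˡ {t zero} (𝕊R.trans (∑-cong (λ j → h (suc j) λ ())) (∑-zero r))) (𝕊R.+-identityʳ (t zero))
  ∑-delta {suc r} t (suc i) h = 𝕊R.trans (𝕊R.+-cong (h zero λ ()) (∑-delta (t ∘ suc) i (λ j j≢i → h (suc j) (j≢i ∘ Finₚ.suc-injective)))) (𝕊R.+-identityˡ (t (suc i)))

  form-term : ∀ {E} P j → length P ℕ.≤ E → IsForm E (evalₛ P X ⊛ W (expo j))
  form-term P j len = c , c-len , 𝕊R.sym (𝕊R.trans (∑-delta (λ j′ → evalₛ (c j′) X ⊛ W (expo j′)) j off) (𝕊R.*-congʳ {W (expo j)} on))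
    where
    c : J → Poly
    c j′ with j′ ≟ j
    ... | yes _ = P
    ... | no  _ = []
    c-len : ∀ j′ → length (c j′) ℕ.≤ _
    c-len j′ with j′ ≟ j
    ... | yes _ = len
    ... | no  _ = z≤n
    off : ∀ j′ → j′ ≢ j → (evalₛ (c j′) X ⊛ W (expo j′)) ≋ 0ₛ
    off j′ j′≢j with j′ ≟ j
    ... | yes j′≡j = ⊥-elim (j′≢j j′≡j)
    ... | no  _    = 0-⊛ (W (expo j′))
    on : evalₛ (c j) X ≋ evalₛ P X
    on with j ≟ j
    ... | yes _   = λ _ → ≡.refl
    ... | no  j≢j = ⊥-elim (j≢j ≡.refl)

  form-monomial : ∀ {E} P m → (∀ i → m i ℕ.< d) → length P ℕ.≤ E → IsForm E (evalₛ P X ⊛ W m)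
  form-monomial P m m<d len = form-cong _ _ (𝕊R.*-congˡ {evalₛ P X} (∏-cong (λ i → ^ₛ-congʳ (w i) (expo-j i)))) (form-term P j len)
    where
    j : J
    j = funToFin (λ i → fromℕ< (m<d i))
    expo-j : ∀ i → expo j i ≡ m i
    expo-j i = ≡.trans (≡.cong toℕ (Finₚ.finToFun-funToFin (λ i → fromℕ< (m<d i)) i)) (Finₚ.toℕ-fromℕ< (m<d i))

  ∏f : Series
  ∏f = ∏ f

  -- A product of two monomials has exponents below 2d, so a single use of f w^d = 1 brings each of
  -- them below d. The factor f_i pays for that use, or else is kept as a polynomial of degree 1;
  -- this is why a product of forms, multiplied by `∏f`, costs at most k in degree.
  reduce : ∀ i m → m ℕ.< d ℕ.+ d →
    Σ Poly λ g → length g ℕ.≤ 2 × Σ ℕ λ m′ → m′ ℕ.< d × (f i ⊛ (w i ^ₛ m)) ≋ (evalₛ g X ⊛ (w i ^ₛ m′))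
  reduce i m m<2d with m ℕₚ.<? d
  ... | yes m<d = fₚ i , ℕₚ.≤-refl , m , m<d , λ _ → ≡.refl
  ... | no  m≮d = constₚ 1# , s≤s z≤n , m ∸ d , m∸d<d , (begin
    f i ⊛ (w i ^ₛ m)                             ≈⟨ 𝕊R.*-congˡ {f i} (^ₛ-congʳ (w i) (ℕₚ.m+[n∸m]≡n d≤m)) ⟨
    f i ⊛ (w i ^ₛ (d ℕ.+ (m ∸ d)))               ≈⟨ 𝕊R.*-congˡ {f i} (^ₛ-homo-* (w i) d (m ∸ d)) ⟩
    f i ⊛ ((w i ^ₛ d) ⊛ (w i ^ₛ (m ∸ d)))        ≈⟨ ⊛-assoc (f i) _ _ ⟨
    (f i ⊛ (w i ^ₛ d)) ⊛ (w i ^ₛ (m ∸ d))        ≈⟨ 𝕊R.*-congʳ {w i ^ₛ (m ∸ d)} (𝕊R.trans (⊛-comm (f i) (w i ^ₛ d)) (R.root^d⊛f≋1 i)) ⟩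
    1ₛ ⊛ (w i ^ₛ (m ∸ d))                        ≈⟨ 𝕊R.*-congʳ {w i ^ₛ (m ∸ d)} (𝕊𝔼.eval-const 1# X) ⟨
    evalₛ (constₚ 1#) X ⊛ (w i ^ₛ (m ∸ d))            ∎)
    where
    open ≋-Reasoning
    d≤m = ℕₚ.≮⇒≥ m≮d
    m∸d<d : m ∸ d ℕ.< d
    m∸d<d = ℕₚ.+-cancelˡ-< d _ _ (≡.subst (ℕ._< d ℕ.+ d) (≡.sym (ℕₚ.m+[n∸m]≡n d≤m)) m<2d)

  form-product : ∀ {a b} P j P′ j′ → length P ℕ.≤ suc a → length P′ ℕ.≤ suc b →
    IsForm (suc (a ℕ.+ b ℕ.+ k)) (∏f ⊛ ((evalₛ P X ⊛ W (expo j)) ⊛ (evalₛ P′ X ⊛ W (expo j′))))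
  form-product {a} {b} P j P′ j′ len len′ = form-cong _ _ (𝕊R.sym eq)
    (form-monomial ((P *ₚ P′) *ₚ ∏ₚ g) m m<d
      (length-* (P *ₚ P′) (∏ₚ g) (length-* P P′ len len′) (≡.subst (λ z → length (∏ₚ g) ℕ.≤ suc z) (ℕₚ.*-identityʳ k) (length-∏ g g-len))))
    where
    open ≋-Reasoning
    open SemiringSolver 𝕊R.commutativeSemiring
    μ : Fin k → ℕ
    μ i = expo j i ℕ.+ expo j′ i
    red : ∀ i → _
    red i = reduce i (μ i) (ℕₚ.+-mono-< (expo<d j i) (expo<d j′ i))
    g : Fin k → Poly
    g i = proj₁ (red i)
    g-len : ∀ i → length (g i) ℕ.≤ 2
    g-len i = proj₁ (proj₂ (red i))
    m : Fin k → ℕ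
    m i = proj₁ (proj₂ (proj₂ (red i)))
    m<d : ∀ i → m i ℕ.< d
    m<d i = proj₁ (proj₂ (proj₂ (proj₂ (red i))))
    factors : (∏f ⊛ (W (expo j) ⊛ W (expo j′))) ≋ (evalₛ (∏ₚ g) X ⊛ W m)
    factors = begin
      ∏f ⊛ (W (expo j) ⊛ W (expo j′))
        ≈⟨ 𝕊R.*-congˡ {∏f} (∏-distrib (λ i → w i ^ₛ expo j i) (λ i → w i ^ₛ expo j′ i)) ⟨
      ∏f ⊛ ∏ (λ i → (w i ^ₛ expo j i) ⊛ (w i ^ₛ expo j′ i))
        ≈⟨ 𝕊R.*-congˡ {∏f} (∏-cong (λ i → ^ₛ-homo-* (w i) (expo j i) (expo j′ i))) ⟨
      ∏f ⊛ W μ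
        ≈⟨ ∏-distrib f (λ i → w i ^ₛ μ i) ⟨
      ∏ (λ i → f i ⊛ (w i ^ₛ μ i))
        ≈⟨ ∏-cong (λ i → proj₂ (proj₂ (proj₂ (proj₂ (red i))))) ⟩
      ∏ (λ i → evalₛ (g i) X ⊛ (w i ^ₛ m i))
        ≈⟨ ∏-distrib (λ i → evalₛ (g i) X) (λ i → w i ^ₛ m i) ⟩
      ∏ (λ i → evalₛ (g i) X) ⊛ W m
        ≈⟨ 𝕊R.*-congʳ {W m} (𝕊𝔼.eval-∏ g X) ⟨
      evalₛ (∏ₚ g) X ⊛ W m ∎
    eq : (∏f ⊛ ((evalₛ P X ⊛ W (expo j)) ⊛ (evalₛ P′ X ⊛ W (expo j′)))) ≋ (evalₛ ((P *ₚ P′) *ₚ ∏ₚ g) X ⊛ W m)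
    eq = begin
      ∏f ⊛ ((evalₛ P X ⊛ W (expo j)) ⊛ (evalₛ P′ X ⊛ W (expo j′)))
        ≈⟨ solve 5 (λ φ x v x′ v′ → φ :* ((x :* v) :* (x′ :* v′)) := (x :* x′) :* (φ :* (v :* v′))) 𝕊R.refl ∏f (evalₛ P X) (W (expo j)) (evalₛ P′ X) (W (expo j′)) ⟩
      (evalₛ P X ⊛ evalₛ P′ X) ⊛ (∏f ⊛ (W (expo j) ⊛ W (expo j′)))
        ≈⟨ 𝕊R.*-cong (𝕊R.sym (𝕊𝔼.eval-* P P′ X)) factors ⟩
      evalₛ (P *ₚ P′) X ⊛ (evalₛ (∏ₚ g) X ⊛ W m)
        ≈⟨ ⊛-assoc (evalₛ (P *ₚ P′) X) (evalₛ (∏ₚ g) X) (W m) ⟨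
      (evalₛ (P *ₚ P′) X ⊛ evalₛ (∏ₚ g) X) ⊛ W m
        ≈⟨ 𝕊R.*-congʳ {W m} (𝕊𝔼.eval-* (P *ₚ P′) (∏ₚ g) X) ⟨
      evalₛ ((P *ₚ P′) *ₚ ∏ₚ g) X ⊛ W m ∎

  0<d : 0 ℕ.< d
  0<d = positive d 1+dN≡q
    where
    positive : ∀ d → suc (d ℕ.* N) ≡ q → 0 ℕ.< d
    positive (suc d) _  = s≤s z≤n
    positive zero    eq = ⊥-elim (ℕₚ.<⇒≢ 1<q eq)

  head-∏f : ∏f 0 ≡ 1#
  head-∏f = go f f0≡1
    where
    go : ∀ {r} (t : Fin r → Series) → (∀ i → t i 0 ≡ 1#) → ∏ t 0 ≡ 1#
    go {zero}  t h = ≡.refl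
    go {suc r} t h = ≡.trans (≡.cong₂ _*_ (h zero) (go (t ∘ suc) (h ∘ suc))) (*-identityˡ 1#)

  W≋Y : ∀ m → W m ≋[ q ] Y m
  W≋Y m = ∏-cong-mod (λ i → ^-cong-mod {q} {w i} (R.root≋f^N i) (m i))

  forms-collide : ∀ {u E} (z : (Fin u → 𝔽) → Series) → (∀ x → IsForm E (z x)) → d ℕ.^ k ℕ.* E ℕ.< u →
    ∃₂ λ x x′ → ¬ (∀ i → x i ≡ x′ i) × z x ≋ z x′
  forms-collide {u} {E} z z-form count with vector-pigeonhole 1<q count (λ x i →
    coef (proj₁ (z-form x) (proj₁ (remQuot {d ℕ.^ k} E i))) (toℕ (proj₂ (remQuot {d ℕ.^ k} E i))))
  ... | x , x′ , x≢x′ , same = x , x′ , x≢x′ , 𝕊R.trans (proj₂ (proj₂ (z-form x))) (𝕊R.trans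
        (∑-cong (λ j → 𝕊R.*-congʳ {W (expo j)} (𝕊R.trans (evalₛ-X (c x j)) (𝕊R.trans (coefs j) (𝕊R.sym (evalₛ-X (c x′ j)))))))
        (𝕊R.sym (proj₂ (proj₂ (z-form x′)))))
    where
    c : (Fin u → 𝔽) → J → Poly
    c x = proj₁ (z-form x)
    beyond : ∀ x j t → E ℕ.≤ t → coef (c x j) t ≡ 0#
    beyond x j = coef-beyond (c x j) (proj₁ (proj₂ (z-form x)) j)
    below : ∀ j t → coef (c x j) (toℕ t) ≡ coef (c x′ j) (toℕ t)
    below j t = ≡.subst (λ jt → coef (c x (proj₁ jt)) (toℕ (proj₂ jt)) ≡ coef (c x′ (proj₁ jt)) (toℕ (proj₂ jt)))
      (Finₚ.remQuot-combine {d ℕ.^ k} {E} j t) (same (combine j t))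
    coefs : ∀ j → coef (c x j) ≋ coef (c x′ j)
    coefs j t with t ℕₚ.<? E
    ... | no  t≮E = ≡.trans (beyond x j t (ℕₚ.≮⇒≥ t≮E)) (≡.sym (beyond x′ j t (ℕₚ.≮⇒≥ t≮E)))
    ... | yes t<E = ≡.subst (λ m → coef (c x j) m ≡ coef (c x′ j) m) (Finₚ.toℕ-fromℕ< t<E) (below j (fromℕ< t<E))

  -- Dimension count: if P ≠ 0 vanished to order q, then (G , H) ↦ ∏f · P · G + H would embed a space of
  -- dimension T q + q, where T = d ^ k, into the forms of degree at most L + q + k − 1.
  zero-estimate : ∀ L (P : J → Poly) → (∀ j → length (P j) ℕ.≤ suc L) → d ℕ.^ k ℕ.* (L ℕ.+ k) ℕ.< q →
    Vanish q (∑ (λ j → evalₛ (P j) X ⊛ Y (expo j))) → ∀ j → IsZero (P j)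
  zero-estimate L P len small van j₀ with isZero? (P j₀)
  ... | yes z     = z
  ... | no  P≢0 = contradict (forms-collide z z-form count)
    where
    T = d ℕ.^ k
    E = suc (L ℕ.+ d ℕ.* N ℕ.+ k)

    -- The hypothesis concerns the polynomials Y; it passes to the Kummer monomials W because the
    -- two agree modulo X^q.
    EvP-vanish : Vanish q (Ev P)
    EvP-vanish i i<q = ≡.trans (∑-cong-mod (λ j → ⊛-cong-mod {q} {evalₛ (P j) X} (λ _ _ → ≡.refl) (W≋Y (expo j))) i i<q) (van i i<q)

    Coefs = Fin (T ℕ.* q ℕ.+ q) → 𝔽

    G : Coefs → J → Poly
    G x j = tabulate (λ t → x (combine j t ↑ˡ q))
    H : Coefs → Poly
    H x = tabulate (λ t → x ((T ℕ.* q) ↑ʳ t))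

    G-len : ∀ x j → length (G x j) ℕ.≤ q
    G-len x j = ℕₚ.≤-reflexive (length-tabulate (λ t → x (combine j t ↑ˡ q)))
    H-len : ∀ x → length (H x) ℕ.≤ q
    H-len x = ℕₚ.≤-reflexive (length-tabulate (λ t → x ((T ℕ.* q) ↑ʳ t)))

    product : Coefs → Series
    product x = ∏f ⊛ (Ev P ⊛ Ev (G x))

    q≤E : q ℕ.≤ E
    q≤E = ≡.subst (ℕ._≤ E) 1+dN≡q (s≤s (ℕₚ.≤-trans (ℕₚ.m≤n+m (d ℕ.* N) L) (ℕₚ.m≤m+n _ k)))

    product-form : ∀ x → IsForm E (product x)
    product-form x = form-cong (∑ (λ j → ∑ (λ j′ → ∏f ⊛ (p′ j ⊛ g′ j′)))) (product x) (𝕊R.sym expand)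
      (form-∑ (λ j → ∑ (λ j′ → ∏f ⊛ (p′ j ⊛ g′ j′))) (λ j → form-∑ (λ j′ → ∏f ⊛ (p′ j ⊛ g′ j′)) (λ j′ →
        form-product (P j) j (G x j′) j′ (len j) (≡.subst (length (G x j′) ℕ.≤_) (≡.sym 1+dN≡q) (G-len x j′)))))
      where
      open ≋-Reasoning
      p′ g′ : J → Series
      p′ j = evalₛ (P j) X ⊛ W (expo j)
      g′ j = evalₛ (G x j) X ⊛ W (expo j)
      expand : product x ≋ ∑ (λ j → ∑ (λ j′ → ∏f ⊛ (p′ j ⊛ g′ j′)))
      expand = begin
        ∏f ⊛ (∑ p′ ⊛ ∑ g′)                            ≈⟨ 𝕊R.*-congˡ {∏f} (⊛-distribʳ-∑ (∑ g′) p′) ⟩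
        ∏f ⊛ ∑ (λ j → p′ j ⊛ ∑ g′)                    ≈⟨ ⊛-distribˡ-∑ ∏f (λ j → p′ j ⊛ ∑ g′) ⟩
        ∑ (λ j → ∏f ⊛ (p′ j ⊛ ∑ g′))                  ≈⟨ ∑-cong (λ j → 𝕊R.trans (𝕊R.*-congˡ {∏f} (⊛-distribˡ-∑ (p′ j) g′)) (⊛-distribˡ-∑ ∏f (λ j′ → p′ j ⊛ g′ j′))) ⟩
        ∑ (λ j → ∑ (λ j′ → ∏f ⊛ (p′ j ⊛ g′ j′)))      ∎

    H-form : ∀ x → IsForm E (evalₛ (H x) X)
    H-form x = form-cong (evalₛ (H x) X ⊛ W (λ _ → 0)) (evalₛ (H x) X) (𝕊R.trans (𝕊R.*-congˡ {evalₛ (H x) X} (W0 k)) (𝕊R.*-identityʳ (evalₛ (H x) X)))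
      (form-monomial (H x) (λ _ → 0) (λ _ → 0<d) (ℕₚ.≤-trans (H-len x) q≤E))
      where
      W0 : ∀ r → ∏ {r} (λ _ → 1ₛ) ≋ 1ₛ
      W0 zero    = λ _ → ≡.refl
      W0 (suc r) = 𝕊R.trans (⊛-identityˡ _) (W0 r)

    z : Coefs → Series
    z x = product x ⊕ evalₛ (H x) X

    z-form : ∀ x → IsForm E (z x)
    z-form x = form-⊕ (product x) (evalₛ (H x) X) (product-form x) (H-form x)

    -- Here E = L + q + k, so this is T (L + k) < q with T q added on both sides.
    count : T ℕ.* E ℕ.< T ℕ.* q ℕ.+ q
    count = ≡.subst (ℕ._< T ℕ.* q ℕ.+ q) eq (ℕₚ.+-monoʳ-< (T ℕ.* q) small)
      where
      arith : ∀ T dN L k → T ℕ.* suc dN ℕ.+ T ℕ.* (L ℕ.+ k) ≡ T ℕ.* suc (L ℕ.+ dN ℕ.+ k)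
      arith = solve-∀
      eq : T ℕ.* q ℕ.+ T ℕ.* (L ℕ.+ k) ≡ T ℕ.* E
      eq = ≡.trans (≡.cong (λ z → T ℕ.* z ℕ.+ T ℕ.* (L ℕ.+ k)) (≡.sym 1+dN≡q)) (arith T (d ℕ.* N) L k)

    product-vanish : ∀ x → Vanish q (product x)
    product-vanish x i i<q = ≡.trans (⊛-comm ∏f (Ev P ⊛ Ev (G x)) i)
      (vanish-⊛ˡ q (Ev P ⊛ Ev (G x)) ∏f (vanish-⊛ˡ q (Ev P) (Ev (G x)) EvP-vanish) i i<q)

    module Collision (x x′ : Coefs) (z≋ : z x ≋ z x′) where

      -- The product part vanishes to order q and H has degree below q, so H is visible in the first
      -- q coefficients of z.
      H≋ : coef (H x) ≋ coef (H x′)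
      H≋ i with i ℕₚ.<? q
      ... | no  i≮q = ≡.trans (coef-beyond (H x) (H-len x) i (ℕₚ.≮⇒≥ i≮q)) (≡.sym (coef-beyond (H x′) (H-len x′) i (ℕₚ.≮⇒≥ i≮q)))
      ... | yes i<q = ≡.trans (≡.sym (at x)) (≡.trans (z≋ i) (at x′))
        where
        at : ∀ x → z x i ≡ coef (H x) i
        at x = ≡.trans (≡.cong₂ _+_ (product-vanish x i i<q) (evalₛ-X (H x) i)) (+-identityˡ _)

      product≋ : product x ≋ product x′
      product≋ i = +-cancelˡ (evalₛ (H x) X i) (≡.trans (+-comm _ _) (≡.trans (z≋ i)
        (≡.trans (+-comm _ _) (≡.cong (_+ product x′ i) (≡.trans (evalₛ-X (H x′) i) (≡.trans (≡.sym (H≋ i)) (≡.sym (evalₛ-X (H x) i))))))))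

      D : Series
      D = Ev (G x) ⊝ Ev (G x′)

      ∏f⊛EvP⊛D≋0 : (∏f ⊛ (Ev P ⊛ D)) ≋ 0ₛ
      ∏f⊛EvP⊛D≋0 = begin
        ∏f ⊛ (Ev P ⊛ D)            ≈⟨ solve 3 (λ a b c → a :* (b :* c) := c :* (a :* b)) 𝕊R.refl ∏f (Ev P) D ⟩
        D ⊛ (∏f ⊛ Ev P)            ≈⟨ ⊝-distribʳ-⊛ (Ev (G x)) (Ev (G x′)) (∏f ⊛ Ev P) ⟩
        (Ev (G x) ⊛ (∏f ⊛ Ev P)) ⊝ (Ev (G x′) ⊛ (∏f ⊛ Ev P))
          ≈⟨ ⊝-self (𝕊R.trans (back (G x)) (𝕊R.trans product≋ (𝕊R.sym (back (G x′))))) ⟩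
        0ₛ                         ∎
        where
        open ≋-Reasoning
        open SemiringSolver 𝕊R.commutativeSemiring
        back : ∀ g → (Ev g ⊛ (∏f ⊛ Ev P)) ≋ (∏f ⊛ (Ev P ⊛ Ev g))
        back g = solve 3 (λ a b c → c :* (a :* b) := a :* (b :* c)) 𝕊R.refl ∏f (Ev P) (Ev g)

      -- If D were nonzero, `Ev P` would be a zero divisor and hence zero; by independence P would
      -- then vanish.
      D≋0 : D ≋ 0ₛ
      D≋0 m with D m ≟ 0#
      ... | yes h = h
      ... | no  h = ⊥-elim (P≢0 (independent T (λ j → j) (λ _ _ eq → eq) P
        (series-no-zero-divisors D (Ev P) m (𝕊R.trans (⊛-comm D (Ev P))
          (series-no-zero-divisors ∏f (Ev P ⊛ D) 0 ∏f⊛EvP⊛D≋0 (λ z → 1≢0 (≡.trans (≡.sym head-∏f) z)))) h) j₀))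

      G≡ : ∀ j i → coef (G x j) i ≡ coef (G x′ j) i
      G≡ j i = ≡.trans (≡.sym (evalₛ-X (G x j) i)) (≡.trans
        (⊝-zero (𝕊R.trans (𝕊R.sym (evalₛ-- (G x j) (G x′ j) X)) (𝕊𝔼.eval-zero (G x j -ₚ G x′ j)
          (independent T (λ j → j) (λ _ _ eq → eq) (λ j → G x j -ₚ G x′ j) (𝕊R.trans (Ev-- (G x) (G x′)) D≋0) j) X)) i)
        (evalₛ-X (G x′ j) i))

      all-equal : ∀ i → x i ≡ x′ i
      all-equal i = ≡.subst (λ i → x i ≡ x′ i) (Finₚ.join-splitAt (T ℕ.* q) q i) (go (splitAt (T ℕ.* q) i))
        where
        go : ∀ s → x (join (T ℕ.* q) q s) ≡ x′ (join (T ℕ.* q) q s)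
        go (inj₁ i) = ≡.subst (λ i → x (i ↑ˡ q) ≡ x′ (i ↑ˡ q)) (Finₚ.combine-remQuot {T} q i)
          (≡.trans (≡.sym (coef-tabulate (λ t → x (combine j t ↑ˡ q)) t)) (≡.trans (G≡ j (toℕ t)) (coef-tabulate (λ t → x′ (combine j t ↑ˡ q)) t)))
          where
          j = proj₁ (remQuot {T} q i)
          t = proj₂ (remQuot {T} q i)
        go (inj₂ t) = ≡.trans (≡.sym (coef-tabulate (λ t → x ((T ℕ.* q) ↑ʳ t)) t)) (≡.trans (H≋ (toℕ t)) (coef-tabulate (λ t → x′ ((T ℕ.* q) ↑ʳ t)) t))

    contradict : (∃₂ λ x x′ → ¬ (∀ i → x i ≡ x′ i) × z x ≋ z x′) → IsZero (P j₀)
    contradict (x , x′ , x≢x′ , z≋) = ⊥-elim (x≢x′ (Collision.all-equal x x′ z≋))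

-- Stepanov's method

module Stepanov {q : ℕ} (F : FinField q) {p n : ℕ} (prime : Prime p) (q≡p^n : q ≡ p ℕ.^ n)
                (d N : ℕ) (1+dN≡q : suc (d ℕ.* N) ≡ q)
                (k : ℕ) (e : Fin k → Fin q) (e-injective : ∀ i j → e i ≡ e j → i ≡ j)
                (e≢0 : ∀ i → e i ≢ FieldTheory.0# F) where
  open FieldTheory F
  open Polynomials F
  open PowerSeries ring
  open Multiplicity F
  open KummerSeries F {p} {n} prime q≡p^n d N 1+dN≡q
  open Tower k e e-injective e≢0
  open ZeroEstimate F {p} {n} prime q≡p^n d N 1+dN≡q k e e-injective e≢0 using (zero-estimate)
  open 𝕊𝔼 using () renaming (eval to evalₛ)
  open CMSum *-commutativeMonoid using () renaming (sum to ∏𝔽; sum-cong-≗ to ∏𝔽-cong)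

  T : ℕ
  T = d ℕ.^ k

  Coefficients : ℕ → Set
  Coefficients R = Fin R → J → Poly

  -- At the points to be counted X^q takes the value of X and each f_i^N the value 1. The expansions
  -- there are therefore controlled by degrees near R + L, although the polynomial itself may have
  -- degree about (R + k) q.
  auxiliary : ∀ {R} → Coefficients R → Poly
  auxiliary P = ∑ₚ (λ r → (Xₚ ^ₚ q) ^ₚ toℕ r *ₚ ∑ₚ (λ j → P r j *ₚ Yₚ (expo j)))

  auxiliaryₛ : ∀ {R} → Coefficients R → Series → (J → Series) → Series → Series
  auxiliaryₛ P s Y s^q = ∑ (λ r → (s^q ^ₛ toℕ r) ⊛ ∑ (λ j → evalₛ (P r j) s ⊛ Y j))

  eval-auxiliary : ∀ {R} (P : Coefficients R) s →
    evalₛ (auxiliary P) s ≋ auxiliaryₛ P s (λ j → ∏ (λ i → (evalₛ (fₚ i) s ^ₛ N) ^ₛ expo j i)) (s ^ₛ q)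
  eval-auxiliary P s = 𝕊R.trans (𝕊𝔼.eval-∑ (λ r → (Xₚ ^ₚ q) ^ₚ toℕ r *ₚ ∑ₚ (λ j → P r j *ₚ Yₚ (expo j))) s)
    (∑-cong λ r → 𝕊R.trans (𝕊𝔼.eval-* ((Xₚ ^ₚ q) ^ₚ toℕ r) (∑ₚ (λ j → P r j *ₚ Yₚ (expo j))) s)
      (𝕊R.*-cong (power r) (𝕊R.trans (𝕊𝔼.eval-∑ (λ j → P r j *ₚ Yₚ (expo j)) s) (∑-cong (inner r)))))
    where
    power : ∀ r → evalₛ ((Xₚ ^ₚ q) ^ₚ toℕ r) s ≋ ((s ^ₛ q) ^ₛ toℕ r)
    power r = 𝕊R.trans (𝕊𝔼.eval-^ (Xₚ ^ₚ q) (toℕ r) s) (^ₛ-congˡ (toℕ r) (𝕊R.trans (𝕊𝔼.eval-^ Xₚ q s) (^ₛ-congˡ q (𝕊𝔼.eval-X s))))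
    inner : ∀ r j → evalₛ (P r j *ₚ Yₚ (expo j)) s ≋ (evalₛ (P r j) s ⊛ ∏ (λ i → (evalₛ (fₚ i) s ^ₛ N) ^ₛ expo j i))
    inner r j = 𝕊R.trans (𝕊𝔼.eval-* (P r j) (Yₚ (expo j)) s) (𝕊R.*-congˡ {evalₛ (P r j) s} (evalₛ-Yₚ (expo j) s))

  length-auxiliary : ∀ {R L} (P : Coefficients R) → (∀ r j → length (P r j) ℕ.≤ suc L) →
    length (auxiliary P) ℕ.≤ suc (R ℕ.* q ℕ.+ (L ℕ.+ k ℕ.* (d ℕ.* N)))
  length-auxiliary {R} {L} P len = length-∑ _ λ r → length-* ((Xₚ ^ₚ q) ^ₚ toℕ r) (∑ₚ (λ j → P r j *ₚ Yₚ (expo j)))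
    (ℕₚ.≤-trans (length-^ (Xₚ ^ₚ q) (length-^ Xₚ ℕₚ.≤-refl q) (toℕ r))
      (s≤s (ℕₚ.*-mono-≤ (ℕₚ.<⇒≤ (Finₚ.toℕ<n r)) (ℕₚ.≤-reflexive (ℕₚ.*-identityʳ q)))))
    (length-∑ _ λ j → length-* (P r j) (Yₚ (expo j)) (len r j) (length-∏ _ λ i →
      ℕₚ.≤-trans (length-^ (fₚ i ^ₚ N) (length-^ (fₚ i) ℕₚ.≤-refl N) (expo j i))
        (s≤s (ℕₚ.*-mono-≤ (ℕₚ.<⇒≤ (expo<d j i)) (ℕₚ.≤-reflexive (ℕₚ.*-identityʳ N))))))

  Z : (J → Poly) → Series
  Z P = ∑ (λ j → evalₛ (P j) X ⊛ Y (expo j))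

  X^q : Series
  X^q = X ^ₛ q

  order-X^q : HasOrder X^q (q ℕ.* 1)
  order-X^q = order-^ ((λ { zero _ → ≡.refl ; (suc _) (s≤s ()) }) , 1≢0) q

  -- Modulo X^q only the term r = 0 is left, and the zero estimate removes it; X^q is then cancelled
  -- from the rest.
  lowest-terms : ∀ R L (P : Coefficients R) → (∀ r j → length (P r j) ℕ.≤ suc L) → T ℕ.* (L ℕ.+ k) ℕ.< q →
    ∑ (λ r → (X^q ^ₛ toℕ r) ⊛ Z (P r)) ≋ 0ₛ → ∀ r j → IsZero (P r j)
  lowest-terms (suc R) L P len small relation = λ { zero → P₀-zero ; (suc r) → lowest-terms R L (P ∘ suc) (len ∘ suc) small rest≋0 r }
    where
    rest : Series
    rest = ∑ (λ r → (X^q ^ₛ toℕ r) ⊛ Z (P (suc r)))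
    relation′ : (Z (P zero) ⊕ (X^q ⊛ rest)) ≋ 0ₛ
    relation′ = 𝕊R.trans (𝕊R.+-cong (𝕊R.sym (⊛-identityˡ (Z (P zero))))
      (𝕊R.trans (⊛-distribˡ-∑ X^q (λ r → (X^q ^ₛ toℕ r) ⊛ Z (P (suc r))))
        (∑-cong (λ r → 𝕊R.sym (⊛-assoc X^q (X^q ^ₛ toℕ r) (Z (P (suc r)))))))) relation
    rest-vanish : Vanish q (X^q ⊛ rest)
    rest-vanish = vanish-⊛ˡ q X^q rest (λ i i<q → proj₁ order-X^q i (ℕₚ.<-≤-trans i<q (ℕₚ.≤-reflexive (≡.sym (ℕₚ.*-identityʳ q)))))
    P₀-zero : ∀ j → IsZero (P zero j)
    P₀-zero = zero-estimate L (P zero) (len zero) small (λ i i<q →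
      ≡.trans (≡.sym (+-identityʳ _)) (≡.trans (≡.cong (Z (P zero) i +_) (≡.sym (rest-vanish i i<q))) (relation′ i)))
    Z₀≋0 : Z (P zero) ≋ 0ₛ
    Z₀≋0 = 𝕊R.trans (∑-cong (λ j → 𝕊R.trans (𝕊R.*-congʳ {Y (expo j)} (𝕊𝔼.eval-zero (P zero j) (P₀-zero j) X)) (0-⊛ (Y (expo j))))) (∑-zero T)
    rest≋0 : rest ≋ 0ₛ
    rest≋0 = series-no-zero-divisors X^q rest (q ℕ.* 1) (drop-zeroˡ (Z (P zero)) (X^q ⊛ rest) Z₀≋0 relation′) (proj₂ order-X^q)

  ⊝-distribˡ-⊛ : ∀ h f g → (h ⊛ (f ⊝ g)) ≋ ((h ⊛ f) ⊝ (h ⊛ g))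
  ⊝-distribˡ-⊛ h f g i = ≡.trans (⊛-comm h (f ⊝ g) i) (≡.trans (⊝-distribʳ-⊛ f g h i)
    (≡.cong₂ (λ u v → u + - v) (⊛-comm f h i) (⊛-comm g h i)))

  _-ᶜ_ : ∀ {R} → Coefficients R → Coefficients R → Coefficients R
  (P -ᶜ P′) r j = P r j -ₚ P′ r j

  auxiliary-injective : ∀ {R} L (P P′ : Coefficients R) → (∀ r j → length ((P -ᶜ P′) r j) ℕ.≤ suc L) → T ℕ.* (L ℕ.+ k) ℕ.< q →
    IsZero (auxiliary P -ₚ auxiliary P′) → ∀ r j → IsZero ((P -ᶜ P′) r j)
  auxiliary-injective {R} L P P′ len small z = lowest-terms R L (P -ᶜ P′) len small (begin
    ∑ (λ r → (X^q ^ₛ toℕ r) ⊛ Z ((P -ᶜ P′) r))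
      ≈⟨ ∑-cong (λ r → 𝕊R.trans (𝕊R.*-congˡ {X^q ^ₛ toℕ r} (Z-- (P r) (P′ r))) (⊝-distribˡ-⊛ (X^q ^ₛ toℕ r) (Z (P r)) (Z (P′ r)))) ⟩
    ∑ (λ r → ((X^q ^ₛ toℕ r) ⊛ Z (P r)) ⊝ ((X^q ^ₛ toℕ r) ⊛ Z (P′ r)))
      ≈⟨ ∑-⊝ (λ r → (X^q ^ₛ toℕ r) ⊛ Z (P r)) (λ r → (X^q ^ₛ toℕ r) ⊛ Z (P′ r)) ⟩
    ∑ (λ r → (X^q ^ₛ toℕ r) ⊛ Z (P r)) ⊝ ∑ (λ r → (X^q ^ₛ toℕ r) ⊛ Z (P′ r))
      ≈⟨ (λ i → ≡.cong₂ (λ u v → u + - v) (eval-auxiliary P X i) (eval-auxiliary P′ X i)) ⟨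
    evalₛ (auxiliary P) X ⊝ evalₛ (auxiliary P′) X
      ≈⟨ evalₛ-- (auxiliary P) (auxiliary P′) X ⟨
    evalₛ (auxiliary P -ₚ auxiliary P′) X
      ≈⟨ 𝕊𝔼.eval-zero (auxiliary P -ₚ auxiliary P′) z X ⟩
    0ₛ ∎)
    where
    open ≋-Reasoning
    Z-- : ∀ P P′ → Z (λ j → P j -ₚ P′ j) ≋ (Z P ⊝ Z P′)
    Z-- P P′ = 𝕊R.trans (∑-cong (λ j → 𝕊R.trans (𝕊R.*-congʳ {Y (expo j)} (evalₛ-- (P j) (P′ j) X)) (⊝-distribʳ-⊛ _ _ (Y (expo j)))))
      (∑-⊝ (λ j → evalₛ (P j) X ⊛ Y (expo j)) (λ j → evalₛ (P′ j) X ⊛ Y (expo j)))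

  -- Coefficient s of `g b` is a polynomial in b of degree at most B + s k. Equating such
  -- polynomials in b imposes vanishing at all points simultaneously, with a number of linear
  -- conditions that does not depend on the number of points.
  PolyFamily : ℕ → (𝔽 → Series) → Set
  PolyFamily B g = ∀ s → Σ Poly λ z → length z ℕ.≤ suc (B ℕ.+ s ℕ.* k) × (∀ b → 𝔼.eval z b ≡ g b s)

  family-≤ : ∀ {B B′ g} → B ℕ.≤ B′ → PolyFamily B g → PolyFamily B′ g
  family-≤ B≤B′ h s with h s
  ... | z , len , eq = z , ℕₚ.≤-trans len (s≤s (ℕₚ.+-monoˡ-≤ (s ℕ.* k) B≤B′)) , eq

  family-⊕ : ∀ {B g h} → PolyFamily B g → PolyFamily B h → PolyFamily B (λ b → g b ⊕ h b)
  family-⊕ {g = g} {h} pg ph s with pg s | ph s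
  ... | z , len , eq | z′ , len′ , eq′ = z +ₚ z′ , length-+ z z′ len len′ ,
    λ b → ≡.trans (𝔼.eval-+ z z′ b) (≡.cong₂ _+_ (eq b) (eq′ b))

  family-⊛ : ∀ {B C g h} → PolyFamily B g → PolyFamily C h → PolyFamily (B ℕ.+ C) (λ b → g b ⊛ h b)
  family-⊛ {B} {C} {g} {h} pg ph zero with pg 0 | ph 0
  ... | z , len , eq | z′ , len′ , eq′ = z *ₚ z′ ,
    ℕₚ.≤-trans (length-* z z′ len len′) (ℕₚ.≤-reflexive (≡.cong suc (≡.trans (≡.cong (ℕ._+ (C ℕ.+ 0)) (ℕₚ.+-identityʳ B)) (≡.sym (ℕₚ.+-assoc B C 0))))) ,
    λ b → ≡.trans (𝔼.eval-* z z′ b) (≡.cong₂ _*_ (eq b) (eq′ b))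
  family-⊛ {B} {C} {g} {h} pg ph (suc s) with pg 0 | ph (suc s) | family-⊛ {B ℕ.+ k} {C} {λ b → shift (g b)} {h} shifted ph s
    where
    shifted : PolyFamily (B ℕ.+ k) (λ b → shift (g b))
    shifted s with pg (suc s)
    ... | z , len , eq = z , ≡.subst (λ m → length z ℕ.≤ suc m) (≡.sym (ℕₚ.+-assoc B k (s ℕ.* k))) len , eq
  ... | z , len , eq | z′ , len′ , eq′ | z″ , len″ , eq″ = z *ₚ z′ +ₚ z″ ,
    length-+ (z *ₚ z′) z″ (ℕₚ.≤-trans (length-* z z′ len len′) (ℕₚ.≤-reflexive
        (≡.cong suc (≡.trans (≡.cong (ℕ._+ (C ℕ.+ suc s ℕ.* k)) (ℕₚ.+-identityʳ B)) (≡.sym (ℕₚ.+-assoc B C (suc s ℕ.* k)))))))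
      (ℕₚ.≤-trans len″ (ℕₚ.≤-reflexive (≡.cong suc (arith B C k (s ℕ.* k))))) ,
    λ b → ≡.trans (𝔼.eval-+ (z *ₚ z′) z″ b) (≡.cong₂ _+_ (≡.trans (𝔼.eval-* z z′ b) (≡.cong₂ _*_ (eq b) (eq′ b))) (eq″ b))
    where
    arith : ∀ B C k m → B ℕ.+ k ℕ.+ C ℕ.+ m ≡ B ℕ.+ C ℕ.+ (k ℕ.+ m)
    arith = solve-∀

  family-const : ∀ c → PolyFamily 0 (λ _ → const c)
  family-const c zero    = constₚ c , s≤s z≤n , λ b → 𝔼.eval-const c b
  family-const c (suc s) = [] , z≤n , λ b → ≡.refl

  family-lin : ∀ {B} z z′ → length z ℕ.≤ suc B → length z′ ℕ.≤ suc (B ℕ.+ k) →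
    PolyFamily B (λ b → lin (𝔼.eval z b) (𝔼.eval z′ b))
  family-lin {B} z z′ len len′ zero          = z , ≡.subst (λ m → length z ℕ.≤ suc m) (≡.sym (ℕₚ.+-identityʳ B)) len , λ b → ≡.refl
  family-lin {B} z z′ len len′ (suc zero)    = z′ , ≡.subst (λ m → length z′ ℕ.≤ suc (B ℕ.+ m)) (≡.sym (ℕₚ.+-identityʳ k)) len′ , λ b → ≡.refl
  family-lin     z z′ len len′ (suc (suc s)) = [] , z≤n , λ b → ≡.refl

  family-^ : ∀ {B g} → PolyFamily B g → ∀ m → PolyFamily (m ℕ.* B) (λ b → g b ^ₛ m)
  family-^ pg zero = family-const 1#
  family-^ {B} {g} pg (suc m) = family-⊛ {B} {m ℕ.* B} {g} pg (family-^ {B} {g} pg m)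

  family-∏ : ∀ {r} (g : Fin r → 𝔽 → Series) → (∀ i → PolyFamily 0 (g i)) → PolyFamily 0 (λ b → ∏ (λ i → g i b))
  family-∏ {zero}  g pg = family-const 1#
  family-∏ {suc r} g pg = family-⊛ {0} {0} {g zero} (pg zero) (family-∏ (g ∘ suc) (pg ∘ suc))

  family-∑ : ∀ {B r} (g : Fin r → 𝔽 → Series) → (∀ i → PolyFamily B (g i)) → PolyFamily B (λ b → ∑ (λ i → g i b))
  family-∑ {r = zero}  g pg s = [] , z≤n , λ b → ≡.refl
  family-∑ {B} {suc r} g pg = family-⊕ {B} {g zero} (pg zero) (family-∑ (g ∘ suc) (pg ∘ suc))

  -- Horner's rule: each entry of `P` costs one multiplication by g and hence one degree.
  family-eval : ∀ {L g} → PolyFamily 1 g → ∀ P → length P ℕ.≤ L → PolyFamily L (λ b → evalₛ P (g b))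
  family-eval pg [] len s = [] , z≤n , λ b → ≡.refl
  family-eval {suc L} {g} pg (a ∷ P) (s≤s len) = family-⊕ {suc L} {λ _ → const a} {λ b → g b ⊛ evalₛ P (g b)}
    (family-≤ {0} {suc L} {λ _ → const a} z≤n (family-const a)) (family-⊛ {1} {L} {g} pg (family-eval {L} {g} pg P len))

  families-collide : ∀ {u B} M (g : (Fin u → 𝔽) → 𝔽 → Series) → (∀ x → PolyFamily B (g x)) →
    M ℕ.* suc (B ℕ.+ M ℕ.* k) ℕ.< u → ∃₂ λ x x′ → ¬ (∀ i → x i ≡ x′ i) × (∀ b → g x b ≋[ M ] g x′ b)
  families-collide {u} {B} M g pg count with vector-pigeonhole 1<q count (λ x i →
    coef (proj₁ (pg x (toℕ (proj₁ (remQuot {M} (suc (B ℕ.+ M ℕ.* k)) i))))) (toℕ (proj₂ (remQuot {M} (suc (B ℕ.+ M ℕ.* k)) i))))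
  ... | x , x′ , x≢x′ , same = x , x′ , x≢x′ , λ b s s<M →
    ≡.trans (≡.sym (proj₂ (proj₂ (pg x s)) b)) (≡.trans (𝔼.eval-cong (z x s) (z x′ s) (coefs s s<M) b) (proj₂ (proj₂ (pg x′ s)) b))
    where
    E = suc (B ℕ.+ M ℕ.* k)
    z : (Fin u → 𝔽) → ℕ → Poly
    z x s = proj₁ (pg x s)
    beyond : ∀ x s → s ℕ.< M → ∀ t → E ℕ.≤ t → coef (z x s) t ≡ 0#
    beyond x s s<M = coef-beyond (z x s) (ℕₚ.≤-trans (proj₁ (proj₂ (pg x s))) (s≤s (ℕₚ.+-monoʳ-≤ B (ℕₚ.*-monoˡ-≤ k (ℕₚ.<⇒≤ s<M)))))
    below : ∀ s t → coef (z x (toℕ s)) (toℕ t) ≡ coef (z x′ (toℕ s)) (toℕ t)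
    below s t = ≡.subst (λ st → coef (z x (toℕ (proj₁ st))) (toℕ (proj₂ st)) ≡ coef (z x′ (toℕ (proj₁ st))) (toℕ (proj₂ st)))
      (Finₚ.remQuot-combine {M} {E} s t) (same (combine s t))
    coefs : ∀ s → s ℕ.< M → ∀ t → coef (z x s) t ≡ coef (z x′ s) t
    coefs s s<M t with t ℕₚ.<? E
    ... | no  t≮E = ≡.trans (beyond x s s<M t (ℕₚ.≮⇒≥ t≮E)) (≡.sym (beyond x′ s s<M t (ℕₚ.≮⇒≥ t≮E)))
    ... | yes t<E = ≡.subst₂ (λ s t → coef (z x s) t ≡ coef (z x′ s) t) (Finₚ.toℕ-fromℕ< s<M) (Finₚ.toℕ-fromℕ< t<E)
                      (below (fromℕ< s<M) (fromℕ< t<E))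

  θₚ : Poly
  θₚ = ∏ₚ fₚ

  others : Fin k → Fin k → Poly
  others i m with m ≟ i
  ... | yes _ = constₚ 1#
  ... | no  _ = fₚ m

  -- The polynomial eᵢ θ / fᵢ, written without a division.
  Θₚ : Fin k → Poly
  Θₚ i = constₚ (e i) *ₚ ∏ₚ (others i)

  θ : 𝔽 → 𝔽
  θ b = 𝔼.eval θₚ b

  -- At b + θ(b) v the factor 1 + eᵢ x becomes (1 + eᵢ b)(1 + Θᵢ(b) v), so that no denominators appear
  -- in the local expansion.
  ξ : 𝔽 → Series
  ξ b = lin (𝔼.eval Xₚ b) (θ b)

  ∏𝔽-remove : ∀ {r} (s t : Fin r → 𝔽) i → t i ≡ 1# → (∀ m → m ≢ i → t m ≡ s m) → ∏𝔽 s ≡ s i * ∏𝔽 t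
  ∏𝔽-remove {suc r} s t zero ti≡1 same = ≡.cong (s zero *_)
    (≡.trans (∏𝔽-cong (λ m → ≡.sym (same (suc m) λ ()))) (≡.sym (≡.trans (≡.cong (_* ∏𝔽 (t ∘ suc)) ti≡1) (*-identityˡ _))))
  ∏𝔽-remove {suc r} s t (suc i) ti≡1 same = begin
    s zero * ∏𝔽 (s ∘ suc)                    ≡⟨ ≡.cong (s zero *_) (∏𝔽-remove (s ∘ suc) (t ∘ suc) i ti≡1 (λ m m≢i → same (suc m) (m≢i ∘ Finₚ.suc-injective))) ⟩
    s zero * (s (suc i) * ∏𝔽 (t ∘ suc))      ≡⟨ *-assoc _ _ _ ⟨
    s zero * s (suc i) * ∏𝔽 (t ∘ suc)        ≡⟨ ≡.cong (_* ∏𝔽 (t ∘ suc)) (≡.trans (*-comm _ _) (≡.cong (s (suc i) *_) (≡.sym (same zero λ ())))) ⟩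
    s (suc i) * t zero * ∏𝔽 (t ∘ suc)        ≡⟨ *-assoc _ _ _ ⟩
    s (suc i) * (t zero * ∏𝔽 (t ∘ suc))      ∎
    where open ≡.≡-Reasoning

  eval-fₚ : ∀ i b → 𝔼.eval (fₚ i) b ≡ 1# + b * e i
  eval-fₚ i b = ≡.cong (λ z → 1# + b * z) (𝔼.eval-const (e i) b)

  θ-factor : ∀ i b → θ b * e i ≡ (1# + b * e i) * 𝔼.eval (Θₚ i) b
  θ-factor i b = begin
    θ b * e i
      ≡⟨ ≡.cong (_* e i) (≡.trans (𝔼.eval-∏ fₚ b) (∏𝔽-remove (λ m → 𝔼.eval (fₚ m) b) (λ m → 𝔼.eval (others i m) b) i at-i off-i)) ⟩
    𝔼.eval (fₚ i) b * ∏𝔽 (λ m → 𝔼.eval (others i m) b) * e i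
      ≡⟨ ≡.trans (*-assoc _ _ _) (≡.cong (𝔼.eval (fₚ i) b *_) (*-comm _ _)) ⟩
    𝔼.eval (fₚ i) b * (e i * ∏𝔽 (λ m → 𝔼.eval (others i m) b))
      ≡⟨ ≡.cong₂ _*_ (eval-fₚ i b) (≡.sym (≡.trans (𝔼.eval-* (constₚ (e i)) (∏ₚ (others i)) b) (≡.cong₂ _*_ (𝔼.eval-const (e i) b) (𝔼.eval-∏ (others i) b)))) ⟩
    (1# + b * e i) * 𝔼.eval (Θₚ i) b ∎
    where
    open ≡.≡-Reasoning
    at-i : 𝔼.eval (others i i) b ≡ 1#
    at-i with i ≟ i
    ... | yes _   = 𝔼.eval-const 1# b
    ... | no  i≢i = ⊥-elim (i≢i ≡.refl)
    off-i : ∀ m → m ≢ i → 𝔼.eval (others i m) b ≡ 𝔼.eval (fₚ m) b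
    off-i m m≢i with m ≟ i
    ... | yes m≡i = ⊥-elim (m≢i m≡i)
    ... | no  _   = ≡.refl

  f-at-ξ : ∀ i b → evalₛ (fₚ i) (ξ b) ≋ (const (1# + b * e i) ⊛ lin 1# (𝔼.eval (Θₚ i) b))
  f-at-ξ i b n = ≡.trans (≡.cong (const 1# n +_) (𝕊R.*-congˡ {ξ b} (𝕊𝔼.eval-const (e i) (ξ b)) n))
    (≡.trans (go n) (≡.sym (const-⊛ (1# + b * e i) (lin 1# (𝔼.eval (Θₚ i) b)) n)))
    where
    open ≡.≡-Reasoning
    go : ∀ n → const 1# n + (ξ b ⊛ const (e i)) n ≡ (1# + b * e i) * lin 1# (𝔼.eval (Θₚ i) b) n
    go zero = ≡.trans (≡.cong (λ z → 1# + z * e i) (𝔼.eval-X b)) (≡.sym (*-identityʳ _))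
    go (suc zero) = begin
      0# + (ξ b ⊛ const (e i)) 1              ≡⟨ ≡.trans (+-identityˡ _) (lin-⊛-suc (𝔼.eval Xₚ b) (θ b) (const (e i)) 0) ⟩
      𝔼.eval Xₚ b * 0# + θ b * e i            ≡⟨ ≡.trans (≡.cong (_+ θ b * e i) (zeroʳ _)) (+-identityˡ _) ⟩
      θ b * e i                               ≡⟨ θ-factor i b ⟩
      (1# + b * e i) * 𝔼.eval (Θₚ i) b        ∎
    go (suc (suc n)) = begin
      0# + (ξ b ⊛ const (e i)) (2 ℕ.+ n)      ≡⟨ ≡.trans (+-identityˡ _) (lin-⊛-suc (𝔼.eval Xₚ b) (θ b) (const (e i)) (suc n)) ⟩
      𝔼.eval Xₚ b * 0# + θ b * 0#             ≡⟨ ≡.trans (≡.cong₂ _+_ (zeroʳ _) (zeroʳ _)) (+-identityˡ 0#) ⟩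
      0#                                      ≡⟨ zeroʳ _ ⟨
      (1# + b * e i) * 0#                     ∎

  const-^ : ∀ c m → const c ^ₛ m ≋ const (c ^ m)
  const-^ c zero    n       = ≡.refl
  const-^ c (suc m) zero    = ≡.cong (c *_) (const-^ c m 0)
  const-^ c (suc m) (suc n) = ≡.trans (const-⊛ c (const c ^ₛ m) (suc n)) (≡.trans (≡.cong (c *_) (const-^ c m (suc n))) (zeroʳ c))

  localY : J → 𝔽 → Series
  localY j b = ∏ (λ i → (lin 1# (𝔼.eval (Θₚ i) b) ^ₛ N) ^ₛ expo j i)

  localAuxiliary : ∀ {R} → Coefficients R → 𝔽 → Series
  localAuxiliary P b = auxiliaryₛ P (ξ b) (λ j → localY j b) (const (𝔼.eval Xₚ b))

  -- For such b the constant factor (1 + eᵢ b)^N drops out of the expansion of fᵢ^N, and ξ^q is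
  -- congruent to b^q = b modulo X^q. What is left depends polynomially on b.
  auxiliary-at-ξ : ∀ {R} (P : Coefficients R) b → (∀ i → (1# + b * e i) ^ N ≡ 1#) →
    evalₛ (auxiliary P) (ξ b) ≋[ q ] localAuxiliary P b
  auxiliary-at-ξ P b unit i i<q = ≡.trans (eval-auxiliary P (ξ b) i)
    (∑-cong-mod (λ r → ⊛-cong-mod {q} (^-cong-mod {q} ξ^q (toℕ r)) (λ n _ → ∑-cong (λ j → 𝕊R.*-congˡ {evalₛ (P r j) (ξ b)}
      (∏-cong (λ i → ^ₛ-congˡ (expo j i) (f^N i)))) n)) i i<q)
    where
    f^N : ∀ i → evalₛ (fₚ i) (ξ b) ^ₛ N ≋ lin 1# (𝔼.eval (Θₚ i) b) ^ₛ N
    f^N i = begin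
      evalₛ (fₚ i) (ξ b) ^ₛ N                                  ≈⟨ ^ₛ-congˡ N (f-at-ξ i b) ⟩
      (const (1# + b * e i) ⊛ lin 1# Θ) ^ₛ N                   ≈⟨ ^ₛ-distrib-⊛ (const (1# + b * e i)) (lin 1# Θ) N ⟩
      (const (1# + b * e i) ^ₛ N) ⊛ (lin 1# Θ ^ₛ N)            ≈⟨ 𝕊R.*-congʳ {lin 1# Θ ^ₛ N} (𝕊R.trans (const-^ (1# + b * e i) N) (const-1 (unit i))) ⟩
      1ₛ ⊛ (lin 1# Θ ^ₛ N)                                     ≈⟨ ⊛-identityˡ (lin 1# Θ ^ₛ N) ⟩
      lin 1# Θ ^ₛ N                                            ∎
      where
      open ≋-Reasoning
      Θ = 𝔼.eval (Θₚ i) b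
      const-1 : ∀ {c} → c ≡ 1# → const c ≋ 1ₛ
      const-1 ≡.refl _ = ≡.refl
    q^1 : ∀ m → m ≡ q → (ξ b ^ₛ m) ≋[ m ] (const (𝔼.eval Xₚ b) ^ₛ m) → (ξ b ^ₛ q) ≋[ q ] (const (𝔼.eval Xₚ b) ^ₛ q)
    q^1 m ≡.refl h = h
    ξ^q : (ξ b ^ₛ q) ≋[ q ] const (𝔼.eval Xₚ b)
    ξ^q i i<q = ≡.trans (q^1 (q ℕ.^ 1) (ℕₚ.*-identityʳ q) (^qᵗ≋head 1 (ξ b)) i i<q)
      (≡.trans (const-^ (𝔼.eval Xₚ b) q i) (≡.cong (λ c → const c i) (x^q≡x (𝔼.eval Xₚ b))))

  family-localAuxiliary : ∀ {R L} (P : Coefficients R) → (∀ r j → length (P r j) ℕ.≤ L) → PolyFamily (R ℕ.+ L) (localAuxiliary P)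
  family-localAuxiliary {R} {L} P len = family-∑ _ λ r →
    family-⊛ {R} {L} {λ b → const (𝔼.eval Xₚ b) ^ₛ toℕ r} {λ b → ∑ (λ j → evalₛ (P r j) (ξ b) ⊛ localY j b)}
      (family-≤ {toℕ r ℕ.* 1} {R} {λ b → const (𝔼.eval Xₚ b) ^ₛ toℕ r}
        (ℕₚ.≤-trans (ℕₚ.≤-reflexive (ℕₚ.*-identityʳ _)) (ℕₚ.<⇒≤ (Finₚ.toℕ<n r))) (family-^ {1} {λ b → const (𝔼.eval Xₚ b)} constX (toℕ r)))
      (family-∑ _ λ j → ≡.subst (λ B → PolyFamily B (λ b → evalₛ (P r j) (ξ b) ⊛ localY j b)) (ℕₚ.+-identityʳ L)
        (family-⊛ {L} {0} {λ b → evalₛ (P r j) (ξ b)} {localY j}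
          (family-eval {L} {ξ} (family-lin {1} Xₚ θₚ ℕₚ.≤-refl (ℕₚ.≤-trans θ-len (s≤s (ℕₚ.n≤1+n k)))) (P r j) (len r j))
          (family-∏ (λ i b → (lin 1# (𝔼.eval (Θₚ i) b) ^ₛ N) ^ₛ expo j i) (λ i →
            ≡.subst (λ B → PolyFamily B (λ b → (lin 1# (𝔼.eval (Θₚ i) b) ^ₛ N) ^ₛ expo j i)) (≡.trans (≡.cong (expo j i ℕ.*_) (ℕₚ.*-zeroʳ N)) (ℕₚ.*-zeroʳ (expo j i)))
              (family-^ {N ℕ.* 0} {λ b → lin 1# (𝔼.eval (Θₚ i) b) ^ₛ N} (family-^ {0} {λ b → lin 1# (𝔼.eval (Θₚ i) b)} (linΘ i) N) (expo j i))))))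
    where
    constX : PolyFamily 1 (λ b → const (𝔼.eval Xₚ b))
    constX zero    = Xₚ , ℕₚ.≤-refl , λ b → ≡.refl
    constX (suc s) = [] , z≤n , λ b → ≡.refl
    θ-len : length θₚ ℕ.≤ suc k
    θ-len = ≡.subst (λ m → length θₚ ℕ.≤ suc m) (ℕₚ.*-identityʳ k) (length-∏ fₚ (λ _ → ℕₚ.≤-refl))
    others-len : ∀ i m → length (others i m) ℕ.≤ 2
    others-len i m with m ≟ i
    ... | yes _ = s≤s z≤n
    ... | no  _ = ℕₚ.≤-refl
    Θ-len : ∀ i → length (Θₚ i) ℕ.≤ suc k
    Θ-len i = ≡.subst (λ m → length (Θₚ i) ℕ.≤ suc m) (ℕₚ.*-identityʳ k) (length-* (constₚ (e i)) (∏ₚ (others i)) {0} (s≤s z≤n) (length-∏ (others i) (others-len i)))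
    linΘ : ∀ i → PolyFamily 0 (λ b → lin 1# (𝔼.eval (Θₚ i) b))
    linΘ i zero = constₚ 1# , s≤s z≤n , λ b → 𝔼.eval-const 1# b
    linΘ i (suc zero) = Θₚ i , ≡.subst (λ m → length (Θₚ i) ℕ.≤ suc m) (≡.sym (ℕₚ.+-identityʳ k)) (Θ-len i) , λ b → ≡.refl
    linΘ i (suc (suc s)) = [] , z≤n , λ b → ≡.refl

  θ-nonzero : ∀ b → (∀ i → (1# + b * e i) ^ N ≡ 1#) → θ b ≢ 0#
  θ-nonzero b unit = λ z → ∏-nonzero (λ i → 𝔼.eval (fₚ i) b) factor (≡.trans (≡.sym (𝔼.eval-∏ fₚ b)) z)
    where
    zero^ : ∀ m → m ≢ 0 → 0# ^ m ≡ 0#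
    zero^ zero    h = ⊥-elim (h ≡.refl)
    zero^ (suc m) _ = zeroˡ _
    factor : ∀ i → 𝔼.eval (fₚ i) b ≢ 0#
    factor i z = 1≢0 (≡.trans (≡.sym (unit i)) (≡.trans (≡.cong (_^ N) (≡.trans (≡.sym (eval-fₚ i b)) z)) (zero^ N N≢0)))

  -- The numerical hypotheses serve, in order, the zero estimate, the excess of the T R (L + 1) free
  -- coefficients over the linear conditions, and the congruence ξ^q = b up to order M. The
  -- conclusion compares zeros counted with multiplicity to the degree of the auxiliary polynomial.
  stepanov : ∀ {s} (b : Fin s → 𝔽) → (∀ i j → b i ≡ b j → i ≡ j) → (∀ t i → (1# + b t * e i) ^ N ≡ 1#) →
    ∀ M R L → T ℕ.* (L ℕ.+ k) ℕ.< q → M ℕ.* suc (R ℕ.+ suc L ℕ.+ M ℕ.* k) ℕ.< T ℕ.* (R ℕ.* suc L) → M ℕ.≤ q →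
    s ℕ.* M ℕ.≤ R ℕ.* q ℕ.+ (L ℕ.+ k ℕ.* (d ℕ.* N))
  stepanov {s} b inj unit M R L small count M≤q with suc (R ℕ.* q ℕ.+ (L ℕ.+ k ℕ.* (d ℕ.* N))) ℕₚ.≤? s ℕ.* M
  ... | no  h = ℕₚ.≮⇒≥ h
  -- Two coefficient vectors with the same local expansions would give a difference A with more
  -- zeros than its degree allows, so A = 0 and the vectors agree by injectivity.
  ... | yes h = ⊥-elim (contradict (families-collide M (λ x → localAuxiliary (P x))
                  (λ x → family-localAuxiliary (P x) (P-len x)) count))
    where
    Vars = Fin (T ℕ.* (R ℕ.* suc L)) → 𝔽
    P : Vars → Coefficients R
    P x r j = tabulate (λ l → x (combine j (combine r l)))
    P-len : ∀ x r j → length (P x r j) ℕ.≤ suc L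
    P-len x r j = ℕₚ.≤-reflexive (length-tabulate (λ l → x (combine j (combine r l))))

    module Collision (x x′ : Vars) (same : ∀ b → localAuxiliary (P x) b ≋[ M ] localAuxiliary (P x′) b) where
      A = auxiliary (P x) -ₚ auxiliary (P x′)
      neg-len : ∀ f {D} → length f ℕ.≤ suc D → length (negₚ f) ℕ.≤ suc D
      neg-len f len = length-* (constₚ (- 1#)) f {0} (s≤s z≤n) len
      A-len : length A ℕ.≤ s ℕ.* M
      A-len = ℕₚ.≤-trans (length-+ (auxiliary (P x)) (negₚ (auxiliary (P x′))) (length-auxiliary (P x) (P-len x))
        (neg-len (auxiliary (P x′)) (length-auxiliary (P x′) (P-len x′)))) h
      A-vanish : ∀ t → Vanish M (evalₛ A (lin (b t) (θ (b t))))
      A-vanish t i i<M = begin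
        evalₛ A (lin (b t) (θ (b t))) i
          ≡⟨ ≡.cong (λ c → evalₛ A (lin c (θ (b t))) i) (𝔼.eval-X (b t)) ⟨
        evalₛ A (ξ (b t)) i
          ≡⟨ evalₛ-- (auxiliary (P x)) (auxiliary (P x′)) (ξ (b t)) i ⟩
        evalₛ (auxiliary (P x)) (ξ (b t)) i + - evalₛ (auxiliary (P x′)) (ξ (b t)) i
          ≡⟨ ≡.cong₂ (λ u v → u + - v) (auxiliary-at-ξ (P x) (b t) (unit t) i i<q) (auxiliary-at-ξ (P x′) (b t) (unit t) i i<q) ⟩
        localAuxiliary (P x) (b t) i + - localAuxiliary (P x′) (b t) i
          ≡⟨ ≡.cong (λ u → u + - localAuxiliary (P x′) (b t) i) (same (b t) i i<M) ⟩
        localAuxiliary (P x′) (b t) i + - localAuxiliary (P x′) (b t) i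
          ≡⟨ -‿inverseʳ _ ⟩
        0# ∎
        where
        open ≡.≡-Reasoning
        i<q = ℕₚ.<-≤-trans i<M M≤q
      A-zero : IsZero A
      A-zero = multiplicity s M A b (θ ∘ b) inj (λ t → θ-nonzero (b t) (unit t)) A-len A-vanish
      differences : ∀ r j → IsZero (P x r j -ₚ P x′ r j)
      differences = auxiliary-injective L (P x) (P x′)
        (λ r j → length-+ (P x r j) (negₚ (P x′ r j)) (P-len x r j) (neg-len (P x′ r j) (P-len x′ r j))) small A-zero
      coefs : ∀ r j i → coef (P x r j) i ≡ coef (P x′ r j) i
      coefs r j i = ≡.trans (≡.sym (evalₛ-X (P x r j) i)) (≡.trans
        (⊝-zero (𝕊R.trans (𝕊R.sym (evalₛ-- (P x r j) (P x′ r j) X)) (𝕊𝔼.eval-zero (P x r j -ₚ P x′ r j) (differences r j) X)) i)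
        (evalₛ-X (P x′ r j) i))
      at : ∀ j r l → x (combine j (combine r l)) ≡ x′ (combine j (combine r l))
      at j r l = ≡.trans (≡.sym (coef-tabulate (λ l → x (combine j (combine r l))) l))
        (≡.trans (coefs r j (toℕ l)) (coef-tabulate (λ l → x′ (combine j (combine r l))) l))
      all-equal : ∀ i → x i ≡ x′ i
      all-equal i = ≡.subst (λ i → x i ≡ x′ i) (Finₚ.combine-remQuot {T} (R ℕ.* suc L) i)
        (≡.subst (λ i′ → x (combine (proj₁ (remQuot {T} (R ℕ.* suc L) i)) i′) ≡ x′ (combine (proj₁ (remQuot {T} (R ℕ.* suc L) i)) i′))
          (Finₚ.combine-remQuot {R} (suc L) (proj₂ (remQuot {T} (R ℕ.* suc L) i)))
          (at (proj₁ (remQuot {T} (R ℕ.* suc L) i)) (proj₁ (remQuot {R} (suc L) (proj₂ (remQuot {T} (R ℕ.* suc L) i))))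
              (proj₂ (remQuot {R} (suc L) (proj₂ (remQuot {T} (R ℕ.* suc L) i))))))

    contradict : (∃₂ λ x x′ → ¬ (∀ i → x i ≡ x′ i) × (∀ b → localAuxiliary (P x) b ≋[ M ] localAuxiliary (P x′) b)) → ⊥
    contradict (x , x′ , x≢x′ , same) = x≢x′ (Collision.all-equal x x′ same)

-- The Hanson–Petridis bound

module HansonPetridis {q : ℕ} (F : FinField q) {p n : ℕ} (prime : Prime p) (q≡p^n : q ≡ p ℕ.^ n)
                      (d N : ℕ) (1+dN≡q : suc (d ℕ.* N) ≡ q) where
  open FieldTheory F
  open Polynomials F
  open PowerSeries ring
  open Multiplicity F
  open Characteristic {p} {n} prime q≡p^n using (∤⇒·1≢0)
  open KummerSeries F {p} {n} prime q≡p^n d N 1+dN≡q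
  open Mult semiring using (×-assoc-*; ×-comm-*; ×-homo-1)
  open 𝕊𝔼 using () renaming (eval to evalₛ)
  open ≡.≡-Reasoning

  moment : ∀ {m} → (Fin m → 𝔽) → (Fin m → 𝔽) → ℕ → 𝔽
  moment c a u = sum (λ i → c i * a i ^ u)

  sum-zero : ∀ {m} (t : Fin m → 𝔽) → (∀ i → t i ≡ 0#) → sum t ≡ 0#
  sum-zero {zero}  t h = ≡.refl
  sum-zero {suc m} t h = ≡.trans (≡.cong₂ _+_ (h zero) (sum-zero (t ∘ suc) (h ∘ suc))) (+-identityˡ 0#)

  sum-linear : ∀ {m} b (s t : Fin m → 𝔽) → sum (λ i → b * s i + t i) ≡ b * sum s + sum t
  sum-linear b s t = ≡.trans (∑-distrib-+ (λ i → b * s i) t) (≡.cong (_+ sum t) (≡.sym (*-distribˡ-sum b s)))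

  -- The weights cᵢ (aᵢ - a₀) drop the point a₀, and their moment u combines the moments u and u + 1
  -- of c; so the hypotheses pass to one point fewer.
  vandermonde : ∀ {m} (c a : Fin m → 𝔽) → (∀ i j → a i ≡ a j → i ≡ j) → (∀ u → u ℕ.< m → moment c a u ≡ 0#) → ∀ i → c i ≡ 0#
  vandermonde {suc m} c a inj zeros = λ { zero → head-zero ; (suc i) → tail-zero i }
    where
    a₀ = a zero
    c′ : Fin (suc m) → 𝔽
    c′ i = c i * (- a₀ + a i)
    c′-moment : ∀ u → moment c′ a u ≡ - a₀ * moment c a u + moment c a (suc u)
    c′-moment u = ≡.trans (sum-cong-≗ (λ i → term (c i) (- a₀) (a i) (a i ^ u))) (sum-linear (- a₀) (λ i → c i * a i ^ u) (λ i → c i * a i ^ suc u))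
      where
      term : ∀ c b a y → c * (b + a) * y ≡ b * (c * y) + c * (a * y)
      term = solve 4 (λ c b a y → c :* (b :+ a) :* y := b :* (c :* y) :+ c :* (a :* y)) ≡.refl
        where open SemiringSolver commutativeSemiring
    c′₀ : c′ zero ≡ 0#
    c′₀ = ≡.trans (≡.cong (c zero *_) (-‿inverseˡ a₀)) (zeroʳ _)
    tail-moment : ∀ u → u ℕ.< m → moment (c′ ∘ suc) (a ∘ suc) u ≡ 0#
    tail-moment u u<m = begin
      moment (c′ ∘ suc) (a ∘ suc) u                     ≡⟨ +-identityˡ _ ⟨
      0# + moment (c′ ∘ suc) (a ∘ suc) u                ≡⟨ ≡.cong (_+ moment (c′ ∘ suc) (a ∘ suc) u) (≡.trans (≡.cong (_* a₀ ^ u) c′₀) (zeroˡ _)) ⟨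
      moment c′ a u                                     ≡⟨ c′-moment u ⟩
      - a₀ * moment c a u + moment c a (suc u)          ≡⟨ ≡.cong₂ (λ x y → - a₀ * x + y) (zeros u (ℕₚ.m≤n⇒m≤1+n u<m)) (zeros (suc u) (s≤s u<m)) ⟩
      - a₀ * 0# + 0#                                    ≡⟨ ≡.trans (+-identityʳ _) (zeroʳ _) ⟩
      0#                                                ∎
    tail-zero : ∀ i → c (suc i) ≡ 0#
    tail-zero i = no-zero-divisors (≡.trans (*-comm _ _) (vandermonde (c′ ∘ suc) (a ∘ suc)
        (λ i j e → Finₚ.suc-injective (inj _ _ e)) tail-moment i))
      (λ z → Finₚ.0≢1+n (inj _ _ (≡.sym (x-y≡0⇒x≡y (≡.trans (+-comm _ _) z)))))
    head-zero : c zero ≡ 0#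
    head-zero = begin
      c zero                                            ≡⟨ *-identityʳ _ ⟨
      c zero * 1#                                       ≡⟨ +-identityʳ _ ⟨
      c zero * 1# + 0#                                  ≡⟨ ≡.cong (c zero * 1# +_) (sum-zero _ (λ i → ≡.trans (≡.cong (_* 1#) (tail-zero i)) (zeroˡ _))) ⟨
      moment c a 0                                      ≡⟨ zeros 0 (s≤s z≤n) ⟩
      0#                                                ∎

  -- Among m + 1 weights, m linear conditions leave a nonzero solution. If its moment m vanished as
  -- well, `vandermonde` would make it zero.
  weights : ∀ {m} (a : Fin (suc m) → 𝔽) → (∀ i j → a i ≡ a j → i ≡ j) →
    ∃ λ c → (∀ u → u ℕ.< m → moment c a u ≡ 0#) × moment c a m ≢ 0#
  weights {m} a inj with vector-pigeonhole 1<q (ℕₚ.n<1+n m) (λ c j → moment c a (toℕ j))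
  ... | x , x′ , x≢x′ , same = c , below , top
    where
    c : Fin (suc m) → 𝔽
    c i = x i - x′ i
    c-moment : ∀ u → moment x a u ≡ moment x′ a u → moment c a u ≡ 0#
    c-moment u eq = begin
      sum (λ i → (x i - x′ i) * a i ^ u)                        ≡⟨ sum-cong-≗ (λ i → ≡.trans (distribʳ (a i ^ u) (x i) (- x′ i)) (+-comm (x i * a i ^ u) (- x′ i * a i ^ u))) ⟩
      sum (λ i → - x′ i * a i ^ u + x i * a i ^ u)
        ≡⟨ sum-cong-≗ (λ i → ≡.cong (_+ x i * a i ^ u) (≡.trans (≡.sym (RingProps.-‿distribˡ-* (CommutativeRing.ring ring) (x′ i) (a i ^ u))) (≡.sym (RingProps.-1*x≈-x (CommutativeRing.ring ring) _)))) ⟩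
      sum (λ i → - 1# * (x′ i * a i ^ u) + x i * a i ^ u)       ≡⟨ sum-linear (- 1#) (λ i → x′ i * a i ^ u) (λ i → x i * a i ^ u) ⟩
      - 1# * moment x′ a u + moment x a u                       ≡⟨ ≡.cong₂ _+_ (RingProps.-1*x≈-x (CommutativeRing.ring ring) _) eq ⟩
      - moment x′ a u + moment x′ a u                           ≡⟨ -‿inverseˡ _ ⟩
      0#                                                        ∎
    below : ∀ u → u ℕ.< m → moment c a u ≡ 0#
    below u u<m = c-moment u (≡.subst (λ u → moment x a u ≡ moment x′ a u) (Finₚ.toℕ-fromℕ< u<m) (same (fromℕ< u<m)))
    top : moment c a m ≢ 0#
    top z = x≢x′ (λ i → x-y≡0⇒x≡y (vandermonde c a inj all i))
      where
      all : ∀ u → u ℕ.< suc m → moment c a u ≡ 0#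
      all u (s≤s u≤m) with u ℕₚ.≟ m
      ... | yes ≡.refl = z
      ... | no  u≢m    = below u (ℕₚ.≤∧≢⇒< u≤m u≢m)

  lin^ : ∀ c r s → (lin c 1# ^ₛ r) s ≡ (r choose s) · c ^ (r ∸ s)
  lin^ c zero    zero    = ≡.sym (+-identityʳ 1#)
  lin^ c zero    (suc s) = ≡.refl
  lin^ c (suc r) zero    = ≡.trans (≡.cong (c *_) (≡.trans (lin^ c r 0) (+-identityʳ _))) (≡.sym (+-identityʳ _))
  lin^ c (suc r) (suc s) = begin
    (lin c 1# ⊛ (lin c 1# ^ₛ r)) (suc s)                              ≡⟨ lin-⊛-suc c 1# (lin c 1# ^ₛ r) s ⟩
    c * (lin c 1# ^ₛ r) (suc s) + 1# * (lin c 1# ^ₛ r) s              ≡⟨ ≡.cong₂ _+_ (≡.cong (c *_) (lin^ c r (suc s))) (≡.trans (*-identityˡ _) (lin^ c r s)) ⟩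
    c * ((r choose suc s) · c ^ (r ∸ suc s)) + (r choose s) · c ^ (r ∸ s)       ≡⟨ +-comm _ _ ⟩
    (r choose s) · c ^ (r ∸ s) + c * ((r choose suc s) · c ^ (r ∸ suc s))       ≡⟨ ≡.cong ((r choose s) · c ^ (r ∸ s) +_) absorb ⟩
    (r choose s) · c ^ (r ∸ s) + (r choose suc s) · c ^ (r ∸ s)                 ≡⟨ ×-homo-+ (c ^ (r ∸ s)) (r choose s) (r choose suc s) ⟨
    (r choose s ℕ.+ r choose suc s) · c ^ (r ∸ s)                               ≡⟨ ≡.cong (_· c ^ (r ∸ s)) (nCk+nC[k+1]≡[n+1]C[k+1] r s) ⟩
    (suc r choose suc s) · c ^ (suc r ∸ suc s)                             ∎
    where
    absorb : c * ((r choose suc s) · c ^ (r ∸ suc s)) ≡ (r choose suc s) · c ^ (r ∸ s)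
    absorb with suc s ℕₚ.≤? r
    ... | yes s<r = ≡.trans (×-comm-* (r choose suc s) c _) (≡.cong (λ e → (r choose suc s) · c ^ e) (≡.sym (ℕₚ.+-∸-assoc 1 s<r)))
    ... | no  s≮r = ≡.trans (≡.trans (≡.cong (λ z → c * (z · c ^ (r ∸ suc s))) none) (zeroʳ c)) (≡.cong (_· c ^ (r ∸ s)) (≡.sym none))
      where none = k>n⇒nCk≡0 (ℕₚ.≰⇒> s≮r)

  module _ {m s} (a : Fin (suc m) → 𝔽) (a-inj : ∀ i j → a i ≡ a j → i ≡ j)
           (b : Fin s → 𝔽) (b-inj : ∀ i j → b i ≡ b j → i ≡ j)
           (unit : ∀ i j → (b j + a i) ^ N ≡ 1#) (p∤ : ¬ (p ∣ ((N ℕ.+ m) choose N))) where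
    private
      c  = proj₁ (weights a a-inj)
      below = proj₁ (proj₂ (weights a a-inj))
      top = moment c a m
      top≢0 : top ≢ 0#
      top≢0 = proj₂ (proj₂ (weights a a-inj))

      -- Mixed moments allow (b + aᵢ)^t to be expanded one factor at a time. Only the total degree u
      -- + t matters: they vanish below m and equal `top`, whatever b is, at m.
      shifted-moment : 𝔽 → ℕ → ℕ → 𝔽
      shifted-moment b u t = sum (λ i → c i * (a i ^ u * (b + a i) ^ t))

      shifted-moment-zero : ∀ b u → shifted-moment b u 0 ≡ moment c a u
      shifted-moment-zero b u = sum-cong-≗ (λ i → ≡.cong (c i *_) (*-identityʳ (a i ^ u)))

      shifted-moment-suc : ∀ b u t → shifted-moment b u (suc t) ≡ b * shifted-moment b u t + shifted-moment b (suc u) t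
      shifted-moment-suc b u t = ≡.trans (sum-cong-≗ (λ i → term (c i) (a i ^ u) b (a i) ((b + a i) ^ t)))
        (sum-linear b (λ i → c i * (a i ^ u * (b + a i) ^ t)) (λ i → c i * (a i ^ suc u * (b + a i) ^ t)))
        where
        open SemiringSolver commutativeSemiring
        term : ∀ c x b a y → c * (x * ((b + a) * y)) ≡ b * (c * (x * y)) + c * (a * x * y)
        term = solve 5 (λ c x b a y → c :* (x :* ((b :+ a) :* y)) := b :* (c :* (x :* y)) :+ c :* (a :* x :* y)) ≡.refl

      shifted-moment-below : ∀ b t u → u ℕ.+ t ℕ.< m → shifted-moment b u t ≡ 0#
      shifted-moment-below b zero    u u<m = ≡.trans (shifted-moment-zero b u) (below u (≡.subst (ℕ._< m) (ℕₚ.+-identityʳ u) u<m))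
      shifted-moment-below b (suc t) u u<m = begin
        shifted-moment b u (suc t)                                   ≡⟨ shifted-moment-suc b u t ⟩
        b * shifted-moment b u t + shifted-moment b (suc u) t
          ≡⟨ ≡.cong₂ (λ x y → b * x + y) (shifted-moment-below b t u (ℕₚ.<-trans (ℕₚ.+-monoʳ-< u (ℕₚ.n<1+n t)) u<m))
               (shifted-moment-below b t (suc u) (≡.subst (ℕ._< m) (ℕₚ.+-suc u t) u<m)) ⟩
        b * 0# + 0#                                                  ≡⟨ ≡.trans (+-identityʳ _) (zeroʳ b) ⟩
        0#                                                           ∎

      shifted-moment-top : ∀ b t u → u ℕ.+ t ≡ m → shifted-moment b u t ≡ top
      shifted-moment-top b zero    u eq = ≡.trans (shifted-moment-zero b u) (≡.cong (moment c a) (≡.trans (≡.sym (ℕₚ.+-identityʳ u)) eq))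
      shifted-moment-top b (suc t) u eq = begin
        shifted-moment b u (suc t)                                   ≡⟨ shifted-moment-suc b u t ⟩
        b * shifted-moment b u t + shifted-moment b (suc u) t
          ≡⟨ ≡.cong₂ (λ x y → b * x + y) (shifted-moment-below b t u (ℕₚ.<-≤-trans (ℕₚ.+-monoʳ-< u (ℕₚ.n<1+n t)) (ℕₚ.≤-reflexive eq)))
               (shifted-moment-top b t (suc u) (≡.trans (≡.sym (ℕₚ.+-suc u t)) eq)) ⟩
        b * 0# + top                                                 ≡⟨ ≡.trans (≡.cong (_+ top) (zeroʳ b)) (+-identityˡ _) ⟩
        top                                                          ∎

      linear : Fin (suc m) → Poly
      linear i = a i ∷ 1# ∷ []

      power : Fin (suc m) → Poly
      power i = linear i ^ₚ (N ℕ.+ m)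

      -- With m + 1 points the exponent is N + m, and the constant λ of the overview is `top`: the
      -- value of the sum at every `b j`, so that subtracting it removes the constant term of the
      -- expansion there.
      g : Poly
      g = ∑ₚ (λ i → constₚ (c i) *ₚ power i) -ₚ constₚ top

      eval-linear : ∀ i y → evalₛ (linear i) (lin y 1#) ≋ lin (y + a i) 1#
      eval-linear i y r = ≡.trans (≡.cong (const (a i) r +_) (≡.trans (𝕊R.*-congˡ {lin y 1#} (𝕊𝔼.eval-const 1# (lin y 1#)) r) (𝕊R.*-identityʳ (lin y 1#) r))) (go r)
        where
        go : ∀ r → const (a i) r + lin y 1# r ≡ lin (y + a i) 1# r
        go zero          = +-comm _ _
        go (suc zero)    = +-identityˡ _
        go (suc (suc r)) = +-identityˡ _

      eval-g : ∀ y r → evalₛ g (lin y 1#) r ≡ ((N ℕ.+ m) choose r) · sum (λ i → c i * (y + a i) ^ (N ℕ.+ m ∸ r)) + - const top r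
      eval-g y r = begin
        evalₛ g (lin y 1#) r
          ≡⟨ evalₛ-- (∑ₚ (λ i → constₚ (c i) *ₚ power i)) (constₚ top) (lin y 1#) r ⟩
        evalₛ (∑ₚ (λ i → constₚ (c i) *ₚ power i)) (lin y 1#) r + - evalₛ (constₚ top) (lin y 1#) r
          ≡⟨ ≡.cong₂ (λ u v → u + - v) (𝕊𝔼.eval-∑ (λ i → constₚ (c i) *ₚ power i) (lin y 1#) r) (𝕊𝔼.eval-const top (lin y 1#) r) ⟩
        ∑ (λ i → evalₛ (constₚ (c i) *ₚ power i) (lin y 1#)) r + - const top r
          ≡⟨ ≡.cong (_+ - const top r) (≡.trans (coordinate (λ i → evalₛ (constₚ (c i) *ₚ power i) (lin y 1#)) r) (sum-cong-≗ term)) ⟩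
        sum (λ i → ((N ℕ.+ m) choose r) · (c i * (y + a i) ^ (N ℕ.+ m ∸ r))) + - const top r
          ≡⟨ ≡.cong (_+ - const top r) (·-sum ((N ℕ.+ m) choose r) (λ i → c i * (y + a i) ^ (N ℕ.+ m ∸ r))) ⟩
        ((N ℕ.+ m) choose r) · sum (λ i → c i * (y + a i) ^ (N ℕ.+ m ∸ r)) + - const top r ∎
        where
        coordinate : ∀ {l} (t : Fin l → Series) r → ∑ t r ≡ sum (λ i → t i r)
        coordinate {zero}  t r = ≡.refl
        coordinate {suc l} t r = ≡.cong (t zero r +_) (coordinate (t ∘ suc) r)
        ·-sum : ∀ K {l} (t : Fin l → 𝔽) → sum (λ i → K · t i) ≡ K · sum t
        ·-sum K t = ≡.trans (sum-cong-≗ (λ i → K·x (t i))) (≡.trans (≡.sym (*-distribˡ-sum (K · 1#) t)) (≡.sym (K·x (sum t))))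
          where
          K·x : ∀ x → K · x ≡ (K · 1#) * x
          K·x x = ≡.trans (≡.cong (K ·_) (≡.sym (*-identityˡ x))) (≡.sym (×-assoc-* K 1# x))
        term : ∀ i → evalₛ (constₚ (c i) *ₚ power i) (lin y 1#) r ≡ ((N ℕ.+ m) choose r) · (c i * (y + a i) ^ (N ℕ.+ m ∸ r))
        term i = begin
          evalₛ (constₚ (c i) *ₚ power i) (lin y 1#) r
            ≡⟨ 𝕊𝔼.eval-* (constₚ (c i)) (power i) (lin y 1#) r ⟩
          (evalₛ (constₚ (c i)) (lin y 1#) ⊛ evalₛ (power i) (lin y 1#)) r
            ≡⟨ 𝕊R.*-cong (𝕊𝔼.eval-const (c i) (lin y 1#)) (𝕊R.trans (𝕊𝔼.eval-^ (linear i) (N ℕ.+ m) (lin y 1#)) (^ₛ-congˡ (N ℕ.+ m) (eval-linear i y))) r ⟩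
          (const (c i) ⊛ (lin (y + a i) 1# ^ₛ (N ℕ.+ m))) r
            ≡⟨ const-⊛ (c i) (lin (y + a i) 1# ^ₛ (N ℕ.+ m)) r ⟩
          c i * (lin (y + a i) 1# ^ₛ (N ℕ.+ m)) r
            ≡⟨ ≡.cong (c i *_) (lin^ (y + a i) (N ℕ.+ m) r) ⟩
          c i * (((N ℕ.+ m) choose r) · (y + a i) ^ (N ℕ.+ m ∸ r))
            ≡⟨ ×-comm-* ((N ℕ.+ m) choose r) (c i) _ ⟩
          ((N ℕ.+ m) choose r) · (c i * (y + a i) ^ (N ℕ.+ m ∸ r)) ∎

      coef-g : ∀ r → coef g r ≡ ((N ℕ.+ m) choose r) · moment c a (N ℕ.+ m ∸ r) + - const top r
      coef-g r = ≡.trans (≡.sym (evalₛ-X g r)) (≡.trans (𝕊-eval r)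
        (≡.trans (eval-g 0# r) (≡.cong (λ z → ((N ℕ.+ m) choose r) · z + - const top r) (sum-cong-≗ (λ i → ≡.cong (λ z → c i * z ^ (N ℕ.+ m ∸ r)) (+-identityˡ (a i)))))))
        where
        X≋lin : X ≋ lin 0# 1#
        X≋lin zero          = ≡.refl
        X≋lin (suc zero)    = ≡.refl
        X≋lin (suc (suc _)) = ≡.refl
        evalₛ-cong : ∀ f {s t} → s ≋ t → evalₛ f s ≋ evalₛ f t
        evalₛ-cong []      e = λ _ → ≡.refl
        evalₛ-cong (a ∷ f) {s} {t} e = 𝕊R.+-congˡ {const a} (𝕊R.*-cong e (evalₛ-cong f e))
        𝕊-eval : ∀ r → evalₛ g X r ≡ evalₛ g (lin 0# 1#) r
        𝕊-eval = evalₛ-cong g X≋lin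

      K·0 : ∀ K → K · 0# ≡ 0#
      K·0 zero    = ≡.refl
      K·0 (suc K) = ≡.trans (+-identityˡ _) (K·0 K)

      -0≡0 : - 0# ≡ 0#
      -0≡0 = RingProps.-0#≈0# (CommutativeRing.ring ring)

      N-positive : N ≢ 0
      N-positive N≡0 = ℕₚ.<⇒≢ 1<q (≡.trans (≡.sym (≡.cong suc (≡.trans (≡.cong (d ℕ.*_) N≡0) (ℕₚ.*-zeroʳ d)))) 1+dN≡q)

      -- A coefficient of index r > N carries the moment N + m - r < m, which the weights
      -- annihilate.
      deg-g : DegBelow (suc N) (coef g)
      deg-g (suc r) (s≤s N≤r) = ≡.trans (coef-g (suc r)) (≡.trans (≡.cong₂ _+_ zeroterm -0≡0) (+-identityʳ _))
        where
        zeroterm : ((N ℕ.+ m) choose suc r) · moment c a (N ℕ.+ m ∸ suc r) ≡ 0#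
        zeroterm with suc r ℕₚ.≤? N ℕ.+ m
        ... | no  h = ≡.cong (_· moment c a (N ℕ.+ m ∸ suc r)) (k>n⇒nCk≡0 (ℕₚ.≰⇒> h))
        ... | yes h = ≡.trans (≡.cong (((N ℕ.+ m) choose suc r) ·_) (below _ (ℕₚ.+-cancelʳ-< (suc r) _ _
                (≡.subst (ℕ._< m ℕ.+ suc r) (≡.sym (ℕₚ.m∸n+n≡m h)) (≡.subst (N ℕ.+ m ℕ.<_) (ℕₚ.+-comm (suc r) m) (ℕₚ.+-monoˡ-< m (s≤s N≤r))))))) (K·0 ((N ℕ.+ m) choose suc r))

      -- Since (b + aᵢ)^N = 1, the exponent N + m - r drops to m - r. For 0 < r ≤ m the resulting
      -- moment is below m, and for r = 0 it is `top`.
      g-vanish : ∀ j → Vanish (suc m) (evalₛ g (lin (b j) 1#))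
      g-vanish j r (s≤s r≤m) = ≡.trans (eval-g (b j) r) (go r r≤m)
        where
        reduce : ∀ r → r ℕ.≤ m → sum (λ i → c i * (b j + a i) ^ (N ℕ.+ m ∸ r)) ≡ shifted-moment (b j) 0 (m ∸ r)
        reduce r r≤m = sum-cong-≗ (λ i → ≡.cong (c i *_) (begin
          (b j + a i) ^ (N ℕ.+ m ∸ r)                    ≡⟨ ≡.cong ((b j + a i) ^_) (ℕₚ.+-∸-assoc N r≤m) ⟩
          (b j + a i) ^ (N ℕ.+ (m ∸ r))                  ≡⟨ ^-homo-* (b j + a i) N (m ∸ r) ⟩
          (b j + a i) ^ N * (b j + a i) ^ (m ∸ r)        ≡⟨ ≡.cong (_* (b j + a i) ^ (m ∸ r)) (unit i j) ⟩
          1# * (b j + a i) ^ (m ∸ r)                     ∎))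
        go : ∀ r → r ℕ.≤ m → ((N ℕ.+ m) choose r) · sum (λ i → c i * (b j + a i) ^ (N ℕ.+ m ∸ r)) + - const top r ≡ 0#
        go zero _ = ≡.trans (≡.cong (_+ - top) (≡.trans (×-homo-1 _) (≡.trans (reduce 0 z≤n) (shifted-moment-top (b j) m 0 ≡.refl)))) (-‿inverseʳ top)
        go (suc r) r<m = ≡.trans (≡.cong₂ _+_ (≡.trans (≡.cong (((N ℕ.+ m) choose suc r) ·_) (≡.trans (reduce (suc r) r<m)
            (shifted-moment-below (b j) (m ∸ suc r) 0 (ℕₚ.∸-monoʳ-< (s≤s z≤n) r<m)))) (K·0 ((N ℕ.+ m) choose suc r))) -0≡0) (+-identityˡ 0#)

      -- At index N the moment is exactly `top`, the binomial coefficient is nonzero modulo p, and N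
      -- ≠ 0 keeps the subtracted constant away.
      leading : coef g N ≢ 0#
      leading z = *-nonzero (∤⇒·1≢0 ((N ℕ.+ m) choose N) p∤) top≢0 (begin
        (((N ℕ.+ m) choose N) · 1#) * top                                     ≡⟨ ×-assoc-* ((N ℕ.+ m) choose N) 1# top ⟩
        ((N ℕ.+ m) choose N) · (1# * top)                                     ≡⟨ ≡.cong (((N ℕ.+ m) choose N) ·_) (≡.trans (*-identityˡ top) (≡.cong (moment c a) (≡.sym (ℕₚ.m+n∸m≡n N m)))) ⟩
        ((N ℕ.+ m) choose N) · moment c a (N ℕ.+ m ∸ N)                       ≡⟨ +-identityʳ _ ⟨
        ((N ℕ.+ m) choose N) · moment c a (N ℕ.+ m ∸ N) + 0#                  ≡⟨ ≡.cong (((N ℕ.+ m) choose N) · moment c a (N ℕ.+ m ∸ N) +_) (constN N N-positive) ⟨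
        ((N ℕ.+ m) choose N) · moment c a (N ℕ.+ m ∸ N) + - const top N       ≡⟨ coef-g N ⟨
        coef g N                                                         ≡⟨ z ⟩
        0#                                                               ∎)
        where
        constN : ∀ N → N ≢ 0 → - const top N ≡ 0#
        constN zero    h = ⊥-elim (h ≡.refl)
        constN (suc N) _ = -0≡0

    hanson-petridis : s ℕ.* suc m ℕ.≤ N
    hanson-petridis = ℕₚ.≮⇒≥ λ h → leading (multiplicity-deg s (suc m) (suc N) g b (λ _ → 1#) b-inj (λ _ → 1≢0) deg-g h g-vanish N)

-- Binomial coefficients modulo p

module Carries {p : ℕ} (prime : Prime p) where
  private instance
    p≢0 : NonZero p
    p≢0 = prime⇒nonZero prime

  open ≡.≡-Reasoning

  -- One factor at a time: a factor prime to p joins u, and a factor (a + 1) p supplies a power of p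
  -- together with the next factor of (a + 1)!.
  factorial-unit-part : ∀ a r → r ℕ.< p → ∃ λ u → Σ (¬ (p ∣ u)) λ _ → (r ℕ.+ a ℕ.* p) ! ≡ u ℕ.* (p ℕ.^ a ℕ.* a !)
  factorial-unit-part zero zero r<p = 1 , prime∤1 prime , ≡.refl
  factorial-unit-part a (suc r) r<p with factorial-unit-part a r (ℕₚ.<-trans (ℕₚ.n<1+n r) r<p)
  ... | u , p∤u , eq = (suc r ℕ.+ a ℕ.* p) ℕ.* u , p∤ , ≡.trans (≡.cong ((suc r ℕ.+ a ℕ.* p) ℕ.*_) eq) (≡.sym (ℕₚ.*-assoc (suc r ℕ.+ a ℕ.* p) u _))
    where
    p∤ : ¬ (p ∣ (suc r ℕ.+ a ℕ.* p) ℕ.* u)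
    p∤ h with euclidsLemma (suc r ℕ.+ a ℕ.* p) u prime h
    ... | inj₂ p∣u = p∤u p∣u
    ... | inj₁ p∣  = ℕₚ.<⇒≱ r<p (∣⇒≤ (∣m+n∣m⇒∣n (≡.subst (p ∣_) (ℕₚ.+-comm (suc r) (a ℕ.* p)) p∣) (divides a ≡.refl)))
  factorial-unit-part (suc a) zero r<p with factorial-unit-part a (ℕ.pred p) (ℕₚ.≤-reflexive (ℕₚ.suc-pred p))
  ... | u , p∤u , eq = u , p∤u , (begin
    (p ℕ.+ a ℕ.* p) !                                    ≡⟨ ≡.cong (λ z → (z ℕ.+ a ℕ.* p) !) (ℕₚ.suc-pred p) ⟨
    (suc (ℕ.pred p) ℕ.+ a ℕ.* p) ℕ.* (ℕ.pred p ℕ.+ a ℕ.* p) !   ≡⟨ ≡.cong₂ ℕ._*_ (≡.cong (ℕ._+ a ℕ.* p) (ℕₚ.suc-pred p)) eq ⟩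
    suc a ℕ.* p ℕ.* (u ℕ.* (p ℕ.^ a ℕ.* a !))            ≡⟨ arith (suc a) p u (p ℕ.^ a) (a !) ⟩
    u ℕ.* (p ℕ.* p ℕ.^ a ℕ.* (suc a ℕ.* a !))            ∎)
    where
    arith : ∀ a p u x y → a ℕ.* p ℕ.* (u ℕ.* (x ℕ.* y)) ≡ u ℕ.* (p ℕ.* x ℕ.* (a ℕ.* y))
    arith = solve-∀

  [m+n]Cm*m!n! : ∀ m n → ((m ℕ.+ n) choose m) ℕ.* (m ! ℕ.* n !) ≡ (m ℕ.+ n) !
  [m+n]Cm*m!n! m n = ≡.trans (≡.cong (λ z → ((m ℕ.+ n) choose m) ℕ.* (m ! ℕ.* z !)) (≡.sym (ℕₚ.m+n∸m≡n m n))) (nCk*k![n∸k]!≡n! (ℕₚ.m≤m+n m n))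

  -- If the lowest digits add without a carry, the powers of p in the three factorials cancel, and
  -- up to factors prime to p the binomial coefficient is that of the numbers with their lowest
  -- digits removed.
  lucas-step : ∀ a b r s → r ℕ.+ s ℕ.< p → ¬ (p ∣ ((a ℕ.+ b) choose a)) →
    ¬ (p ∣ ((r ℕ.+ a ℕ.* p ℕ.+ (s ℕ.+ b ℕ.* p)) choose (r ℕ.+ a ℕ.* p)))
  lucas-step a b r s r+s<p p∤ p∣
    with factorial-unit-part a r (ℕₚ.≤-<-trans (ℕₚ.m≤m+n r s) r+s<p)
       | factorial-unit-part b s (ℕₚ.≤-<-trans (ℕₚ.m≤n+m s r) r+s<p)
       | factorial-unit-part (a ℕ.+ b) (r ℕ.+ s) r+s<p
  ... | u , _ , eq | u′ , _ , eq′ | u″ , p∤u″ , eq″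
    with euclidsLemma u″ ((a ℕ.+ b) choose a) prime (≡.subst (p ∣_) key (∣m⇒∣m*n (u ℕ.* u′) p∣))
    where
    A = r ℕ.+ a ℕ.* p
    B = s ℕ.+ b ℕ.* p
    common = p ℕ.^ a ℕ.* p ℕ.^ b ℕ.* (a ! ℕ.* b !)
    arith₁ : ∀ c u x y u′ x′ y′ → c ℕ.* (u ℕ.* u′) ℕ.* (x ℕ.* x′ ℕ.* (y ℕ.* y′)) ≡ c ℕ.* (u ℕ.* (x ℕ.* y) ℕ.* (u′ ℕ.* (x′ ℕ.* y′)))
    arith₁ = solve-∀
    arith₂ : ∀ u x c z → u ℕ.* (x ℕ.* (c ℕ.* z)) ≡ u ℕ.* c ℕ.* (x ℕ.* z)
    arith₂ = solve-∀
    arith₃ : ∀ r s a b p → r ℕ.+ a ℕ.* p ℕ.+ (s ℕ.+ b ℕ.* p) ≡ r ℕ.+ s ℕ.+ (a ℕ.+ b) ℕ.* p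
    arith₃ = solve-∀
    scaled : ((A ℕ.+ B) choose A) ℕ.* (u ℕ.* u′) ℕ.* common ≡ u″ ℕ.* ((a ℕ.+ b) choose a) ℕ.* common
    scaled = begin
      ((A ℕ.+ B) choose A) ℕ.* (u ℕ.* u′) ℕ.* common
        ≡⟨ arith₁ ((A ℕ.+ B) choose A) u (p ℕ.^ a) (a !) u′ (p ℕ.^ b) (b !) ⟩
      ((A ℕ.+ B) choose A) ℕ.* (u ℕ.* (p ℕ.^ a ℕ.* a !) ℕ.* (u′ ℕ.* (p ℕ.^ b ℕ.* b !)))
        ≡⟨ ≡.cong₂ (λ x y → ((A ℕ.+ B) choose A) ℕ.* (x ℕ.* y)) eq eq′ ⟨
      ((A ℕ.+ B) choose A) ℕ.* (A ! ℕ.* B !)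
        ≡⟨ [m+n]Cm*m!n! A B ⟩
      (A ℕ.+ B) !
        ≡⟨ ≡.cong _! (arith₃ r s a b p) ⟩
      (r ℕ.+ s ℕ.+ (a ℕ.+ b) ℕ.* p) !
        ≡⟨ eq″ ⟩
      u″ ℕ.* (p ℕ.^ (a ℕ.+ b) ℕ.* (a ℕ.+ b) !)
        ≡⟨ ≡.cong₂ (λ x y → u″ ℕ.* (x ℕ.* y)) (ℕₚ.^-distribˡ-+-* p a b) (≡.sym ([m+n]Cm*m!n! a b)) ⟩
      u″ ℕ.* (p ℕ.^ a ℕ.* p ℕ.^ b ℕ.* (((a ℕ.+ b) choose a) ℕ.* (a ! ℕ.* b !)))
        ≡⟨ arith₂ u″ (p ℕ.^ a ℕ.* p ℕ.^ b) ((a ℕ.+ b) choose a) (a ! ℕ.* b !) ⟩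
      u″ ℕ.* ((a ℕ.+ b) choose a) ℕ.* common ∎
    key : ((A ℕ.+ B) choose A) ℕ.* (u ℕ.* u′) ≡ u″ ℕ.* ((a ℕ.+ b) choose a)
    key = ℕₚ.*-cancelʳ-≡ _ _ common {{ℕₚ.m*n≢0 _ _ {{ℕₚ.m*n≢0 _ _ {{ℕₚ.m^n≢0 p a}} {{ℕₚ.m^n≢0 p b}}}} {{a !* b !≢0}}}} scaled
  ... | inj₁ p∣u″ = p∤u″ p∣u″
  ... | inj₂ p∣C  = p∤ p∣C

  digit-suc : ∀ m j → digit p m (suc j) ≡ digit p (m / p) j
  digit-suc m j = ≡.cong (_% p) (≡.sym (m/n/o≡m/[n*o] m p (p ℕ.^ j) {{p≢0}} {{ℕₚ.m^n≢0 p j}} {{ℕₚ.m^n≢0 p (suc j)}}))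

  -- M′ has the digits min (digit of M , p − 1 − digit of N), so that N + M′ is computed without carries.
  truncate-digits : ∀ {u v} → u ℕ.≤ v → ∀ K N M → M ℕ.< p ℕ.^ K →
    (∀ j → j ℕ.< K → u ℕ.* (p ℕ.∸ 1) ℕ.≤ v ℕ.* (p ℕ.∸ 1 ℕ.∸ digit p N j)) →
    ∃ λ M′ → Σ (M′ ℕ.≤ M) λ _ → Σ (u ℕ.* M ℕ.≤ v ℕ.* M′) λ _ → ¬ (p ∣ ((N ℕ.+ M′) choose N))
  truncate-digits {u} {v} u≤v zero N zero M<1 good = 0 , z≤n , ℕₚ.≤-reflexive (≡.trans (ℕₚ.*-zeroʳ u) (≡.sym (ℕₚ.*-zeroʳ v))) ,
    λ h → prime∤1 prime (≡.subst (p ∣_) (≡.trans (≡.cong (_choose N) (ℕₚ.+-identityʳ N)) (nCn≡1 N)) h)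
  truncate-digits {u} {v} u≤v zero N (suc M) (s≤s ()) good
  truncate-digits {u} {v} u≤v (suc K) N M M<p^ good
    with truncate-digits u≤v K (N / p) (M / p) M/p< (λ j j<K → ≡.subst (λ x → u ℕ.* (p ℕ.∸ 1) ℕ.≤ v ℕ.* (p ℕ.∸ 1 ℕ.∸ x)) (digit-suc N j) (good (suc j) (s≤s j<K)))
    where
    M/p< : M / p ℕ.< p ℕ.^ K
    M/p< = m<n*o⇒m/o<n (≡.subst (M ℕ.<_) (ℕₚ.*-comm p (p ℕ.^ K)) M<p^)
  ... | M₁ , M₁≤ , uM₁≤ , p∤ = r′ ℕ.+ M₁ ℕ.* p , M′≤M , uM≤ , λ h → lucas-step (N / p) M₁ (N % p) r′ nocarry p∤
          (≡.subst (λ z → p ∣ ((z ℕ.+ (r′ ℕ.+ M₁ ℕ.* p)) choose z)) (m≡m%n+[m/n]*n N p) h)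
    where
    r = M % p
    e₀ = N % p
    r′ = r ℕ.⊓ (p ℕ.∸ 1 ℕ.∸ e₀)
    digit₀ : digit p N 0 ≡ e₀
    digit₀ = ≡.cong (_% p) (n/1≡n N)
    p-1 : ℕ
    p-1 = p ℕ.∸ 1
    e₀≤p-1 : e₀ ℕ.≤ p-1
    e₀≤p-1 = ℕₚ.<⇒≤pred (m%n<n N p)
    nocarry : e₀ ℕ.+ r′ ℕ.< p
    nocarry = ℕₚ.≤-trans (s≤s (ℕₚ.≤-trans (ℕₚ.+-monoʳ-≤ e₀ (ℕₚ.m⊓n≤n r _)) (ℕₚ.≤-reflexive (ℕₚ.m+[n∸m]≡n e₀≤p-1)))) (ℕₚ.≤-reflexive (ℕₚ.suc-pred p))
    M≡ = m≡m%n+[m/n]*n M p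
    M′≤M : r′ ℕ.+ M₁ ℕ.* p ℕ.≤ M
    M′≤M = ≡.subst (r′ ℕ.+ M₁ ℕ.* p ℕ.≤_) (≡.sym M≡) (ℕₚ.+-mono-≤ (ℕₚ.m⊓n≤m r _) (ℕₚ.*-monoˡ-≤ p M₁≤))
    ur≤ : u ℕ.* r ℕ.≤ v ℕ.* r′
    ur≤ with ℕₚ.⊓-sel r (p ℕ.∸ 1 ℕ.∸ e₀)
    ... | inj₁ eq = ≡.subst (λ z → u ℕ.* r ℕ.≤ v ℕ.* z) (≡.sym eq) (ℕₚ.*-monoˡ-≤ r u≤v)
    -- A digit that is cut was at most p - 1, and p - 1 - e₀ is at least the fraction u/v of p - 1.
    ... | inj₂ eq = ≡.subst (λ z → u ℕ.* r ℕ.≤ v ℕ.* z) (≡.sym eq)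
      (ℕₚ.≤-trans (ℕₚ.*-monoʳ-≤ u (ℕₚ.<⇒≤pred (m%n<n M p))) (≡.subst (λ x → u ℕ.* p-1 ℕ.≤ v ℕ.* (p-1 ℕ.∸ x)) digit₀ (good 0 (s≤s z≤n))))
    uM≤ : u ℕ.* M ℕ.≤ v ℕ.* (r′ ℕ.+ M₁ ℕ.* p)
    uM≤ = ≡.subst₂ ℕ._≤_ (≡.sym (≡.trans (≡.cong (u ℕ.*_) M≡) (dist u r (M / p) p))) (≡.sym (dist v r′ M₁ p))
      (ℕₚ.+-mono-≤ ur≤ (ℕₚ.*-monoˡ-≤ p uM₁≤))
      where
      dist : ∀ u r m p → u ℕ.* (r ℕ.+ m ℕ.* p) ≡ u ℕ.* r ℕ.+ u ℕ.* m ℕ.* p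
      dist = solve-∀

-- Counting

open CMSum ℕₚ.+-0-commutativeMonoid using () renaming (sum to ∑ℕ; ∑-distrib-+ to ∑ℕ-distrib-+)

count : ∀ {n} → (Fin n → Bool) → ℕ
count {zero}  P = 0
count {suc n} P = (if P zero then 1 else 0) ℕ.+ count (P ∘ suc)

member : ∀ {n} (P : Fin n → Bool) → Fin (count P) → Fin n
member {suc n} P i with P zero
member {suc n} P zero    | true  = zero
member {suc n} P (suc i) | true  = suc (member (P ∘ suc) i)
member {suc n} P i       | false = suc (member (P ∘ suc) i)

member-true : ∀ {n} (P : Fin n → Bool) i → P (member P i) ≡ true
member-true {suc n} P i with P zero in eq
member-true {suc n} P zero    | true  = eq
member-true {suc n} P (suc i) | true  = member-true (P ∘ suc) i
member-true {suc n} P i       | false = member-true (P ∘ suc) i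

member-injective : ∀ {n} (P : Fin n → Bool) i j → member P i ≡ member P j → i ≡ j
member-injective {suc n} P i j eq with P zero
member-injective {suc n} P zero    zero    eq | true  = ≡.refl
member-injective {suc n} P (suc i) (suc j) eq | true  = ≡.cong suc (member-injective (P ∘ suc) i j (Finₚ.suc-injective eq))
member-injective {suc n} P i       j       eq | false = member-injective (P ∘ suc) i j (Finₚ.suc-injective eq)

member-onto : ∀ {n} (P : Fin n → Bool) x → P x ≡ true → ∃ λ i → member P i ≡ x
member-onto {suc n} P zero    Px with P zero
... | true = zero , ≡.refl
member-onto {suc n} P (suc x) Px with P zero | member-onto (P ∘ suc) x Px
... | true  | i , eq = suc i , ≡.cong suc eq
... | false | i , eq = i , ≡.cong suc eq

∑ℕ-mono : ∀ {n} (s t : Fin n → ℕ) → (∀ i → s i ℕ.≤ t i) → ∑ℕ s ℕ.≤ ∑ℕ t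
∑ℕ-mono {zero}  s t h = z≤n
∑ℕ-mono {suc n} s t h = ℕₚ.+-mono-≤ (h zero) (∑ℕ-mono (s ∘ suc) (t ∘ suc) (h ∘ suc))

∑ℕ-const : ∀ n c → ∑ℕ {n} (λ _ → c) ≡ n ℕ.* c
∑ℕ-const zero    c = ≡.refl
∑ℕ-const (suc n) c = ≡.cong (c ℕ.+_) (∑ℕ-const n c)

private
  indicator : Bool → ℕ
  indicator b = if b then 1 else 0

  ∑-indicator-≤1 : ∀ {n} (P : Fin n → Bool) → (∀ i j → P i ≡ true → P j ≡ true → i ≡ j) → ∑ℕ (indicator ∘ P) ℕ.≤ 1
  ∑-indicator-≤1 {zero}  P h = z≤n
  ∑-indicator-≤1 {suc n} P h with P zero in eq
  ... | false = ∑-indicator-≤1 (P ∘ suc) (λ i j p r → Finₚ.suc-injective (h _ _ p r))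
  ... | true  = s≤s (ℕₚ.≤-reflexive (zeros (P ∘ suc) (λ i → rest i)))
    where
    zeros : ∀ {n} (Q : Fin n → Bool) → (∀ i → Q i ≡ false) → ∑ℕ (indicator ∘ Q) ≡ 0
    zeros {zero}  Q h = ≡.refl
    zeros {suc n} Q h = ≡.cong₂ (λ b m → indicator b ℕ.+ m) (h zero) (zeros (Q ∘ suc) (h ∘ suc))
    rest : ∀ i → P (suc i) ≡ false
    rest i with P (suc i) in eq′
    ... | false = ≡.refl
    ... | true  = ⊥-elim (Finₚ.0≢1+n (h zero (suc i) eq eq′))

  ∑-indicator-≥1 : ∀ {n} (P : Fin n → Bool) i → P i ≡ true → 1 ℕ.≤ ∑ℕ (indicator ∘ P)
  ∑-indicator-≥1 P zero    h = ≡.subst (λ b → 1 ℕ.≤ indicator b ℕ.+ ∑ℕ (indicator ∘ P ∘ suc)) (≡.sym h) (s≤s z≤n)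
  ∑-indicator-≥1 P (suc i) h = ℕₚ.≤-trans (∑-indicator-≥1 (P ∘ suc) i h) (ℕₚ.m≤n+m _ (indicator (P zero)))

∑-count-≤ : ∀ {m n} (B : Fin m → Fin n → Bool) → (∀ j i i′ → B i j ≡ true → B i′ j ≡ true → i ≡ i′) → ∑ℕ (λ i → count (B i)) ℕ.≤ n
∑-count-≤ {m} {zero}  B h = ℕₚ.≤-reflexive (≡.trans (∑ℕ-const m 0) (ℕₚ.*-zeroʳ m))
∑-count-≤ {m} {suc n} B h = ℕₚ.≤-trans (ℕₚ.≤-reflexive (∑ℕ-distrib-+ (λ i → indicator (B i zero)) (λ i → count (B i ∘ suc))))
  (ℕₚ.+-mono-≤ (∑-indicator-≤1 (λ i → B i zero) (h zero)) (∑-count-≤ (λ i → B i ∘ suc) (h ∘ suc)))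

∑-count-≥ : ∀ {m n} (B : Fin m → Fin n → Bool) → (∀ j → ∃ λ i → B i j ≡ true) → n ℕ.≤ ∑ℕ (λ i → count (B i))
∑-count-≥ {m} {zero}  B h = z≤n
∑-count-≥ {m} {suc n} B h = ℕₚ.≤-trans
  (ℕₚ.+-mono-≤ (∑-indicator-≥1 (λ i → B i zero) (proj₁ (h zero)) (proj₂ (h zero))) (∑-count-≥ (λ i → B i ∘ suc) (h ∘ suc)))
  (ℕₚ.≤-reflexive (≡.sym (∑ℕ-distrib-+ (λ i → indicator (B i zero)) (λ i → count (B i ∘ suc)))))

isYes-true : ∀ {A : Set} (d : Dec A) → A → isYes d ≡ true
isYes-true (yes _) _ = ≡.refl
isYes-true (no ¬a) a = ⊥-elim (¬a a)

true-isYes : ∀ {A : Set} (d : Dec A) → isYes d ≡ true → A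
true-isYes (yes a) _ = a

fibre : ∀ {m n} → (Fin m → Fin n) → Fin n → Fin m → Bool
fibre f y x = isYes (f x ≟ y)

fibre-sum : ∀ {m n} (f : Fin m → Fin n) → m ℕ.≤ ∑ℕ (λ y → count (fibre f y))
fibre-sum f = ∑-count-≥ (fibre f) (λ x → f x , isYes-true (f x ≟ f x) ≡.refl)

fibres-≤ : ∀ {m n} d (f : Fin m → Fin n) → (∀ y → count (fibre f y) ℕ.≤ d) → m ℕ.≤ n ℕ.* d
fibres-≤ {m} {n} d f h = ℕₚ.≤-trans (fibre-sum f) (ℕₚ.≤-trans (∑ℕ-mono (λ y → count (fibre f y)) (λ _ → d) h) (ℕₚ.≤-reflexive (∑ℕ-const n d)))

square-cancel-≤ : ∀ {a b} → a ℕ.* a ℕ.≤ b ℕ.* b → a ℕ.≤ b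
square-cancel-≤ {a} {b} h with a ℕₚ.≤? b
... | yes a≤b = a≤b
... | no  a≰b = ⊥-elim (ℕₚ.<⇒≱ (ℕₚ.*-mono-< (ℕₚ.≰⇒> a≰b) (ℕₚ.≰⇒> a≰b)) h)

4uv≤[u+v]² : ∀ u v → 4 ℕ.* (u ℕ.* v) ℕ.≤ (u ℕ.+ v) ℕ.* (u ℕ.+ v)
4uv≤[u+v]² u v with ℕₚ.≤-total u v
... | inj₁ u≤v = ≡.subst (λ v → 4 ℕ.* (u ℕ.* v) ℕ.≤ (u ℕ.+ v) ℕ.* (u ℕ.+ v)) (ℕₚ.m+[n∸m]≡n u≤v)
  (≡.subst (4 ℕ.* (u ℕ.* (u ℕ.+ (v ∸ u))) ℕ.≤_) (expand u (v ∸ u)) (ℕₚ.m≤m+n _ ((v ∸ u) ℕ.* (v ∸ u))))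
  where
  expand : ∀ u w → 4 ℕ.* (u ℕ.* (u ℕ.+ w)) ℕ.+ w ℕ.* w ≡ (u ℕ.+ (u ℕ.+ w)) ℕ.* (u ℕ.+ (u ℕ.+ w))
  expand = solve-∀
... | inj₂ v≤u = ≡.subst (λ u → 4 ℕ.* (u ℕ.* v) ℕ.≤ (u ℕ.+ v) ℕ.* (u ℕ.+ v)) (ℕₚ.m+[n∸m]≡n v≤u)
  (≡.subst (4 ℕ.* ((v ℕ.+ (u ∸ v)) ℕ.* v) ℕ.≤_) (expand v (u ∸ v)) (ℕₚ.m≤m+n _ ((u ∸ v) ℕ.* (u ∸ v))))
  where
  expand : ∀ v w → 4 ℕ.* ((v ℕ.+ w) ℕ.* v) ℕ.+ w ℕ.* w ≡ (v ℕ.+ w ℕ.+ v) ℕ.* (v ℕ.+ w ℕ.+ v)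
  expand = solve-∀

-- A version of Cauchy-Schwarz without square roots, by induction: the cross term 2 x₀ x₁ is bounded
-- after squaring, by the inequality of arithmetic and geometric means for r₀ s₁ and r₁ s₀.
cauchy-schwarz : ∀ {m} τ (x r s : Fin m → ℕ) → (∀ i → x i ℕ.* x i ℕ.≤ τ ℕ.* (r i ℕ.* s i)) →
  ∑ℕ x ℕ.* ∑ℕ x ℕ.≤ τ ℕ.* (∑ℕ r ℕ.* ∑ℕ s)
cauchy-schwarz {zero}  τ x r s h = z≤n
cauchy-schwarz {suc m} τ x r s h = begin
  (x₀ ℕ.+ x₁) ℕ.* (x₀ ℕ.+ x₁)                                                       ≡⟨ square x₀ x₁ ⟩
  x₀ ℕ.* x₀ ℕ.+ 2 ℕ.* (x₀ ℕ.* x₁) ℕ.+ x₁ ℕ.* x₁                                     ≤⟨ ℕₚ.+-mono-≤ (ℕₚ.+-mono-≤ (h zero) cross) ih ⟩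
  τ ℕ.* (r₀ ℕ.* s₀) ℕ.+ τ ℕ.* (r₀ ℕ.* s₁ ℕ.+ r₁ ℕ.* s₀) ℕ.+ τ ℕ.* (r₁ ℕ.* s₁)       ≡⟨ product τ r₀ s₀ r₁ s₁ ⟩
  τ ℕ.* ((r₀ ℕ.+ r₁) ℕ.* (s₀ ℕ.+ s₁))                                               ∎
  where
  open ℕₚ.≤-Reasoning
  x₀ = x zero
  r₀ = r zero
  s₀ = s zero
  x₁ = ∑ℕ (x ∘ suc)
  r₁ = ∑ℕ (r ∘ suc)
  s₁ = ∑ℕ (s ∘ suc)
  ih = cauchy-schwarz τ (x ∘ suc) (r ∘ suc) (s ∘ suc) (h ∘ suc)
  square : ∀ a b → (a ℕ.+ b) ℕ.* (a ℕ.+ b) ≡ a ℕ.* a ℕ.+ 2 ℕ.* (a ℕ.* b) ℕ.+ b ℕ.* b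
  square = solve-∀
  product : ∀ τ r s r′ s′ → τ ℕ.* (r ℕ.* s) ℕ.+ τ ℕ.* (r ℕ.* s′ ℕ.+ r′ ℕ.* s) ℕ.+ τ ℕ.* (r′ ℕ.* s′) ≡ τ ℕ.* ((r ℕ.+ r′) ℕ.* (s ℕ.+ s′))
  product = solve-∀
  regroup₁ : ∀ a b → 2 ℕ.* (a ℕ.* b) ℕ.* (2 ℕ.* (a ℕ.* b)) ≡ 4 ℕ.* ((a ℕ.* a) ℕ.* (b ℕ.* b))
  regroup₁ = solve-∀
  regroup₂ : ∀ τ r s r′ s′ → 4 ℕ.* ((τ ℕ.* (r ℕ.* s)) ℕ.* (τ ℕ.* (r′ ℕ.* s′))) ≡ τ ℕ.* τ ℕ.* (4 ℕ.* ((r ℕ.* s′) ℕ.* (r′ ℕ.* s)))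
  regroup₂ = solve-∀
  regroup₃ : ∀ τ w → τ ℕ.* τ ℕ.* (w ℕ.* w) ≡ (τ ℕ.* w) ℕ.* (τ ℕ.* w)
  regroup₃ = solve-∀
  cross : 2 ℕ.* (x₀ ℕ.* x₁) ℕ.≤ τ ℕ.* (r₀ ℕ.* s₁ ℕ.+ r₁ ℕ.* s₀)
  cross = square-cancel-≤ (begin
    2 ℕ.* (x₀ ℕ.* x₁) ℕ.* (2 ℕ.* (x₀ ℕ.* x₁))                                       ≡⟨ regroup₁ x₀ x₁ ⟩
    4 ℕ.* ((x₀ ℕ.* x₀) ℕ.* (x₁ ℕ.* x₁))                                             ≤⟨ ℕₚ.*-monoʳ-≤ 4 (ℕₚ.*-mono-≤ (h zero) ih) ⟩
    4 ℕ.* ((τ ℕ.* (r₀ ℕ.* s₀)) ℕ.* (τ ℕ.* (r₁ ℕ.* s₁)))                             ≡⟨ regroup₂ τ r₀ s₀ r₁ s₁ ⟩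
    τ ℕ.* τ ℕ.* (4 ℕ.* ((r₀ ℕ.* s₁) ℕ.* (r₁ ℕ.* s₀)))                               ≤⟨ ℕₚ.*-monoʳ-≤ (τ ℕ.* τ) (4uv≤[u+v]² (r₀ ℕ.* s₁) (r₁ ℕ.* s₀)) ⟩
    τ ℕ.* τ ℕ.* ((r₀ ℕ.* s₁ ℕ.+ r₁ ℕ.* s₀) ℕ.* (r₀ ℕ.* s₁ ℕ.+ r₁ ℕ.* s₀))           ≡⟨ regroup₃ τ _ ⟩
    τ ℕ.* (r₀ ℕ.* s₁ ℕ.+ r₁ ℕ.* s₀) ℕ.* (τ ℕ.* (r₀ ℕ.* s₁ ℕ.+ r₁ ℕ.* s₀))           ∎)

injective⇒≤ : ∀ {m n} (f : Fin m → Fin n) → (∀ i j → f i ≡ f j → i ≡ j) → m ℕ.≤ n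
injective⇒≤ f inj = Finₚ.injective⇒≤ {f = f} (λ {i} {j} → inj i j)

-- Slice by the value of z. A slice injects through P into τ₁ elements, and also into pairs of
-- values of R and Q over that slice, which determine x and y. Multiplying the two estimates gives
-- the hypothesis of `cauchy-schwarz`.
loomis-whitney : ∀ {σ α β γ τ₁ τ₂ τ₃} (x : Fin σ → Fin α) (y : Fin σ → Fin β) (z : Fin σ → Fin γ) →
  (∀ t t′ → x t ≡ x t′ → y t ≡ y t′ → z t ≡ z t′ → t ≡ t′) →
  (P : Fin σ → Fin τ₁) → (∀ t t′ → P t ≡ P t′ → x t ≡ x t′ × y t ≡ y t′) →
  (Q : Fin σ → Fin τ₂) → (∀ t t′ → Q t ≡ Q t′ → y t ≡ y t′ × z t ≡ z t′) →
  (R : Fin σ → Fin τ₃) → (∀ t t′ → R t ≡ R t′ → x t ≡ x t′ × z t ≡ z t′) →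
  σ ℕ.* σ ℕ.≤ τ₁ ℕ.* (τ₃ ℕ.* τ₂)
loomis-whitney {σ} {γ = γ} {τ₁} {τ₂} {τ₃} x y z joint P P-inj Q Q-inj R R-inj = begin
  σ ℕ.* σ                                         ≤⟨ ℕₚ.*-mono-≤ (fibre-sum z) (fibre-sum z) ⟩
  ∑ℕ size ℕ.* ∑ℕ size                             ≤⟨ cauchy-schwarz τ₁ size r s size² ⟩
  τ₁ ℕ.* (∑ℕ r ℕ.* ∑ℕ s)                          ≤⟨ ℕₚ.*-monoʳ-≤ τ₁ (ℕₚ.*-mono-≤ (projected R (λ t t′ e → proj₂ (R-inj t t′ e))) (projected Q (λ t t′ e → proj₂ (Q-inj t t′ e)))) ⟩
  τ₁ ℕ.* (τ₃ ℕ.* τ₂)                              ∎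
  where
  open ℕₚ.≤-Reasoning
  size : Fin γ → ℕ
  size l = count (fibre z l)
  above? : ∀ {τ} (R : Fin σ → Fin τ) l ρ → Dec (∃ λ t → z t ≡ l × R t ≡ ρ)
  above? R l ρ = any? (λ t → (z t ≟ l) ×-dec (R t ≟ ρ))
  above : ∀ {τ} (R : Fin σ → Fin τ) → Fin γ → Fin τ → Bool
  above R l ρ = isYes (above? R l ρ)
  r s : Fin γ → ℕ
  r l = count (above R l)
  s l = count (above Q l)
  projected : ∀ {τ} (R : Fin σ → Fin τ) → (∀ t t′ → R t ≡ R t′ → z t ≡ z t′) → ∑ℕ (λ l → count (above R l)) ℕ.≤ τ
  projected R inj = ∑-count-≤ (above R) (λ ρ l l′ h h′ → unique l l′ (true-isYes (above? R l ρ) h) (true-isYes (above? R l′ ρ) h′))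
    where
    unique : ∀ {ρ} l l′ → (∃ λ t → z t ≡ l × R t ≡ ρ) → (∃ λ t → z t ≡ l′ × R t ≡ ρ) → l ≡ l′
    unique l l′ (t , zt , Rt) (t′ , zt′ , Rt′) = ≡.trans (≡.sym zt) (≡.trans (inj t t′ (≡.trans Rt (≡.sym Rt′))) zt′)
  module Fibre (l : Fin γ) where
    t : Fin (size l) → Fin σ
    t = member (fibre z l)
    zt : ∀ i → z (t i) ≡ l
    zt i = true-isYes (z (t i) ≟ l) (member-true (fibre z l) i)
    same : ∀ i j → x (t i) ≡ x (t j) → y (t i) ≡ y (t j) → i ≡ j
    same i j ex ey = member-injective (fibre z l) i j (joint _ _ ex ey (≡.trans (zt i) (≡.sym (zt j))))
    size≤τ₁ : size l ℕ.≤ τ₁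
    size≤τ₁ = injective⇒≤ (P ∘ t) (λ i j e → same i j (proj₁ (P-inj _ _ e)) (proj₂ (P-inj _ _ e)))
    index : ∀ {τ} (R : Fin σ → Fin τ) → Fin (size l) → Fin (count (above R l))
    index R i = proj₁ (member-onto (above R l) (R (t i)) (isYes-true (above? R l (R (t i))) (t i , zt i , ≡.refl)))
    index-injective : ∀ {τ} (R : Fin σ → Fin τ) i j → index R i ≡ index R j → R (t i) ≡ R (t j)
    index-injective R i j e = ≡.trans (≡.sym (proj₂ (member-onto (above R l) (R (t i)) _))) (≡.trans (≡.cong (member (above R l)) e) (proj₂ (member-onto (above R l) (R (t j)) _)))
    size≤rs : size l ℕ.≤ r l ℕ.* s l
    size≤rs = injective⇒≤ (λ i → combine (index R i) (index Q i)) (λ i j e →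
      let (eR , eQ) = Finₚ.combine-injective (index R i) (index Q i) (index R j) (index Q j) e
      in same i j (proj₁ (R-inj _ _ (index-injective R i j eR))) (proj₁ (Q-inj _ _ (index-injective Q i j eQ))))
  size² : ∀ l → size l ℕ.* size l ℕ.≤ τ₁ ℕ.* (r l ℕ.* s l)
  size² l = ℕₚ.*-mono-≤ (Fibre.size≤τ₁ l) (Fibre.size≤rs l)

least : ∀ {n} {P : Fin n → Set} → (∀ i → Dec (P i)) → ∃ P → ∃ λ i → P i × (∀ j → j Fin.< i → ¬ P j)
least {suc n} P? (i , Pi) with P? zero
... | yes P₀ = zero , P₀ , λ j ()
... | no ¬P₀ with i | Pi
...   | zero  | P₀ = ⊥-elim (¬P₀ P₀)
...   | suc i | Pi′ with least (P? ∘ suc) (i , Pi′)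
...     | m , Pm , below = suc m , Pm , λ { zero _ → ¬P₀ ; (suc j) (s≤s j<m) → below j j<m }

-- Sumsets

module Sets {q : ℕ} (F : FinField q) where
  open FieldTheory F

  Subset : Set
  Subset = 𝔽 → Bool

  infix 4 _∈_
  _∈_ : 𝔽 → Subset → Set
  x ∈ A = A x ≡ true

  _∈?_ : ∀ x A → Dec (x ∈ A)
  x ∈? A = A x Boolₚ.≟ true

  infixl 6 _⊞_
  _⊞_ : Subset → Subset → Subset
  (A ⊞ B) x = isYes (any? λ a → any? λ b → (a ∈? A) ×-dec ((b ∈? B) ×-dec ((a + b) ≟ x)))

  ⊞-intro : ∀ {A B a b} → a ∈ A → b ∈ B → (a + b) ∈ (A ⊞ B)
  ⊞-intro {a = a} {b} a∈A b∈B = isYes-true _ (a , b , a∈A , b∈B , ≡.refl)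

  ⊞-elim : ∀ {A B x} → x ∈ (A ⊞ B) → ∃₂ λ a b → a ∈ A × b ∈ B × a + b ≡ x
  ⊞-elim x∈ = true-isYes _ x∈

  index : ∀ A x → x ∈ A → Fin (count A)
  index A x x∈A = proj₁ (member-onto A x x∈A)

  index-injective : ∀ A x y {x∈A y∈A} → index A x x∈A ≡ index A y y∈A → x ≡ y
  index-injective A x y {x∈A} {y∈A} e = ≡.trans (≡.sym (proj₂ (member-onto A x x∈A)))
    (≡.trans (≡.cong (member A) e) (proj₂ (member-onto A y y∈A)))

  count-covered : ∀ S A B → (∀ x → x ∈ S → ∃₂ λ a b → a ∈ A × b ∈ B × a + b ≡ x) → count S ℕ.≤ count A ℕ.* count B
  count-covered S A B cover = injective⇒≤ f inj
    where
    c : ∀ i → _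
    c i = cover (member S i) (member-true S i)
    f : Fin (count S) → Fin (count A ℕ.* count B)
    f i = let (a , b , a∈ , b∈ , _) = c i in Fin.combine (index A a a∈) (index B b b∈)
    inj : ∀ i j → f i ≡ f j → i ≡ j
    inj i j e = let (a , b , a∈ , b∈ , eq) = c i
                    (a′ , b′ , a′∈ , b′∈ , eq′) = c j
                    (ea , eb) = Finₚ.combine-injective (index A a a∈) (index B b b∈) (index A a′ a′∈) (index B b′ b′∈) e
      in member-injective S i j (≡.trans (≡.sym eq) (≡.trans (≡.cong₂ _+_ (index-injective A a a′ ea) (index-injective B b b′ eb)) eq′))

  -- Each x ∈ S is represented by its lexicographically least a + b + c; by minimality any two of
  -- a , b , c are then determined by their sum.
  ruzsa : ∀ S A B C → (∀ x → x ∈ S → ∃ λ a → ∃₂ λ b c → a ∈ A × b ∈ B × c ∈ C × a + b + c ≡ x) →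
    count S ℕ.* count S ℕ.≤ count (A ⊞ B) ℕ.* (count (A ⊞ C) ℕ.* count (B ⊞ C))
  ruzsa S A B C cover = loomis-whitney a b c joint
      (λ t → index (A ⊞ B) (a t + b t) (⊞-intro (a∈ t) (b∈ t))) (λ t t′ e → ab t t′ (index-injective (A ⊞ B) _ _ e))
      (λ t → index (B ⊞ C) (b t + c t) (⊞-intro (b∈ t) (c∈ t))) (λ t t′ e → bc t t′ (index-injective (B ⊞ C) _ _ e))
      (λ t → index (A ⊞ C) (a t + c t) (⊞-intro (a∈ t) (c∈ t))) (λ t t′ e → ac t t′ (index-injective (A ⊞ C) _ _ e))
    where
    Rep : 𝔽 → 𝔽 → 𝔽 → 𝔽 → Set
    Rep x a b c = a ∈ A × b ∈ B × c ∈ C × a + b + c ≡ x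
    rep? : ∀ x a b c → Dec (Rep x a b c)
    rep? x a b c = (a ∈? A) ×-dec ((b ∈? B) ×-dec ((c ∈? C) ×-dec ((a + b + c) ≟ x)))
    First : 𝔽 → 𝔽 → Set
    First x a = ∃₂ λ b c → Rep x a b c
    Second : 𝔽 → 𝔽 → 𝔽 → Set
    Second x a b = ∃ λ c → Rep x a b c
    σ = count S
    s : Fin σ → 𝔽
    s = member S
    first : ∀ t → ∃ λ a → First (s t) a × (∀ j → j Fin.< a → ¬ First (s t) j)
    first t = least (λ a → any? λ b → any? λ c → rep? (s t) a b c) (cover (s t) (member-true S t))
    a : Fin σ → 𝔽
    a t = proj₁ (first t)
    second : ∀ t → ∃ λ b → Second (s t) (a t) b × (∀ j → j Fin.< b → ¬ Second (s t) (a t) j)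
    second t = least (λ b → any? λ c → rep? (s t) (a t) b c) (proj₁ (proj₂ (first t)))
    b : Fin σ → 𝔽
    b t = proj₁ (second t)
    c : Fin σ → 𝔽
    c t = proj₁ (proj₁ (proj₂ (second t)))
    rep : ∀ t → Rep (s t) (a t) (b t) (c t)
    rep t = proj₂ (proj₁ (proj₂ (second t)))
    a∈ : ∀ t → a t ∈ A
    a∈ t = proj₁ (rep t)
    b∈ : ∀ t → b t ∈ B
    b∈ t = proj₁ (proj₂ (rep t))
    c∈ : ∀ t → c t ∈ C
    c∈ t = proj₁ (proj₂ (proj₂ (rep t)))
    sum≡ : ∀ t → a t + b t + c t ≡ s t
    sum≡ t = proj₂ (proj₂ (proj₂ (rep t)))
    a-least : ∀ t t′ b′ c′ → b′ ∈ B → c′ ∈ C → a t + b′ + c′ ≡ s t′ → ¬ (a t Fin.< a t′)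
    a-least t t′ b′ c′ b′∈ c′∈ eq a<a′ = proj₂ (proj₂ (first t′)) (a t) a<a′ (b′ , c′ , a∈ t , b′∈ , c′∈ , eq)
    antisym : ∀ {x y : 𝔽} → ¬ (x Fin.< y) → ¬ (y Fin.< x) → x ≡ y
    antisym x≮y y≮x = Finₚ.≤-antisym (ℕₚ.≮⇒≥ y≮x) (ℕₚ.≮⇒≥ x≮y)
    joint : ∀ t t′ → a t ≡ a t′ → b t ≡ b t′ → c t ≡ c t′ → t ≡ t′
    joint t t′ ea eb ec = member-injective S t t′ (≡.trans (≡.sym (sum≡ t)) (≡.trans (≡.cong₂ _+_ (≡.cong₂ _+_ ea eb) ec) (sum≡ t′)))
    ab : ∀ t t′ → a t + b t ≡ a t′ + b t′ → a t ≡ a t′ × b t ≡ b t′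
    -- With equal sums a + b the third summands can be exchanged, so each of the two first summands
    -- is admissible for the other element, and minimality makes them equal.
    ab t t′ e = ea , +-cancelˡ (a t) (≡.trans e (≡.cong (_+ b t′) (≡.sym ea)))
      where
      ea = antisym (a-least t t′ (b t) (c t′) (b∈ t) (c∈ t′) (≡.trans (≡.cong (_+ c t′) e) (sum≡ t′)))
                   (a-least t′ t (b t′) (c t) (b∈ t′) (c∈ t) (≡.trans (≡.cong (_+ c t) (≡.sym e)) (sum≡ t)))
    swap : ∀ x y z → x + y + z ≡ x + z + y
    swap x y z = ≡.trans (+-assoc x y z) (≡.trans (≡.cong (x +_) (+-comm y z)) (≡.sym (+-assoc x z y)))
    ac : ∀ t t′ → a t + c t ≡ a t′ + c t′ → a t ≡ a t′ × c t ≡ c t′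
    ac t t′ e = ea , +-cancelˡ (a t) (≡.trans e (≡.cong (_+ c t′) (≡.sym ea)))
      where
      ea = antisym (a-least t t′ (b t′) (c t) (b∈ t′) (c∈ t) (≡.trans (swap _ _ _) (≡.trans (≡.cong (_+ b t′) e) (≡.trans (swap _ _ _) (sum≡ t′)))))
                   (a-least t′ t (b t) (c t′) (b∈ t) (c∈ t′) (≡.trans (swap _ _ _) (≡.trans (≡.cong (_+ b t) (≡.sym e)) (≡.trans (swap _ _ _) (sum≡ t)))))
    b-least : ∀ t t′ c′ → c′ ∈ C → a t′ + b t + c′ ≡ s t′ → ¬ (b t Fin.< b t′)
    b-least t t′ c′ c′∈ eq b<b′ = proj₂ (proj₂ (second t′)) (b t) b<b′ (c′ , a∈ t′ , b∈ t , c′∈ , eq)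
    bc : ∀ t t′ → b t + c t ≡ b t′ + c t′ → b t ≡ b t′ × c t ≡ c t′
    -- Here the pair (b , c) is transplanted while the first summand stays, so the comparison is
    -- between second summands for the same first one.
    bc t t′ e = eb , +-cancelˡ (b t) (≡.trans e (≡.cong (_+ c t′) (≡.sym eb)))
      where
      eb = antisym (b-least t t′ (c t) (c∈ t) (≡.trans (+-assoc _ _ _) (≡.trans (≡.cong (a t′ +_) e) (≡.trans (≡.sym (+-assoc _ _ _)) (sum≡ t′)))))
                   (b-least t′ t (c t′) (c∈ t′) (≡.trans (+-assoc _ _ _) (≡.trans (≡.cong (a t +_) (≡.sym e)) (≡.trans (≡.sym (+-assoc _ _ _)) (sum≡ t)))))

-- Both bounds for sets, and the choice of parameters

module Bounds {q : ℕ} (F : FinField q) {p n : ℕ} (prime : Prime p) (q≡p^n : q ≡ p ℕ.^ n)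
              (d N : ℕ) (1+dN≡q : suc (d ℕ.* N) ≡ q) where
  open FieldTheory F
  open Sets F

  hanson-petridis-set : ∀ X Y → (∀ x y → x ∈ X → y ∈ Y → (y + x) ^ N ≡ 1#) → ∀ m → suc m ℕ.≤ count X →
    ¬ (p ∣ ((N ℕ.+ m) choose N)) → count Y ℕ.* suc m ℕ.≤ N
  hanson-petridis-set X Y unit m m<X p∤ = HansonPetridis.hanson-petridis F {p} {n} prime q≡p^n d N 1+dN≡q
    (λ i → member X (inject≤ i m<X)) (λ i j e → Finₚ.inject≤-injective m<X m<X i j (member-injective X _ _ e))
    (member Y) (member-injective Y)
    (λ i j → unit _ _ (member-true X _) (member-true Y j)) p∤

  -- The binomial coefficient belonging to m itself may vanish modulo p. Passing to m′ with N + m′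
  -- free of carries costs at most the factor u/v, and u ≤ v extends this from m to the m + 1
  -- elements in use. The bound p^K restricts m to the digits under control.
  truncated-hanson-petridis : .{{_ : NonZero p}} → ∀ {u v K} → u ℕ.≤ v →
    (∀ j → j ℕ.< K → u ℕ.* (p ∸ 1) ℕ.≤ v ℕ.* (p ∸ 1 ∸ digit p N j)) →
    ∀ X Y → (∀ x y → x ∈ X → y ∈ Y → (y + x) ^ N ≡ 1#) → ∀ m → m ℕ.≤ count X → m ℕ.≤ p ℕ.^ K →
    u ℕ.* (m ℕ.* count Y) ℕ.≤ v ℕ.* N
  truncated-hanson-petridis {u} {v} u≤v good X Y unit zero _ _ = ≡.subst (ℕ._≤ v ℕ.* N) (≡.sym (ℕₚ.*-zeroʳ u)) z≤n
  truncated-hanson-petridis {u} {v} {K} u≤v good X Y unit (suc m) m<X m<p^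
    with Carries.truncate-digits prime u≤v K N m m<p^ good
  ... | m′ , m′≤m , um≤vm′ , p∤ = begin
    u ℕ.* (suc m ℕ.* count Y)          ≡⟨ ≡.trans (≡.sym (ℕₚ.*-assoc u (suc m) (count Y))) (≡.cong (ℕ._* count Y) (ℕₚ.*-suc u m)) ⟩
    (u ℕ.+ u ℕ.* m) ℕ.* count Y        ≤⟨ ℕₚ.*-monoˡ-≤ (count Y) (ℕₚ.+-mono-≤ u≤v um≤vm′) ⟩
    (v ℕ.+ v ℕ.* m′) ℕ.* count Y       ≡⟨ ≡.trans (≡.cong (ℕ._* count Y) (≡.sym (ℕₚ.*-suc v m′))) (≡.trans (ℕₚ.*-assoc v (suc m′) (count Y)) (≡.cong (v ℕ.*_) (ℕₚ.*-comm (suc m′) (count Y)))) ⟩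
    v ℕ.* (count Y ℕ.* suc m′)         ≤⟨ ℕₚ.*-monoʳ-≤ v (hanson-petridis-set X Y unit m′ (ℕₚ.≤-trans (s≤s m′≤m) m<X) p∤) ⟩
    v ℕ.* N                            ∎
    where open ℕₚ.≤-Reasoning

  -- the choice of L, about q/T
  parameters : ∀ T .{{_ : NonZero T}} k M R₁ → 9 ℕ.* M ℕ.≤ 8 ℕ.* (T ℕ.* R₁) → M ℕ.* M ℕ.* k ℕ.+ T ℕ.* k ℕ.< q →
    T ℕ.* (8 ℕ.* R₁ ℕ.+ 16 ℕ.+ k) ℕ.≤ q →
    ∃ λ L → T ℕ.* (L ℕ.+ k) ℕ.< q × M ℕ.* suc (suc R₁ ℕ.+ suc L ℕ.+ M ℕ.* k) ℕ.< T ℕ.* (suc R₁ ℕ.* suc L) × L ℕ.≤ q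
  parameters T k M R₁ c₁ c₂ c₃ = L , below , conditions , L≤q
    where
    open ℕₚ.≤-Reasoning
    Q₁ = (q ∸ 1) / T
    -- As large as T (L + k) < q permits.
    L = Q₁ ∸ k
    1+[q-1]≡q : suc (q ∸ 1) ≡ q
    1+[q-1]≡q = ℕₚ.suc-pred q {{ℕ.>-nonZero (ℕₚ.<⇒≤ 1<q)}}
    TQ₁<q : T ℕ.* Q₁ ℕ.< q
    TQ₁<q = ℕₚ.≤-trans (s≤s (≡.subst (ℕ._≤ q ∸ 1) (ℕₚ.*-comm Q₁ T) (m/n*n≤m (q ∸ 1) T))) (ℕₚ.≤-reflexive 1+[q-1]≡q)
    q≤T[1+Q₁] : q ℕ.≤ T ℕ.* suc Q₁
    q≤T[1+Q₁] = begin
      q                                            ≡⟨ 1+[q-1]≡q ⟨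
      suc (q ∸ 1)                                  ≡⟨ ≡.cong suc (m≡m%n+[m/n]*n (q ∸ 1) T) ⟩
      suc ((q ∸ 1) % T) ℕ.+ Q₁ ℕ.* T               ≤⟨ ℕₚ.+-monoˡ-≤ (Q₁ ℕ.* T) (m%n<n (q ∸ 1) T) ⟩
      T ℕ.+ Q₁ ℕ.* T                               ≡⟨ ℕₚ.*-comm (suc Q₁) T ⟩
      T ℕ.* suc Q₁                                 ∎
    k≤Q₁ : k ℕ.≤ Q₁
    k≤Q₁ = ℕₚ.≤-pred (ℕₚ.*-cancelˡ-≤ T (begin
      T ℕ.* suc k                                  ≤⟨ ℕₚ.*-monoʳ-≤ T (ℕₚ.+-monoˡ-≤ k (ℕₚ.≤-trans (s≤s z≤n) (ℕₚ.m≤n+m 16 (8 ℕ.* R₁)))) ⟩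
      T ℕ.* (8 ℕ.* R₁ ℕ.+ 16 ℕ.+ k)                ≤⟨ ℕₚ.≤-trans c₃ q≤T[1+Q₁] ⟩
      T ℕ.* suc Q₁                                 ∎))
    L+k≡Q₁ : L ℕ.+ k ≡ Q₁
    L+k≡Q₁ = ℕₚ.m∸n+n≡m k≤Q₁
    below : T ℕ.* (L ℕ.+ k) ℕ.< q
    below = ≡.subst (λ x → T ℕ.* x ℕ.< q) (≡.sym L+k≡Q₁) TQ₁<q
    L≤q : L ℕ.≤ q
    L≤q = ℕₚ.≤-trans (ℕₚ.m∸n≤m Q₁ k) (ℕₚ.≤-trans (ℕₚ.m≤n*m Q₁ T) (ℕₚ.<⇒≤ TQ₁<q))
    Λ = suc L
    q≤TΛ+Tk : q ℕ.≤ T ℕ.* Λ ℕ.+ T ℕ.* k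
    q≤TΛ+Tk = ℕₚ.≤-trans q≤T[1+Q₁] (ℕₚ.≤-reflexive (≡.trans (≡.cong (λ x → T ℕ.* suc x) (≡.sym L+k≡Q₁)) (ℕₚ.*-distribˡ-+ T Λ k)))
    MMk<TΛ : M ℕ.* M ℕ.* k ℕ.< T ℕ.* Λ
    MMk<TΛ = ℕₚ.+-cancelʳ-< (T ℕ.* k) _ _ (ℕₚ.<-≤-trans c₂ q≤TΛ+Tk)
    8[R+1]≤Λ : 8 ℕ.* (R₁ ℕ.+ 2) ℕ.≤ Λ
    8[R+1]≤Λ = ℕₚ.*-cancelˡ-≤ T (ℕₚ.+-cancelʳ-≤ (T ℕ.* k) _ _ (begin
      T ℕ.* (8 ℕ.* (R₁ ℕ.+ 2)) ℕ.+ T ℕ.* k         ≡⟨ arith T R₁ k ⟩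
      T ℕ.* (8 ℕ.* R₁ ℕ.+ 16 ℕ.+ k)                ≤⟨ ℕₚ.≤-trans c₃ q≤TΛ+Tk ⟩
      T ℕ.* Λ ℕ.+ T ℕ.* k                          ∎))
      where
      arith : ∀ T R k → T ℕ.* (8 ℕ.* (R ℕ.+ 2)) ℕ.+ T ℕ.* k ≡ T ℕ.* (8 ℕ.* R ℕ.+ 16 ℕ.+ k)
      arith = solve-∀
    conditions : M ℕ.* suc (suc R₁ ℕ.+ Λ ℕ.+ M ℕ.* k) ℕ.< T ℕ.* (suc R₁ ℕ.* Λ)
    -- With Λ = L + 1, the terms of lower order in R₁ take an eighth of M Λ, whence the ratio 9/8 in
    -- the hypothesis, and M² k takes the term T Λ by which R₁ + 1 exceeds R₁.
    conditions = ℕₚ.*-cancelˡ-< 8 _ _ (begin-strict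
      8 ℕ.* (M ℕ.* suc (suc R₁ ℕ.+ Λ ℕ.+ M ℕ.* k))                             ≡⟨ arith₁ M R₁ Λ k ⟩
      8 ℕ.* (M ℕ.* Λ) ℕ.+ M ℕ.* (8 ℕ.* (R₁ ℕ.+ 2)) ℕ.+ 8 ℕ.* (M ℕ.* M ℕ.* k)
        <⟨ ℕₚ.+-mono-≤-< (ℕₚ.+-monoʳ-≤ (8 ℕ.* (M ℕ.* Λ)) (ℕₚ.*-monoʳ-≤ M 8[R+1]≤Λ)) (ℕₚ.*-monoʳ-< 8 MMk<TΛ) ⟩
      8 ℕ.* (M ℕ.* Λ) ℕ.+ M ℕ.* Λ ℕ.+ 8 ℕ.* (T ℕ.* Λ)                          ≡⟨ arith₂ M Λ T ⟩
      9 ℕ.* M ℕ.* Λ ℕ.+ 8 ℕ.* (T ℕ.* Λ)                                        ≤⟨ ℕₚ.+-monoˡ-≤ (8 ℕ.* (T ℕ.* Λ)) (ℕₚ.*-monoˡ-≤ Λ c₁) ⟩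
      8 ℕ.* (T ℕ.* R₁) ℕ.* Λ ℕ.+ 8 ℕ.* (T ℕ.* Λ)                               ≡⟨ arith₃ T R₁ Λ ⟩
      8 ℕ.* (T ℕ.* (suc R₁ ℕ.* Λ))                                             ∎)
      where
      arith₁ : ∀ M R Λ k → 8 ℕ.* (M ℕ.* suc (suc R ℕ.+ Λ ℕ.+ M ℕ.* k)) ≡ 8 ℕ.* (M ℕ.* Λ) ℕ.+ M ℕ.* (8 ℕ.* (R ℕ.+ 2)) ℕ.+ 8 ℕ.* (M ℕ.* M ℕ.* k)
      arith₁ = solve-∀
      arith₂ : ∀ M Λ T → 8 ℕ.* (M ℕ.* Λ) ℕ.+ M ℕ.* Λ ℕ.+ 8 ℕ.* (T ℕ.* Λ) ≡ 9 ℕ.* M ℕ.* Λ ℕ.+ 8 ℕ.* (T ℕ.* Λ)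
      arith₂ = solve-∀
      arith₃ : ∀ T R Λ → 8 ℕ.* (T ℕ.* R) ℕ.* Λ ℕ.+ 8 ℕ.* (T ℕ.* Λ) ≡ 8 ℕ.* (T ℕ.* (suc R ℕ.* Λ))
      arith₃ = solve-∀

  dN≤q : d ℕ.* N ℕ.≤ q
  dN≤q = ≡.subst (d ℕ.* N ℕ.≤_) 1+dN≡q (ℕₚ.n≤1+n _)

  -- With a point b₀ of D as origin, b + aᵢ divided by b₀ + aᵢ becomes 1 + eᵢ x, and its N-th power
  -- is 1 as soon as the N-th power of b + aᵢ is constant on D. The common value may differ from 1,
  -- which the sign patterns of the quadratic case exploit.
  shifts-bound : .{{_ : NonZero d}} → ∀ k .{{_ : NonZero k}} (a : Fin k → 𝔽) → (∀ i j → a i ≡ a j → i ≡ j) → ∀ D →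
    (∀ b i → b ∈ D → b + a i ≢ 0#) → (∀ b b′ i → b ∈ D → b′ ∈ D → (b + a i) ^ N ≡ (b′ + a i) ^ N) →
    ∀ M R₁ → 9 ℕ.* M ℕ.≤ 8 ℕ.* (d ℕ.^ k ℕ.* R₁) → M ℕ.* M ℕ.* k ℕ.+ d ℕ.^ k ℕ.* k ℕ.< q →
    d ℕ.^ k ℕ.* (8 ℕ.* R₁ ℕ.+ 16 ℕ.+ k) ℕ.≤ q → count D ℕ.* M ℕ.≤ (R₁ ℕ.+ 2 ℕ.+ k) ℕ.* q
  shifts-bound k a a-inj D nonzero coset M R₁ c₁ c₂ c₃ = main (count D) (member D) (member-injective D) (member-true D)
    where
    T = d ℕ.^ k
    main : ∀ s (b : Fin s → 𝔽) → (∀ i j → b i ≡ b j → i ≡ j) → (∀ i → b i ∈ D) → s ℕ.* M ℕ.≤ (R₁ ℕ.+ 2 ℕ.+ k) ℕ.* q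
    main zero    b b-inj b∈ = z≤n
    main (suc s) b b-inj b∈ = conclude (parameters T {{ℕₚ.m^n≢0 d k}} k M R₁ c₁ c₂ c₃)
      where
      arith : ∀ R k q → suc R ℕ.* q ℕ.+ (q ℕ.+ k ℕ.* q) ≡ (R ℕ.+ 2 ℕ.+ k) ℕ.* q
      arith = solve-∀
      M≤q : M ℕ.≤ q
      M≤q = ℕₚ.≤-trans (ℕₚ.≤-trans (square M) (ℕₚ.m≤m*n (M ℕ.* M) k)) (ℕₚ.≤-trans (ℕₚ.m≤m+n _ _) (ℕₚ.<⇒≤ c₂))
        where
        square : ∀ M → M ℕ.≤ M ℕ.* M
        square zero    = z≤n
        square (suc M) = ℕₚ.m≤m*n (suc M) (suc M)
      b₀ = b zero
      c≢0 : ∀ i → b₀ + a i ≢ 0#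
      c≢0 i = nonzero b₀ i (b∈ zero)
      e : Fin k → 𝔽
      e i = proj₁ (inverse (b₀ + a i) (c≢0 i))
      c*e : ∀ i → (b₀ + a i) * e i ≡ 1#
      c*e i = proj₂ (inverse (b₀ + a i) (c≢0 i))
      e≢0 : ∀ i → e i ≢ 0#
      e≢0 i z = 1≢0 (≡.trans (≡.sym (c*e i)) (≡.trans (≡.cong ((b₀ + a i) *_) z) (zeroʳ _)))
      e-inj : ∀ i j → e i ≡ e j → i ≡ j
      e-inj i j eq = a-inj i j (+-cancelˡ b₀ (*-cancelˡ (e i) (e≢0 i) (≡.trans (*-comm _ _) (≡.trans (c*e i)
        (≡.trans (≡.sym (c*e j)) (≡.trans (*-comm _ _) (≡.cong (_* (b₀ + a j)) (≡.sym eq))))))))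
      pts : Fin (suc s) → 𝔽
      pts t = - b₀ + b t
      pts-inj : ∀ i j → pts i ≡ pts j → i ≡ j
      pts-inj i j eq = b-inj i j (+-cancelˡ (- b₀) eq)
      unit : ∀ t i → (1# + pts t * e i) ^ N ≡ 1#
      unit t i = begin
        (1# + pts t * e i) ^ N                              ≡⟨ ≡.cong (_^ N) value ⟩
        ((b t + a i) * e i) ^ N                             ≡⟨ ^-distrib-* (b t + a i) (e i) N ⟩
        (b t + a i) ^ N * e i ^ N                           ≡⟨ ≡.cong (_* e i ^ N) (coset (b t) b₀ i (b∈ t) (b∈ zero)) ⟩
        (b₀ + a i) ^ N * e i ^ N                            ≡⟨ ^-distrib-* (b₀ + a i) (e i) N ⟨
        ((b₀ + a i) * e i) ^ N                              ≡⟨ ≡.cong (_^ N) (c*e i) ⟩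
        1# ^ N                                              ≡⟨ 1^n≡1 N ⟩
        1#                                                  ∎
        where
        open ≡.≡-Reasoning
        value : 1# + pts t * e i ≡ (b t + a i) * e i
        value = begin
          1# + pts t * e i                                  ≡⟨ ≡.cong (_+ pts t * e i) (c*e i) ⟨
          (b₀ + a i) * e i + (- b₀ + b t) * e i             ≡⟨ distribʳ (e i) (b₀ + a i) (- b₀ + b t) ⟨
          ((b₀ + a i) + (- b₀ + b t)) * e i                 ≡⟨ ≡.cong (_* e i) (begin
            (b₀ + a i) + (- b₀ + b t)                         ≡⟨ ≡.cong (_+ (- b₀ + b t)) (+-comm b₀ (a i)) ⟩
            (a i + b₀) + (- b₀ + b t)                         ≡⟨ +-assoc (a i) b₀ _ ⟩
            a i + (b₀ + (- b₀ + b t))                         ≡⟨ ≡.cong (a i +_) (≡.trans (≡.sym (+-assoc b₀ (- b₀) (b t))) (≡.trans (≡.cong (_+ b t) (-‿inverseʳ b₀)) (+-identityˡ (b t)))) ⟩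
            a i + b t                                         ≡⟨ +-comm (a i) (b t) ⟩
            b t + a i                                         ∎) ⟩
          (b t + a i) * e i                                 ∎
      conclude : (∃ λ L → T ℕ.* (L ℕ.+ k) ℕ.< q × M ℕ.* suc (suc R₁ ℕ.+ suc L ℕ.+ M ℕ.* k) ℕ.< T ℕ.* (suc R₁ ℕ.* suc L) × L ℕ.≤ q) →
        suc s ℕ.* M ℕ.≤ (R₁ ℕ.+ 2 ℕ.+ k) ℕ.* q
      conclude (L , small , conditions , L≤q) = ℕₚ.≤-trans
        (Stepanov.stepanov F {p} {n} prime q≡p^n d N 1+dN≡q k e e-inj e≢0 pts pts-inj unit M (suc R₁) L small conditions M≤q)
        (ℕₚ.≤-trans (ℕₚ.+-monoʳ-≤ (suc R₁ ℕ.* q) (ℕₚ.+-mono-≤ L≤q (ℕₚ.*-monoʳ-≤ k dN≤q))) (ℕₚ.≤-reflexive (arith R₁ k q)))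

-- Lower bounds for the summands

≤-by-computation : ∀ m n → {True (m ℕ.≤? n)} → m ℕ.≤ n
≤-by-computation m n {t} = toWitness t

count-∪ : ∀ {n} (S P Q : Fin n → Bool) → (∀ x → S x ≡ true → P x ≡ true ⊎ Q x ≡ true) → count S ℕ.≤ count P ℕ.+ count Q
count-∪ {zero}  S P Q h = z≤n
count-∪ {suc n} S P Q h with S zero | P zero | Q zero | h zero | count-∪ (S ∘ suc) (P ∘ suc) (Q ∘ suc) (h ∘ suc)
... | false | P₀    | Q₀    | _  | ih = ℕₚ.≤-trans ih (ℕₚ.+-mono-≤ (ℕₚ.m≤n+m (count (P ∘ suc)) (if P₀ then 1 else 0)) (ℕₚ.m≤n+m (count (Q ∘ suc)) (if Q₀ then 1 else 0)))
... | true  | true  | Q₀    | _  | ih = s≤s (ℕₚ.≤-trans ih (ℕₚ.+-monoʳ-≤ (count (P ∘ suc)) (ℕₚ.m≤n+m (count (Q ∘ suc)) (if Q₀ then 1 else 0))))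
... | true  | false | true  | _  | ih = ℕₚ.≤-trans (s≤s ih) (ℕₚ.≤-reflexive (≡.sym (ℕₚ.+-suc (count (P ∘ suc)) (count (Q ∘ suc)))))
... | true  | false | false | h₀ | ih with h₀ ≡.refl
...   | inj₁ ()
...   | inj₂ ()

count-singleton : ∀ {n} (x : Fin n) → count (λ y → isYes (y ≟ x)) ℕ.≤ 1
count-singleton x = injective⇒≤ {n = 1} (λ _ → zero) (λ i j _ → member-injective P i j
  (≡.trans (true-isYes (_ ≟ x) (member-true P i)) (≡.sym (true-isYes (_ ≟ x) (member-true P j)))))
  where P = λ y → isYes (y ≟ x)

-- An exponent j requires j + 1 distinct shifts from a set of α elements, hence j ≤ α - 1, and d^j
-- must exceed α by a fixed factor. The factor 4/3 is attained at α = 3, d = 2; at α = d = 2 there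
-- is no gain, as d^(α-1) = α.
exponent-exists : ∀ α d → 2 ℕ.≤ α → 2 ℕ.≤ d → (4 ℕ.* α ℕ.≤ 3 ℕ.* d ℕ.^ (α ∸ 1)) ⊎ (α ≡ 2 × d ≡ 2)
exponent-exists (suc zero) _ (s≤s ()) _
exponent-exists (suc (suc zero)) (suc zero) _ (s≤s ())
exponent-exists (suc (suc zero)) (suc (suc zero)) _ _ = inj₂ (≡.refl , ≡.refl)
exponent-exists (suc (suc zero)) (suc (suc (suc d))) _ _ = inj₁ (ℕₚ.≤-trans (≤-by-computation 8 9)
  (ℕₚ.*-monoʳ-≤ 3 (ℕₚ.≤-trans (s≤s (s≤s (s≤s z≤n))) (ℕₚ.≤-reflexive (≡.sym (ℕₚ.*-identityʳ (3 ℕ.+ d)))))))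
exponent-exists (suc (suc (suc α))) d _ 2≤d = inj₁ (ℕₚ.≤-trans (go α) (ℕₚ.*-monoʳ-≤ 3 (ℕₚ.^-monoˡ-≤ (suc (suc α)) 2≤d)))
  where
  go : ∀ α → 4 ℕ.* (3 ℕ.+ α) ℕ.≤ 3 ℕ.* 2 ℕ.^ (2 ℕ.+ α)
  go zero    = ℕₚ.≤-refl
  go (suc α) = ℕₚ.≤-trans (ℕₚ.≤-trans (ℕₚ.m≤m+n _ (4 ℕ.* (2 ℕ.+ α))) (ℕₚ.≤-reflexive (arith α)))
    (ℕₚ.≤-trans (ℕₚ.*-monoʳ-≤ 2 (go α)) (ℕₚ.≤-reflexive (arith′ (2 ℕ.^ (2 ℕ.+ α)))))
    where
    arith : ∀ α → 4 ℕ.* (3 ℕ.+ suc α) ℕ.+ 4 ℕ.* (2 ℕ.+ α) ≡ 2 ℕ.* (4 ℕ.* (3 ℕ.+ α))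
    arith = solve-∀
    arith′ : ∀ x → 2 ℕ.* (3 ℕ.* x) ≡ 3 ℕ.* (2 ℕ.* x)
    arith′ = solve-∀

-- Large literals stand on the right of a product: multiplication unfolds its left argument.
κ : ℕ → ℕ
κ g = g ℕ.* g ℕ.* 512

-- The side conditions of `shifts-bound` for M = 32 g z and R₁ = 27 g, where z = α d, under the
-- negation `small` of the lower bound to be proved.
module Arithmetic {q d g z : ℕ} (1≤g : 1 ℕ.≤ g) (dd≤q : d ℕ.* d ℕ.≤ q) (small : z ℕ.* κ g ℕ.* (z ℕ.* κ g) ℕ.< q) where
  open ℕₚ.≤-Reasoning

  g≤gg : g ℕ.≤ g ℕ.* g
  g≤gg = ≡.subst (ℕ._≤ g ℕ.* g) (ℕₚ.*-identityʳ g) (ℕₚ.*-monoʳ-≤ g 1≤g)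

  zdκ≤q : z ℕ.* d ℕ.* κ g ℕ.≤ q
  zdκ≤q = square-cancel-≤ (begin
    z ℕ.* d ℕ.* κ g ℕ.* (z ℕ.* d ℕ.* κ g)            ≡⟨ arith z d (κ g) ⟩
    z ℕ.* κ g ℕ.* (z ℕ.* κ g) ℕ.* (d ℕ.* d)          ≤⟨ ℕₚ.*-mono-≤ (ℕₚ.<⇒≤ small) dd≤q ⟩
    q ℕ.* q                                          ∎)
    where
    arith : ∀ z d κ → z ℕ.* d ℕ.* κ ℕ.* (z ℕ.* d ℕ.* κ) ≡ z ℕ.* κ ℕ.* (z ℕ.* κ) ℕ.* (d ℕ.* d)
    arith = solve-∀

  module _ {T k : ℕ} (3T≤4zd : 3 ℕ.* T ℕ.≤ 4 ℕ.* (z ℕ.* d)) (k≤g : k ℕ.≤ g) where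

    -- 384 is three quarters of the 512 in κ; the remaining quarter pays for the factor 4/3 in the
    -- bound for T.
    3Tc≤3q : ∀ c → c ℕ.≤ 384 → 3 ℕ.* (T ℕ.* (g ℕ.* c)) ℕ.≤ 3 ℕ.* q
    3Tc≤3q c c≤ = begin
      3 ℕ.* (T ℕ.* (g ℕ.* c))                        ≡⟨ ℕₚ.*-assoc 3 T (g ℕ.* c) ⟨
      3 ℕ.* T ℕ.* (g ℕ.* c)                          ≤⟨ ℕₚ.*-mono-≤ 3T≤4zd (ℕₚ.*-mono-≤ g≤gg c≤) ⟩
      4 ℕ.* (z ℕ.* d) ℕ.* (g ℕ.* g ℕ.* 384)          ≡⟨ arith₂ 4 384 (z ℕ.* d) (g ℕ.* g) ⟩
      z ℕ.* d ℕ.* (g ℕ.* g) ℕ.* 1536                 ≡⟨ arith₃ 3 512 (z ℕ.* d) (g ℕ.* g) ⟨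
      3 ℕ.* (z ℕ.* d ℕ.* (g ℕ.* g ℕ.* 512))          ≤⟨ ℕₚ.*-monoʳ-≤ 3 zdκ≤q ⟩
      3 ℕ.* q                                        ∎
      where
      arith₂ : ∀ a c y x → a ℕ.* y ℕ.* (x ℕ.* c) ≡ y ℕ.* x ℕ.* (a ℕ.* c)
      arith₂ = solve-∀
      arith₃ : ∀ a c y x → a ℕ.* (y ℕ.* (x ℕ.* c)) ≡ y ℕ.* x ℕ.* (a ℕ.* c)
      arith₃ = solve-∀

    T[8R+16+k]≤q : T ℕ.* (8 ℕ.* (g ℕ.* 27) ℕ.+ 16 ℕ.+ k) ℕ.≤ q
    T[8R+16+k]≤q = ℕₚ.≤-trans (ℕₚ.*-monoʳ-≤ T (begin
      8 ℕ.* (g ℕ.* 27) ℕ.+ 16 ℕ.+ k                  ≤⟨ ℕₚ.+-mono-≤ (ℕₚ.+-monoʳ-≤ (8 ℕ.* (g ℕ.* 27)) (ℕₚ.*-monoˡ-≤ 16 1≤g)) k≤g ⟩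
      8 ℕ.* (g ℕ.* 27) ℕ.+ g ℕ.* 16 ℕ.+ g            ≡⟨ arith 8 27 16 g ⟩
      g ℕ.* 233                                      ∎)) (ℕₚ.*-cancelˡ-≤ 3 (3Tc≤3q 233 (≤-by-computation 233 384)))
      where
      arith : ∀ a b c g → a ℕ.* (g ℕ.* b) ℕ.+ g ℕ.* c ℕ.+ g ≡ g ℕ.* (a ℕ.* b ℕ.+ c ℕ.+ 1)
      arith = solve-∀

    MMk+Tk<q : g ℕ.* z ℕ.* 32 ℕ.* (g ℕ.* z ℕ.* 32) ℕ.* k ℕ.+ T ℕ.* k ℕ.< q
    MMk+Tk<q = ℕₚ.*-cancelˡ-< 2 _ _ (begin-strict
      2 ℕ.* (g ℕ.* z ℕ.* 32 ℕ.* (g ℕ.* z ℕ.* 32) ℕ.* k ℕ.+ T ℕ.* k)          ≡⟨ arith₁ 32 g z k T ⟩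
      g ℕ.* g ℕ.* k ℕ.* (z ℕ.* z) ℕ.* 2048 ℕ.+ T ℕ.* (k ℕ.* 2)
        <⟨ ℕₚ.+-mono-<-≤ (ℕₚ.≤-<-trans MM small) (ℕₚ.≤-trans (ℕₚ.*-monoʳ-≤ T (ℕₚ.*-monoˡ-≤ 2 k≤g)) (ℕₚ.*-cancelˡ-≤ 3 (3Tc≤3q 2 (≤-by-computation 2 384)))) ⟩
      q ℕ.+ q                                                                  ≡⟨ ≡.cong (q ℕ.+_) (ℕₚ.+-identityʳ q) ⟨
      2 ℕ.* q                                                                  ∎)
      where
      arith₁ : ∀ c g z k T → 2 ℕ.* (g ℕ.* z ℕ.* c ℕ.* (g ℕ.* z ℕ.* c) ℕ.* k ℕ.+ T ℕ.* k) ≡ g ℕ.* g ℕ.* k ℕ.* (z ℕ.* z) ℕ.* (2 ℕ.* (c ℕ.* c)) ℕ.+ T ℕ.* (k ℕ.* 2)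
      arith₁ = solve-∀
      arith₂ : ∀ c G z → G ℕ.* G ℕ.* (z ℕ.* z) ℕ.* (c ℕ.* c) ≡ z ℕ.* (G ℕ.* c) ℕ.* (z ℕ.* (G ℕ.* c))
      arith₂ = solve-∀
      MM : g ℕ.* g ℕ.* k ℕ.* (z ℕ.* z) ℕ.* 2048 ℕ.≤ z ℕ.* κ g ℕ.* (z ℕ.* κ g)
      MM = begin
        g ℕ.* g ℕ.* k ℕ.* (z ℕ.* z) ℕ.* 2048                   ≤⟨ ℕₚ.*-monoʳ-≤ (g ℕ.* g ℕ.* k ℕ.* (z ℕ.* z)) (≤-by-computation 2048 262144) ⟩
        g ℕ.* g ℕ.* k ℕ.* (z ℕ.* z) ℕ.* 262144                 ≤⟨ ℕₚ.*-monoˡ-≤ 262144 (ℕₚ.*-monoˡ-≤ (z ℕ.* z) (ℕₚ.*-monoʳ-≤ (g ℕ.* g) (ℕₚ.≤-trans k≤g g≤gg))) ⟩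
        g ℕ.* g ℕ.* (g ℕ.* g) ℕ.* (z ℕ.* z) ℕ.* 262144         ≡⟨ arith₂ 512 (g ℕ.* g) z ⟩
        z ℕ.* κ g ℕ.* (z ℕ.* κ g)                              ∎

module LowerBound {q : ℕ} (F : FinField q) {p n : ℕ} (prime : Prime p) (q≡p^n : q ≡ p ℕ.^ n)
                  (d N : ℕ) .{{d≢0 : NonZero d}} (1+dN≡q : suc (d ℕ.* N) ≡ q) (2≤d : 2 ℕ.≤ d) (dd≤q : d ℕ.* d ℕ.≤ q)
                  (l : ℕ) (log : ∀ k → 2 ℕ.^ k ℕ.< 8 ℕ.* q → k ℕ.≤ l) where
  open FieldTheory F
  open Sets F
  open Bounds F {p} {n} prime q≡p^n d N 1+dN≡q

  private
    -- For k ≤ l this gives 2 + k ≤ g, so the coefficient 27 g + 2 + k is at most 28 g.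
    g = l ℕ.+ 4

    1≤g : 1 ℕ.≤ g
    1≤g = ℕₚ.≤-trans (≤-by-computation 1 4) (ℕₚ.m≤n+m 4 l)

  N≢0 : N ≢ 0
  N≢0 N≡0 = ℕₚ.<⇒≢ 1<q (≡.trans (≡.sym (≡.cong suc (≡.trans (≡.cong (d ℕ.*_) N≡0) (ℕₚ.*-zeroʳ d)))) 1+dN≡q)

  0^N≡0 : 0# ^ N ≡ 0#
  0^N≡0 = go N N≢0
    where
    go : ∀ N → N ≢ 0 → 0# ^ N ≡ 0#
    go zero    h = ⊥-elim (h ≡.refl)
    go (suc N) _ = zeroˡ _

  ^N≢0⇒≢0 : ∀ {x ζ} → ζ ≢ 0# → x ^ N ≡ ζ → x ≢ 0#
  ^N≢0⇒≢0 ζ≢0 eq x≡0 = ζ≢0 (≡.trans (≡.sym eq) (≡.trans (≡.cong (_^ N) x≡0) 0^N≡0))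

  1≤αd : ∀ {α} → 2 ℕ.≤ α → 1 ℕ.≤ α ℕ.* d
  1≤αd {α} 2≤α = ℕₚ.*-mono-≤ {1} {α} {1} {d} (ℕₚ.<⇒≤ 2≤α) (ℕₚ.<⇒≤ 2≤d)

  module _ (X Y S : Subset) (2≤X : 2 ℕ.≤ count X) (N≤S : N ℕ.≤ count S)
           (cover : ∀ s → s ∈ S → ∃₂ λ x y → x ∈ X × y ∈ Y × x + y ≡ s)
           (unit : ∀ x y → x ∈ X → y ∈ Y → (y + x) ^ N ≡ 1#) where
    private
      α = count X
      z = α ℕ.* d

    N≤αY : N ℕ.≤ α ℕ.* count Y
    N≤αY = ℕₚ.≤-trans N≤S (count-covered S X Y cover)

    -- The exponent j = i + 1 is taken minimal. Then T = d^(j+1) is large enough for the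
    -- intersection bound to fall below N/α, whereas failure at i keeps T below 4 α d² / 3.
    module Generic (small : z ℕ.* κ g ℕ.* (z ℕ.* κ g) ℕ.< q) (j : Fin α) (4α≤ : 4 ℕ.* α ℕ.≤ 3 ℕ.* d ℕ.^ toℕ j)
                   (i : ℕ) (j≡1+i : toℕ j ≡ suc i) (<4α : 3 ℕ.* d ℕ.^ i ℕ.< 4 ℕ.* α) where
      open Arithmetic {q} {d} {g} {z} 1≤g dd≤q small
      open ℕₚ.≤-Reasoning

      k : ℕ
      k = suc (suc i)

      k≤α : k ℕ.≤ α
      k≤α = ≡.subst (λ m → suc m ℕ.≤ α) j≡1+i (Finₚ.toℕ<n j)

      α≤q : α ℕ.≤ q
      α≤q = injective⇒≤ (member X) (member-injective X)

      k≤l : k ℕ.≤ l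
      k≤l = log k (ℕₚ.*-cancelˡ-< 3 _ _ (begin-strict
        3 ℕ.* 2 ℕ.^ k                   ≡⟨ arith (2 ℕ.^ i) ⟩
        4 ℕ.* (3 ℕ.* 2 ℕ.^ i)           ≤⟨ ℕₚ.*-monoʳ-≤ 4 (ℕₚ.*-monoʳ-≤ 3 (ℕₚ.^-monoˡ-≤ i 2≤d)) ⟩
        4 ℕ.* (3 ℕ.* d ℕ.^ i)           <⟨ ℕₚ.*-monoʳ-< 4 <4α ⟩
        4 ℕ.* (4 ℕ.* α)                 ≤⟨ ℕₚ.*-monoʳ-≤ 4 (ℕₚ.*-monoʳ-≤ 4 α≤q) ⟩
        4 ℕ.* (4 ℕ.* q)                 ≤⟨ ℕₚ.≤-trans (ℕₚ.m≤m+n _ (8 ℕ.* q)) (ℕₚ.≤-reflexive (arith′ q)) ⟩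
        3 ℕ.* (8 ℕ.* q)                 ∎))
        where
        arith : ∀ x → 3 ℕ.* (2 ℕ.* (2 ℕ.* x)) ≡ 4 ℕ.* (3 ℕ.* x)
        arith = solve-∀
        arith′ : ∀ q → 4 ℕ.* (4 ℕ.* q) ℕ.+ 8 ℕ.* q ≡ 3 ℕ.* (8 ℕ.* q)
        arith′ = solve-∀

      k≤g : k ℕ.≤ g
      k≤g = ℕₚ.≤-trans k≤l (ℕₚ.m≤m+n l 4)

      3T≤4zd : 3 ℕ.* d ℕ.^ k ℕ.≤ 4 ℕ.* (z ℕ.* d)
      3T≤4zd = begin
        3 ℕ.* (d ℕ.* (d ℕ.* d ℕ.^ i))   ≡⟨ arith d (d ℕ.^ i) ⟩
        3 ℕ.* d ℕ.^ i ℕ.* (d ℕ.* d)     ≤⟨ ℕₚ.*-monoˡ-≤ (d ℕ.* d) (ℕₚ.<⇒≤ <4α) ⟩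
        4 ℕ.* α ℕ.* (d ℕ.* d)           ≡⟨ arith′ α d ⟩
        4 ℕ.* (α ℕ.* d ℕ.* d)           ∎
        where
        arith : ∀ d x → 3 ℕ.* (d ℕ.* (d ℕ.* x)) ≡ 3 ℕ.* x ℕ.* (d ℕ.* d)
        arith = solve-∀
        arith′ : ∀ α d → 4 ℕ.* α ℕ.* (d ℕ.* d) ≡ 4 ℕ.* (α ℕ.* d ℕ.* d)
        arith′ = solve-∀

      -- Then 9 M = 72 g d (4 α), and 4 α ≤ 3 d^j turns this into 8 T (27 g). The bound |Y| ≤ 28 g q
      -- / M is smaller than q/(α d) by the factor 28/32, and this margin gives the contradiction.
      M = g ℕ.* z ℕ.* 32

      9M≤8TR : 9 ℕ.* M ℕ.≤ 8 ℕ.* (d ℕ.^ k ℕ.* (g ℕ.* 27))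
      9M≤8TR = begin
        9 ℕ.* (g ℕ.* (α ℕ.* d) ℕ.* 32)                       ≡⟨ arith 8 g α d ⟩
        g ℕ.* d ℕ.* (4 ℕ.* α) ℕ.* 72                         ≤⟨ ℕₚ.*-monoˡ-≤ 72 (ℕₚ.*-monoʳ-≤ (g ℕ.* d) 4α≤) ⟩
        g ℕ.* d ℕ.* (3 ℕ.* d ℕ.^ toℕ j) ℕ.* 72               ≡⟨ ≡.cong (λ m → g ℕ.* d ℕ.* (3 ℕ.* d ℕ.^ m) ℕ.* 72) j≡1+i ⟩
        g ℕ.* d ℕ.* (3 ℕ.* d ℕ.^ suc i) ℕ.* 72               ≡⟨ arith′ 8 g d (d ℕ.^ suc i) ⟩
        8 ℕ.* (d ℕ.* d ℕ.^ suc i ℕ.* (g ℕ.* 27))             ∎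
        where
        arith : ∀ c g α d → 9 ℕ.* (g ℕ.* (α ℕ.* d) ℕ.* (4 ℕ.* c)) ≡ g ℕ.* d ℕ.* (4 ℕ.* α) ℕ.* (9 ℕ.* c)
        arith = solve-∀
        arith′ : ∀ c g d x → g ℕ.* d ℕ.* (3 ℕ.* x) ℕ.* (9 ℕ.* c) ≡ c ℕ.* (d ℕ.* x ℕ.* (g ℕ.* 27))
        arith′ = solve-∀

      bound : count Y ℕ.* M ℕ.≤ (g ℕ.* 27 ℕ.+ 2 ℕ.+ k) ℕ.* q
      bound = shifts-bound k (λ t → member X (inject≤ t k≤α)) (λ s t e → Finₚ.inject≤-injective k≤α k≤α s t (member-injective X _ _ e))
        Y (λ y t y∈Y → ^N≢0⇒≢0 1≢0 (unit _ y (member-true X _) y∈Y))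
        (λ y y′ t y∈Y y′∈Y → ≡.trans (unit _ y (member-true X _) y∈Y) (≡.sym (unit _ y′ (member-true X _) y′∈Y)))
        M (g ℕ.* 27) 9M≤8TR (MMk+Tk<q {d ℕ.^ k} {k} 3T≤4zd k≤g) (T[8R+16+k]≤q {d ℕ.^ k} {k} 3T≤4zd k≤g)

      -- N ≤ α |Y| multiplied by M = 32 g α d, where d N = q - 1; the last summand makes up for the
      -- 1.
      32gq≤ : g ℕ.* q ℕ.* 32 ℕ.≤ g ℕ.* 28 ℕ.* q ℕ.+ g ℕ.* 32
      32gq≤ = ℕₚ.*-cancelˡ-≤ α {{ℕ.>-nonZero (ℕₚ.<⇒≤ 2≤X)}} (begin
        α ℕ.* (g ℕ.* q ℕ.* 32)                                          ≡⟨ ≡.cong (λ q → α ℕ.* (g ℕ.* q ℕ.* 32)) 1+dN≡q ⟨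
        α ℕ.* (g ℕ.* suc (d ℕ.* N) ℕ.* 32)                              ≡⟨ arith₁ 32 α g d N ⟩
        N ℕ.* (g ℕ.* (α ℕ.* d) ℕ.* 32) ℕ.+ α ℕ.* (g ℕ.* 32)             ≤⟨ ℕₚ.+-monoˡ-≤ (α ℕ.* (g ℕ.* 32)) (ℕₚ.*-monoˡ-≤ M N≤αY) ⟩
        α ℕ.* count Y ℕ.* M ℕ.+ α ℕ.* (g ℕ.* 32)                        ≡⟨ ≡.cong (ℕ._+ α ℕ.* (g ℕ.* 32)) (ℕₚ.*-assoc α (count Y) M) ⟩
        α ℕ.* (count Y ℕ.* M) ℕ.+ α ℕ.* (g ℕ.* 32)                      ≤⟨ ℕₚ.+-monoˡ-≤ (α ℕ.* (g ℕ.* 32)) (ℕₚ.*-monoʳ-≤ α (ℕₚ.≤-trans bound (ℕₚ.*-monoˡ-≤ q coefficient))) ⟩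
        α ℕ.* (g ℕ.* 28 ℕ.* q) ℕ.+ α ℕ.* (g ℕ.* 32)                     ≡⟨ ℕₚ.*-distribˡ-+ α (g ℕ.* 28 ℕ.* q) (g ℕ.* 32) ⟨
        α ℕ.* (g ℕ.* 28 ℕ.* q ℕ.+ g ℕ.* 32)                             ∎)
        where
        arith₁ : ∀ c α g d N → α ℕ.* (g ℕ.* suc (d ℕ.* N) ℕ.* c) ≡ N ℕ.* (g ℕ.* (α ℕ.* d) ℕ.* c) ℕ.+ α ℕ.* (g ℕ.* c)
        arith₁ = solve-∀
        arith₃ : ∀ l c → (l ℕ.+ 4) ℕ.* c ℕ.+ 2 ℕ.+ l ℕ.+ 2 ≡ (l ℕ.+ 4) ℕ.* suc c
        arith₃ = solve-∀
        coefficient : g ℕ.* 27 ℕ.+ 2 ℕ.+ k ℕ.≤ g ℕ.* 28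
        coefficient = ℕₚ.≤-trans (ℕₚ.+-monoʳ-≤ (g ℕ.* 27 ℕ.+ 2) k≤l) (ℕₚ.≤-trans (ℕₚ.m≤m+n _ 2) (ℕₚ.≤-reflexive (arith₃ l 27)))

      q≤8 : q ℕ.≤ 8
      q≤8 = ℕₚ.*-cancelˡ-≤ (g ℕ.* 4) {{ℕₚ.m*n≢0 g 4 {{ℕ.>-nonZero 1≤g}} {{_}}}} (ℕₚ.+-cancelˡ-≤ (g ℕ.* 28 ℕ.* q) _ _ (begin
        g ℕ.* 28 ℕ.* q ℕ.+ g ℕ.* 4 ℕ.* q          ≡⟨ arith 28 4 g q ⟩
        g ℕ.* q ℕ.* 32                            ≤⟨ 32gq≤ ⟩
        g ℕ.* 28 ℕ.* q ℕ.+ g ℕ.* 32               ≡⟨ ≡.cong (g ℕ.* 28 ℕ.* q ℕ.+_) (≡.sym (ℕₚ.*-assoc g 4 8)) ⟩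
        g ℕ.* 28 ℕ.* q ℕ.+ g ℕ.* 4 ℕ.* 8          ∎))
        where
        arith : ∀ a b g q → g ℕ.* a ℕ.* q ℕ.+ g ℕ.* b ℕ.* q ≡ g ℕ.* q ℕ.* (a ℕ.+ b)
        arith = solve-∀

    512≤κ : 512 ℕ.≤ κ g
    512≤κ = ℕₚ.*-mono-≤ {1} {g ℕ.* g} {512} {512} (ℕₚ.*-mono-≤ 1≤g 1≤g) ℕₚ.≤-refl

    large : z ℕ.* κ g ℕ.* (z ℕ.* κ g) ℕ.< q → 262144 ℕ.< q
    large small = ℕₚ.≤-<-trans (ℕₚ.*-mono-≤ {512} {z ℕ.* κ g} {512} {z ℕ.* κ g} 512≤ 512≤) small
      where
      512≤ : 512 ℕ.≤ z ℕ.* κ g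
      512≤ = ℕₚ.*-mono-≤ {1} {z} {512} {κ g} (1≤αd 2≤X) 512≤κ

    -- When |X| = d = 2, say X = {x₀ , x₀ + h}, every s ∈ S has s + h or s − h in the range of the d-th powers;
    -- this excludes one of the four sign patterns, each of which occurs about equally often.
    module Quadratic (small : z ℕ.* κ g ℕ.* (z ℕ.* κ g) ℕ.< q) (α≡2 : α ≡ 2) (d≡2 : d ≡ 2) where
      i₀ i₁ : Fin α
      i₀ = ≡.subst Fin (≡.sym α≡2) zero
      i₁ = ≡.subst Fin (≡.sym α≡2) (suc zero)

      two-indices : ∀ i → i ≡ i₀ ⊎ i ≡ i₁
      two-indices = go α≡2
        where
        go : ∀ {α} (eq : α ≡ 2) (i : Fin α) → i ≡ ≡.subst Fin (≡.sym eq) zero ⊎ i ≡ ≡.subst Fin (≡.sym eq) (suc zero)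
        go ≡.refl zero       = inj₁ ≡.refl
        go ≡.refl (suc zero) = inj₂ ≡.refl

      i₀≢i₁ : i₀ ≢ i₁
      i₀≢i₁ = go α≡2
        where
        go : ∀ {α} (eq : α ≡ 2) → ≡.subst Fin (≡.sym eq) zero ≢ ≡.subst Fin (≡.sym eq) (suc zero)
        go ≡.refl ()

      x₀ x₁ h : 𝔽
      x₀ = member X i₀
      x₁ = member X i₁
      h  = x₁ - x₀

      h≢0 : h ≢ 0#
      h≢0 z = i₀≢i₁ (member-injective X _ _ (≡.sym (x-y≡0⇒x≡y z)))

      x₀+h≡x₁ : x₀ + h ≡ x₁
      x₀+h≡x₁ = ≡.trans (+-comm x₀ h) (≡.trans (+-assoc x₁ (- x₀) x₀) (≡.trans (≡.cong (x₁ +_) (-‿inverseˡ x₀)) (+-identityʳ x₁)))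

      x₁-h≡x₀ : x₁ - h ≡ x₀
      x₁-h≡x₀ = ≡.trans (≡.cong (_- h) (≡.sym x₀+h≡x₁)) (≡.trans (+-assoc x₀ h (- h)) (≡.trans (≡.cong (x₀ +_) (-‿inverseʳ h)) (+-identityʳ x₀)))

      neighbour : ∀ s → s ∈ S → s ^ N ≡ 1# × ((s + h) ^ N ≡ 1# ⊎ (s - h) ^ N ≡ 1#)
      neighbour s s∈S with cover s s∈S
      ... | x , y , x∈X , y∈Y , x+y≡s = ≡.trans (≡.cong (_^ N) (≡.sym y+x≡s)) (unit x y x∈X y∈Y) , which (two-indices (proj₁ (member-onto X x x∈X)))
        where
        y+x≡s : y + x ≡ s
        y+x≡s = ≡.trans (+-comm y x) x+y≡s
        x≡ : member X (proj₁ (member-onto X x x∈X)) ≡ x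
        x≡ = proj₂ (member-onto X x x∈X)
        move : ∀ {w x′} → x + w ≡ x′ → s + w ≡ y + x′
        move {w} e = ≡.trans (≡.cong (_+ w) (≡.sym y+x≡s)) (≡.trans (+-assoc y x w) (≡.cong (y +_) e))
        which : _ → (s + h) ^ N ≡ 1# ⊎ (s - h) ^ N ≡ 1#
        which (inj₁ e) = inj₁ (≡.trans (≡.cong (_^ N) (move (≡.trans (≡.cong (_+ h) (≡.trans (≡.sym x≡) (≡.cong (member X) e))) x₀+h≡x₁))) (unit x₁ y (member-true X i₁) y∈Y))
        which (inj₂ e) = inj₂ (≡.trans (≡.cong (_^ N) (move (≡.trans (≡.cong (_- h) (≡.trans (≡.sym x≡) (≡.cong (member X) e))) x₁-h≡x₀))) (unit x₀ y (member-true X i₀) y∈Y))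

      1+2N≡q : suc (2 ℕ.* N) ≡ q
      1+2N≡q = ≡.subst (λ d → suc (d ℕ.* N) ≡ q) d≡2 1+dN≡q

      -1≢0 : - 1# ≢ 0#
      -1≢0 e = 1≢0 (+-cancelˡ (- 1#) (≡.trans (-‿inverseˡ 1#) (≡.trans (≡.sym e) (≡.sym (+-identityʳ _)))))

      -- As q = 1 + 2N is odd, 2h = 0 would give h = q · h = 0. Hence the shifts 0, h and -h are
      -- distinct.
      h+h≢0 : h + h ≢ 0#
      h+h≢0 e = h≢0 (≡.trans (≡.trans (≡.sym (+-identityʳ h)) (≡.cong (h +_) (≡.sym (even·h N)))) (≡.trans (≡.cong (_· h) 1+2N≡q) (q·x≡0 h)))
        where
        open Mult semiring using (×-assocˡ)
        2·h≡0 : 2 · h ≡ 0#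
        2·h≡0 = ≡.trans (≡.cong (h +_) (+-identityʳ h)) e
        zeros : ∀ m → m · 0# ≡ 0#
        zeros zero    = ≡.refl
        zeros (suc m) = ≡.trans (+-identityˡ _) (zeros m)
        even·h : ∀ m → (2 ℕ.* m) · h ≡ 0#
        even·h m = ≡.trans (≡.cong (_· h) (ℕₚ.*-comm 2 m)) (≡.trans (≡.sym (×-assocˡ h m 2)) (≡.trans (≡.cong (m ·_) 2·h≡0) (zeros m)))

      sign : ∀ {x} → x ≢ 0# → x ^ N ≡ 1# ⊎ x ^ N ≡ - 1#
      sign {x} x≢0 with (x ^ N - 1#) ≟ 0#
      ... | yes e = inj₁ (x-y≡0⇒x≡y e)
      ... | no ne = inj₂ (+-cancelˡ 1# (≡.trans (no-zero-divisors product ne) (≡.sym (-‿inverseʳ 1#))))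
        where
        open ≡.≡-Reasoning
        w = x ^ N
        ww≡1 : w * w ≡ 1#
        ww≡1 = ≡.trans (≡.trans (≡.sym (^-homo-* x N N)) (≡.cong (λ m → x ^ (N ℕ.+ m)) (≡.sym (ℕₚ.+-identityʳ N)))) (x^[q-1]≡1 1+2N≡q x≢0)
        product : (w - 1#) * (1# + w) ≡ 0#
        product = begin
          (w - 1#) * (1# + w)                ≡⟨ distribʳ (1# + w) w (- 1#) ⟩
          w * (1# + w) + - 1# * (1# + w)     ≡⟨ ≡.cong₂ _+_ (distribˡ w 1# w) (RingProps.-1*x≈-x (CommutativeRing.ring ring) (1# + w)) ⟩
          (w * 1# + w * w) + - (1# + w)      ≡⟨ ≡.cong (_+ - (1# + w)) (≡.trans (≡.cong₂ _+_ (*-identityʳ w) ww≡1) (+-comm w 1#)) ⟩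
          (1# + w) + - (1# + w)              ≡⟨ -‿inverseʳ _ ⟩
          0#                                 ∎

      shifts : Fin 3 → 𝔽
      shifts zero             = 0#
      shifts (suc zero)       = h
      shifts (suc (suc zero)) = - h

      -h≢0 : - h ≢ 0#
      -h≢0 e = h≢0 (≡.trans (≡.sym (+-identityʳ h)) (≡.trans (≡.cong (h +_) (≡.sym e)) (-‿inverseʳ h)))

      h≢-h : h ≢ - h
      h≢-h e = h+h≢0 (≡.trans (≡.cong (h +_) e) (-‿inverseʳ h))

      shifts-injective : ∀ i j → shifts i ≡ shifts j → i ≡ j
      shifts-injective zero             zero             e = ≡.refl
      shifts-injective zero             (suc zero)       e = ⊥-elim (h≢0 (≡.sym e))
      shifts-injective zero             (suc (suc zero)) e = ⊥-elim (-h≢0 (≡.sym e))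
      shifts-injective (suc zero)       zero             e = ⊥-elim (h≢0 e)
      shifts-injective (suc zero)       (suc zero)       e = ≡.refl
      shifts-injective (suc zero)       (suc (suc zero)) e = ⊥-elim (h≢-h e)
      shifts-injective (suc (suc zero)) zero             e = ⊥-elim (-h≢0 e)
      shifts-injective (suc (suc zero)) (suc zero)       e = ⊥-elim (h≢-h (≡.sym e))
      shifts-injective (suc (suc zero)) (suc (suc zero)) e = ≡.refl

      pattern? : ∀ ζ ζ′ s → Dec (s ^ N ≡ 1# × (s + h) ^ N ≡ ζ × (s - h) ^ N ≡ ζ′)
      pattern? ζ ζ′ s = (s ^ N ≟ 1#) ×-dec (((s + h) ^ N ≟ ζ) ×-dec ((s - h) ^ N ≟ ζ′))

      Pattern : 𝔽 → 𝔽 → Subset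
      Pattern ζ ζ′ s = isYes (pattern? ζ ζ′ s)

      pattern-bound : ∀ ζ ζ′ → ζ ≢ 0# → ζ′ ≢ 0# → count (Pattern ζ ζ′) ℕ.* 256 ℕ.≤ 41 ℕ.* q
      pattern-bound ζ ζ′ ζ≢0 ζ′≢0 = shifts-bound 3 shifts shifts-injective (Pattern ζ ζ′)
        (λ s i s∈ → ^N≢0⇒≢0 (value≢0 i) (value s i s∈)) (λ s s′ i s∈ s′∈ → ≡.trans (value s i s∈) (≡.sym (value s′ i s′∈)))
        -- 9 · 256 = 8 · 2³ · 36, and 36 + 2 + 3 = 41. Each pattern has at most 41 q/256 members, so
        -- three of them stay below q/2 because 123 < 128.
        256 36
        (≡.subst (λ d → 9 ℕ.* 256 ℕ.≤ 8 ℕ.* (d ℕ.^ 3 ℕ.* 36)) (≡.sym d≡2) (≤-by-computation 2304 2304))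
        (≡.subst (λ d → 256 ℕ.* 256 ℕ.* 3 ℕ.+ d ℕ.^ 3 ℕ.* 3 ℕ.< q) (≡.sym d≡2) (ℕₚ.≤-<-trans (≤-by-computation 196632 262144) (large small)))
        (≡.subst (λ d → d ℕ.^ 3 ℕ.* (8 ℕ.* 36 ℕ.+ 16 ℕ.+ 3) ℕ.≤ q) (≡.sym d≡2) (ℕₚ.≤-trans (≤-by-computation 2456 262144) (ℕₚ.<⇒≤ (large small))))
        where
        values : Fin 3 → 𝔽
        values zero             = 1#
        values (suc zero)       = ζ
        values (suc (suc zero)) = ζ′
        value≢0 : ∀ i → values i ≢ 0#
        value≢0 zero             = 1≢0
        value≢0 (suc zero)       = ζ≢0
        value≢0 (suc (suc zero)) = ζ′≢0
        value : ∀ s i → s ∈ Pattern ζ ζ′ → (s + shifts i) ^ N ≡ values i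
        value s zero             s∈ = ≡.trans (≡.cong (_^ N) (+-identityʳ s)) (proj₁ (true-isYes (pattern? ζ ζ′ s) s∈))
        value s (suc zero)       s∈ = proj₁ (proj₂ (true-isYes (pattern? ζ ζ′ s) s∈))
        value s (suc (suc zero)) s∈ = proj₂ (proj₂ (true-isYes (pattern? ζ ζ′ s) s∈))

      D₁ D₂ D₃ E₁ E₂ : Subset
      D₁ = Pattern 1# 1#
      D₂ = Pattern 1# (- 1#)
      D₃ = Pattern (- 1#) 1#
      -- At s = -h and s = h one of the shifted values is 0 and has no sign; these points are
      -- counted separately.
      E₁ s = isYes (s ≟ (- h))
      E₂ s = isYes (s ≟ h)

      classify : ∀ s → s ∈ S → s ∈ D₁ ⊎ (s ∈ D₂ ⊎ (s ∈ D₃ ⊎ (s ∈ E₁ ⊎ s ∈ E₂)))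
      classify s s∈S with neighbour s s∈S | (s + h) ≟ 0# | (s - h) ≟ 0#
      ... | _ | yes e | _ = inj₂ (inj₂ (inj₂ (inj₁ (isYes-true (s ≟ (- h)) (+-cancelˡ h (≡.trans (+-comm h s) (≡.trans e (≡.sym (-‿inverseʳ h)))))))))
      ... | _ | no _ | yes e = inj₂ (inj₂ (inj₂ (inj₂ (isYes-true (s ≟ h) (x-y≡0⇒x≡y e)))))
      ... | s^N , inj₁ plus | no _ | no ne with sign ne
      ...   | inj₁ minus = inj₁ (isYes-true (pattern? 1# 1# s) (s^N , plus , minus))
      ...   | inj₂ minus = inj₂ (inj₁ (isYes-true (pattern? 1# (- 1#) s) (s^N , plus , minus)))
      classify s s∈S | s^N , inj₂ minus | no ne | no _ with sign ne
      ...   | inj₁ plus = inj₁ (isYes-true (pattern? 1# 1# s) (s^N , plus , minus))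
      ...   | inj₂ plus = inj₂ (inj₂ (inj₁ (isYes-true (pattern? (- 1#) 1# s) (s^N , plus , minus))))

      infixr 5 _∪_
      _∪_ : Subset → Subset → Subset
      (A ∪ B) s = A s ∨ B s

      ∪-intro : ∀ A B s → s ∈ A ⊎ s ∈ B → s ∈ (A ∪ B)
      ∪-intro A B s (inj₁ e) = ≡.cong (_∨ B s) e
      ∪-intro A B s (inj₂ e) = ≡.trans (≡.cong (A s ∨_) e) (Boolₚ.∨-zeroʳ (A s))

      ∪-elim : ∀ A B s → s ∈ (A ∪ B) → s ∈ A ⊎ s ∈ B
      ∪-elim A B s e with A s
      ... | true  = inj₁ ≡.refl
      ... | false = inj₂ e

      count-S : count S ℕ.≤ count D₁ ℕ.+ (count D₂ ℕ.+ (count D₃ ℕ.+ 2))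
      count-S = ℕₚ.≤-trans (count-∪ S D₁ (D₂ ∪ D₃ ∪ E₁ ∪ E₂) (λ s s∈ → map₂ (λ r → ∪-intro D₂ (D₃ ∪ E₁ ∪ E₂) s
          (map₂ (λ r → ∪-intro D₃ (E₁ ∪ E₂) s (map₂ (∪-intro E₁ E₂ s) r)) r)) (classify s s∈)))
        (ℕₚ.+-monoʳ-≤ (count D₁) (ℕₚ.≤-trans (count-∪ (D₂ ∪ D₃ ∪ E₁ ∪ E₂) D₂ (D₃ ∪ E₁ ∪ E₂) (∪-elim D₂ (D₃ ∪ E₁ ∪ E₂)))
        (ℕₚ.+-monoʳ-≤ (count D₂) (ℕₚ.≤-trans (count-∪ (D₃ ∪ E₁ ∪ E₂) D₃ (E₁ ∪ E₂) (∪-elim D₃ (E₁ ∪ E₂)))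
        (ℕₚ.+-monoʳ-≤ (count D₃) (ℕₚ.≤-trans (count-∪ (E₁ ∪ E₂) E₁ E₂ (∪-elim E₁ E₂))
          (ℕₚ.+-mono-≤ (count-singleton (- h)) (count-singleton h))))))))

      N*256≤ : N ℕ.* 256 ℕ.≤ q ℕ.* 123 ℕ.+ 512
      N*256≤ = begin
        N ℕ.* 256                                                                     ≤⟨ ℕₚ.*-monoˡ-≤ 256 (ℕₚ.≤-trans N≤S count-S) ⟩
        (count D₁ ℕ.+ (count D₂ ℕ.+ (count D₃ ℕ.+ 2))) ℕ.* 256                        ≡⟨ arith₁ (count D₁) (count D₂) (count D₃) 256 ⟩
        count D₁ ℕ.* 256 ℕ.+ (count D₂ ℕ.* 256 ℕ.+ count D₃ ℕ.* 256) ℕ.+ 512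
          ≤⟨ ℕₚ.+-monoˡ-≤ 512 (ℕₚ.+-mono-≤ (pattern-bound 1# 1# 1≢0 1≢0) (ℕₚ.+-mono-≤ (pattern-bound 1# (- 1#) 1≢0 -1≢0) (pattern-bound (- 1#) 1# -1≢0 1≢0))) ⟩
        41 ℕ.* q ℕ.+ (41 ℕ.* q ℕ.+ 41 ℕ.* q) ℕ.+ 512                                  ≡⟨ ≡.cong (ℕ._+ 512) (arith₂ 41 q) ⟩
        q ℕ.* 123 ℕ.+ 512                                                             ∎
        where
        open ℕₚ.≤-Reasoning
        arith₁ : ∀ a b c m → (a ℕ.+ (b ℕ.+ (c ℕ.+ 2))) ℕ.* m ≡ a ℕ.* m ℕ.+ (b ℕ.* m ℕ.+ c ℕ.* m) ℕ.+ 2 ℕ.* m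
        arith₁ = solve-∀
        arith₂ : ∀ c q → c ℕ.* q ℕ.+ (c ℕ.* q ℕ.+ c ℕ.* q) ≡ q ℕ.* (3 ℕ.* c)
        arith₂ = solve-∀

      q≤128 : q ℕ.≤ 128
      q≤128 = ℕₚ.*-cancelʳ-≤ q 128 5 (ℕₚ.+-cancelˡ-≤ (q ℕ.* 123) _ _ (begin
        q ℕ.* 123 ℕ.+ q ℕ.* 5                ≡⟨ ℕₚ.*-distribˡ-+ q 123 5 ⟨
        q ℕ.* 128                            ≡⟨ ≡.cong (ℕ._* 128) 1+2N≡q ⟨
        suc (2 ℕ.* N) ℕ.* 128                ≡⟨ arith N 128 ⟩
        N ℕ.* 256 ℕ.+ 128                    ≤⟨ ℕₚ.+-monoˡ-≤ 128 N*256≤ ⟩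
        q ℕ.* 123 ℕ.+ 512 ℕ.+ 128            ≡⟨ ℕₚ.+-assoc (q ℕ.* 123) 512 128 ⟩
        q ℕ.* 123 ℕ.+ 640                    ∎))
        where
        open ℕₚ.≤-Reasoning
        arith : ∀ N c → suc (2 ℕ.* N) ℕ.* c ≡ N ℕ.* (2 ℕ.* c) ℕ.+ c
        arith = solve-∀

    -- Failure of the bound would make q exceed 512², whereas it would force q ≤ 8 in the generic
    -- case and q ≤ 128 in the exceptional one.
    lower-bound : q ℕ.≤ z ℕ.* κ g ℕ.* (z ℕ.* κ g)
    lower-bound = ℕₚ.≮⇒≥ contradiction
      where
      contradiction : ¬ (z ℕ.* κ g ℕ.* (z ℕ.* κ g) ℕ.< q)
      contradiction small with exponent-exists α d 2≤X 2≤d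
      ... | inj₂ (α≡2 , d≡2) = ℕₚ.<⇒≱ (large small) (ℕₚ.≤-trans (Quadratic.q≤128 small α≡2 d≡2) (≤-by-computation 128 262144))
      ... | inj₁ 4α≤ = from-least (least {P = λ j → 4 ℕ.* α ℕ.≤ 3 ℕ.* d ℕ.^ toℕ j} (λ j → 4 ℕ.* α ℕₚ.≤? 3 ℕ.* d ℕ.^ toℕ j)
            (fromℕ< α-1<α , ≡.subst (λ m → 4 ℕ.* α ℕ.≤ 3 ℕ.* d ℕ.^ m) (≡.sym (Finₚ.toℕ-fromℕ< α-1<α)) 4α≤))
        where
        α-1<α : α ∸ 1 ℕ.< α
        α-1<α = ℕₚ.≤-reflexive (ℕₚ.suc-pred α {{ℕ.>-nonZero (ℕₚ.<⇒≤ 2≤X)}})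
        from-least : (∃ λ j → 4 ℕ.* α ℕ.≤ 3 ℕ.* d ℕ.^ toℕ j × (∀ i → i Fin.< j → ¬ 4 ℕ.* α ℕ.≤ 3 ℕ.* d ℕ.^ toℕ i)) → ⊥
        from-least (j , 4α≤ , below) = split (toℕ j) ≡.refl
          where
          split : ∀ m → toℕ j ≡ m → ⊥
          split zero    j≡0 = ℕₚ.<⇒≱ (≤-by-computation 4 8) (ℕₚ.≤-trans (ℕₚ.*-monoʳ-≤ 4 2≤X) (≡.subst (λ m → 4 ℕ.* α ℕ.≤ 3 ℕ.* d ℕ.^ m) j≡0 4α≤))
          split (suc i) j≡1+i = ℕₚ.<⇒≱ (large small) (ℕₚ.≤-trans (Generic.q≤8 small j 4α≤ i j≡1+i
              (ℕₚ.≰⇒> (≡.subst (λ m → ¬ 4 ℕ.* α ℕ.≤ 3 ℕ.* d ℕ.^ m) (Finₚ.toℕ-fromℕ< i<α)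
                (below (fromℕ< i<α) (≡.subst₂ ℕ._<_ (≡.sym (Finₚ.toℕ-fromℕ< i<α)) (≡.sym j≡1+i) (ℕₚ.n<1+n i)))))) (≤-by-computation 8 262144))
            where
            i<α : i ℕ.< α
            i<α = ℕₚ.<-trans (≡.subst (i ℕ.<_) (≡.sym j≡1+i) (ℕₚ.n<1+n i)) (Finₚ.toℕ<n j)

-- Comparison of the bounds

^-distribʳ-* : ∀ n x y → (x ℕ.* y) ℕ.^ n ≡ x ℕ.^ n ℕ.* y ℕ.^ n
^-distribʳ-* zero    x y = ≡.refl
^-distribʳ-* (suc n) x y = ≡.trans (≡.cong (x ℕ.* y ℕ.*_) (^-distribʳ-* n x y)) (ℕₚ.[m*n]*[o*p]≡[m*o]*[n*p] x y (x ℕ.^ n) (y ℕ.^ n))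

n<2^n : ∀ n → n ℕ.< 2 ℕ.^ n
n<2^n zero    = s≤s z≤n
n<2^n (suc n) = begin-strict
  suc n                                 ≡⟨ ℕₚ.+-comm 1 n ⟩
  n ℕ.+ 1                               <⟨ ℕₚ.+-mono-<-≤ (n<2^n n) (ℕₚ.≤-trans (s≤s z≤n) (n<2^n n)) ⟩
  2 ℕ.^ n ℕ.+ 2 ℕ.^ n                   ≡⟨ ≡.cong (2 ℕ.^ n ℕ.+_) (ℕₚ.+-identityʳ (2 ℕ.^ n)) ⟨
  2 ℕ.^ suc n                           ∎
  where open ℕₚ.≤-Reasoning

-- For t = ⌊l / 2E⌋ the base l + 4 is at most (2E + 4) 2^t, so the left side is at most W 2^(tE).
-- Since 2tE ≤ l, a second factor 2^(tE) is available to absorb W.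
polynomial<exponential : ∀ E .{{_ : NonZero E}} c → ∃ λ l₀ → ∀ l → l₀ ℕ.≤ l → c ℕ.* (l ℕ.+ 4) ℕ.^ E ℕ.< 2 ℕ.^ l
polynomial<exponential E c = EE ℕ.* W , λ l l₀≤l → go l (l / EE) (W≤ l l₀≤l) (l<  l) (ℕₚ.≤-trans (ℕₚ.≤-reflexive (ℕₚ.*-comm EE (l / EE))) (m/n*n≤m l EE))
  where
  open ℕₚ.≤-Reasoning
  EE = 2 ℕ.* E
  instance
    EE≢0 : NonZero EE
    EE≢0 = ℕₚ.m*n≢0 2 E
  W = c ℕ.* (EE ℕ.+ 4) ℕ.^ E
  W≤ : ∀ l → EE ℕ.* W ℕ.≤ l → W ℕ.≤ l / EE
  W≤ l h = ≡.subst (ℕ._≤ l / EE) (≡.trans (≡.cong (_/ EE) (ℕₚ.*-comm EE W)) (m*n/n≡m W EE)) (/-mono-≤ {o = EE} {p = EE} h ℕₚ.≤-refl)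
  l< : ∀ l → l ℕ.≤ EE ℕ.* suc (l / EE)
  l< l = begin
    l                                   ≡⟨ m≡m%n+[m/n]*n l EE ⟩
    l % EE ℕ.+ l / EE ℕ.* EE            ≤⟨ ℕₚ.+-monoˡ-≤ (l / EE ℕ.* EE) (ℕₚ.<⇒≤ (m%n<n l EE)) ⟩
    EE ℕ.+ l / EE ℕ.* EE                ≡⟨ ℕₚ.*-comm (suc (l / EE)) EE ⟩
    EE ℕ.* suc (l / EE)                 ∎
  go : ∀ l t → W ℕ.≤ t → l ℕ.≤ EE ℕ.* suc t → EE ℕ.* t ℕ.≤ l → c ℕ.* (l ℕ.+ 4) ℕ.^ E ℕ.< 2 ℕ.^ l
  go l t W≤t l≤ ≤l = begin-strict
    c ℕ.* (l ℕ.+ 4) ℕ.^ E                               ≤⟨ ℕₚ.*-monoʳ-≤ c (ℕₚ.^-monoˡ-≤ E (begin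
      l ℕ.+ 4                                              ≤⟨ ℕₚ.+-mono-≤ l≤ (ℕₚ.m≤m*n 4 (suc t)) ⟩
      EE ℕ.* suc t ℕ.+ 4 ℕ.* suc t                         ≡⟨ ℕₚ.*-distribʳ-+ (suc t) EE 4 ⟨
      (EE ℕ.+ 4) ℕ.* suc t                                 ≤⟨ ℕₚ.*-monoʳ-≤ (EE ℕ.+ 4) (n<2^n t) ⟩
      (EE ℕ.+ 4) ℕ.* 2 ℕ.^ t                               ∎)) ⟩
    c ℕ.* ((EE ℕ.+ 4) ℕ.* 2 ℕ.^ t) ℕ.^ E                ≡⟨ ≡.cong (c ℕ.*_) (^-distribʳ-* E (EE ℕ.+ 4) (2 ℕ.^ t)) ⟩
    c ℕ.* ((EE ℕ.+ 4) ℕ.^ E ℕ.* (2 ℕ.^ t) ℕ.^ E)        ≡⟨ ≡.trans (≡.sym (ℕₚ.*-assoc c _ _)) (≡.cong (W ℕ.*_) (ℕₚ.^-*-assoc 2 t E)) ⟩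
    W ℕ.* 2 ℕ.^ (t ℕ.* E)                               <⟨ ℕₚ.*-monoˡ-< (2 ℕ.^ (t ℕ.* E)) {{ℕₚ.m^n≢0 2 (t ℕ.* E)}} (begin-strict
      W                                                    ≤⟨ W≤t ⟩
      t                                                    <⟨ n<2^n t ⟩
      2 ℕ.^ t                                              ≤⟨ ℕₚ.^-monoʳ-≤ 2 (ℕₚ.m≤m*n t E) ⟩
      2 ℕ.^ (t ℕ.* E)                                      ∎) ⟩
    2 ℕ.^ (t ℕ.* E) ℕ.* 2 ℕ.^ (t ℕ.* E)                 ≡⟨ ℕₚ.^-distribˡ-+-* 2 (t ℕ.* E) (t ℕ.* E) ⟨
    2 ℕ.^ (t ℕ.* E ℕ.+ t ℕ.* E)                         ≤⟨ ℕₚ.^-monoʳ-≤ 2 (ℕₚ.≤-trans (ℕₚ.≤-reflexive (arith t E)) ≤l) ⟩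
    2 ℕ.^ l                                             ∎
    where
    arith : ∀ t E → t ℕ.* E ℕ.+ t ℕ.* E ≡ 2 ℕ.* E ℕ.* t
    arith = solve-∀

κ-growth : ∀ e .{{_ : NonZero e}} → ∃ λ l₀ → ∀ l → l₀ ℕ.≤ l → 8 ℕ.* κ (l ℕ.+ 4) ℕ.^ e ℕ.< 2 ℕ.^ l
κ-growth e = growth 8 512
  where
  growth : ∀ k c → ∃ λ l₀ → ∀ l → l₀ ℕ.≤ l → k ℕ.* ((l ℕ.+ 4) ℕ.* (l ℕ.+ 4) ℕ.* c) ℕ.^ e ℕ.< 2 ℕ.^ l
  growth k c with polynomial<exponential (2 ℕ.* e) {{ℕₚ.m*n≢0 2 e}} (k ℕ.* c ℕ.^ e)
  ... | l₀ , h = l₀ , λ l l₀≤l → ≡.subst (ℕ._< 2 ℕ.^ l) (eq (l ℕ.+ 4)) (h l l₀≤l)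
    where
    open ≡.≡-Reasoning
    square^ : ∀ g → (g ℕ.* g) ℕ.^ e ≡ g ℕ.^ (2 ℕ.* e)
    square^ g = ≡.trans (≡.cong (ℕ._^ e) (≡.cong (g ℕ.*_) (≡.sym (ℕₚ.*-identityʳ g)))) (ℕₚ.^-*-assoc g 2 e)
    eq : ∀ g → k ℕ.* c ℕ.^ e ℕ.* g ℕ.^ (2 ℕ.* e) ≡ k ℕ.* (g ℕ.* g ℕ.* c) ℕ.^ e
    eq g = begin
      k ℕ.* c ℕ.^ e ℕ.* g ℕ.^ (2 ℕ.* e)       ≡⟨ ℕₚ.*-assoc k (c ℕ.^ e) _ ⟩
      k ℕ.* (c ℕ.^ e ℕ.* g ℕ.^ (2 ℕ.* e))     ≡⟨ ≡.cong (k ℕ.*_) (≡.trans (ℕₚ.*-comm (c ℕ.^ e) _) (≡.cong (ℕ._* c ℕ.^ e) (≡.sym (square^ g)))) ⟩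
      k ℕ.* ((g ℕ.* g) ℕ.^ e ℕ.* c ℕ.^ e)     ≡⟨ ≡.cong (k ℕ.*_) (^-distribʳ-* e (g ℕ.* g) c) ⟨
      k ℕ.* (g ℕ.* g ℕ.* c) ℕ.^ e             ∎

floor-log : ∀ m → 1 ℕ.≤ m → ∃ λ l → 2 ℕ.^ l ℕ.≤ m × m ℕ.< 2 ℕ.^ suc l
floor-log m 1≤m = go m (n<2^n m)
  where
  go : ∀ k → m ℕ.< 2 ℕ.^ k → ∃ λ l → 2 ℕ.^ l ℕ.≤ m × m ℕ.< 2 ℕ.^ suc l
  go zero    m<1 = ⊥-elim (ℕₚ.<⇒≱ m<1 1≤m)
  go (suc k) m<2^ with 2 ℕ.^ k ℕₚ.≤? m
  ... | yes 2^k≤m = k , 2^k≤m , m<2^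
  ... | no  2^k≰m = go k (ℕₚ.≰⇒> 2^k≰m)

2^k<⇒k≤l : ∀ {m l} → m ℕ.< 2 ℕ.^ suc l → ∀ k → 2 ℕ.^ k ℕ.< m → k ℕ.≤ l
2^k<⇒k≤l {m} {l} m< k 2^k<m with k ℕₚ.≤? l
... | yes k≤l = k≤l
... | no  k≰l = ⊥-elim (ℕₚ.<-irrefl ≡.refl (ℕₚ.<-trans 2^k<m (ℕₚ.<-≤-trans m< (ℕₚ.^-monoʳ-≤ 2 (ℕₚ.≰⇒> k≰l)))))

^-cancelˡ-≤ : ∀ b {x y} → 1 ℕ.≤ b → x ℕ.^ b ℕ.≤ y ℕ.^ b → x ℕ.≤ y
^-cancelˡ-≤ b {x} {y} 1≤b h with x ℕₚ.≤? y
... | yes x≤y = x≤y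
... | no  x≰y = ⊥-elim (ℕₚ.<⇒≱ (ℕₚ.^-monoˡ-< b {{ℕ.>-nonZero 1≤b}} (ℕₚ.≰⇒> x≰y)) h)

-- Ruzsa's inequality and the three Hanson-Petridis bounds give u³ a₁a₂a₃ ≤ v³ N. Squaring, and
-- inserting (aᵢ d κ)² ≥ q and d N ≤ q, yields the claim times q²; squares avoid all roots.
combine-bounds : ∀ {q d N σ u v κ a₁ a₂ a₃ y₁ y₂ y₃} .{{_ : NonZero q}} .{{_ : NonZero N}} →
  N ℕ.≤ σ → σ ℕ.* σ ℕ.≤ y₃ ℕ.* (y₂ ℕ.* y₁) → d ℕ.* N ℕ.≤ q →
  u ℕ.* (a₁ ℕ.* y₁) ℕ.≤ v ℕ.* N → u ℕ.* (a₂ ℕ.* y₂) ℕ.≤ v ℕ.* N → u ℕ.* (a₃ ℕ.* y₃) ℕ.≤ v ℕ.* N →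
  q ℕ.≤ a₁ ℕ.* d ℕ.* κ ℕ.* (a₁ ℕ.* d ℕ.* κ) → q ℕ.≤ a₂ ℕ.* d ℕ.* κ ℕ.* (a₂ ℕ.* d ℕ.* κ) → q ℕ.≤ a₃ ℕ.* d ℕ.* κ ℕ.* (a₃ ℕ.* d ℕ.* κ) →
  q ℕ.* u ℕ.^ 6 ℕ.≤ d ℕ.^ 4 ℕ.* κ ℕ.^ 6 ℕ.* v ℕ.^ 6
combine-bounds {q} {d} {N} {σ} {u} {v} {κ} {a₁} {a₂} {a₃} {y₁} {y₂} {y₃} N≤σ σσ≤ dN≤q h₁ h₂ h₃ l₁ l₂ l₃ =
  ≡.subst₂ ℕ._≤_ (≡.cong (q ℕ.*_) (sixth u)) (≡.cong₂ ℕ._*_ (≡.cong₂ ℕ._*_ (fourth d) (sixth κ)) (sixth v))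
    (ℕₚ.*-cancelˡ-≤ (q ℕ.* q) {{ℕₚ.m*n≢0 q q}} (begin
    q ℕ.* q ℕ.* (q ℕ.* (u³ ℕ.* u³))                          ≡⟨ arith₁ q (u³ ℕ.* u³) ⟩
    q ℕ.* (q ℕ.* q) ℕ.* (u³ ℕ.* u³)                          ≤⟨ ℕₚ.*-monoˡ-≤ (u³ ℕ.* u³) (ℕₚ.*-mono-≤ l₁ (ℕₚ.*-mono-≤ l₂ l₃)) ⟩
    s₁ ℕ.* s₁ ℕ.* (s₂ ℕ.* s₂ ℕ.* (s₃ ℕ.* s₃)) ℕ.* (u³ ℕ.* u³)       ≡⟨ arith₂ a₁ a₂ a₃ d κ u³ ⟩
    U ℕ.* U ℕ.* cube (d ℕ.* κ) ℕ.* cube (d ℕ.* κ)            ≡⟨ ℕₚ.*-assoc (U ℕ.* U) _ _ ⟩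
    U ℕ.* U ℕ.* (cube (d ℕ.* κ) ℕ.* cube (d ℕ.* κ))          ≤⟨ ℕₚ.*-monoˡ-≤ (cube (d ℕ.* κ) ℕ.* cube (d ℕ.* κ)) (ℕₚ.*-mono-≤ U≤ U≤) ⟩
    v³ ℕ.* N ℕ.* (v³ ℕ.* N) ℕ.* (cube (d ℕ.* κ) ℕ.* cube (d ℕ.* κ))     ≡⟨ arith₃ v³ N d κ ⟩
    d ℕ.* N ℕ.* (d ℕ.* N) ℕ.* (d ℕ.* d ℕ.* (d ℕ.* d) ℕ.* (cube κ ℕ.* cube κ) ℕ.* (v³ ℕ.* v³))
      ≤⟨ ℕₚ.*-monoˡ-≤ (d ℕ.* d ℕ.* (d ℕ.* d) ℕ.* (cube κ ℕ.* cube κ) ℕ.* (v³ ℕ.* v³)) (ℕₚ.*-mono-≤ dN≤q dN≤q) ⟩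
    q ℕ.* q ℕ.* (d ℕ.* d ℕ.* (d ℕ.* d) ℕ.* (cube κ ℕ.* cube κ) ℕ.* (v³ ℕ.* v³))     ∎))
  where
  open ℕₚ.≤-Reasoning
  cube : ℕ → ℕ
  cube x = x ℕ.* x ℕ.* x
  u³ = cube u
  v³ = cube v
  s₁ = a₁ ℕ.* d ℕ.* κ
  s₂ = a₂ ℕ.* d ℕ.* κ
  s₃ = a₃ ℕ.* d ℕ.* κ
  U = u³ ℕ.* (a₁ ℕ.* a₂ ℕ.* a₃)
  fourth : ∀ x → x ℕ.* x ℕ.* (x ℕ.* x) ≡ x ℕ.* (x ℕ.* (x ℕ.* (x ℕ.* 1)))
  fourth = solve-∀
  sixth : ∀ x → x ℕ.* x ℕ.* x ℕ.* (x ℕ.* x ℕ.* x) ≡ x ℕ.* (x ℕ.* (x ℕ.* (x ℕ.* (x ℕ.* (x ℕ.* 1)))))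
  sixth = solve-∀
  arith₁ : ∀ q x → q ℕ.* q ℕ.* (q ℕ.* x) ≡ q ℕ.* (q ℕ.* q) ℕ.* x
  arith₁ = solve-∀
  arith₂′ : ∀ a b c e w → a ℕ.* e ℕ.* (a ℕ.* e) ℕ.* (b ℕ.* e ℕ.* (b ℕ.* e) ℕ.* (c ℕ.* e ℕ.* (c ℕ.* e))) ℕ.* (w ℕ.* w)
    ≡ w ℕ.* (a ℕ.* b ℕ.* c) ℕ.* (w ℕ.* (a ℕ.* b ℕ.* c)) ℕ.* (e ℕ.* e ℕ.* e) ℕ.* (e ℕ.* e ℕ.* e)
  arith₂′ = solve-∀
  arith₂ : ∀ a b c d κ w → a ℕ.* d ℕ.* κ ℕ.* (a ℕ.* d ℕ.* κ) ℕ.* (b ℕ.* d ℕ.* κ ℕ.* (b ℕ.* d ℕ.* κ) ℕ.* (c ℕ.* d ℕ.* κ ℕ.* (c ℕ.* d ℕ.* κ))) ℕ.* (w ℕ.* w)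
    ≡ w ℕ.* (a ℕ.* b ℕ.* c) ℕ.* (w ℕ.* (a ℕ.* b ℕ.* c)) ℕ.* cube (d ℕ.* κ) ℕ.* cube (d ℕ.* κ)
  arith₂ a b c d κ w rewrite ℕₚ.*-assoc a d κ | ℕₚ.*-assoc b d κ | ℕₚ.*-assoc c d κ = arith₂′ a b c (d ℕ.* κ) w
  arith₃ : ∀ t N d κ → t ℕ.* N ℕ.* (t ℕ.* N) ℕ.* (d ℕ.* κ ℕ.* (d ℕ.* κ) ℕ.* (d ℕ.* κ) ℕ.* (d ℕ.* κ ℕ.* (d ℕ.* κ) ℕ.* (d ℕ.* κ)))
    ≡ d ℕ.* N ℕ.* (d ℕ.* N) ℕ.* (d ℕ.* d ℕ.* (d ℕ.* d) ℕ.* (κ ℕ.* κ ℕ.* κ ℕ.* (κ ℕ.* κ ℕ.* κ)) ℕ.* (t ℕ.* t))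
  arith₃ = solve-∀
  arith₅ : ∀ u a b c x y z → u ℕ.* u ℕ.* u ℕ.* (a ℕ.* b ℕ.* c) ℕ.* (z ℕ.* (y ℕ.* x)) ≡ u ℕ.* (a ℕ.* x) ℕ.* (u ℕ.* (b ℕ.* y) ℕ.* (u ℕ.* (c ℕ.* z)))
  arith₅ = solve-∀
  arith₆ : ∀ v N → v ℕ.* N ℕ.* (v ℕ.* N ℕ.* (v ℕ.* N)) ≡ N ℕ.* N ℕ.* (v ℕ.* v ℕ.* v ℕ.* N)
  arith₆ = solve-∀
  U≤ : U ℕ.≤ v³ ℕ.* N
  U≤ = ℕₚ.*-cancelˡ-≤ (N ℕ.* N) {{ℕₚ.m*n≢0 N N}} (begin
    N ℕ.* N ℕ.* U                                            ≡⟨ ℕₚ.*-comm (N ℕ.* N) U ⟩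
    U ℕ.* (N ℕ.* N)                                          ≤⟨ ℕₚ.*-monoʳ-≤ U (ℕₚ.≤-trans (ℕₚ.*-mono-≤ N≤σ N≤σ) σσ≤) ⟩
    U ℕ.* (y₃ ℕ.* (y₂ ℕ.* y₁))                               ≡⟨ arith₅ u a₁ a₂ a₃ y₁ y₂ y₃ ⟩
    u ℕ.* (a₁ ℕ.* y₁) ℕ.* (u ℕ.* (a₂ ℕ.* y₂) ℕ.* (u ℕ.* (a₃ ℕ.* y₃)))   ≤⟨ ℕₚ.*-mono-≤ h₁ (ℕₚ.*-mono-≤ h₂ h₃) ⟩
    v ℕ.* N ℕ.* (v ℕ.* N ℕ.* (v ℕ.* N))                      ≡⟨ arith₆ v N ⟩
    N ℕ.* N ℕ.* (v³ ℕ.* N)                                   ∎)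

-- `size` is d ≤ q^(1/4 - a/b) (u/v)^(3/2), raised to the power 4b and cleared of denominators.
module _ {q d u v a b : ℕ} (1≤b : 1 ℕ.≤ b) (u≤v : u ℕ.≤ v) .{{_ : NonZero q}} .{{_ : NonZero d}} .{{_ : NonZero v}}
         (size : d ℕ.^ (4 ℕ.* b) ℕ.* q ℕ.^ (4 ℕ.* a) ℕ.* v ℕ.^ (6 ℕ.* b) ℕ.≤ q ℕ.^ b ℕ.* u ℕ.^ (6 ℕ.* b)) where
  open ℕₚ.≤-Reasoning

  -- With u ≤ v, `size` even gives d⁴ ≤ q.
  size⇒dd≤q : d ℕ.* d ℕ.≤ q
  size⇒dd≤q = ℕₚ.≤-trans (ℕₚ.≤-trans (ℕₚ.m≤m*n (d ℕ.* d) (d ℕ.* d) {{ℕₚ.m*n≢0 d d}}) (ℕₚ.≤-reflexive (arith d)))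
    (^-cancelˡ-≤ b 1≤b (≡.subst (ℕ._≤ q ℕ.^ b) (≡.sym (ℕₚ.^-*-assoc d 4 b)) (ℕₚ.*-cancelʳ-≤ _ _ (v ℕ.^ (6 ℕ.* b)) {{ℕₚ.m^n≢0 v (6 ℕ.* b)}} (begin
      d ℕ.^ (4 ℕ.* b) ℕ.* v ℕ.^ (6 ℕ.* b)                          ≤⟨ ℕₚ.*-monoˡ-≤ (v ℕ.^ (6 ℕ.* b)) (ℕₚ.m≤m*n (d ℕ.^ (4 ℕ.* b)) (q ℕ.^ (4 ℕ.* a)) {{ℕₚ.m^n≢0 q (4 ℕ.* a)}}) ⟩
      d ℕ.^ (4 ℕ.* b) ℕ.* q ℕ.^ (4 ℕ.* a) ℕ.* v ℕ.^ (6 ℕ.* b)      ≤⟨ size ⟩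
      q ℕ.^ b ℕ.* u ℕ.^ (6 ℕ.* b)                                  ≤⟨ ℕₚ.*-monoʳ-≤ (q ℕ.^ b) (ℕₚ.^-monoˡ-≤ (6 ℕ.* b) u≤v) ⟩
      q ℕ.^ b ℕ.* v ℕ.^ (6 ℕ.* b)                                  ∎))))
    where
    arith : ∀ d → d ℕ.* d ℕ.* (d ℕ.* d) ≡ d ℕ.* (d ℕ.* (d ℕ.* (d ℕ.* 1)))
    arith = solve-∀

  -- Chaining `size` with the b-th power of the combined bound cancels d, u, v and q^b. What remains
  -- is q^(4a) ≤ κ^(6b), which bounds q by a power of its logarithm.
  size⇒q≤κ^ : ∀ {κ} → 1 ℕ.≤ a → q ℕ.* u ℕ.^ 6 ℕ.≤ d ℕ.^ 4 ℕ.* κ ℕ.^ 6 ℕ.* v ℕ.^ 6 → q ℕ.≤ κ ℕ.^ (6 ℕ.* b)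
  size⇒q≤κ^ {κ} 1≤a bound = ℕₚ.≤-trans (ℕₚ.≤-trans (ℕₚ.≤-reflexive (≡.sym (ℕₚ.^-identityʳ q))) (ℕₚ.^-monoʳ-≤ q (ℕₚ.≤-trans 1≤a (ℕₚ.m≤n*m a 4))))
    (ℕₚ.*-cancelˡ-≤ (d ℕ.^ (4 ℕ.* b) ℕ.* v ℕ.^ (6 ℕ.* b)) {{ℕₚ.m*n≢0 _ _ {{ℕₚ.m^n≢0 d (4 ℕ.* b)}} {{ℕₚ.m^n≢0 v (6 ℕ.* b)}}}} (begin
      d ℕ.^ (4 ℕ.* b) ℕ.* v ℕ.^ (6 ℕ.* b) ℕ.* q ℕ.^ (4 ℕ.* a)      ≡⟨ swap (d ℕ.^ (4 ℕ.* b)) (v ℕ.^ (6 ℕ.* b)) (q ℕ.^ (4 ℕ.* a)) ⟩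
      d ℕ.^ (4 ℕ.* b) ℕ.* q ℕ.^ (4 ℕ.* a) ℕ.* v ℕ.^ (6 ℕ.* b)      ≤⟨ size ⟩
      q ℕ.^ b ℕ.* u ℕ.^ (6 ℕ.* b)                                  ≡⟨ ≡.cong (q ℕ.^ b ℕ.*_) (ℕₚ.^-*-assoc u 6 b) ⟨
      q ℕ.^ b ℕ.* (u ℕ.^ 6) ℕ.^ b                                  ≡⟨ ^-distribʳ-* b q (u ℕ.^ 6) ⟨
      (q ℕ.* u ℕ.^ 6) ℕ.^ b                                        ≤⟨ ℕₚ.^-monoˡ-≤ b bound ⟩
      (d ℕ.^ 4 ℕ.* κ ℕ.^ 6 ℕ.* v ℕ.^ 6) ℕ.^ b                      ≡⟨ ≡.trans (^-distribʳ-* b (d ℕ.^ 4 ℕ.* κ ℕ.^ 6) (v ℕ.^ 6)) (≡.cong (ℕ._* (v ℕ.^ 6) ℕ.^ b) (^-distribʳ-* b (d ℕ.^ 4) (κ ℕ.^ 6))) ⟩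
      (d ℕ.^ 4) ℕ.^ b ℕ.* (κ ℕ.^ 6) ℕ.^ b ℕ.* (v ℕ.^ 6) ℕ.^ b
        ≡⟨ ≡.cong₂ ℕ._*_ (≡.cong₂ ℕ._*_ (ℕₚ.^-*-assoc d 4 b) (ℕₚ.^-*-assoc κ 6 b)) (ℕₚ.^-*-assoc v 6 b) ⟩
      d ℕ.^ (4 ℕ.* b) ℕ.* κ ℕ.^ (6 ℕ.* b) ℕ.* v ℕ.^ (6 ℕ.* b)      ≡⟨ swap (d ℕ.^ (4 ℕ.* b)) (v ℕ.^ (6 ℕ.* b)) (κ ℕ.^ (6 ℕ.* b)) ⟨
      d ℕ.^ (4 ℕ.* b) ℕ.* v ℕ.^ (6 ℕ.* b) ℕ.* κ ℕ.^ (6 ℕ.* b)      ∎))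
    where
    swap : ∀ x y z → x ℕ.* y ℕ.* z ≡ x ℕ.* z ℕ.* y
    swap = solve-∀

-- Transport of the field structure to Fin q, where equality is propositional.
module Transport {q : ℕ} (F : FiniteField 0ℓ 0ℓ q) where
  open FiniteField F

  ix : Carrier → Fin q
  ix x = proj₁ (enum-surj x)

  enum-ix : ∀ x → enum (ix x) ≈ x
  enum-ix x = proj₂ (enum-surj x)

  ix-cong : ∀ {x y} → x ≈ y → ix x ≡ ix y
  ix-cong {x} {y} x≈y = enum-inj _ _ (trans (enum-ix x) (trans x≈y (sym (enum-ix y))))

  ix-enum : ∀ i → ix (enum i) ≡ i
  ix-enum i = enum-inj _ _ (enum-ix (enum i))

  ix-injective : ∀ {x y} → ix x ≡ ix y → x ≈ y
  ix-injective {x} {y} e = trans (sym (enum-ix x)) (trans (reflexive (≡.cong enum e)) (enum-ix y))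

  finField : FinField q
  finField = record
    { _+′_ = λ i j → ix (enum i + enum j) ; _*′_ = λ i j → ix (enum i * enum j) ; -′_ = λ i → ix (- enum i)
    ; 0′ = ix 0# ; 1′ = ix 1#
    ; isCommutativeRing = record
      { isRing = record
        { +-isAbelianGroup = record
          { isGroup = record
            { isMonoid = record
              { isSemigroup = record
                { isMagma = record { isEquivalence = ≡.isEquivalence ; ∙-cong = ≡.cong₂ _ }
                ; assoc = λ i j k → ix-cong (trans (+-congʳ (enum-ix _)) (trans (+-assoc _ _ _) (+-congˡ (sym (enum-ix _))))) }
              ; identity = (λ i → ≡.trans (ix-cong (trans (+-congʳ (enum-ix _)) (+-identityˡ _))) (ix-enum i))
                         , (λ i → ≡.trans (ix-cong (trans (+-congˡ (enum-ix _)) (+-identityʳ _))) (ix-enum i)) }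
            ; inverse = (λ i → ix-cong (trans (+-congʳ (enum-ix _)) (-‿inverseˡ _)))
                      , (λ i → ix-cong (trans (+-congˡ (enum-ix _)) (-‿inverseʳ _)))
            ; ⁻¹-cong = ≡.cong (λ i → ix (- enum i)) }
          ; comm = λ i j → ix-cong (+-comm _ _) }
        ; *-cong = ≡.cong₂ _
        ; *-assoc = λ i j k → ix-cong (trans (*-congʳ (enum-ix _)) (trans (*-assoc _ _ _) (*-congˡ (sym (enum-ix _)))))
        ; *-identity = (λ i → ≡.trans (ix-cong (trans (*-congʳ (enum-ix _)) (*-identityˡ _))) (ix-enum i))
                     , (λ i → ≡.trans (ix-cong (trans (*-congˡ (enum-ix _)) (*-identityʳ _))) (ix-enum i))
        ; distrib = (λ i j k → ix-cong (trans (*-congˡ (enum-ix _)) (trans (distribˡ _ _ _) (sym (+-cong (enum-ix _) (enum-ix _))))))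
                  , (λ i j k → ix-cong (trans (*-congʳ (enum-ix _)) (trans (distribʳ _ _ _) (sym (+-cong (enum-ix _) (enum-ix _)))))) }
      ; *-comm = λ i j → ix-cong (*-comm _ _) }
    ; 1≢0 = λ e → 1≉0 (ix-injective e)
    ; inverse = λ i i≢0 → let (y , xy≈1) = inverse (enum i) (λ i≈0 → i≢0 (≡.trans (≡.sym (ix-enum i)) (ix-cong i≈0)))
                          in ix y , ix-cong (trans (*-congˡ (enum-ix y)) xy≈1) }

-- The inequality forced by a decomposition of the d-th powers

module DecompositionBound {q : ℕ} (F : FinField q) {p n : ℕ} (prime : Prime p) (q≡p^n : q ≡ p ℕ.^ n)
                          (d N : ℕ) .{{d≢0 : NonZero d}} (1+dN≡q : suc (d ℕ.* N) ≡ q) where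
  open FieldTheory F
  open Polynomials F
  open PowerSeries ring
  open Multiplicity F
  open KummerSeries F {p} {n} prime q≡p^n d N 1+dN≡q
  open Sets F
  open Bounds F {p} {n} prime q≡p^n d N 1+dN≡q using (truncated-hanson-petridis; dN≤q)
  open 𝕊𝔼 using () renaming (eval to evalₛ)

  isPower? : ∀ x → Dec (∃ λ y → y ≢ 0# × y ^ d ≡ x)
  isPower? x = Finₚ.any? (λ y → ¬? (y ≟ 0#) ×-dec (y ^ d ≟ x))

  Powers : Subset
  Powers x = isYes (isPower? x)

  power-unit : ∀ x → x ∈ Powers → x ^ N ≡ 1#
  power-unit x x∈ with true-isYes (isPower? x) x∈
  ... | y , y≢0 , y^d≡x = ≡.trans (≡.cong (_^ N) (≡.sym y^d≡x)) (≡.trans (^-assocʳ y d N) (x^[q-1]≡1 1+dN≡q y≢0))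

  roots-bound : ∀ c s (b : Fin s → 𝔽) → (∀ i j → b i ≡ b j → i ≡ j) → (∀ i → b i ^ d ≡ c) → s ℕ.≤ d
  roots-bound c s b inj root = ℕₚ.≮⇒≥ λ d<s → leading (multiplicity s 1 g b (λ _ → 1#) inj (λ _ → 1≢0)
      (ℕₚ.≤-trans g-len (ℕₚ.≤-trans d<s (ℕₚ.≤-reflexive (≡.sym (ℕₚ.*-identityʳ s))))) vanish d)
    where
    g : Poly
    g = (Xₚ ^ₚ d) -ₚ constₚ c
    g-len : length g ℕ.≤ suc d
    g-len = length-+ (Xₚ ^ₚ d) (negₚ (constₚ c)) (≡.subst (λ m → length (Xₚ ^ₚ d) ℕ.≤ suc m) (ℕₚ.*-identityʳ d) (length-^ Xₚ ℕₚ.≤-refl d))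
      (ℕₚ.≤-trans (length-* (constₚ (- 1#)) (constₚ c) {0} {0} ℕₚ.≤-refl ℕₚ.≤-refl) (s≤s z≤n))
    eval-g : ∀ s → evalₛ g s ≋ ((s ^ₛ d) ⊝ const c)
    eval-g s i = ≡.trans (evalₛ-- (Xₚ ^ₚ d) (constₚ c) s i) (≡.cong₂ (λ u v → u + - v)
      (𝕊R.trans (𝕊𝔼.eval-^ Xₚ d s) (^ₛ-congˡ d (𝕊𝔼.eval-X s)) i) (𝕊𝔼.eval-const c s i))
    head-^ : ∀ s m → (s ^ₛ m) 0 ≡ s 0 ^ m
    head-^ s zero    = ≡.refl
    head-^ s (suc m) = ≡.cong (s 0 *_) (head-^ s m)
    vanish : ∀ i → Vanish 1 (evalₛ g (lin (b i) 1#))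
    vanish i zero _ = ≡.trans (eval-g (lin (b i) 1#) 0)
      (≡.trans (≡.cong (λ u → u + - c) (≡.trans (head-^ (lin (b i) 1#) d) (root i))) (-‿inverseʳ c))
    vanish i (suc _) (s≤s ())
    leading : coef g d ≢ 0#
    leading z = proj₂ (order-^ {X} {1} ((λ { zero _ → ≡.refl ; (suc _) (s≤s ()) }) , 1≢0) d)
      (≡.trans (≡.cong (X ^ₛ d) (ℕₚ.*-identityʳ d)) (≡.trans (≡.sym (+-identityʳ _)) (≡.trans (≡.cong ((X ^ₛ d) d +_) (≡.sym (tail d (ℕ.≢-nonZero⁻¹ d))))
        (≡.trans (≡.sym (eval-g X d)) (≡.trans (evalₛ-X g d) z)))))
      where
      tail : ∀ m → m ≢ 0 → - const c m ≡ 0#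
      tail zero    h = ⊥-elim (h ≡.refl)
      tail (suc m) _ = RingProps.-0#≈0# (CommutativeRing.ring ring)

  -- The d N units are mapped to d-th powers with fibres of at most d elements.
  N≤Powers : N ℕ.≤ count Powers
  N≤Powers = ℕₚ.*-cancelˡ-≤ d (begin
    d ℕ.* N                    ≤⟨ ℕₚ.≤-pred nonzero-count ⟩
    count Nonzero              ≤⟨ fibres-≤ d f fibre-bound ⟩
    count Powers ℕ.* d         ≡⟨ ℕₚ.*-comm (count Powers) d ⟩
    d ℕ.* count Powers         ∎)
    where
    open ℕₚ.≤-Reasoning
    Nonzero : Subset
    Nonzero y = isYes (¬? (y ≟ 0#))
    count-all : ∀ m → count {m} (λ _ → true) ≡ m
    count-all zero    = ≡.refl
    count-all (suc m) = ≡.cong suc (count-all m)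
    nonzero-count : suc (d ℕ.* N) ℕ.≤ suc (count Nonzero)
    nonzero-count = begin
      suc (d ℕ.* N)                                           ≡⟨ 1+dN≡q ⟩
      q                                                       ≡⟨ count-all q ⟨
      count {q} (λ _ → true)                                  ≤⟨ count-∪ (λ _ → true) (λ y → isYes (y ≟ 0#)) Nonzero (λ y _ → cases y) ⟩
      count (λ y → isYes (y ≟ 0#)) ℕ.+ count Nonzero          ≤⟨ ℕₚ.+-monoˡ-≤ (count Nonzero) (count-singleton 0#) ⟩
      suc (count Nonzero)                                     ∎
      where
      cases : ∀ y → isYes (y ≟ 0#) ≡ true ⊎ isYes (¬? (y ≟ 0#)) ≡ true
      cases y with y ≟ 0#
      ... | yes _ = inj₁ ≡.refl
      ... | no  _ = inj₂ ≡.refl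
    y : Fin (count Nonzero) → 𝔽
    y = member Nonzero
    y^d∈ : ∀ i → (y i ^ d) ∈ Powers
    y^d∈ i = isYes-true (isPower? (y i ^ d)) (y i , true-isYes (¬? (y i ≟ 0#)) (member-true Nonzero i) , ≡.refl)
    f : Fin (count Nonzero) → Fin (count Powers)
    f i = index Powers (y i ^ d) (y^d∈ i)
    fibre-bound : ∀ s → count (fibre f s) ℕ.≤ d
    fibre-bound s = roots-bound (member Powers s) (count (fibre f s)) (λ t → y (member (fibre f s) t))
      (λ t t′ e → member-injective (fibre f s) t t′ (member-injective Nonzero _ _ e))
      (λ t → ≡.trans (≡.sym (proj₂ (member-onto Powers _ (y^d∈ (member (fibre f s) t)))))
        (≡.cong (member Powers) (true-isYes (f (member (fibre f s) t) ≟ s) (member-true (fibre f s) t))))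

  module _ .{{_ : NonZero p}} (2≤d : 2 ℕ.≤ d) (dd≤q : d ℕ.* d ℕ.≤ q) (l : ℕ) (log : ∀ k → 2 ℕ.^ k ℕ.< 8 ℕ.* q → k ℕ.≤ l)
           {u v : ℕ} (u≤v : u ℕ.≤ v)
           (good : ∀ j → 2 ℕ.* j ℕ.< n ℕ.+ 1 → u ℕ.* (p ∸ 1) ℕ.≤ v ℕ.* (p ∸ 1 ∸ digit p N j)) where
    open LowerBound F {p} {n} prime q≡p^n d N 1+dN≡q 2≤d dd≤q l log using (lower-bound; N≢0)

    private
      κ₀ = κ (l ℕ.+ 4)

      1≤κ₀ : 1 ℕ.≤ κ₀
      1≤κ₀ = ℕₚ.*-mono-≤ {1} {(l ℕ.+ 4) ℕ.* (l ℕ.+ 4)} {1} {512} (ℕₚ.*-mono-≤ {1} {l ℕ.+ 4} {1} {l ℕ.+ 4} 1≤ 1≤) (≤-by-computation 1 512)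
        where
        1≤ : 1 ℕ.≤ l ℕ.+ 4
        1≤ = ℕₚ.≤-trans (≤-by-computation 1 4) (ℕₚ.m≤n+m 4 l)

      -- The indices with 2j < n + 1 are those up to ⌊n/2⌋: this many low digits are controlled, and
      -- it is enough for p^K ≥ √q.
      K : ℕ
      K = suc (n / 2)

      below-K : ∀ j → j ℕ.< K → 2 ℕ.* j ℕ.< n ℕ.+ 1
      below-K j (s≤s j≤n/2) = ≡.subst (2 ℕ.* j ℕ.<_) (ℕₚ.+-comm 1 n) (s≤s (begin
        2 ℕ.* j                        ≤⟨ ℕₚ.*-monoʳ-≤ 2 j≤n/2 ⟩
        2 ℕ.* (n / 2)                  ≡⟨ ℕₚ.*-comm 2 (n / 2) ⟩
        n / 2 ℕ.* 2                    ≤⟨ ℕₚ.m≤n+m _ (n % 2) ⟩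
        n % 2 ℕ.+ n / 2 ℕ.* 2          ≡⟨ m≡m%n+[m/n]*n n 2 ⟨
        n                              ∎))
        where open ℕₚ.≤-Reasoning

      q≤p^K² : q ℕ.≤ p ℕ.^ K ℕ.* p ℕ.^ K
      q≤p^K² = begin
        q                              ≡⟨ q≡p^n ⟩
        p ℕ.^ n                        ≤⟨ ℕₚ.^-monoʳ-≤ p n≤K+K ⟩
        p ℕ.^ (K ℕ.+ K)                ≡⟨ ℕₚ.^-distribˡ-+-* p K K ⟩
        p ℕ.^ K ℕ.* p ℕ.^ K            ∎
        where
        open ℕₚ.≤-Reasoning
        arith : ∀ m → 2 ℕ.+ m ℕ.* 2 ≡ suc m ℕ.+ suc m
        arith = solve-∀
        n≤K+K : n ℕ.≤ K ℕ.+ K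
        n≤K+K = begin
          n                            ≡⟨ m≡m%n+[m/n]*n n 2 ⟩
          n % 2 ℕ.+ n / 2 ℕ.* 2        ≤⟨ ℕₚ.+-monoˡ-≤ (n / 2 ℕ.* 2) (ℕₚ.<⇒≤ (m%n<n n 2)) ⟩
          2 ℕ.+ n / 2 ℕ.* 2            ≡⟨ arith (n / 2) ⟩
          K ℕ.+ K                      ∎

    -- m is |X| cut off at p^K, the range of the digit condition. The cut is harmless: p^K ≥ √q
    -- already satisfies the lower bound, while below p^K that bound comes from Stepanov's method.
    summand-bounds : ∀ X Y → 2 ℕ.≤ count X → (∀ s → s ∈ Powers → ∃₂ λ x y → x ∈ X × y ∈ Y × x + y ≡ s) →
      (∀ x y → x ∈ X → y ∈ Y → (x + y) ∈ Powers) →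
      ∃ λ m → u ℕ.* (m ℕ.* count Y) ℕ.≤ v ℕ.* N × q ℕ.≤ m ℕ.* d ℕ.* κ₀ ℕ.* (m ℕ.* d ℕ.* κ₀)
    summand-bounds X Y 2≤X cover sum∈ = m ,
        truncated-hanson-petridis {u} {v} {K} u≤v (λ j j<K → good j (below-K j j<K)) X Y unit m (ℕₚ.m⊓n≤m (count X) (p ℕ.^ K)) (ℕₚ.m⊓n≤n (count X) (p ℕ.^ K)) ,
        large (ℕₚ.⊓-sel (count X) (p ℕ.^ K))
      where
      m = count X ℕ.⊓ p ℕ.^ K
      unit : ∀ x y → x ∈ X → y ∈ Y → (y + x) ^ N ≡ 1#
      unit x y x∈X y∈Y = ≡.trans (≡.cong (_^ N) (+-comm y x)) (power-unit (x + y) (sum∈ x y x∈X y∈Y))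
      P = p ℕ.^ K
      large : m ≡ count X ⊎ m ≡ P → q ℕ.≤ m ℕ.* d ℕ.* κ₀ ℕ.* (m ℕ.* d ℕ.* κ₀)
      large (inj₁ eq) = ≡.subst (λ m → q ℕ.≤ m ℕ.* d ℕ.* κ₀ ℕ.* (m ℕ.* d ℕ.* κ₀)) (≡.sym eq)
        (lower-bound X Y Powers 2≤X N≤Powers cover unit)
      large (inj₂ eq) = ≡.subst (λ m → q ℕ.≤ m ℕ.* d ℕ.* κ₀ ℕ.* (m ℕ.* d ℕ.* κ₀)) (≡.sym eq)
        (ℕₚ.≤-trans q≤p^K² (ℕₚ.*-mono-≤ P≤ P≤))
        where
        P≤ : P ℕ.≤ P ℕ.* d ℕ.* κ₀
        P≤ = ℕₚ.≤-trans (ℕₚ.m≤m*n P d) (ℕₚ.m≤m*n (P ℕ.* d) κ₀ {{ℕ.>-nonZero 1≤κ₀}})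

    decomposition-bound : ∀ A B C → 2 ℕ.≤ count A → 2 ℕ.≤ count B → 2 ℕ.≤ count C →
      (∀ x → x ∈ Powers → ∃ λ a → ∃₂ λ b c → a ∈ A × b ∈ B × c ∈ C × a + b + c ≡ x) →
      (∀ a b c → a ∈ A → b ∈ B → c ∈ C → (a + b + c) ∈ Powers) →
      q ℕ.* u ℕ.^ 6 ℕ.≤ d ℕ.^ 4 ℕ.* κ (l ℕ.+ 4) ℕ.^ 6 ℕ.* v ℕ.^ 6
    decomposition-bound A B C 2≤A 2≤B 2≤C cover sum∈ = conclude
        (summand-bounds A (B ⊞ C) 2≤A (λ s s∈ → let (a , b , c , a∈ , b∈ , c∈ , eq) = cover s s∈ in
            a , b + c , a∈ , ⊞-intro b∈ c∈ , ≡.trans (≡.sym (+-assoc a b c)) eq)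
          (λ a w a∈ w∈ → let (b , c , b∈ , c∈ , eq) = ⊞-elim w∈ in
            ≡.subst (_∈ Powers) (≡.trans (+-assoc a b c) (≡.cong (a +_) eq)) (sum∈ a b c a∈ b∈ c∈)))
        (summand-bounds B (A ⊞ C) 2≤B (λ s s∈ → let (a , b , c , a∈ , b∈ , c∈ , eq) = cover s s∈ in
            b , a + c , b∈ , ⊞-intro a∈ c∈ , ≡.trans (rotate b a c) eq)
          (λ b w b∈ w∈ → let (a , c , a∈ , c∈ , eq) = ⊞-elim w∈ in
            ≡.subst (_∈ Powers) (≡.trans (≡.sym (rotate b a c)) (≡.cong (b +_) eq)) (sum∈ a b c a∈ b∈ c∈)))
        (summand-bounds C (A ⊞ B) 2≤C (λ s s∈ → let (a , b , c , a∈ , b∈ , c∈ , eq) = cover s s∈ in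
            c , a + b , c∈ , ⊞-intro a∈ b∈ , ≡.trans (+-comm c (a + b)) eq)
          (λ c w c∈ w∈ → let (a , b , a∈ , b∈ , eq) = ⊞-elim w∈ in
            ≡.subst (_∈ Powers) (≡.trans (+-comm (a + b) c) (≡.cong (c +_) eq)) (sum∈ a b c a∈ b∈ c∈)))
      where
      rotate : ∀ b a c → b + (a + c) ≡ a + b + c
      rotate b a c = ≡.trans (≡.sym (+-assoc b a c)) (≡.cong (_+ c) (+-comm b a))
      conclude : (∃ λ m → u ℕ.* (m ℕ.* count (B ⊞ C)) ℕ.≤ v ℕ.* N × q ℕ.≤ m ℕ.* d ℕ.* κ₀ ℕ.* (m ℕ.* d ℕ.* κ₀)) →
                 (∃ λ m → u ℕ.* (m ℕ.* count (A ⊞ C)) ℕ.≤ v ℕ.* N × q ℕ.≤ m ℕ.* d ℕ.* κ₀ ℕ.* (m ℕ.* d ℕ.* κ₀)) →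
                 (∃ λ m → u ℕ.* (m ℕ.* count (A ⊞ B)) ℕ.≤ v ℕ.* N × q ℕ.≤ m ℕ.* d ℕ.* κ₀ ℕ.* (m ℕ.* d ℕ.* κ₀)) →
                 q ℕ.* u ℕ.^ 6 ℕ.≤ d ℕ.^ 4 ℕ.* κ₀ ℕ.^ 6 ℕ.* v ℕ.^ 6
      conclude (m₁ , h₁ , l₁) (m₂ , h₂ , l₂) (m₃ , h₃ , l₃) =
        combine-bounds {q} {d} {N} {count Powers} {u} {v} {κ₀} {m₁} {m₂} {m₃} {count (B ⊞ C)} {count (A ⊞ C)} {count (A ⊞ B)}
          {{ℕ.>-nonZero (ℕₚ.<⇒≤ 1<q)}} {{ℕ.≢-nonZero N≢0}} N≤Powers (ruzsa Powers A B C cover) dN≤q h₁ h₂ h₃ l₁ l₂ l₃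

-- Clearing denominators in ε and δ, and the conclusion

open import Data.Integer using (+_)

module Fraction (u v-1 : ℕ) where
  v : ℕ
  v = suc v-1

  infix 9 _/v^_
  _/v^_ : ℕ → ℕ → ℚᵘ
  x /v^ k = mkℚᵘ (+ x) (ℕ.pred (v ℕ.^ k))

  v^ : ∀ k → suc (ℕ.pred (v ℕ.^ k)) ≡ v ℕ.^ k
  v^ k = ℕₚ.suc-pred (v ℕ.^ k) {{ℕₚ.m^n≢0 v k}}

  module _ (δ : ℚ) (δ≃ : toℚᵘ δ ℚᵘ.≃ mkℚᵘ (+ u) v-1) where

    power : ∀ k → toℚᵘ (δ ^ℚ k) ℚᵘ.≃ (u ℕ.^ k) /v^ k
    power zero    = *≡* ≡.refl
    power (suc k) = ℚᵘₚ.≃-trans (ℚₚ.toℚᵘ-homo-* δ (δ ^ℚ k)) (ℚᵘₚ.≃-trans (ℚᵘₚ.*-cong δ≃ (power k))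
      (*≡* (≡.cong₂ ℤ._*_ (≡.sym (ℤₚ.pos-* u (u ℕ.^ k))) (≡.cong +_ denominators))))
      where
      denominators : suc (ℕ.pred (v ℕ.^ suc k)) ≡ v ℕ.* suc (ℕ.pred (v ℕ.^ k))
      denominators = ≡.trans (v^ (suc k)) (≡.cong (v ℕ.*_) (≡.sym (v^ k)))

    integer : ∀ x → toℚᵘ ((+ x) ℚ./ 1) ℚᵘ.≃ mkℚᵘ (+ x) 0
    integer x = ℚₚ.toℚᵘ-fromℚᵘ (mkℚᵘ (+ x) 0)

    scaled-power-bound : ∀ x y k → ((+ x) ℚ./ 1) ℚ.≤ ((+ y) ℚ./ 1) ℚ.* (δ ^ℚ k) → x ℕ.* v ℕ.^ k ℕ.≤ y ℕ.* u ℕ.^ k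
    scaled-power-bound x y k h = clear (ℚᵘₚ.≤-trans (ℚᵘₚ.≤-reflexive (ℚᵘₚ.≃-sym (integer x))) (ℚᵘₚ.≤-trans (ℚₚ.toℚᵘ-mono-≤ h)
      (ℚᵘₚ.≤-reflexive (ℚᵘₚ.≃-trans (ℚₚ.toℚᵘ-homo-* ((+ y) ℚ./ 1) (δ ^ℚ k)) (ℚᵘₚ.*-cong (integer y) (power k))))))
      where
      clear : mkℚᵘ (+ x) 0 ℚᵘ.≤ mkℚᵘ (+ y) 0 ℚᵘ.* ((u ℕ.^ k) /v^ k) → x ℕ.* v ℕ.^ k ℕ.≤ y ℕ.* u ℕ.^ k
      clear (*≤* h) = ℤₚ.drop‿+≤+ (≡.subst₂ ℤ._≤_
        (≡.trans (≡.sym (ℤₚ.pos-* x _)) (≡.cong (λ m → + (x ℕ.* m)) (≡.trans (ℕₚ.+-identityʳ _) (v^ k))))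
        (≡.trans (ℤₚ.*-identityʳ _) (≡.sym (ℤₚ.pos-* y (u ℕ.^ k)))) h)

    -- The inequality e ≤ (1 - u/v) m multiplied by v, with the negative term moved over so that no
    -- truncated subtraction occurs.
    floor-bound : ∀ e m → (+ e) ℤ.≤ floor ((1ℚ ℚ.- δ) ℚ.* ((+ m) ℚ./ 1)) → u ℕ.* m ℕ.+ v ℕ.* e ℕ.≤ v ℕ.* m
    floor-bound e m h = clear (ℚᵘₚ.≤-trans e≤x (ℚᵘₚ.≤-reflexive (ℚᵘₚ.≃-trans (ℚₚ.toℚᵘ-homo-* (1ℚ ℚ.- δ) ((+ m) ℚ./ 1))
        (ℚᵘₚ.*-cong (ℚᵘₚ.≃-trans (ℚₚ.toℚᵘ-homo-+ 1ℚ (ℚ.- δ)) (ℚᵘₚ.+-congʳ (toℚᵘ 1ℚ) (ℚᵘₚ.≃-trans (ℚₚ.toℚᵘ-homo‿- δ) (ℚᵘₚ.-‿cong δ≃)))) (integer m)))))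
      where
      below-floor : ∀ x → (+ e) ℤ.≤ floor x → mkℚᵘ (+ e) 0 ℚᵘ.≤ toℚᵘ x
      below-floor x@record{} h = *≤* (ℤₚ.≤-trans (ℤₚ.*-monoʳ-≤-nonNeg (↧ x) h)
        (ℤₚ.≤-trans (ℤ-DivMod.[n/d]*d≤n (↥ x) (↧ x)) (ℤₚ.≤-reflexive (≡.sym (ℤₚ.*-identityʳ (↥ x))))))
      e≤x : mkℚᵘ (+ e) 0 ℚᵘ.≤ toℚᵘ ((1ℚ ℚ.- δ) ℚ.* ((+ m) ℚ./ 1))
      e≤x = below-floor _ h
      clear : mkℚᵘ (+ e) 0 ℚᵘ.≤ (toℚᵘ 1ℚ ℚᵘ.+ (ℚᵘ.- mkℚᵘ (+ u) v-1)) ℚᵘ.* mkℚᵘ (+ m) 0 → u ℕ.* m ℕ.+ v ℕ.* e ℕ.≤ v ℕ.* m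
      clear (*≤* h) = ℤₚ.drop‿+≤+ (≡.subst₂ ℤ._≤_ left right (ℤₚ.+-monoʳ-≤ (+ u ℤ.* + m) h))
        where
        left : + u ℤ.* + m ℤ.+ + e ℤ.* (+ (1 ℕ.* v ℕ.* 1)) ≡ + (u ℕ.* m ℕ.+ v ℕ.* e)
        left = ≡.trans (≡.cong₂ ℤ._+_ (≡.sym (ℤₚ.pos-* u m)) (≡.trans (≡.sym (ℤₚ.pos-* e _))
          (≡.cong +_ (≡.trans (≡.cong (e ℕ.*_) (≡.trans (ℕₚ.*-identityʳ _) (ℕₚ.*-identityˡ v))) (ℕₚ.*-comm e v)))))
          (≡.sym (ℤₚ.pos-+ (u ℕ.* m) (v ℕ.* e)))
        rearrange : ∀ u m v → u ℤ.* m ℤ.+ ((+ 1) ℤ.* v ℤ.+ ((ℤ.- u) ℤ.* (+ 1))) ℤ.* m ℤ.* (+ 1) ≡ v ℤ.* m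
        rearrange = ℤ-Solver.solve-∀
        right : + u ℤ.* + m ℤ.+ ((+ 1 ℤ.* + v ℤ.+ (ℤ.- + u) ℤ.* (+ 1)) ℤ.* + m) ℤ.* (+ 1) ≡ + (v ℕ.* m)
        right = ≡.trans (rearrange (+ u) (+ m) (+ v)) (≡.sym (ℤₚ.pos-* v m))

open import Data.Nat using (_^_)

-- The sets are arbitrary predicates, but the theorem is a negation, so their decidability on
-- finitely many indices may be assumed under a double negation.
¬¬-decidable : ∀ {n} (P : Fin n → Set) → ¬ ¬ (∀ i → Dec (P i))
¬¬-decidable {zero}  P k = k λ ()
¬¬-decidable {suc n} P k = ¬¬-decidable (λ i → P (suc i)) λ d →
  k λ { zero → no λ p → k λ { zero → yes p ; (suc i) → d i } ; (suc i) → d i }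

positive-fraction : ∀ δ → 0ℚ ℚ.< δ → ∃₂ λ u v-1 → toℚᵘ δ ℚᵘ.≃ mkℚᵘ (+ u) v-1
positive-fraction (mkℚ (+ u) v-1 c)    _          = u , v-1 , *≡* ≡.refl
positive-fraction (mkℚ -[1+ u ] v-1 c) (ℚ.*<* ())

-- The decisions concern the saturations of A, B and C under `≈`, since the predicates themselves
-- are not assumed to respect `≈`.
module NoDecomposition {q : ℕ} (F : FiniteField 0ℓ 0ℓ q) (d : ℕ) (A B C : FiniteField.Carrier F → Set)
    (2≤A : FiniteField.AtLeastTwo F A) (2≤B : FiniteField.AtLeastTwo F B) (2≤C : FiniteField.AtLeastTwo F C)
    (S⊆ : ∀ x → FiniteField.InS F d x → FiniteField.InSum F A B C x)
    (⊆S : ∀ x → FiniteField.InSum F A B C x → FiniteField.InS F d x)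
    (A? : ∀ i → Dec (∃ λ x → A x × FiniteField._≈_ F x (FiniteField.enum F i)))
    (B? : ∀ i → Dec (∃ λ x → B x × FiniteField._≈_ F x (FiniteField.enum F i)))
    (C? : ∀ i → Dec (∃ λ x → C x × FiniteField._≈_ F x (FiniteField.enum F i))) where
  open FiniteField F
  open Transport F
  open Sets finField
  private module 𝔽 = FieldTheory finField

  Sub : {P : Fin q → Set} → (∀ i → Dec (P i)) → Subset
  Sub P? i = isYes (P? i)

  index∈ : ∀ {P : Carrier → Set} (P? : ∀ i → Dec (∃ λ x → P x × x ≈ enum i)) x → P x → ix x ∈ Sub P?
  index∈ P? x Px = isYes-true (P? (ix x)) (x , Px , sym (enum-ix x))

  2≤count : ∀ {P : Carrier → Set} (P? : ∀ i → Dec (∃ λ x → P x × x ≈ enum i)) → AtLeastTwo P → 2 ℕ.≤ count (Sub P?)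
  2≤count P? (x , x′ , Px , Px′ , x≉x′) = injective⇒≤ f inj
    where
    i₀ = index (Sub P?) (ix x) (index∈ P? x Px)
    i₁ = index (Sub P?) (ix x′) (index∈ P? x′ Px′)
    i₀≢i₁ : i₀ ≢ i₁
    i₀≢i₁ e = x≉x′ (ix-injective (index-injective (Sub P?) (ix x) (ix x′) e))
    f : Fin 2 → Fin (count (Sub P?))
    f zero       = i₀
    f (suc zero) = i₁
    inj : ∀ i j → f i ≡ f j → i ≡ j
    inj zero       zero       e = ≡.refl
    inj zero       (suc zero) e = ⊥-elim (i₀≢i₁ e)
    inj (suc zero) zero       e = ⊥-elim (i₀≢i₁ (≡.sym e))
    inj (suc zero) (suc zero) e = ≡.refl

  ix-pow : ∀ y m → ix (pow y m) ≡ ix y 𝔽.^ m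
  ix-pow y zero    = ≡.refl
  ix-pow y (suc m) = ix-cong (*-cong (sym (enum-ix y)) (trans (sym (enum-ix (pow y m))) (reflexive (≡.cong enum (ix-pow y m)))))

  ix-+ : ∀ x y → ix (x + y) ≡ ix x 𝔽.+ ix y
  ix-+ x y = ix-cong (+-cong (sym (enum-ix x)) (sym (enum-ix y)))

  module _ {p n : ℕ} (prime : Prime p) (q≡p^n : q ≡ p ^ n) (N : ℕ) .{{d≢0 : NonZero d}} (1+dN≡q : suc (d ℕ.* N) ≡ q) where
    open DecompositionBound finField {p} {n} prime q≡p^n d N 1+dN≡q

    cover : ∀ i → i ∈ Powers → ∃ λ a → ∃₂ λ b c → a ∈ Sub A? × b ∈ Sub B? × c ∈ Sub C? × a 𝔽.+ b 𝔽.+ c ≡ i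
    cover i i∈ with true-isYes (isPower? i) i∈
    ... | y , y≢0 , y^d≡i with S⊆ (enum i) (enum y , (λ y≈0 → y≢0 (≡.trans (≡.sym (ix-enum y)) (ix-cong y≈0))) ,
            trans (reflexive (≡.cong enum (≡.trans (≡.sym y^d≡i) (≡.trans (≡.cong (𝔽._^ d) (≡.sym (ix-enum y))) (≡.sym (ix-pow (enum y) d)))))) (enum-ix _))
    ... | a , b , c , Aa , Bb , Cc , i≈ = ix a , ix b , ix c , index∈ A? a Aa , index∈ B? b Bb , index∈ C? c Cc ,
      ≡.sym (≡.trans (≡.sym (ix-enum i)) (≡.trans (ix-cong i≈) (≡.trans (ix-+ (a + b) c) (≡.cong (𝔽._+ ix c) (ix-+ a b)))))

    sum∈ : ∀ a b c → a ∈ Sub A? → b ∈ Sub B? → c ∈ Sub C? → (a 𝔽.+ b 𝔽.+ c) ∈ Powers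
    sum∈ a b c a∈ b∈ c∈ with true-isYes (A? a) a∈ | true-isYes (B? b) b∈ | true-isYes (C? c) c∈
    ... | x , Ax , x≈a | y , By , y≈b | z , Cz , z≈c with ⊆S (x + y + z) (x , y , z , Ax , By , Cz , refl)
    ... | w , w≉0 , sum≈ = isYes-true (isPower? (a 𝔽.+ b 𝔽.+ c)) (ix w , (λ e → w≉0 (ix-injective e)) ,
      ≡.trans (≡.sym (ix-pow w d)) (≡.trans (≡.sym (ix-cong sum≈)) (≡.trans (ix-+ (x + y) z)
        (≡.cong₂ 𝔽._+_ (≡.trans (ix-+ x y) (≡.cong₂ 𝔽._+_ (ix≡ x≈a) (ix≡ y≈b))) (ix≡ z≈c)))))
      where
      ix≡ : ∀ {x i} → x ≈ enum i → ix x ≡ i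
      ix≡ {i = i} e = ≡.trans (ix-cong e) (ix-enum i)

    bound : .{{_ : NonZero p}} → 2 ℕ.≤ d → d ℕ.* d ℕ.≤ q → (l : ℕ) → (∀ k → 2 ^ k ℕ.< 8 ℕ.* q → k ℕ.≤ l) → ∀ {u v} → u ℕ.≤ v →
      (∀ j → 2 ℕ.* j ℕ.< n ℕ.+ 1 → u ℕ.* (p ∸ 1) ℕ.≤ v ℕ.* (p ∸ 1 ∸ digit p N j)) →
      q ℕ.* u ^ 6 ℕ.≤ d ^ 4 ℕ.* κ (l ℕ.+ 4) ^ 6 ℕ.* v ^ 6
    bound 2≤d dd≤q l log u≤v good = decomposition-bound 2≤d dd≤q l log u≤v good (Sub A?) (Sub B?) (Sub C?)
      (2≤count A? 2≤A) (2≤count B? 2≤B) (2≤count C? 2≤C) cover sum∈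

theorem1p8 : (a b : ℕ) → 1 ℕ.≤ a → 1 ℕ.≤ b →
    Σ ℕ λ Q → Σ ℕ λ P →
    (p n : ℕ) → .{{_ : NonZero p}} → Prime p → 1 ℕ.≤ n → Q ℕ.< p ^ n → P ℕ.< p →
    (F : FiniteField 0ℓ 0ℓ (p ^ n)) →
    (δ : ℚ) → 0ℚ ℚ.< δ →
    (d : ℕ) → .{{_ : NonZero d}} → d ∣ (p ^ n ∸ 1) → 2 ℕ.≤ d →
    ((+ (d ^ (4 ℕ.* b) ℕ.* (p ^ n) ^ (4 ℕ.* a))) ℚ./ 1
    ℚ.≤ ((+ ((p ^ n) ^ b)) ℚ./ 1) ℚ.* (δ ^ℚ (6 ℕ.* b))) →
    DeltaGood δ d p n →
    ¬ (Σ (FiniteField.Carrier F → Set) λ A →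
    Σ (FiniteField.Carrier F → Set) λ B →
    Σ (FiniteField.Carrier F → Set) λ C →
    FiniteField.AtLeastTwo F A × FiniteField.AtLeastTwo F B × FiniteField.AtLeastTwo F C ×
    (∀ x → FiniteField.InS F d x → FiniteField.InSum F A B C x) ×
    (∀ x → FiniteField.InSum F A B C x → FiniteField.InS F d x))
-- q > 2^l₀ puts the logarithm l of 8q beyond l₀, where 2^l exceeds 8 κ^(6b).
theorem1p8 a b 1≤a 1≤b = 2 ^ l₀ , 0 , proof
  where
  instance
    6b≢0 : NonZero (6 ℕ.* b)
    6b≢0 = ℕₚ.m*n≢0 6 b {{_}} {{ℕ.>-nonZero 1≤b}}
  growth = κ-growth (6 ℕ.* b)
  l₀ = proj₁ growth
  proof : (p n : ℕ) → .{{_ : NonZero p}} → Prime p → 1 ℕ.≤ n → 2 ^ l₀ ℕ.< p ^ n → 0 ℕ.< p → _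
  proof p n p-prime 1≤n Q<q 0<p F δ δ>0 d (divides N q-1≡Nd) 2≤d size (_ , _ , good) (A , B , C , 2≤A , 2≤B , 2≤C , S⊆ , ⊆S) =
    ¬¬-decidable (λ i → ∃ λ x → A x × FiniteField._≈_ F x (FiniteField.enum F i)) λ A? →
    ¬¬-decidable (λ i → ∃ λ x → B x × FiniteField._≈_ F x (FiniteField.enum F i)) λ B? →
    ¬¬-decidable (λ i → ∃ λ x → C x × FiniteField._≈_ F x (FiniteField.enum F i)) λ C? →
    contradiction (NoDecomposition.bound F d A B C 2≤A 2≤B 2≤C S⊆ ⊆S A? B? C? {p} {n} p-prime ≡.refl N 1+dN≡q
      2≤d dd≤q l (2^k<⇒k≤l {8 ℕ.* q} {l} 8q<2^) u≤v good-digits)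
    where
    q = p ^ n
    1≤q : 1 ℕ.≤ q
    1≤q = ℕₚ.<-≤-trans (ℕ.s≤s ℕ.z≤n) (ℕₚ.≤-trans (ℕ.s≤s ℕ.z≤n) Q<q)
    instance
      q≢0 : NonZero q
      q≢0 = ℕ.>-nonZero 1≤q
    1+dN≡q : suc (d ℕ.* N) ≡ q
    1+dN≡q = ≡.trans (≡.cong suc (≡.trans (ℕₚ.*-comm d N) (≡.sym q-1≡Nd))) (ℕₚ.suc-pred q)
    quotient≡N : (q ∸ 1) / d ≡ N
    quotient≡N = ≡.trans (≡.cong (_/ d) q-1≡Nd) (m*n/n≡m N d)
    -- The factor 8 leaves room for the number k = i + 2 of shifts: 3 · 2^i < 4α ≤ 4q gives 2^k < 16
    -- q/3.
    logarithm = floor-log (8 ℕ.* q) (ℕₚ.≤-trans 1≤q (ℕₚ.m≤n*m q 8))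
    l = proj₁ logarithm
    8q<2^ : 8 ℕ.* q ℕ.< 2 ^ suc l
    8q<2^ = proj₂ (proj₂ logarithm)
    l₀≤l : l₀ ℕ.≤ l
    l₀≤l = 2^k<⇒k≤l {8 ℕ.* q} {l} 8q<2^ l₀ (ℕₚ.<-≤-trans Q<q (ℕₚ.m≤n*m q 8))
    fraction = positive-fraction δ δ>0
    u = proj₁ fraction
    v = suc (proj₁ (proj₂ fraction))
    open Fraction u (proj₁ (proj₂ fraction)) using (scaled-power-bound; floor-bound)
    size′ : d ^ (4 ℕ.* b) ℕ.* q ^ (4 ℕ.* a) ℕ.* v ^ (6 ℕ.* b) ℕ.≤ q ^ b ℕ.* u ^ (6 ℕ.* b)
    size′ = scaled-power-bound δ (proj₂ (proj₂ fraction)) (d ^ (4 ℕ.* b) ℕ.* q ^ (4 ℕ.* a)) (q ^ b) (6 ℕ.* b) size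
    digit-bound : ∀ j → 2 ℕ.* j ℕ.< n ℕ.+ 1 → u ℕ.* (p ∸ 1) ℕ.+ v ℕ.* digit p N j ℕ.≤ v ℕ.* (p ∸ 1)
    digit-bound j 2j<n+1 = ≡.subst (λ N → u ℕ.* (p ∸ 1) ℕ.+ v ℕ.* digit p N j ℕ.≤ v ℕ.* (p ∸ 1)) quotient≡N
      (floor-bound δ (proj₂ (proj₂ fraction)) (digit p ((q ∸ 1) / d) j) (p ∸ 1) (good j 2j<n+1))
    good-digits : ∀ j → 2 ℕ.* j ℕ.< n ℕ.+ 1 → u ℕ.* (p ∸ 1) ℕ.≤ v ℕ.* (p ∸ 1 ∸ digit p N j)
    good-digits j h = ≡.subst (u ℕ.* (p ∸ 1) ℕ.≤_) (≡.sym (ℕₚ.*-distribˡ-∸ v (p ∸ 1) (digit p N j)))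
      (ℕₚ.m+n≤o⇒m≤o∸n (u ℕ.* (p ∸ 1)) (digit-bound j h))
    u≤v : u ℕ.≤ v
    -- δ ≤ 1 is a consequence of the digit condition at j = 0.
    u≤v = ℕₚ.*-cancelʳ-≤ u v (p ∸ 1) {{ℕ.>-nonZero (ℕₚ.≤-pred (ℕₚ.≤-trans (p>1 p-prime) (ℕₚ.≤-reflexive (≡.sym (ℕₚ.suc-pred p)))))}}
      (ℕₚ.≤-trans (ℕₚ.m≤m+n _ _) (digit-bound 0 (≡.subst (0 ℕ.<_) (ℕₚ.+-comm 1 n) (ℕ.s≤s ℕ.z≤n))))
    dd≤q : d ℕ.* d ℕ.≤ q
    dd≤q = size⇒dd≤q {q} {d} {u} {v} {a} {b} 1≤b u≤v size′
    contradiction : q ℕ.* u ^ 6 ℕ.≤ d ^ 4 ℕ.* κ (l ℕ.+ 4) ^ 6 ℕ.* v ^ 6 → ⊥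
    -- 8 κ^(6b) < 2^l ≤ 8 q ≤ 8 κ^(6b).
    contradiction bound = ℕₚ.<⇒≱ (proj₂ growth l l₀≤l) (ℕₚ.≤-trans (proj₁ (proj₂ logarithm))
      (ℕₚ.*-monoʳ-≤ 8 (size⇒q≤κ^ {q} {d} {u} {v} {a} {b} 1≤b u≤v size′ {κ (l ℕ.+ 4)} 1≤a bound)))
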